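{- Let $s,N\in\mathbb{N}$ with $2\leq N\leq s$. For $k\in\mathbb{N}_0$ let \[ \alpha_q(k)=(-1)^k q^{s\binom{k+1}{2}-k}\,[2sk+1]\,\frac{(xq;q^s)_k\,(q/x;q^s)_k\,(q;q^s)_k}{(xq^s;q^s)_k\,(q^s/x;q^s)_k\,(q^s;q^s)_k}, \] and \[ t_q(k)=\sum_{\substack{i_1,\ldots,i_N\geq 0\\ i_1+\cdots+i_N=k}}\alpha_q(i_1)\cdots\alpha_q(i_N). \] Then for every positive integer $n$ all of whose prime factors are congruent to $1$ modulo $s$, \[ \sum_{k=0}^{n-1}t_q(k)\equiv q^{N(n-1)(n-s+1)/(2s)}[n]^N(-1)^{N(n-1)/s}\pmod{[n](1-xq^n)(x-q^n)}. \]
   Context: $x$ is an indeterminate and $q$ a variable. $(a;q)_0=1$, $(a;q)_k=\prod_{j=0}^{k-1}(1-aq^j)$; $[n]=[n]_q=(1-q^n)/(1-q)=1+q+\cdots+q^{n-1}$. For rational functions $A,B$ and a polynomial $P$, $A\equiv B\pmod P$ means that, writing $A-B=A_1/A_2$ in lowest terms, $P$ divides $A_1$ and $\gcd(P,A_2)=1$. -}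

module Defs where

open import Data.Nat as ℕ using (ℕ; zero; suc; _∸_; _≤_)
open import Data.Nat.Combinatorics using (_C_)
open import Data.Integer as ℤ using (ℤ; +_; -_)
open import Data.Product using (Σ; ∃; _×_; _,_)
open import Data.List using (List; []; _∷_; concatMap; foldr; map)
open import Data.Vec as Vec using (Vec)
open import Relation.Binary.PropositionalEquality using (_≡_)
open import Relation.Nullary using (¬_)

-- Polynomials in Z[x,q], as coefficient functions:
--   f i j = coefficient of x^i q^j.
-- A coefficient function is a genuine polynomial iff it has finite support.

Poly : Set
Poly = ℕ → ℕ → ℤ

IsPoly : Poly → Set
IsPoly f = ∃ λ D → ∀ i j → D ≤ i ℕ.+ j → f i j ≡ + 0

_≈_ : Poly → Poly → Set
f ≈ g = ∀ i j → f i j ≡ g i j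
infix 4 _≈_

sumTo : ℕ → (ℕ → ℤ) → ℤ
sumTo zero h = h 0
sumTo (suc n) h = sumTo n h ℤ.+ h (suc n)

const : ℤ → Poly
const c zero zero = c
const c _ _ = + 0

𝟘 𝟙 X Q : Poly
𝟘 _ _ = + 0
𝟙 = const (+ 1)
X (suc zero) zero = + 1
X _ _ = + 0
Q zero (suc zero) = + 1
Q _ _ = + 0

_⊕_ _⊖_ _⊗_ : Poly → Poly → Poly
(f ⊕ g) i j = f i j ℤ.+ g i j
(f ⊖ g) i j = f i j ℤ.- g i j
(f ⊗ g) i j = sumTo i λ a → sumTo j λ b → f a b ℤ.* g (i ∸ a) (j ∸ b)
infixl 6 _⊕_ _⊖_
infixl 7 _⊗_

_^ᵖ_ : Poly → ℕ → Poly
f ^ᵖ zero = 𝟙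
f ^ᵖ suc n = f ⊗ (f ^ᵖ n)
infixr 8 _^ᵖ_

sgn : ℕ → Poly
sgn m = const (- + 1) ^ᵖ m

qint : ℕ → Poly
qint zero = 𝟘
qint (suc n) = qint n ⊕ Q ^ᵖ n

_∣ᵖ_ : Poly → Poly → Set
D ∣ᵖ F = ∃ λ C → IsPoly C × (F ≈ D ⊗ C)
infix 4 _∣ᵖ_

Coprime : Poly → Poly → Set
Coprime F G = ∀ D → IsPoly D → D ∣ᵖ F → D ∣ᵖ G → D ∣ᵖ 𝟙

-- Rational functions in Q(x,q), represented as (numerator , denominator)
-- with numerator, denominator in Z[x,q].

RF : Set
RF = Poly × Poly

poly : Poly → RF
poly f = f , 𝟙

_+ʳ_ _-ʳ_ _*ʳ_ _/ʳ_ : RF → RF → RF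
(a , b) +ʳ (c , d) = a ⊗ d ⊕ c ⊗ b , b ⊗ d
(a , b) -ʳ (c , d) = a ⊗ d ⊖ c ⊗ b , b ⊗ d
(a , b) *ʳ (c , d) = a ⊗ c , b ⊗ d
(a , b) /ʳ (c , d) = a ⊗ d , b ⊗ c
infixl 6 _+ʳ_ _-ʳ_
infixl 7 _*ʳ_ _/ʳ_

_^ʳ_ : RF → ℕ → RF
r ^ʳ zero = poly 𝟙
r ^ʳ suc n = r *ʳ (r ^ʳ n)

poch : RF → RF → ℕ → RF
poch a b zero = poly 𝟙
poch a b (suc k) = poch a b k *ʳ (poly 𝟙 -ʳ a *ʳ (b ^ʳ k))

sumʳ : ℕ → (ℕ → RF) → RF
sumʳ zero f = poly 𝟘
sumʳ (suc n) f = sumʳ n f +ʳ f n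

x q : RF
x = poly X
q = poly Q

α : ℕ → ℕ → RF
α s k =
  poly (sgn k ⊗ Q ^ᵖ (s ℕ.* (suc k C 2) ∸ k) ⊗ qint (2 ℕ.* s ℕ.* k ℕ.+ 1))
  *ʳ ((poch (x *ʳ q) (q ^ʳ s) k *ʳ poch (q /ʳ x) (q ^ʳ s) k *ʳ poch q (q ^ʳ s) k)
      /ʳ (poch (x *ʳ (q ^ʳ s)) (q ^ʳ s) k *ʳ poch ((q ^ʳ s) /ʳ x) (q ^ʳ s) k
            *ʳ poch (q ^ʳ s) (q ^ʳ s) k))

boxVecs : (N k : ℕ) → List (Vec ℕ N)
boxVecs zero k = Vec.[] ∷ []
boxVecs (suc N) k =
  concatMap (λ i → map (i Vec.∷_) (boxVecs N k)) (Data.List.upTo (suc k))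

t : (s N k : ℕ) → RF
t s N k = foldr (λ v acc → term v +ʳ acc) (poly 𝟘) (boxVecs N k)
  where
  prodα : ∀ {m} → Vec ℕ m → RF
  prodα Vec.[] = poly 𝟙
  prodα (i Vec.∷ v) = α s i *ʳ prodα v
  term : Vec ℕ N → RF
  term v with Vec.sum v ℕ.≟ k
  ... | Relation.Nullary.yes _ = prodα v
  ... | Relation.Nullary.no _ = poly 𝟘

-- Congruence of rational functions modulo a polynomial P:
-- A - B = A1/A2 in lowest terms, P | A1 and gcd(P, A2) = 1.

_≡ʳ_mod_ : RF → RF → Poly → Set
A ≡ʳ B mod P with A -ʳ B
... | (U , V) = Σ Poly λ A1 → Σ Poly λ A2 →
  IsPoly A1 × IsPoly A2 × ¬ (A2 ≈ 𝟘) × (U ⊗ A2 ≈ A1 ⊗ V)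
  × Coprime A1 A2 × (P ∣ᵖ A1) × Coprime P A2

-- natural division m / d (d > 0 in all uses; 0 returned for d = 0)
divℕ : ℕ → ℕ → ℕ
divℕ m zero = 0
divℕ m (suc d) = m ℕ./ suc d

-- natural remainder m mod d (d > 0 in all uses; m returned for d = 0)
modℕ : ℕ → ℕ → ℕ
modℕ m zero = m
modℕ m (suc d) = m ℕ.% suc d

{-# OPTIONS --safe #-}
module Submission where

-- The factors of the modulus are treated one at a time. Where x q^n = 1 or x = q^n, with n = sm + 1, the summands
-- α(k) with k > m vanish and Σ_{k≤m} α(k) is a terminating very-well-poised ₆φ₅ series (one parameter being sent to
-- infinity), which is summed by a WZ pair; since Nm < n, the sum of the t(k) is the N-th power of its value.
-- At a primitive d-th root of unity, where d ∣ n and hence d = sm + 1 for some m, the generating function of α is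
-- a(z) c(z^d) with deg a ≤ m, and a(1) = 0 because α(m - k) = -α(k); as Nm < d, the sum of t(k) over each block of
-- d consecutive indices is zero. Letting d run over the divisors of n gives divisibility by [n].
-- Lowest terms are reached by taking, among all fractions with the given value, a denominator of least total degree
-- (found by linear algebra over ℤ) and then removing the integer content.

-- Evaluation at a special point uses no roots of unity or extension fields. A point is an ideal I
-- of ℤ[x,q], and a rational function is evaluated as a fraction whose denominator is regular both
-- in the ring and modulo I. Such a fraction has an exact value and a value modulo I; if the latter
-- is zero, the numerator of every fraction with the same exact value lies in I. The obstacle is at
-- primitive d-th roots of unity, where (q^s;q^s)_k vanishes from k = d on. But (q;q^s)_k acquires
-- its factor 1 - q^d already at k = m + 1. Cancelling these factors in pairs leaves none if the
-- residue of k modulo d is at most m, and one in the numerator otherwise; summands of the second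
-- kind are zero, which is why a(z) has degree at most m and not d - 1. Unique factorisation is
-- replaced by regularity: the factors of the modulus may be multiplied together because they are
-- regular modulo one another, and in place of cyclotomic factors there are Bézout's identity for
-- the exponents and cancellation of integers modulo 1 - q^d.

open import Level using (0ℓ)
open import Algebra.Bundles using (CommutativeRing)
open import Data.Nat.Base as ℕ using (ℕ; zero; suc; _∸_; _≤_; _<_; z≤n; s≤s)
import Data.Nat.Properties as ℕₚ
import Data.Nat.Solver
import Relation.Binary.PropositionalEquality as ≡

-- Polynomial identities with integer coefficients in a commutative ring.

module IntegerSolver (R : CommutativeRing 0ℓ 0ℓ) where
  open import Data.Integer.Base as ℤ using (ℤ; +_; -[1+_]; _⊖_; _◃_)
  import Data.Integer.Properties as ℤₚ
  open import Data.Sign.Base using (Sign)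
  open import Data.Maybe.Base using (Maybe; just; nothing)
  open import Relation.Nullary using (yes; no)
  open CommutativeRing R
  open import Algebra.Properties.Ring ring
  open import Algebra.Properties.AbelianGroup +-abelianGroup using (⁻¹-∙-comm; ε⁻¹≈ε; ⁻¹-involutive)
  open import Algebra.Properties.Semiring.Mult.TCOptimised semiring
  open import Algebra.Solver.Ring.AlmostCommutativeRing
  open import Relation.Binary.Reasoning.Setoid setoid

  -- Equality in `R` is not decidable, so the coefficients of normal forms are taken from ℤ, where
  -- cancellations such as a - a = 0 can be decided.
  ⟦_⟧ℤ : ℤ → Carrier
  ⟦ + n ⟧ℤ      = n × 1#
  ⟦ -[1+ n ] ⟧ℤ = - (suc n × 1#)

  ⊖-homo : ∀ m n → ⟦ m ⊖ n ⟧ℤ ≈ m × 1# - n × 1#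
  ⊖-homo m zero = sym (trans (+-congˡ ε⁻¹≈ε) (+-identityʳ _))
  ⊖-homo zero (suc n) = sym (+-identityˡ _)
  ⊖-homo (suc m) (suc n) = begin
    ⟦ suc m ⊖ suc n ⟧ℤ ≡⟨ ≡.cong ⟦_⟧ℤ (ℤₚ.[1+m]⊖[1+n]≡m⊖n m n) ⟩
    ⟦ m ⊖ n ⟧ℤ ≈⟨ ⊖-homo m n ⟩
    m × 1# - n × 1# ≈⟨ +-congʳ (+-identityˡ _) ⟨
    (0# + m × 1#) - n × 1# ≈⟨ +-congʳ (+-congʳ (-‿inverseʳ 1#)) ⟨
    ((1# - 1#) + m × 1#) - n × 1# ≈⟨ +-congʳ (trans (+-assoc _ _ _) (trans (+-congˡ (+-comm _ _)) (sym (+-assoc _ _ _)))) ⟩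
    ((1# + m × 1#) - 1#) - n × 1# ≈⟨ +-assoc _ _ _ ⟩
    (1# + m × 1#) + (- 1# - n × 1#) ≈⟨ +-cong (sym (1+× m 1#)) (trans (⁻¹-∙-comm _ _) (-‿cong (sym (1+× n 1#)))) ⟩
    suc m × 1# - suc n × 1# ∎

  ℤ-+-homo : ∀ i j → ⟦ i ℤ.+ j ⟧ℤ ≈ ⟦ i ⟧ℤ + ⟦ j ⟧ℤ
  ℤ-+-homo (+ m) (+ n) = ×-homo-+ 1# m n
  ℤ-+-homo (+ m) -[1+ n ] = ⊖-homo m (suc n)
  ℤ-+-homo -[1+ m ] (+ n) = trans (⊖-homo n (suc m)) (+-comm _ _)
  ℤ-+-homo -[1+ m ] -[1+ n ] = begin
    - (suc (suc (m ℕ.+ n)) × 1#) ≡⟨ ≡.cong (λ k → - (k × 1#)) (≡.cong suc (≡.sym (ℕ+-suc m n))) ⟩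
    - ((suc m ℕ.+ suc n) × 1#) ≈⟨ -‿cong (×-homo-+ 1# (suc m) (suc n)) ⟩
    - (suc m × 1# + suc n × 1#) ≈⟨ ⁻¹-∙-comm _ _ ⟨
    - (suc m × 1#) - suc n × 1# ∎
    where open import Data.Nat.Properties using () renaming (+-suc to ℕ+-suc)

  neg-homo : ∀ i → ⟦ ℤ.- i ⟧ℤ ≈ - ⟦ i ⟧ℤ
  neg-homo (+ zero) = sym ε⁻¹≈ε
  neg-homo (+ suc n) = refl
  neg-homo -[1+ n ] = sym (⁻¹-involutive _)

  +◃-homo : ∀ n → ⟦ Sign.+ ◃ n ⟧ℤ ≈ n × 1#
  +◃-homo zero = refl
  +◃-homo (suc n) = refl

  -◃-homo : ∀ n → ⟦ Sign.- ◃ n ⟧ℤ ≈ - (n × 1#)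
  -◃-homo zero = sym ε⁻¹≈ε
  -◃-homo (suc n) = refl

  ℤ-*-homo : ∀ i j → ⟦ i ℤ.* j ⟧ℤ ≈ ⟦ i ⟧ℤ * ⟦ j ⟧ℤ
  ℤ-*-homo (+ m) (+ n) = trans (+◃-homo (m ℕ.* n)) (×1-homo-* m n)
  ℤ-*-homo (+ m) -[1+ n ] = trans (-◃-homo (m ℕ.* suc n)) (trans (-‿cong (×1-homo-* m (suc n))) (-‿distribʳ-* _ _))
  ℤ-*-homo -[1+ m ] (+ n) = trans (-◃-homo (suc m ℕ.* n)) (trans (-‿cong (×1-homo-* (suc m) n)) (-‿distribˡ-* _ _))
  ℤ-*-homo -[1+ m ] -[1+ n ] = begin
    ⟦ Sign.+ ◃ (suc m ℕ.* suc n) ⟧ℤ ≈⟨ +◃-homo (suc m ℕ.* suc n) ⟩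
    (suc m ℕ.* suc n) × 1# ≈⟨ ×1-homo-* (suc m) (suc n) ⟩
    (suc m × 1#) * (suc n × 1#) ≈⟨ ⁻¹-involutive _ ⟨
    - - ((suc m × 1#) * (suc n × 1#)) ≈⟨ -‿cong (-‿distribˡ-* _ _) ⟩
    - (- (suc m × 1#) * (suc n × 1#)) ≈⟨ -‿distribʳ-* _ _ ⟩
    - (suc m × 1#) * - (suc n × 1#) ∎

  morphism : CommutativeRing.rawRing ℤₚ.+-*-commutativeRing -Raw-AlmostCommutative⟶ fromCommutativeRing R
  morphism = record
    { ⟦_⟧ = ⟦_⟧ℤ ; +-homo = ℤ-+-homo ; *-homo = ℤ-*-homo ; -‿homo = neg-homo
    ; 0-homo = refl ; 1-homo = refl }

  ℤ≟ : ∀ i j → Maybe (⟦ i ⟧ℤ ≈ ⟦ j ⟧ℤ)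
  ℤ≟ i j with i ℤₚ.≟ j
  ... | yes ≡.refl = just refl
  ... | no _ = nothing

  open import Algebra.Solver.Ring (CommutativeRing.rawRing ℤₚ.+-*-commutativeRing) (fromCommutativeRing R) morphism ℤ≟ public
    using (solve; _:=_; _:+_; _:*_; _:-_; :-_; con)

-- The ring of formal power series.

module PowerSeries (R : CommutativeRing 0ℓ 0ℓ) where
  open import Data.Product using (_,_)
  open CommutativeRing R
  open import Algebra.Properties.Ring ring
  open import Algebra.Properties.CommutativeSemigroup +-commutativeSemigroup using (interchange)
  open import Relation.Binary.Reasoning.Setoid setoid

  Series : Set
  Series = ℕ → Carrier

  infix 4 _≋_
  _≋_ : Series → Series → Set
  f ≋ g = ∀ n → f n ≈ g n

  Σ≤ : ℕ → Series → Carrier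
  Σ≤ zero h = h 0
  Σ≤ (suc n) h = Σ≤ n h + h (suc n)

  Σ≤-cong≤ : ∀ n {f g} → (∀ i → i ≤ n → f i ≈ g i) → Σ≤ n f ≈ Σ≤ n g
  Σ≤-cong≤ zero eq = eq 0 z≤n
  Σ≤-cong≤ (suc n) eq = +-cong (Σ≤-cong≤ n λ i i≤n → eq i (ℕₚ.m≤n⇒m≤1+n i≤n)) (eq (suc n) ℕₚ.≤-refl)

  Σ≤-cong : ∀ n {f g} → f ≋ g → Σ≤ n f ≈ Σ≤ n g
  Σ≤-cong n eq = Σ≤-cong≤ n λ i _ → eq i

  Σ≤-zero : ∀ n {f} → (∀ i → i ≤ n → f i ≈ 0#) → Σ≤ n f ≈ 0#
  Σ≤-zero zero eq = eq 0 z≤n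
  Σ≤-zero (suc n) eq = trans (+-cong (Σ≤-zero n λ i i≤n → eq i (ℕₚ.m≤n⇒m≤1+n i≤n)) (eq (suc n) ℕₚ.≤-refl)) (+-identityˡ 0#)

  Σ≤-+ : ∀ n f g → Σ≤ n (λ i → f i + g i) ≈ Σ≤ n f + Σ≤ n g
  Σ≤-+ zero f g = refl
  Σ≤-+ (suc n) f g = trans (+-congʳ (Σ≤-+ n f g)) (interchange _ _ _ _)

  Σ≤-*ˡ : ∀ n c f → Σ≤ n (λ i → c * f i) ≈ c * Σ≤ n f
  Σ≤-*ˡ zero c f = refl
  Σ≤-*ˡ (suc n) c f = trans (+-congʳ (Σ≤-*ˡ n c f)) (sym (distribˡ _ _ _))

  Σ≤-first : ∀ n f → Σ≤ (suc n) f ≈ f 0 + Σ≤ n (λ i → f (suc i))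
  Σ≤-first zero f = refl
  Σ≤-first (suc n) f = trans (+-congʳ (Σ≤-first n f)) (+-assoc _ _ _)

  infixl 7 _∙_
  _∙_ : Series → Series → Series
  (f ∙ g) n = Σ≤ n (λ i → f i * g (n ∸ i))

  tail : Series → Series
  tail f n = f (suc n)

  -- Splitting off a constant coefficient turns the ring laws of the Cauchy product into inductions
  -- on n.
  ∙-tailˡ : ∀ f g n → (f ∙ g) (suc n) ≈ f 0 * g (suc n) + (tail f ∙ g) n
  ∙-tailˡ f g n = Σ≤-first n (λ i → f i * g (suc n ∸ i))

  ∙-tailʳ : ∀ f g n → (f ∙ g) (suc n) ≈ (f ∙ tail g) n + f (suc n) * g 0
  ∙-tailʳ f g n = +-cong
    (Σ≤-cong≤ n λ i i≤n → *-congˡ (reflexive (≡.cong g (ℕₚ.+-∸-assoc 1 i≤n))))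
    (*-congˡ (reflexive (≡.cong g (ℕₚ.n∸n≡0 n))))

  ∙-cong : ∀ {f f′ g g′} → f ≋ f′ → g ≋ g′ → f ∙ g ≋ f′ ∙ g′
  ∙-cong p r n = Σ≤-cong n λ i → *-cong (p i) (r (n ∸ i))

  ∙-comm : ∀ f g → f ∙ g ≋ g ∙ f
  ∙-comm f g zero = *-comm _ _
  ∙-comm f g (suc n) = begin
    (f ∙ g) (suc n) ≈⟨ ∙-tailˡ f g n ⟩
    f 0 * g (suc n) + (tail f ∙ g) n ≈⟨ +-cong (*-comm _ _) (∙-comm (tail f) g n) ⟩
    g (suc n) * f 0 + (g ∙ tail f) n ≈⟨ +-comm _ _ ⟩
    (g ∙ tail f) n + g (suc n) * f 0 ≈⟨ ∙-tailʳ g f n ⟨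
    (g ∙ f) (suc n) ∎

  _⊹_ : Series → Series → Series
  (f ⊹ g) n = f n + g n

  ∙-distribˡ : ∀ f g h → f ∙ (g ⊹ h) ≋ ((f ∙ g) ⊹ (f ∙ h))
  ∙-distribˡ f g h n = trans (Σ≤-cong n λ i → distribˡ _ _ _) (Σ≤-+ n _ _)

  ∙-distribʳ : ∀ f g h → (g ⊹ h) ∙ f ≋ ((g ∙ f) ⊹ (h ∙ f))
  ∙-distribʳ f g h n = trans (Σ≤-cong n λ i → distribʳ _ _ _) (Σ≤-+ n _ _)

  ∙-scaleˡ : ∀ c f g → (λ i → c * f i) ∙ g ≋ λ n → c * (f ∙ g) n
  ∙-scaleˡ c f g n = trans (Σ≤-cong n λ i → *-assoc _ _ _) (Σ≤-*ˡ n c _)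

  ∙-assoc : ∀ f g h → (f ∙ g) ∙ h ≋ f ∙ (g ∙ h)
  ∙-assoc f g h zero = *-assoc _ _ _
  ∙-assoc f g h (suc n) = begin
    ((f ∙ g) ∙ h) (suc n)
      ≈⟨ ∙-tailˡ (f ∙ g) h n ⟩
    (f 0 * g 0) * h (suc n) + (tail (f ∙ g) ∙ h) n
      ≈⟨ +-cong (*-assoc _ _ _) (∙-cong {g = h} {g′ = h} (∙-tailˡ f g) (λ _ → refl) n) ⟩
    f 0 * (g 0 * h (suc n)) + (((λ i → f 0 * g (suc i)) ⊹ (tail f ∙ g)) ∙ h) n
      ≈⟨ +-congˡ (∙-distribʳ h _ _ n) ⟩
    f 0 * (g 0 * h (suc n)) + (((λ i → f 0 * g (suc i)) ∙ h) n + ((tail f ∙ g) ∙ h) n)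
      ≈⟨ +-congˡ (+-cong (∙-scaleˡ (f 0) (tail g) h n) (∙-assoc (tail f) g h n)) ⟩
    f 0 * (g 0 * h (suc n)) + (f 0 * (tail g ∙ h) n + (tail f ∙ (g ∙ h)) n)
      ≈⟨ +-assoc _ _ _ ⟨
    (f 0 * (g 0 * h (suc n)) + f 0 * (tail g ∙ h) n) + (tail f ∙ (g ∙ h)) n
      ≈⟨ +-congʳ (trans (*-congˡ (∙-tailˡ g h n)) (distribˡ _ _ _)) ⟨
    f 0 * (g ∙ h) (suc n) + (tail f ∙ (g ∙ h)) n
      ≈⟨ ∙-tailˡ f (g ∙ h) n ⟨
    (f ∙ (g ∙ h)) (suc n) ∎

  unit : Series
  unit zero = 1#
  unit (suc _) = 0#

  ∙-identityˡ : ∀ f → unit ∙ f ≋ f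
  ∙-identityˡ f zero = *-identityˡ _
  ∙-identityˡ f (suc n) = begin
    (unit ∙ f) (suc n) ≈⟨ ∙-tailˡ unit f n ⟩
    1# * f (suc n) + (tail unit ∙ f) n ≈⟨ +-cong (*-identityˡ _) (Σ≤-zero n λ i _ → zeroˡ _) ⟩
    f (suc n) + 0# ≈⟨ +-identityʳ _ ⟩
    f (suc n) ∎

  -- It has two uses: iterated over ℤ it provides the ring laws for polynomials in x and q, and over
  -- a ring of fractions it contains the generating function of α.
  seriesRing : CommutativeRing 0ℓ 0ℓ
  seriesRing = record
    { Carrier = Series ; _≈_ = _≋_ ; _+_ = _⊹_ ; _*_ = _∙_
    ; -_ = λ f n → - f n ; 0# = λ _ → 0# ; 1# = unit
    ; isCommutativeRing = record
      { isRing = record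
        { +-isAbelianGroup = record
          { isGroup = record
            { isMonoid = record
              { isSemigroup = record
                { isMagma = record
                  { isEquivalence = record
                    { refl = λ _ → refl ; sym = λ p n → sym (p n) ; trans = λ p r n → trans (p n) (r n) }
                  ; ∙-cong = λ p r n → +-cong (p n) (r n) }
                ; assoc = λ f g h n → +-assoc _ _ _ }
              ; identity = (λ f n → +-identityˡ _) , (λ f n → +-identityʳ _) }
            ; inverse = (λ f n → -‿inverseˡ _) , (λ f n → -‿inverseʳ _)
            ; ⁻¹-cong = λ p n → -‿cong (p n) }
          ; comm = λ f g n → +-comm _ _ }
        ; *-cong = ∙-cong
        ; *-assoc = ∙-assoc
        ; *-identity = ∙-identityˡ , λ f n → trans (∙-comm f unit n) (∙-identityˡ f n)
        ; distrib = ∙-distribˡ , ∙-distribʳ }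
      ; *-comm = ∙-comm } }

-- Units, finite sums and finite products in a commutative ring.

module RingTools (R : CommutativeRing 0ℓ 0ℓ) where
  open import Data.Integer.Base using (+_)
  open import Data.Product using (∃; _,_)
  open CommutativeRing R public hiding (zero)
  open IntegerSolver R public using (solve; _:=_; _:+_; _:*_; _:-_; :-_; con)
  open import Algebra.Properties.CommutativeSemiring.Exp commutativeSemiring public
    using (_^_; ^-congˡ; ^-congʳ; ^-homo-*; ^-assocʳ; ^-distrib-*)
  open import Relation.Binary.Reasoning.Setoid setoid

  Unit : Carrier → Set
  Unit a = ∃ λ b → a * b ≈ 1#

  unit-cancelˡ : ∀ {a b c} → Unit a → a * b ≈ a * c → b ≈ c
  unit-cancelˡ {a} {b} {c} (a⁻¹ , inv) eq = begin
    b ≈⟨ *-identityˡ b ⟨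
    1# * b ≈⟨ *-congʳ inv ⟨
    a * a⁻¹ * b ≈⟨ solve 3 (λ a a⁻¹ b → a :* a⁻¹ :* b := a⁻¹ :* (a :* b)) refl a a⁻¹ b ⟩
    a⁻¹ * (a * b) ≈⟨ *-congˡ eq ⟩
    a⁻¹ * (a * c) ≈⟨ solve 3 (λ a a⁻¹ b → a :* a⁻¹ :* b := a⁻¹ :* (a :* b)) refl a a⁻¹ c ⟨
    a * a⁻¹ * c ≈⟨ *-congʳ inv ⟩
    1# * c ≈⟨ *-identityˡ c ⟩
    c ∎

  unit-* : ∀ {a b} → Unit a → Unit b → Unit (a * b)
  unit-* {a} {b} (a⁻¹ , p) (b⁻¹ , r) = a⁻¹ * b⁻¹ , (begin
    a * b * (a⁻¹ * b⁻¹) ≈⟨ solve 4 (λ a b c d → a :* b :* (c :* d) := (a :* c) :* (b :* d)) refl a b a⁻¹ b⁻¹ ⟩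
    a * a⁻¹ * (b * b⁻¹) ≈⟨ *-cong p r ⟩
    1# * 1# ≈⟨ *-identityˡ 1# ⟩
    1# ∎)

  unit-cong : ∀ {a b} → a ≈ b → Unit a → Unit b
  unit-cong eq (c , p) = c , trans (*-congʳ (sym eq)) p

  unit-factorˡ : ∀ {a b} → Unit (a * b) → Unit a
  unit-factorˡ {a} {b} (c , p) = b * c , trans (sym (*-assoc _ _ _)) p

  unit-^ : ∀ {a} n → Unit a → Unit (a ^ n)
  unit-^ zero u = 1# , *-identityˡ 1#
  unit-^ (suc n) u = unit-* u (unit-^ n u)

  ∏ : ℕ → (ℕ → Carrier) → Carrier
  ∏ zero f = 1#
  ∏ (suc n) f = ∏ n f * f n

  ∑ : ℕ → (ℕ → Carrier) → Carrier
  ∑ zero f = 0#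
  ∑ (suc n) f = ∑ n f + f n

  ∏-cong< : ∀ n {f g} → (∀ i → i < n → f i ≈ g i) → ∏ n f ≈ ∏ n g
  ∏-cong< zero eq = refl
  ∏-cong< (suc n) eq = *-cong (∏-cong< n λ i lt → eq i (ℕₚ.m≤n⇒m≤1+n lt)) (eq n ℕₚ.≤-refl)

  ∏-cong : ∀ n {f g} → (∀ i → f i ≈ g i) → ∏ n f ≈ ∏ n g
  ∏-cong n eq = ∏-cong< n λ i _ → eq i

  ∑-cong< : ∀ n {f g} → (∀ i → i < n → f i ≈ g i) → ∑ n f ≈ ∑ n g
  ∑-cong< zero eq = refl
  ∑-cong< (suc n) eq = +-cong (∑-cong< n λ i lt → eq i (ℕₚ.m≤n⇒m≤1+n lt)) (eq n ℕₚ.≤-refl)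

  ∑-cong : ∀ n {f g} → (∀ i → f i ≈ g i) → ∑ n f ≈ ∑ n g
  ∑-cong n eq = ∑-cong< n λ i _ → eq i

  ∑-zero : ∀ n {f} → (∀ i → i < n → f i ≈ 0#) → ∑ n f ≈ 0#
  ∑-zero zero eq = refl
  ∑-zero (suc n) eq = trans (+-cong (∑-zero n λ i lt → eq i (ℕₚ.m≤n⇒m≤1+n lt)) (eq n ℕₚ.≤-refl)) (+-identityˡ 0#)

  ∑-*ˡ : ∀ n c f → ∑ n (λ i → c * f i) ≈ c * ∑ n f
  ∑-*ˡ zero c f = sym (zeroʳ c)
  ∑-*ˡ (suc n) c f = trans (+-congʳ (∑-*ˡ n c f)) (sym (distribˡ _ _ _))

  ∑-+ : ∀ n f g → ∑ n (λ i → f i + g i) ≈ ∑ n f + ∑ n g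
  ∑-+ zero f g = sym (+-identityˡ 0#)
  ∑-+ (suc n) f g = trans (+-congʳ (∑-+ n f g))
    (solve 4 (λ a b c d → (a :+ b) :+ (c :+ d) := (a :+ c) :+ (b :+ d)) refl _ _ _ _)

  ∑-first : ∀ n f → ∑ (suc n) f ≈ f 0 + ∑ n (λ i → f (suc i))
  ∑-first zero f = trans (+-identityˡ _) (sym (+-identityʳ _))
  ∑-first (suc n) f = trans (+-congʳ (∑-first n f)) (+-assoc _ _ _)

  ∏-first : ∀ n f → ∏ (suc n) f ≈ f 0 * ∏ n (λ i → f (suc i))
  ∏-first zero f = trans (*-identityˡ _) (sym (*-identityʳ _))
  ∏-first (suc n) f = trans (*-congʳ (∏-first n f)) (*-assoc _ _ _)

  ∏-* : ∀ n f g → ∏ n (λ i → f i * g i) ≈ ∏ n f * ∏ n g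
  ∏-* zero f g = sym (*-identityˡ 1#)
  ∏-* (suc n) f g = trans (*-congʳ (∏-* n f g))
    (solve 4 (λ a b c d → (a :* b) :* (c :* d) := (a :* c) :* (b :* d)) refl _ _ _ _)

  ∏-reverse : ∀ n f → ∏ n f ≈ ∏ n (λ i → f (n ∸ suc i))
  ∏-reverse zero f = refl
  ∏-reverse (suc n) f = begin
    ∏ n f * f n ≈⟨ *-comm _ _ ⟩
    f n * ∏ n f ≈⟨ *-congˡ (∏-reverse n f) ⟩
    f n * ∏ n (λ i → f (n ∸ suc i)) ≈⟨ ∏-first n (λ i → f (n ∸ i)) ⟨
    ∏ (suc n) (λ i → f (n ∸ i)) ∎

  ∏-unit : ∀ n {f} → (∀ i → i < n → Unit (f i)) → Unit (∏ n f)
  ∏-unit zero u = 1# , *-identityˡ 1#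
  ∏-unit (suc n) u = unit-* (∏-unit n λ i lt → u i (ℕₚ.m≤n⇒m≤1+n lt)) (u n ℕₚ.≤-refl)

  ∏-const : ∀ n c → ∏ n (λ _ → c) ≈ c ^ n
  ∏-const zero c = refl
  ∏-const (suc n) c = trans (*-comm _ _) (*-congˡ (∏-const n c))

  geom : ∀ p n → (1# - p) * ∑ n (p ^_) ≈ 1# - p ^ n
  geom p zero = solve 1 (λ p → (con (+ 1) :- p) :* con (+ 0) := con (+ 1) :- con (+ 1)) refl p
  geom p (suc n) = begin
    (1# - p) * (∑ n (p ^_) + p ^ n) ≈⟨ distribˡ _ _ _ ⟩
    (1# - p) * ∑ n (p ^_) + (1# - p) * p ^ n ≈⟨ +-congʳ (geom p n) ⟩
    1# - p ^ n + (1# - p) * p ^ n ≈⟨ solve 2 (λ p q → con (+ 1) :- q :+ (con (+ 1) :- p) :* q := con (+ 1) :- p :* q) refl p (p ^ n) ⟩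
    1# - p ^ suc n ∎

  1^n : ∀ n → 1# ^ n ≈ 1#
  1^n zero = refl
  1^n (suc n) = trans (*-identityˡ _) (1^n n)

open import Data.Nat.Base as ℕ using (ℕ; zero; suc; _∸_; _≤_; z≤n; s≤s)

-- A terminating very-well-poised series summed by a WZ pair.

module WellPoised (R : CommutativeRing 0ℓ 0ℓ) (a p y : CommutativeRing.Carrier R) where
  open import Data.Integer.Base using (+_)
  open import Data.Product using (_,_; proj₁; proj₂)
  open RingTools R
  open import Relation.Binary.Reasoning.Setoid setoid

  module Identity
    (unit-p : ∀ j → Unit (1# - p ^ suc j))
    (unit-a : ∀ j → Unit (1# - a * p ^ j))
    (unit-y : ∀ j → Unit (1# - y * p ^ suc j))
    where

    u v t : ℕ → Carrier
    u j = proj₁ (unit-p j)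
    v j = proj₁ (unit-a j)
    t j = proj₁ (unit-y j)

    ratio : ℕ → Carrier
    ratio k = (p ^ k * p ^ k) * (p * (y - a * p ^ k)) * (1# - a * p ^ k)

    -- Multiplied by 1 - a p^(2k), this is the k-th term of the ₆φ₅ in base p with parameters a,
    -- a/y, p^(-m) and one parameter sent to infinity, divided by the value of the series, so that
    -- every row m sums to 1. The powers of p in (p^(-m);p)_k and in the argument are combined,
    -- which leaves only non-negative powers of p; the factor 1 - p^(m ∸ k) ends the series after k
    -- = m.
    h : ℕ → ℕ → Carrier
    h m zero = ∏ m (λ j → 1# - y * p ^ suc j) * ∏ (suc m) v
    h m (suc k) = h m k * (1# - p ^ (m ∸ k)) * ratio k * (u k * t k * v (suc (m ℕ.+ k)))

    -- The WZ pair: summand (m + 1) k - summand m k = cert m k - cert m (k - 1).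
    cert : ℕ → ℕ → Carrier
    cert m k = - (h m k * (p ^ suc m * p ^ k) * (y - a * p ^ k) * (1# - a * p ^ k) * v (suc (m ℕ.+ k)))

    -- The quotient of consecutive rows is a rational function of p^m and p^k; here its denominators
    -- are multiplied out. From k to k + 1 both rows acquire the same `ratio`, `u` and `t`, so only
    -- the factor 1 - p^(m - k) and the index of `v` have to be tracked.
    h-suc : ∀ m k → k ≤ m →
      h (suc m) k * (1# - p ^ (suc m ∸ k)) * (1# - a * p ^ suc (m ℕ.+ k))
        ≈ h m k * (1# - p ^ suc m) * (1# - y * p ^ suc m)
    h-suc m zero _ = begin
      (A * Y) * (V * v (suc m)) * (1# - P) * (1# - a * p ^ suc (m ℕ.+ 0))
        ≈⟨ *-congˡ (+-congˡ (-‿cong (*-congˡ (^-congʳ p (≡.cong suc (ℕₚ.+-identityʳ m)))))) ⟩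
      (A * Y) * (V * v (suc m)) * (1# - P) * (1# - a * P)
        ≈⟨ solve 6 (λ A Y V v P B → (A :* Y) :* (V :* v) :* P :* B := (A :* V :* P :* Y) :* (B :* v)) refl A Y V (v (suc m)) (1# - P) (1# - a * P) ⟩
      (A * V * (1# - P) * Y) * ((1# - a * P) * v (suc m))
        ≈⟨ *-congˡ (proj₂ (unit-a (suc m))) ⟩
      (A * V * (1# - P) * Y) * 1#
        ≈⟨ *-identityʳ _ ⟩
      A * V * (1# - P) * Y ∎
      where
      A = ∏ m (λ j → 1# - y * p ^ suc j)
      Y = 1# - y * p ^ suc m
      V = ∏ (suc m) v
      P = p ^ suc m
    h-suc m (suc k) k<m = begin
      h (suc m) k * (1# - p ^ (suc m ∸ k)) * ratio k * (u k * t k * v (suc (suc m ℕ.+ k))) * (1# - p ^ (m ∸ k)) * (1# - a * p ^ suc (m ℕ.+ suc k))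
        ≈⟨ *-congˡ (+-congˡ (-‿cong (*-congˡ (^-congʳ p (≡.cong suc (ℕₚ.+-suc m k)))))) ⟩
      h (suc m) k * (1# - p ^ (suc m ∸ k)) * ratio k * (u k * t k * v (suc (suc m ℕ.+ k))) * (1# - p ^ (m ∸ k)) * (1# - a * p ^ suc (suc m ℕ.+ k))
        ≈⟨ solve 8 (λ H B E u t v K C → H :* B :* E :* (u :* t :* v) :* K :* C := (H :* B :* K :* E :* (u :* t)) :* (C :* v)) refl _ _ _ _ _ _ _ _ ⟩
      (h (suc m) k * (1# - p ^ (suc m ∸ k)) * (1# - p ^ (m ∸ k)) * ratio k * (u k * t k)) * ((1# - a * p ^ suc (suc m ℕ.+ k)) * v (suc (suc m ℕ.+ k)))
        -- The index of `v` differs by one between the rows m + 1 and m; both products with their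
        -- inverses are 1 and may be exchanged.
        ≈⟨ *-congˡ (trans (proj₂ (unit-a _)) (sym (proj₂ (unit-a (suc (m ℕ.+ k)))))) ⟩
      (h (suc m) k * (1# - p ^ (suc m ∸ k)) * (1# - p ^ (m ∸ k)) * ratio k * (u k * t k)) * ((1# - a * p ^ suc (m ℕ.+ k)) * v (suc (m ℕ.+ k)))
        ≈⟨ solve 8 (λ H B E u t v K C → (H :* B :* K :* E :* (u :* t)) :* (C :* v) := (H :* B :* C) :* (K :* E :* (u :* t :* v))) refl _ _ _ _ _ _ _ _ ⟩
      (h (suc m) k * (1# - p ^ (suc m ∸ k)) * (1# - a * p ^ suc (m ℕ.+ k))) * ((1# - p ^ (m ∸ k)) * ratio k * (u k * t k * v (suc (m ℕ.+ k))))
        ≈⟨ *-congʳ (h-suc m k (ℕₚ.<⇒≤ k<m)) ⟩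
      h m k * (1# - p ^ suc m) * (1# - y * p ^ suc m) * ((1# - p ^ (m ∸ k)) * ratio k * (u k * t k * v (suc (m ℕ.+ k))))
        ≈⟨ solve 6 (λ H B C K E u → H :* B :* C :* (K :* E :* u) := H :* K :* E :* u :* B :* C) refl _ _ _ _ _ _ ⟩
      h m k * (1# - p ^ (m ∸ k)) * ratio k * (u k * t k * v (suc (m ℕ.+ k))) * (1# - p ^ suc m) * (1# - y * p ^ suc m) ∎

    -- cert m (k - 1), written in terms of the k-th summand; it vanishes at k = 0.
    cert⁻ : ℕ → ℕ → Carrier
    cert⁻ m k = - (p ^ (suc m ∸ k) * (1# - p ^ k) * (1# - y * p ^ k) * u (m ∸ k) * h m k)

    inv-p : ∀ j → (1# - p ^ suc j) * u j ≈ 1#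
    inv-p j = proj₂ (unit-p j)

    inv-a : ∀ j → (1# - a * p ^ j) * v j ≈ 1#
    inv-a j = proj₂ (unit-a j)

    inv-y : ∀ j → (1# - y * p ^ suc j) * t j ≈ 1#
    inv-y j = proj₂ (unit-y j)

    inv-p∸ : ∀ {k m} → suc k ≤ m → (1# - p ^ (m ∸ k)) * u (m ∸ suc k) ≈ 1#
    inv-p∸ {k} {m} k<m = trans (*-congʳ (+-congˡ (-‿cong (^-congʳ p (ℕₚ.+-∸-assoc 1 k<m))))) (inv-p (m ∸ suc k))

    ^-split : ∀ {k m} → k ≤ m → p ^ m ≈ p ^ (m ∸ k) * p ^ k
    ^-split {k} {m} k≤m = trans (^-congʳ p (≡.sym (ℕₚ.m∸n+n≡m k≤m))) (^-homo-* p (m ∸ k) k)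

    cert⁻-suc : ∀ m k → suc k ≤ m → cert⁻ m (suc k) ≈ cert m k
    cert⁻-suc m k k<m = -‿cong (begin
      κ * A * B * w * (H * (1# - κ) * ((K * K) * (p * Z) * C) * (u k * t k * V))
        ≈⟨ solve 13 (λ κ A B w H W K p Z C u t V → κ :* A :* B :* w :* (H :* W :* ((K :* K) :* (p :* Z) :* C) :* (u :* t :* V))
             := H :* ((p :* (κ :* K)) :* K) :* Z :* C :* V :* ((A :* u) :* (B :* t) :* (W :* w)))
             refl κ A B w H (1# - κ) K p Z C (u k) (t k) V ⟩
      H * ((p * (κ * K)) * K) * Z * C * V * ((A * u k) * (B * t k) * ((1# - κ) * w))
        ≈⟨ *-cong (*-congʳ (*-congʳ (*-congʳ (*-congˡ (*-congʳ (*-congˡ (sym (^-split (ℕₚ.<⇒≤ k<m)))))))))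
             (*-cong (*-cong (inv-p k) (inv-y k)) (inv-p∸ k<m)) ⟩
      H * (p ^ suc m * K) * Z * C * V * (1# * 1# * 1#)
        ≈⟨ solve 1 (λ x → x :* (con (+ 1) :* con (+ 1) :* con (+ 1)) := x) refl _ ⟩
      H * (p ^ suc m * K) * Z * C * V ∎)
      where
      κ = p ^ (m ∸ k)
      K = p ^ k
      A = 1# - p * K
      B = 1# - y * (p * K)
      w = u (m ∸ suc k)
      H = h m k
      V = v (suc (m ℕ.+ k))
      Z = y - a * K
      C = 1# - a * K

    summand : ℕ → ℕ → Carrier
    summand m k = (1# - a * (p ^ k * p ^ k)) * h m k

    -- The WZ equation. Multiplied by the units 1 - κ and D it loses its inverses and becomes one
    -- polynomial identity in a, y, κ = p^(m+1-k) and K = p^k, because p^(m+1) = κK.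
    summand-suc : ∀ m k → k ≤ m → summand (suc m) k + cert⁻ m k ≈ summand m k + cert m k
    summand-suc m k k≤m = unit-cancelˡ (unit-* (u (m ∸ k) , invκ) (V , invA)) (begin
      ((1# - κ) * D) * (E * H′ + - (κ * A * B * w * H))
        ≈⟨ solve 9 (λ κ D E H′ A B w H o → ((o :- κ) :* D) :* (E :* H′ :+ :- (κ :* A :* B :* w :* H))
              := E :* (H′ :* (o :- κ) :* D) :- κ :* A :* B :* H :* D :* ((o :- κ) :* w)) refl κ D E H′ A B w H 1# ⟩
      E * (H′ * (1# - κ) * D) - κ * A * B * H * D * ((1# - κ) * w)
        ≈⟨ +-cong (*-congˡ hs) (-‿cong (trans (*-congˡ invκ) (*-identityʳ _))) ⟩
      E * (H * (1# - κ * K) * (1# - y * (κ * K))) - κ * A * B * H * D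
        ≈⟨ solve 5 (λ a y κ K H → let o = con (+ 1) in
             (o :- a :* (K :* K)) :* (H :* (o :- κ :* K) :* (o :- y :* (κ :* K))) :- κ :* (o :- K) :* (o :- y :* K) :* H :* (o :- a :* (κ :* K :* K))
             := (o :- a :* (K :* K)) :* H :* (o :- κ) :* (o :- a :* (κ :* K :* K)) :- H :* (κ :* K :* K) :* (y :- a :* K) :* (o :- a :* K) :* (o :- κ))
             refl a y κ K H ⟩
      E * H * (1# - κ) * D - H * (κ * K * K) * Z * C * (1# - κ)
        ≈⟨ +-congˡ (-‿cong (trans (*-congˡ invA) (*-identityʳ _))) ⟨
      E * H * (1# - κ) * D - H * (κ * K * K) * Z * C * (1# - κ) * (D * V)
        ≈⟨ solve 9 (λ κ D E H P Z C V o →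
             E :* H :* (o :- κ) :* D :- H :* P :* Z :* C :* (o :- κ) :* (D :* V)
             := ((o :- κ) :* D) :* (E :* H :+ :- (H :* P :* Z :* C :* V))) refl κ D E H (κ * K * K) Z C V 1# ⟩
      ((1# - κ) * D) * (E * H + - (H * (κ * K * K) * Z * C * V))
        ≈⟨ *-congˡ (+-congˡ (-‿cong (*-congʳ (*-congʳ (*-congʳ (*-congˡ (*-congʳ P≈))))))) ⟨
      ((1# - κ) * D) * (E * H + - (H * (p ^ suc m * K) * Z * C * V)) ∎)
      where
      κ = p ^ (suc m ∸ k)
      K = p ^ k
      A = 1# - K
      B = 1# - y * K
      E = 1# - a * (K * K)
      w = u (m ∸ k)
      H = h m k
      H′ = h (suc m) k
      V = v (suc (m ℕ.+ k))
      Z = y - a * K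
      C = 1# - a * K
      D = 1# - a * (κ * K * K)
      P≈ : p ^ suc m ≈ κ * K
      P≈ = ^-split (ℕₚ.m≤n⇒m≤1+n k≤m)
      PK≈ : p ^ suc (m ℕ.+ k) ≈ κ * K * K
      PK≈ = trans (^-homo-* p (suc m) k) (*-congʳ P≈)
      D≈ : 1# - a * p ^ suc (m ℕ.+ k) ≈ D
      D≈ = +-congˡ (-‿cong (*-congˡ PK≈))
      invA : D * V ≈ 1#
      invA = trans (*-congʳ (sym D≈)) (inv-a _)
      invκ : (1# - κ) * w ≈ 1#
      invκ = inv-p∸ (s≤s k≤m)
      hs : H′ * (1# - κ) * D ≈ H * (1# - κ * K) * (1# - y * (κ * K))
      hs = trans (*-congˡ (sym D≈)) (trans (h-suc m k k≤m)
             (*-cong (*-congˡ (+-congˡ (-‿cong P≈))) (+-congˡ (-‿cong (*-congˡ P≈)))))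

    partial-sums : ∀ m k → k ≤ m → ∑ (suc k) (summand (suc m)) ≈ ∑ (suc k) (summand m) + cert m k
    partial-sums m zero _ = begin
      0# + summand (suc m) 0 ≈⟨ +-congˡ (solve 5 (λ x κ B w H → x := x :+ :- (κ :* (con (+ 1) :- con (+ 1)) :* B :* w :* H)) refl (summand (suc m) 0) (p ^ suc m) (1# - y * 1#) (u m) (h m 0)) ⟩
      0# + (summand (suc m) 0 + cert⁻ m 0) ≈⟨ +-congˡ (summand-suc m 0 z≤n) ⟩
      0# + (summand m 0 + cert m 0) ≈⟨ +-assoc _ _ _ ⟨
      0# + summand m 0 + cert m 0 ∎
    partial-sums m (suc k) k<m = begin
      ∑ (suc k) (summand (suc m)) + summand (suc m) (suc k) ≈⟨ +-congʳ (partial-sums m k (ℕₚ.<⇒≤ k<m)) ⟩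
      ∑ (suc k) (summand m) + cert m k + summand (suc m) (suc k) ≈⟨ +-congʳ (+-congˡ (cert⁻-suc m k k<m)) ⟨
      ∑ (suc k) (summand m) + cert⁻ m (suc k) + summand (suc m) (suc k) ≈⟨ solve 3 (λ a b c → a :+ b :+ c := a :+ (c :+ b)) refl _ _ _ ⟩
      ∑ (suc k) (summand m) + (summand (suc m) (suc k) + cert⁻ m (suc k)) ≈⟨ +-congˡ (summand-suc m (suc k) k<m) ⟩
      ∑ (suc k) (summand m) + (summand m (suc k) + cert m (suc k)) ≈⟨ +-assoc _ _ _ ⟨
      ∑ (suc (suc k)) (summand m) + cert m (suc k) ∎

    -- Row m + 1 has one term more than row m, outside the range of the WZ equation. It cancels the
    -- boundary term left by telescoping.
    last-summand : ∀ m → summand (suc m) (suc m) + cert m m ≈ 0#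
    last-summand m = begin
      E * (H′ * (1# - p ^ (suc m ∸ m)) * ((K * K) * (p * Z) * C) * (u m * t m * v (suc (suc m ℕ.+ m)))) + cert m m
        ≈⟨ +-congʳ (solve 10 (λ E H′ D K p Z C u t V → E :* (H′ :* D :* ((K :* K) :* (p :* Z) :* C) :* (u :* t :* V))
             := (H′ :* D) :* ((p :* K :* K) :* Z :* C) :* (u :* t) :* (E :* V)) refl E H′ _ K p Z C _ _ _) ⟩
      (H′ * (1# - p ^ (suc m ∸ m))) * ((p * K * K) * Z * C) * (u m * t m) * (E * v (suc (suc m ℕ.+ m))) + cert m m
        ≈⟨ +-congʳ (*-congˡ (trans (*-congʳ E≈) (trans (inv-a _) (sym (inv-a (suc (m ℕ.+ m))))))) ⟩
      (H′ * (1# - p ^ (suc m ∸ m))) * ((p * K * K) * Z * C) * (u m * t m) * ((1# - a * p ^ suc (m ℕ.+ m)) * V) + cert m m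
        ≈⟨ +-congʳ (solve 6 (λ H′ D F G A V → H′ :* D :* F :* G :* (A :* V) := (H′ :* D :* A) :* F :* G :* V) refl H′ _ _ _ _ _) ⟩
      (H′ * (1# - p ^ (suc m ∸ m)) * (1# - a * p ^ suc (m ℕ.+ m))) * ((p * K * K) * Z * C) * (u m * t m) * V + cert m m
        ≈⟨ +-congʳ (*-congʳ (*-congʳ (*-congʳ (h-suc m m ℕₚ.≤-refl)))) ⟩
      (h m m * (1# - p ^ suc m) * (1# - y * p ^ suc m)) * ((p * K * K) * Z * C) * (u m * t m) * V + cert m m
        ≈⟨ +-congʳ (solve 10 (λ H A B p K Z C u t V → H :* A :* B :* ((p :* K :* K) :* Z :* C) :* (u :* t) :* V
             := H :* (p :* K :* K) :* Z :* C :* V :* ((A :* u) :* (B :* t))) refl _ _ _ _ _ _ _ _ _ _) ⟩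
      h m m * (p * K * K) * Z * C * V * (((1# - p ^ suc m) * u m) * ((1# - y * p ^ suc m) * t m)) + cert m m
        ≈⟨ +-congʳ (*-congˡ (*-cong (inv-p m) (inv-y m))) ⟩
      h m m * (p * K * K) * Z * C * V * (1# * 1#) + - (h m m * (p * K * K) * Z * C * V)
        ≈⟨ solve 1 (λ x → x :* (con (+ 1) :* con (+ 1)) :+ :- x := con (+ 0)) refl _ ⟩
      0# ∎
      where
      K = p ^ m
      E = 1# - a * (p ^ suc m * p ^ suc m)
      H′ = h (suc m) m
      Z = y - a * K
      C = 1# - a * K
      V = v (suc (m ℕ.+ m))
      E≈ : E ≈ 1# - a * p ^ suc (suc m ℕ.+ m)
      E≈ = +-congˡ (-‿cong (*-congˡ (sym (trans (^-congʳ p (≡.cong suc (≡.sym (ℕₚ.+-suc m m)))) (^-homo-* p (suc m) (suc m))))))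

    total : ∀ m → ∑ (suc m) (summand m) ≈ 1#
    total zero = begin
      0# + (1# - a * (1# * 1#)) * (1# * (1# * v 0))
        ≈⟨ solve 2 (λ a v → con (+ 0) :+ (con (+ 1) :- a :* (con (+ 1) :* con (+ 1))) :* (con (+ 1) :* (con (+ 1) :* v)) := (con (+ 1) :- a :* con (+ 1)) :* v) refl a (v 0) ⟩
      (1# - a * 1#) * v 0 ≈⟨ inv-a 0 ⟩
      1# ∎
    total (suc m) = begin
      ∑ (suc m) (summand (suc m)) + summand (suc m) (suc m) ≈⟨ +-congʳ (partial-sums m m ℕₚ.≤-refl) ⟩
      ∑ (suc m) (summand m) + cert m m + summand (suc m) (suc m) ≈⟨ +-congʳ (+-congʳ (total m)) ⟩
      1# + cert m m + summand (suc m) (suc m) ≈⟨ solve 3 (λ a b c → a :+ b :+ c := a :+ (c :+ b)) refl _ _ _ ⟩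
      1# + (summand (suc m) (suc m) + cert m m) ≈⟨ +-congˡ (last-summand m) ⟩
      1# + 0# ≈⟨ +-identityʳ 1# ⟩
      1# ∎

-- The summands α(k), and their sum where x q^n = 1 or x = q^n.

open import Data.Nat.Base as ℕ using (ℕ; zero; suc; _∸_; _≤_; _<_)

-- With s = s′ + 1 this is the exponent s·C(k+1,2) - k of the theorem, accumulated as the sum of
-- s(j+1) - 1 over j < k so that no subtraction occurs.
qExponent : ℕ → ℕ → ℕ
qExponent s′ zero = 0
qExponent s′ (suc k) = qExponent s′ k ℕ.+ (s′ ℕ.+ suc s′ ℕ.* k)

-- `w j` stands for the quotient of the j-th factors of the q-shifted factorials, so `∏ k w` is the
-- quotient of the factorials themselves. It is a parameter because each special point writes this
-- quotient in its own ring of fractions.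
module Summands (R : CommutativeRing 0ℓ 0ℓ) (q : CommutativeRing.Carrier R) (s′ : ℕ)
  (w : ℕ → CommutativeRing.Carrier R) where
  open RingTools R
  open import Data.Integer.Base using (+_)
  open import Relation.Binary.Reasoning.Setoid setoid

  [_] : ℕ → Carrier
  [ n ] = ∑ n (q ^_)

  -- α without its bracket: this part satisfies a two-term recurrence, which is compared with that
  -- of `h` and, at roots of unity, with its own reflection.
  g : ℕ → Carrier
  g k = (- 1#) ^ k * q ^ qExponent s′ k * ∏ k w

  αᵣ : ℕ → Carrier
  αᵣ k = (- 1#) ^ k * q ^ qExponent s′ k * [ 2 ℕ.* suc s′ ℕ.* k ℕ.+ 1 ] * ∏ k w

  α≈g : ∀ k → αᵣ k ≈ g k * [ 2 ℕ.* suc s′ ℕ.* k ℕ.+ 1 ]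
  α≈g k = solve 3 (λ a b c → a :* b :* c := a :* c :* b) refl _ _ _

  g-suc : ∀ k → g (suc k) ≈ - (q ^ (s′ ℕ.+ suc s′ ℕ.* k)) * w k * g k
  g-suc k = begin
    (- 1# * (- 1#) ^ k) * q ^ (qExponent s′ k ℕ.+ (s′ ℕ.+ suc s′ ℕ.* k)) * (∏ k w * w k)
      ≈⟨ *-congʳ (*-congˡ (^-homo-* q (qExponent s′ k) _)) ⟩
    (- 1# * (- 1#) ^ k) * (q ^ qExponent s′ k * q ^ (s′ ℕ.+ suc s′ ℕ.* k)) * (∏ k w * w k)
      ≈⟨ solve 5 (λ a b c d e → (:- con (+ 1) :* a) :* (b :* c) :* (d :* e) := :- c :* e :* (a :* b :* d)) refl _ _ _ _ _ ⟩
    - (q ^ (s′ ℕ.+ suc s′ ℕ.* k)) * w k * g k ∎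

  q^2sk+1 : ∀ k → q ^ (2 ℕ.* suc s′ ℕ.* k ℕ.+ 1) ≈ q * ((q ^ suc s′) ^ k * (q ^ suc s′) ^ k)
  q^2sk+1 k = begin
    q ^ (2 ℕ.* s ℕ.* k ℕ.+ 1) ≡⟨ ≡.cong (q ^_) (≡.trans (ℕₚ.+-comm _ 1) (≡.cong suc (≡.trans (ℕₚ.*-assoc 2 s k) (≡.cong (s ℕ.* k ℕ.+_) (ℕₚ.+-identityʳ (s ℕ.* k)))))) ⟩
    q * q ^ (s ℕ.* k ℕ.+ s ℕ.* k) ≈⟨ *-congˡ (^-homo-* q (s ℕ.* k) (s ℕ.* k)) ⟩
    q * (q ^ (s ℕ.* k) * q ^ (s ℕ.* k)) ≈⟨ *-congˡ (*-cong (^-assocʳ q s k) (^-assocʳ q s k)) ⟨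
    q * ((q ^ s) ^ k * (q ^ s) ^ k) ∎
    where s = suc s′

-- One computation serves both points: `y` is the inverse of q^n, and the pair x, 1/x is y, q^n in
-- one order or the other.
module Evaluation (R : CommutativeRing 0ℓ 0ℓ) (q y : CommutativeRing.Carrier R) (s′ m : ℕ)
  (w : ℕ → CommutativeRing.Carrier R) where
  open RingTools R
  open import Data.Integer.Base using (+_)
  open import Relation.Nullary using (yes; no)
  open import Data.Product using (_,_)
  open import Relation.Binary.Reasoning.Setoid setoid
  open Summands R q s′ w public

  s n : ℕ
  s = suc s′
  n = suc (s ℕ.* m)

  p : Carrier
  p = q ^ s

  numerator denominator : ℕ → Carrier
  numerator j = (1# - y * (q * p ^ j)) * (1# - q ^ n * (q * p ^ j)) * (1# - q * p ^ j)
  denominator j = (1# - y * p ^ suc j) * (1# - q ^ n * p ^ suc j) * (1# - p ^ suc j)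

  module _ (y-inv : y * q ^ n ≈ 1#)
    (w-ratio : ∀ j → w j * denominator j ≈ numerator j)
    (unit-p : ∀ j → Unit (1# - p ^ suc j))
    (unit-a : ∀ j → Unit (1# - q * p ^ j))
    (unit-y : ∀ j → Unit (1# - y * p ^ suc j))
    where

    open WellPoised R q p y
    open Identity unit-p unit-a unit-y

    q^n≈ : q ^ n ≈ q * p ^ m
    q^n≈ = *-congˡ (sym (^-assocʳ q s m))

    y-inv′ : y * (q * p ^ m) ≈ 1#
    y-inv′ = trans (*-congˡ (sym q^n≈)) y-inv

    q^n-p : ∀ j → q * p ^ (m ℕ.+ j) ≈ q ^ n * p ^ j
    q^n-p j = begin
      q * p ^ (m ℕ.+ j) ≈⟨ *-congˡ (^-homo-* p m j) ⟩
      q * (p ^ m * p ^ j) ≈⟨ *-assoc _ _ _ ⟨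
      q * p ^ m * p ^ j ≈⟨ *-congʳ q^n≈ ⟨
      q ^ n * p ^ j ∎

    unit-den : ∀ j → Unit (denominator j)
    unit-den j = unit-* (unit-* (unit-y j) (unit-cong (+-congˡ (-‿cong (q^n-p (suc j)))) (unit-a (m ℕ.+ suc j)))) (unit-p j)

    -- The first factor of `numerator m` is 1 - y q p^m = 1 - y q^n = 0.
    w-vanish : w m ≈ 0#
    w-vanish = unit-cancelˡ (unit-den m) (begin
      denominator m * w m ≈⟨ *-comm _ _ ⟩
      w m * denominator m ≈⟨ w-ratio m ⟩
      numerator m ≈⟨ *-congʳ (*-congʳ (trans (+-congˡ (-‿cong y-inv′)) (-‿inverseʳ 1#))) ⟩
      0# * _ * _ ≈⟨ solve 3 (λ a b c → con (+ 0) :* a :* b := c :* con (+ 0)) refl _ _ _ ⟩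
      denominator m * 0# ∎)

    ∏w-vanish : ∀ k → m < k → ∏ k w ≈ 0#
    ∏w-vanish (suc k) m<k with m ℕₚ.≟ k
    ... | yes ≡.refl = trans (*-congˡ w-vanish) (zeroʳ _)
    ... | no m≢k = trans (*-congʳ (∏w-vanish k (ℕₚ.≤∧≢⇒< (ℕₚ.≤-pred m<k) m≢k))) (zeroˡ _)

    α-vanish : ∀ k → m < k → αᵣ k ≈ 0#
    α-vanish k m<k = trans (*-congˡ (∏w-vanish k m<k)) (zeroʳ _)

    w-step : ∀ k → suc k ≤ m → - (q ^ (s′ ℕ.+ s ℕ.* k)) * w k ≈ (1# - p ^ (m ∸ k)) * ratio k * (u k * t k * v (suc (m ℕ.+ k)))
    w-step k k<m = unit-cancelˡ (unit-den k) (begin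
      denominator k * (- (q ^ (s′ ℕ.+ s ℕ.* k)) * w k)
        ≈⟨ solve 3 (λ d r w → d :* (:- r :* w) := :- r :* (w :* d)) refl _ _ _ ⟩
      - (q ^ (s′ ℕ.+ s ℕ.* k)) * (w k * denominator k)
        ≈⟨ *-cong (-‿cong (trans (^-homo-* q s′ (s ℕ.* k)) (*-congˡ (sym (^-assocʳ q s k))))) (w-ratio k) ⟩
      - (r * K) * ((1# - y * (q * K)) * B * C)
        -- Writing 1 as y q p^m lets y q p^k be taken out of 1 - y q p^k, leaving p^(m-k) - 1.
        ≈⟨ *-congˡ (*-congʳ (*-congʳ (+-congʳ (sym κ-inv)))) ⟩
      - (r * K) * ((y * (q * (κ * K)) - y * (q * K)) * B * C)
        ≈⟨ solve 7 (λ r K y q κ B C → :- (r :* K) :* ((y :* (q :* (κ :* K)) :- y :* (q :* K)) :* B :* C)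
             := (con (+ 1) :- κ) :* ((K :* K) :* ((q :* r) :* (y :* B)) :* C)) refl r K y q κ B C ⟩
      (1# - κ) * ((K * K) * (p * (y * B)) * C)
        ≈⟨ *-congˡ (*-congʳ (*-congˡ (*-congˡ yB))) ⟩
      (1# - κ) * ((K * K) * (p * (y - q * K)) * C)
        ≈⟨ solve 1 (λ x → x := (con (+ 1) :* con (+ 1) :* con (+ 1)) :* x) refl _ ⟩
      (1# * 1# * 1#) * ((1# - κ) * ratio k)
        ≈⟨ *-congʳ (*-cong (*-cong (inv-p k) (inv-y k)) (inv-a (suc (m ℕ.+ k)))) ⟨
      ((1# - p ^ suc k) * u k * ((1# - y * p ^ suc k) * t k) * ((1# - q * p ^ suc (m ℕ.+ k)) * v (suc (m ℕ.+ k)))) * ((1# - κ) * ratio k)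
        ≈⟨ *-congʳ (*-congˡ (*-congʳ (+-congˡ (-‿cong (trans (*-congˡ (^-congʳ p (≡.sym (ℕₚ.+-suc m k)))) (q^n-p (suc k))))))) ⟩
      ((1# - p ^ suc k) * u k * ((1# - y * p ^ suc k) * t k) * ((1# - q ^ n * p ^ suc k) * v (suc (m ℕ.+ k)))) * ((1# - κ) * ratio k)
        ≈⟨ solve 8 (λ A u B t D v κ ρ → (A :* u :* (B :* t) :* (D :* v)) :* (κ :* ρ) := (B :* D :* A) :* (κ :* ρ :* (u :* t :* v))) refl _ _ _ _ _ _ _ _ ⟩
      denominator k * ((1# - κ) * ratio k * (u k * t k * v (suc (m ℕ.+ k)))) ∎)
      where
      κ = p ^ (m ∸ k)
      K = p ^ k
      r = q ^ s′
      B = 1# - q ^ n * (q * K)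
      C = 1# - q * K
      κ-inv : y * (q * (κ * K)) ≈ 1#
      κ-inv = trans (*-congˡ (*-congˡ (sym (^-split (ℕₚ.<⇒≤ k<m))))) y-inv′
      yB : y * B ≈ y - q * K
      yB = begin
        y * (1# - q ^ n * (q * K)) ≈⟨ solve 3 (λ y a b → y :* (con (+ 1) :- a :* b) := y :- (y :* a) :* b) refl y (q ^ n) (q * K) ⟩
        y - (y * q ^ n) * (q * K) ≈⟨ +-congˡ (-‿cong (trans (*-congʳ y-inv) (*-identityˡ _))) ⟩
        y - q * K ∎

    g≈h : ∀ k → k ≤ m → g k * h m 0 ≈ h m k
    g≈h zero _ = solve 1 (λ x → con (+ 1) :* con (+ 1) :* con (+ 1) :* x := x) refl _
    g≈h (suc k) k<m = begin
      g (suc k) * h m 0 ≈⟨ *-congʳ (trans (g-suc k) (*-congʳ (w-step k k<m))) ⟩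
      (1# - p ^ (m ∸ k)) * ratio k * (u k * t k * v (suc (m ℕ.+ k))) * g k * h m 0
        ≈⟨ solve 5 (λ a b c g h → a :* b :* c :* g :* h := g :* h :* a :* b :* c) refl _ _ _ _ _ ⟩
      g k * h m 0 * (1# - p ^ (m ∸ k)) * ratio k * (u k * t k * v (suc (m ℕ.+ k)))
        ≈⟨ *-congʳ (*-congʳ (*-congʳ (g≈h k (ℕₚ.<⇒≤ k<m)))) ⟩
      h m (suc k) ∎

    -- The bracket is the very-well-poised factor: (1 - q)[2sk + 1] = 1 - a p^(2k) for a = q and p =
    -- q^s.
    α-summand : ∀ k → k ≤ m → ((1# - q) * h m 0) * αᵣ k ≈ summand m k
    α-summand k k≤m = begin
      ((1# - q) * h m 0) * αᵣ k ≈⟨ *-congˡ (α≈g k) ⟩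
      ((1# - q) * h m 0) * (g k * [ 2 ℕ.* s ℕ.* k ℕ.+ 1 ])
        ≈⟨ solve 4 (λ a h g b → (a :* h) :* (g :* b) := (a :* b) :* (g :* h)) refl _ _ _ _ ⟩
      ((1# - q) * [ 2 ℕ.* s ℕ.* k ℕ.+ 1 ]) * (g k * h m 0)
        ≈⟨ *-cong (trans (geom q (2 ℕ.* s ℕ.* k ℕ.+ 1)) (+-congˡ (-‿cong (q^2sk+1 k)))) (g≈h k k≤m) ⟩
      summand m k ∎

    -- Since y q p^m = 1, multiplication by -q p^(m-j-1) turns 1 - y p^(j+1) into 1 - q p^(m-j-1).
    reversal : ∏ m (λ j → - (q * p ^ j)) * ∏ m (λ j → 1# - y * p ^ suc j) ≈ ∏ m (λ j → 1# - q * p ^ j)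
    reversal = begin
      ∏ m (λ j → - (q * p ^ j)) * ∏ m (λ j → 1# - y * p ^ suc j) ≈⟨ *-congʳ (∏-reverse m _) ⟩
      ∏ m (λ j → - (q * p ^ (m ∸ suc j))) * ∏ m (λ j → 1# - y * p ^ suc j) ≈⟨ ∏-* m _ _ ⟨
      ∏ m (λ j → - (q * p ^ (m ∸ suc j)) * (1# - y * p ^ suc j)) ≈⟨ ∏-cong< m term ⟩
      ∏ m (λ j → 1# - q * p ^ (m ∸ suc j)) ≈⟨ ∏-reverse m _ ⟨
      ∏ m (λ j → 1# - q * p ^ j) ∎
      where
      term : ∀ j → j < m → - (q * p ^ (m ∸ suc j)) * (1# - y * p ^ suc j) ≈ 1# - q * p ^ (m ∸ suc j)
      term j j<m = begin
        - (q * p ^ (m ∸ suc j)) * (1# - y * p ^ suc j)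
          ≈⟨ solve 4 (λ q a y b → :- (q :* a) :* (con (+ 1) :- y :* b) := y :* (q :* (a :* b)) :- q :* a) refl q _ y _ ⟩
        y * (q * (p ^ (m ∸ suc j) * p ^ suc j)) - q * p ^ (m ∸ suc j)
          ≈⟨ +-congʳ (trans (*-congˡ (*-congˡ (sym (^-split j<m)))) y-inv′) ⟩
        1# - q * p ^ (m ∸ suc j) ∎

    value : Carrier
    value = ∏ m (λ j → - (q * p ^ j)) * [ n ]

    value-inv : ((1# - q) * h m 0) * value ≈ 1#
    value-inv = begin
      ((1# - q) * (Y * ∏ (suc m) v)) * (X * [ n ])
        ≈⟨ solve 5 (λ a Y V X b → (a :* (Y :* V)) :* (X :* b) := ((X :* Y) :* (a :* b)) :* V) refl _ Y _ X _ ⟩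
      ((X * Y) * ((1# - q) * [ n ])) * ∏ (suc m) v
        ≈⟨ *-congʳ (*-cong reversal (trans (geom q n) (+-congˡ (-‿cong q^n≈)))) ⟩
      ∏ (suc m) (λ j → 1# - q * p ^ j) * ∏ (suc m) v
        ≈⟨ ∏-* (suc m) _ _ ⟨
      ∏ (suc m) (λ j → (1# - q * p ^ j) * v j)
        ≈⟨ ∏-cong (suc m) inv-a ⟩
      ∏ (suc m) (λ _ → 1#)
        ≈⟨ trans (∏-const (suc m) 1#) (1^n (suc m)) ⟩
      1# ∎
      where
      X = ∏ m (λ j → - (q * p ^ j))
      Y = ∏ m (λ j → 1# - y * p ^ suc j)

    ∑α : ∑ (suc m) αᵣ ≈ value
    ∑α = unit-cancelˡ {(1# - q) * h m 0} (value , value-inv) (begin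
      ((1# - q) * h m 0) * ∑ (suc m) αᵣ ≈⟨ ∑-*ˡ (suc m) _ _ ⟨
      ∑ (suc m) (λ k → ((1# - q) * h m 0) * αᵣ k) ≈⟨ ∑-cong< (suc m) (λ k k<m → α-summand k (ℕₚ.≤-pred k<m)) ⟩
      ∑ (suc m) (summand m) ≈⟨ total m ⟩
      1# ≈⟨ value-inv ⟨
      ((1# - q) * h m 0) * value ∎)

-- The exponent of q in terms of binomial coefficients.

module BinomialExponent where
  open import Data.Nat.Combinatorics using (_C_; nCk+nC[k+1]≡[n+1]C[k+1]; nC1≡n)

  qExponent-binomial : ∀ s′ k → suc s′ ℕ.* (suc k C 2) ≡.≡ qExponent s′ k ℕ.+ k
  qExponent-binomial s′ zero = ℕₚ.*-zeroʳ (suc s′)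
  qExponent-binomial s′ (suc k) = begin
    suc s′ ℕ.* (suc (suc k) C 2) ≡⟨ ≡.cong (suc s′ ℕ.*_) (nCk+nC[k+1]≡[n+1]C[k+1] (suc k) 1) ⟨
    suc s′ ℕ.* (suc k C 1 ℕ.+ suc k C 2) ≡⟨ ≡.cong (λ c → suc s′ ℕ.* (c ℕ.+ suc k C 2)) (nC1≡n (suc k)) ⟩
    suc s′ ℕ.* (suc k ℕ.+ suc k C 2) ≡⟨ ℕₚ.*-distribˡ-+ (suc s′) (suc k) _ ⟩
    suc s′ ℕ.* suc k ℕ.+ suc s′ ℕ.* (suc k C 2) ≡⟨ ≡.cong (suc s′ ℕ.* suc k ℕ.+_) (qExponent-binomial s′ k) ⟩
    suc s′ ℕ.* suc k ℕ.+ (qExponent s′ k ℕ.+ k)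
      ≡⟨ S.solve 3 (λ s e k → (S.con 1 S.:+ s) S.:* (S.con 1 S.:+ k) S.:+ (e S.:+ k) S.:= e S.:+ (s S.:+ (S.con 1 S.:+ s) S.:* k) S.:+ (S.con 1 S.:+ k)) ≡.refl s′ (qExponent s′ k) k ⟩
    qExponent s′ (suc k) ℕ.+ suc k ∎
    where
    module S = Data.Nat.Solver.+-*-Solver
    open ≡.≡-Reasoning

  exponent≡ : ∀ s′ k → suc s′ ℕ.* (suc k C 2) ∸ k ≡.≡ qExponent s′ k
  exponent≡ s′ k = ≡.trans (≡.cong (_∸ k) (qExponent-binomial s′ k)) (ℕₚ.m+n∸n≡m (qExponent s′ k) k)

-- Powers of generating functions and their partial sums.

module Convolution (R : CommutativeRing 0ℓ 0ℓ) where
  open import Data.Nat.Divisibility using (_∣_; _∣?_; ∣m∸n∣n⇒∣m; _∣0; divides)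
  open import Data.Integer.Base using (+_)
  open import Relation.Nullary using (¬_; yes; no)
  open import Data.Product using (_,_)
  open RingTools R
  open PowerSeries R public
  open import Relation.Binary.Reasoning.Setoid setoid
  module S = CommutativeRing seriesRing
  open IntegerSolver seriesRing using () renaming (solve to solveₛ; _:*_ to _:∙_; _:=_ to _:≋_)

  -- For f = α the coefficients of this power are the t(k).
  power : Series → ℕ → Series
  power f zero = unit
  power f (suc N) = f ∙ power f N

  power-cong : ∀ {f g} N → f ≋ g → power f N ≋ power g N
  power-cong zero eq = S.refl
  power-cong (suc N) eq = ∙-cong eq (power-cong N eq)

  power-∙ : ∀ f g N → power (f ∙ g) N ≋ power g N ∙ power f N
  power-∙ f g zero = S.sym (∙-identityˡ unit)
  power-∙ f g (suc N) = S.trans (∙-cong {f = f ∙ g} S.refl (power-∙ f g N))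
    (solveₛ 4 (λ a b c d → (a :∙ b) :∙ (c :∙ d) :≋ (b :∙ c) :∙ (a :∙ d)) S.refl f g (power g N) (power f N))

  ∑≈Σ≤ : ∀ k f → ∑ (suc k) f ≈ Σ≤ k f
  ∑≈Σ≤ zero f = +-identityˡ _
  ∑≈Σ≤ (suc k) f = +-congʳ (∑≈Σ≤ k f)

  -- The series 1/(1 - z), multiplication by which forms partial sums; `∑-∙` is then associativity
  -- of the Cauchy product.
  ones : Series
  ones _ = 1#

  ∑≈∙ones : ∀ k f → ∑ (suc k) f ≈ (f ∙ ones) k
  ∑≈∙ones k f = trans (∑≈Σ≤ k f) (Σ≤-cong k λ i → sym (*-identityʳ _))

  ∑-∙ : ∀ k f g → ∑ (suc k) (f ∙ g) ≈ Σ≤ k (λ i → f i * ∑ (suc (k ∸ i)) g)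
  ∑-∙ k f g = begin
    ∑ (suc k) (f ∙ g) ≈⟨ ∑≈∙ones k (f ∙ g) ⟩
    ((f ∙ g) ∙ ones) k ≈⟨ ∙-assoc f g ones k ⟩
    (f ∙ (g ∙ ones)) k ≈⟨ Σ≤-cong k (λ i → *-congˡ (sym (∑≈∙ones (k ∸ i) g))) ⟩
    Σ≤ k (λ i → f i * ∑ (suc (k ∸ i)) g) ∎

  ∑-truncate : ∀ {M f} → (∀ i → M < i → f i ≈ 0#) → ∀ k → M ≤ k → ∑ (suc k) f ≈ ∑ (suc M) f
  ∑-truncate {M} {f} f0 k M≤k = trans (reflexive (≡.cong (λ j → ∑ (suc j) f) (≡.sym (ℕₚ.m∸n+n≡m M≤k)))) (go (k ∸ M))
    where
    go : ∀ j → ∑ (suc (j ℕ.+ M)) f ≈ ∑ (suc M) f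
    go zero = refl
    go (suc j) = trans (+-cong (go j) (f0 _ (s≤s (ℕₚ.m≤n+m M j)))) (+-identityʳ _)

  -- f is a polynomial of degree at most M, so f^N has degree at most NM. A partial sum reaching
  -- that far is the value at z = 1, which is f(1)^N.
  ∑-power : ∀ {M f} → (∀ i → M < i → f i ≈ 0#) → ∀ N k → N ℕ.* M ≤ k → ∑ (suc k) (power f N) ≈ ∑ (suc M) f ^ N
  ∑-power f0 zero zero _ = +-identityˡ _
  ∑-power f0 zero (suc k) le = trans (+-identityʳ _) (∑-power f0 zero k z≤n)
  ∑-power {M} {f} f0 (suc N) k le = begin
    ∑ (suc k) (f ∙ power f N) ≈⟨ ∑-∙ k f (power f N) ⟩
    Σ≤ k (λ i → f i * ∑ (suc (k ∸ i)) (power f N)) ≈⟨ Σ≤-cong≤ k (λ i _ → term i) ⟩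
    Σ≤ k (λ i → f i * S ^ N) ≈⟨ Σ≤-cong k (λ i → *-comm _ _) ⟩
    Σ≤ k (λ i → S ^ N * f i) ≈⟨ Σ≤-*ˡ k (S ^ N) f ⟩
    S ^ N * Σ≤ k f ≈⟨ *-congˡ (∑≈Σ≤ k f) ⟨
    S ^ N * ∑ (suc k) f ≈⟨ *-congˡ (∑-truncate f0 k (ℕₚ.≤-trans (ℕₚ.m≤m+n M (N ℕ.* M)) le)) ⟩
    S ^ N * S ≈⟨ *-comm _ _ ⟩
    S ^ suc N ∎
    where
    S = ∑ (suc M) f
    term : ∀ i → f i * ∑ (suc (k ∸ i)) (power f N) ≈ f i * S ^ N
    term i with i ℕₚ.≤? M
    ... | yes i≤M = *-congˡ (∑-power f0 N (k ∸ i) (≡.subst (_≤ k ∸ i) (ℕₚ.m+n∸m≡n i (N ℕ.* M))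
                      (ℕₚ.∸-monoˡ-≤ i (ℕₚ.≤-trans (ℕₚ.+-monoˡ-≤ (N ℕ.* M) i≤M) le))))
    ... | no i≰M = trans (*-congʳ z) (trans (zeroˡ _) (sym (trans (*-congʳ z) (zeroˡ _))))
      where z = f0 i (ℕₚ.≰⇒> i≰M)

  OnMultiples : ℕ → Series → Set
  OnMultiples d c = ∀ i → ¬ d ∣ i → c i ≈ 0#

  unit-onMultiples : ∀ d → OnMultiples d unit
  unit-onMultiples d zero d∤0 = contradiction (d ∣0) d∤0
    where open import Relation.Nullary using (contradiction)
  unit-onMultiples d (suc i) _ = refl

  ∙-onMultiples : ∀ {d f g} → OnMultiples d f → OnMultiples d g → OnMultiples d (f ∙ g)
  ∙-onMultiples {d} {f} {g} f0 g0 k d∤k = Σ≤-zero k term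
    where
    term : ∀ i → i ≤ k → f i * g (k ∸ i) ≈ 0#
    term i i≤k with d ∣? i
    ... | no d∤i = trans (*-congʳ (f0 i d∤i)) (zeroˡ _)
    ... | yes d∣i = trans (*-congˡ (g0 (k ∸ i) λ d∣k∸i → d∤k (∣m∸n∣n⇒∣m d i≤k d∣k∸i d∣i))) (zeroʳ _)

  power-onMultiples : ∀ {d c} N → OnMultiples d c → OnMultiples d (power c N)
  power-onMultiples zero c0 = unit-onMultiples _
  power-onMultiples (suc N) c0 = ∙-onMultiples c0 (power-onMultiples N c0)

  -- Write (ac)^(N+1) as c^(N+1) a^(N+1). A term z^(jd) of the first factor with j < e leaves room
  -- for at least d coefficients of the second, whose degree is below d; they add up to a(1)^(N+1) =
  -- 0. The exponent is taken positive because 0^0 = 1.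
  ∑-blocks : ∀ {d M a c} → (∀ i → M < i → a i ≈ 0#) → OnMultiples d c → ∑ (suc M) a ≈ 0# →
    ∀ N e → suc N ℕ.* M < d → ∑ (e ℕ.* d) (power (a ∙ c) (suc N)) ≈ 0#
  ∑-blocks a0 c0 S0 N zero N*M<d = refl
  ∑-blocks {suc d} {M} {a} {c} a0 c0 S0 N (suc e) (s≤s N*M≤d) = begin
    ∑ (suc k) (power (a ∙ c) (suc N)) ≈⟨ ∑-cong (suc k) (power-∙ a c (suc N)) ⟩
    ∑ (suc k) (power c (suc N) ∙ power a (suc N)) ≈⟨ ∑-∙ k (power c (suc N)) (power a (suc N)) ⟩
    Σ≤ k (λ i → power c (suc N) i * ∑ (suc (k ∸ i)) (power a (suc N))) ≈⟨ Σ≤-zero k term ⟩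
    0# ∎
    where
    k = d ℕ.+ e ℕ.* suc d
    term : ∀ i → i ≤ k → power c (suc N) i * ∑ (suc (k ∸ i)) (power a (suc N)) ≈ 0#
    term i i≤k with suc d ∣? i
    ... | no d∤i = trans (*-congʳ (power-onMultiples (suc N) c0 i d∤i)) (zeroˡ _)
    ... | yes (divides j ≡.refl) = trans (*-congˡ (begin
        ∑ (suc (k ∸ j ℕ.* suc d)) (power a (suc N)) ≈⟨ ∑-power a0 (suc N) _ (ℕₚ.≤-trans N*M≤d d≤) ⟩
        ∑ (suc M) a ^ suc N ≈⟨ *-congʳ S0 ⟩
        0# * _ ≈⟨ zeroˡ _ ⟩
        0# ∎)) (zeroʳ _)
      where
      j≤e : j ≤ e
      j≤e = ℕₚ.≤-pred (ℕₚ.*-cancelʳ-< (suc d) j (suc e) (s≤s i≤k))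
      d≤ : d ≤ k ∸ j ℕ.* suc d
      d≤ = ≡.subst (d ≤_) (≡.sym (ℕₚ.+-∸-assoc d (ℕₚ.*-monoˡ-≤ (suc d) j≤e))) (ℕₚ.m≤m+n d _)

-- The exponent is quadratic in k. When d divides a, the cross term s·a·r is a multiple of d, so q
-- to this exponent is multiplicative across blocks if q^d = 1.
qExponent-+ : ∀ s′ a r → qExponent s′ (a ℕ.+ r) ≡.≡ qExponent s′ a ℕ.+ qExponent s′ r ℕ.+ suc s′ ℕ.* a ℕ.* r
qExponent-+ s′ a zero = begin
  qExponent s′ (a ℕ.+ 0) ≡⟨ ≡.cong (qExponent s′) (ℕₚ.+-identityʳ a) ⟩
  qExponent s′ a ≡⟨ S.solve 2 (λ e b → e S.:= e S.:+ S.con 0 S.:+ b S.:* S.con 0) ≡.refl (qExponent s′ a) (suc s′ ℕ.* a) ⟩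
  qExponent s′ a ℕ.+ 0 ℕ.+ suc s′ ℕ.* a ℕ.* 0 ∎
  where
  module S = Data.Nat.Solver.+-*-Solver
  open ≡.≡-Reasoning
qExponent-+ s′ a (suc r) = begin
  qExponent s′ (a ℕ.+ suc r) ≡⟨ ≡.cong (qExponent s′) (ℕₚ.+-suc a r) ⟩
  qExponent s′ (a ℕ.+ r) ℕ.+ (s′ ℕ.+ suc s′ ℕ.* (a ℕ.+ r)) ≡⟨ ≡.cong (ℕ._+ (s′ ℕ.+ suc s′ ℕ.* (a ℕ.+ r))) (qExponent-+ s′ a r) ⟩
  qExponent s′ a ℕ.+ qExponent s′ r ℕ.+ suc s′ ℕ.* a ℕ.* r ℕ.+ (s′ ℕ.+ suc s′ ℕ.* (a ℕ.+ r))
    ≡⟨ S.solve 6 (λ e f t a r s → e S.:+ f S.:+ s S.:* a S.:* r S.:+ (t S.:+ s S.:* (a S.:+ r))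
         S.:= e S.:+ (f S.:+ (t S.:+ s S.:* r)) S.:+ s S.:* a S.:* (S.con 1 S.:+ r)) ≡.refl (qExponent s′ a) (qExponent s′ r) s′ a r (suc s′) ⟩
  qExponent s′ a ℕ.+ qExponent s′ (suc r) ℕ.+ suc s′ ℕ.* a ℕ.* suc r ∎
  where
  module S = Data.Nat.Solver.+-*-Solver
  open ≡.≡-Reasoning

-- Periodicity and reflection of the summands where q^d = 1.

module RootOfUnity (R : CommutativeRing 0ℓ 0ℓ) (q x : CommutativeRing.Carrier R) (s′ m : ℕ)
  (w : ℕ → CommutativeRing.Carrier R) where
  open RingTools R
  open Summands R q s′ w public
  open Convolution R
  open import Data.Integer.Base using (+_)
  open import Data.Product using (_,_)
  open import Relation.Nullary using (¬_; Dec; yes; no; contradiction)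
  open import Relation.Binary.Definitions using (tri<; tri≈; tri>)
  open import Relation.Binary.Reasoning.Setoid setoid

  s d : ℕ
  s = suc s′
  d = suc (s ℕ.* m)

  p : Carrier
  p = q ^ s

  -- This is x(1 - xb)(1 - b/x)(1 - b). The power of x that clears 1/x is the same in `numerator`
  -- and `denominator`.
  factor : Carrier → Carrier
  factor b = (1# - x * b) * (x - b) * (1# - b)

  numerator denominator : ℕ → Carrier
  numerator j = factor (q * p ^ j)
  denominator j = factor (p ^ suc j)

  cube : Carrier → Carrier
  cube b = b * b * b

  -- `factor` is an antipalindromic cubic in b.
  factor-inverse : ∀ {b c} → b * c ≈ 1# → cube c * factor b ≈ - factor c
  factor-inverse {b} {c} bc = begin
    cube c * factor b
      ≈⟨ solve 3 (λ x b c → c :* c :* c :* ((con (+ 1) :- x :* b) :* (x :- b) :* (con (+ 1) :- b))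
           := (c :- x :* (b :* c)) :* (x :* c :- b :* c) :* (c :- b :* c)) refl x b c ⟩
    (c - x * (b * c)) * (x * c - b * c) * (c - b * c)
      ≈⟨ *-cong (*-cong (+-congˡ (-‿cong (*-congˡ bc))) (+-congˡ (-‿cong bc))) (+-congˡ (-‿cong bc)) ⟩
    (c - x * 1#) * (x * c - 1#) * (c - 1#)
      ≈⟨ solve 2 (λ x c → (c :- x :* con (+ 1)) :* (x :* c :- con (+ 1)) :* (c :- con (+ 1))
           := :- ((con (+ 1) :- x :* c) :* (x :- c) :* (con (+ 1) :- c))) refl x c ⟩
    - factor c ∎

  ∑-reverse : ∀ n f → ∑ n f ≈ ∑ n (λ i → f (n ∸ suc i))
  ∑-reverse zero f = refl
  ∑-reverse (suc n) f = begin
    ∑ n f + f n ≈⟨ +-comm _ _ ⟩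
    f n + ∑ n f ≈⟨ +-congˡ (∑-reverse n f) ⟩
    f n + ∑ n (λ i → f (n ∸ suc i)) ≈⟨ ∑-first n (λ i → f (n ∸ i)) ⟨
    ∑ (suc n) (λ i → f (n ∸ i)) ∎

  module _ (q^d : q ^ d ≈ 1#)
    (w-ratio : ∀ l j → j < m → w (l ℕ.* d ℕ.+ j) * denominator j ≈ numerator j)
    (unit-num : ∀ j → j < m → Unit (numerator j))
    (unit-den : ∀ j → j < m → Unit (denominator j))
    (unit-1-q : Unit (1# - q))
    (unit-2 : Unit (1# + 1#))
    where

    q^d∣ : ∀ l → q ^ (d ℕ.* l) ≈ 1#
    q^d∣ l = trans (sym (^-assocʳ q d l)) (trans (^-congˡ l q^d) (1^n l))

    qp^m : q * p ^ m ≈ 1#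
    qp^m = trans (*-congˡ (^-assocʳ q s m)) q^d

    unit-q : Unit q
    unit-q = p ^ m , qp^m

    unit-p : Unit p
    unit-p = unit-^ s unit-q

    -- All the reflections below rest on q p^m = q^(sm+1) = q^d = 1.
    inverse-pair : ∀ i j → i ℕ.+ j ≡.≡ m → (q * p ^ i) * p ^ j ≈ 1#
    inverse-pair i j eq = begin
      (q * p ^ i) * p ^ j ≈⟨ *-assoc _ _ _ ⟩
      q * (p ^ i * p ^ j) ≈⟨ *-congˡ (^-homo-* p i j) ⟨
      q * p ^ (i ℕ.+ j) ≡⟨ ≡.cong (λ k → q * p ^ k) eq ⟩
      q * p ^ m ≈⟨ qp^m ⟩
      1# ∎

    w-ratio₀ : ∀ {j} → j < m → w j * denominator j ≈ numerator j
    w-ratio₀ j<m = w-ratio 0 _ j<m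

    w-periodic : ∀ l j → j < m → w (l ℕ.* d ℕ.+ j) ≈ w j
    w-periodic l j j<m = unit-cancelˡ (unit-den j j<m)
      (trans (*-comm _ _) (trans (w-ratio l j j<m) (trans (sym (w-ratio₀ j<m)) (*-comm _ _))))

    ∏w-periodic : ∀ l r → r ≤ m → ∏ (l ℕ.* d ℕ.+ r) w ≈ ∏ (l ℕ.* d) w * ∏ r w
    ∏w-periodic l zero _ = trans (reflexive (≡.cong (λ k → ∏ k w) (ℕₚ.+-identityʳ (l ℕ.* d)))) (sym (*-identityʳ _))
    ∏w-periodic l (suc r) r<m = begin
      ∏ (l ℕ.* d ℕ.+ suc r) w ≡⟨ ≡.cong (λ k → ∏ k w) (ℕₚ.+-suc (l ℕ.* d) r) ⟩
      ∏ (l ℕ.* d ℕ.+ r) w * w (l ℕ.* d ℕ.+ r) ≈⟨ *-cong (∏w-periodic l r (ℕₚ.<⇒≤ r<m)) (w-periodic l r r<m) ⟩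
      ∏ (l ℕ.* d) w * ∏ r w * w r ≈⟨ *-assoc _ _ _ ⟩
      ∏ (l ℕ.* d) w * ∏ (suc r) w ∎

    bracket-cong : ∀ a b → q ^ a ≈ q ^ b → [ a ] ≈ [ b ]
    bracket-cong a b eq = unit-cancelˡ unit-1-q (trans (geom q a) (trans (+-congˡ (-‿cong eq)) (sym (geom q b))))

    bracket-periodic : ∀ l r → [ 2 ℕ.* s ℕ.* (l ℕ.* d ℕ.+ r) ℕ.+ 1 ] ≈ [ 2 ℕ.* s ℕ.* r ℕ.+ 1 ]
    bracket-periodic l r = bracket-cong (2 ℕ.* s ℕ.* (l ℕ.* d ℕ.+ r) ℕ.+ 1) (2 ℕ.* s ℕ.* r ℕ.+ 1) (begin
      q ^ (2 ℕ.* s ℕ.* (l ℕ.* d ℕ.+ r) ℕ.+ 1) ≡⟨ ≡.cong (q ^_) (Sℕ.solve 4 (λ a l d r → a Sℕ.:* (l Sℕ.:* d Sℕ.:+ r) Sℕ.:+ Sℕ.con 1 Sℕ.:= d Sℕ.:* (a Sℕ.:* l) Sℕ.:+ (a Sℕ.:* r Sℕ.:+ Sℕ.con 1)) ≡.refl (2 ℕ.* s) l d r) ⟩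
      q ^ (d ℕ.* (2 ℕ.* s ℕ.* l) ℕ.+ (2 ℕ.* s ℕ.* r ℕ.+ 1)) ≈⟨ ^-homo-* q (d ℕ.* (2 ℕ.* s ℕ.* l)) _ ⟩
      q ^ (d ℕ.* (2 ℕ.* s ℕ.* l)) * q ^ (2 ℕ.* s ℕ.* r ℕ.+ 1) ≈⟨ trans (*-congʳ (q^d∣ (2 ℕ.* s ℕ.* l))) (*-identityˡ _) ⟩
      q ^ (2 ℕ.* s ℕ.* r ℕ.+ 1) ∎)
      where
      module Sℕ = Data.Nat.Solver.+-*-Solver

    q^e-periodic : ∀ l r → q ^ qExponent s′ (l ℕ.* d ℕ.+ r) ≈ q ^ qExponent s′ (l ℕ.* d) * q ^ qExponent s′ r
    q^e-periodic l r = begin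
      q ^ qExponent s′ (l ℕ.* d ℕ.+ r) ≡⟨ ≡.cong (q ^_) (≡.trans (qExponent-+ s′ (l ℕ.* d) r)
         (Sℕ.solve 6 (λ e f s l d r → e Sℕ.:+ f Sℕ.:+ s Sℕ.:* (l Sℕ.:* d) Sℕ.:* r Sℕ.:= (e Sℕ.:+ f) Sℕ.:+ d Sℕ.:* (s Sℕ.:* l Sℕ.:* r)) ≡.refl (qExponent s′ (l ℕ.* d)) (qExponent s′ r) s l d r)) ⟩
      q ^ (qExponent s′ (l ℕ.* d) ℕ.+ qExponent s′ r ℕ.+ d ℕ.* (s ℕ.* l ℕ.* r)) ≈⟨ ^-homo-* q (qExponent s′ (l ℕ.* d) ℕ.+ qExponent s′ r) _ ⟩
      q ^ (qExponent s′ (l ℕ.* d) ℕ.+ qExponent s′ r) * q ^ (d ℕ.* (s ℕ.* l ℕ.* r)) ≈⟨ *-cong (^-homo-* q (qExponent s′ (l ℕ.* d)) _) (q^d∣ (s ℕ.* l ℕ.* r)) ⟩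
      q ^ qExponent s′ (l ℕ.* d) * q ^ qExponent s′ r * 1# ≈⟨ *-identityʳ _ ⟩
      q ^ qExponent s′ (l ℕ.* d) * q ^ qExponent s′ r ∎
      where
      module Sℕ = Data.Nat.Solver.+-*-Solver

    -- Sign, power of q, bracket and product of the `w` are each multiplicative across a block
    -- boundary, and the bracket at ld is [1]. This is the source of the factorisation of the
    -- generating function.
    α-periodic : ∀ l r → r ≤ m → αᵣ (l ℕ.* d ℕ.+ r) ≈ αᵣ r * αᵣ (l ℕ.* d)
    α-periodic l r r≤m = begin
      αᵣ (l ℕ.* d ℕ.+ r)
        ≈⟨ *-cong (*-cong (*-cong (^-homo-* (- 1#) (l ℕ.* d) r) (q^e-periodic l r)) (bracket-periodic l r)) (∏w-periodic l r r≤m) ⟩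
      (σ * σ′) * (e * e′) * b * (π * π′)
        ≈⟨ solve 7 (λ σ σ′ e e′ b π π′ → (σ :* σ′) :* (e :* e′) :* b :* (π :* π′) := (σ′ :* e′ :* b :* π′) :* (σ :* e :* (con (+ 0) :+ con (+ 1)) :* π)) refl σ σ′ e e′ b π π′ ⟩
      αᵣ r * (σ * e * [ 1 ] * π)
        ≈⟨ *-congˡ (*-congʳ (*-congˡ (sym b₀))) ⟩
      αᵣ r * αᵣ (l ℕ.* d) ∎
      where
      σ = (- 1#) ^ (l ℕ.* d)
      σ′ = (- 1#) ^ r
      e = q ^ qExponent s′ (l ℕ.* d)
      e′ = q ^ qExponent s′ r
      b = [ 2 ℕ.* s ℕ.* r ℕ.+ 1 ]
      π = ∏ (l ℕ.* d) w
      π′ = ∏ r w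
      b₀ : [ 2 ℕ.* s ℕ.* (l ℕ.* d) ℕ.+ 1 ] ≈ [ 1 ]
      b₀ = begin
        [ 2 ℕ.* s ℕ.* (l ℕ.* d) ℕ.+ 1 ] ≡⟨ ≡.cong (λ k → [ 2 ℕ.* s ℕ.* k ℕ.+ 1 ]) (≡.sym (ℕₚ.+-identityʳ (l ℕ.* d))) ⟩
        [ 2 ℕ.* s ℕ.* (l ℕ.* d ℕ.+ 0) ℕ.+ 1 ] ≈⟨ bracket-periodic l 0 ⟩
        [ 2 ℕ.* s ℕ.* 0 ℕ.+ 1 ] ≡⟨ ≡.cong (λ k → [ k ℕ.+ 1 ]) (ℕₚ.*-zeroʳ (2 ℕ.* s)) ⟩
        [ 1 ] ∎

    num-reflect : ∀ i j → suc i ℕ.+ j ≡.≡ m → cube (p ^ suc j) * numerator i ≈ - denominator j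
    num-reflect i j eq = factor-inverse (inverse-pair i (suc j) (≡.trans (ℕₚ.+-suc i j) eq))

    den-reflect : ∀ i j → suc i ℕ.+ j ≡.≡ m → cube (q * p ^ j) * denominator i ≈ - numerator j
    den-reflect i j eq = factor-inverse (trans (*-comm _ _) (inverse-pair j (suc i) (≡.trans (ℕₚ.+-comm j (suc i)) eq)))

    left< : ∀ {i j} → suc i ℕ.+ j ≡.≡ m → i < m
    left< {i} {j} eq = ≡.subst (i <_) eq (ℕₚ.m≤m+n (suc i) j)

    right< : ∀ {i j} → suc i ℕ.+ j ≡.≡ m → j < m
    right< {i} {j} eq = ≡.subst (j <_) eq (s≤s (ℕₚ.m≤n+m j i))

    -- For i + j = m - 1, q p^i and p^(j+1) are inverse to each other, so `numerator i` matches
    -- `denominator j` and conversely. In w i · w j only the cubes produced by the reflection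
    -- survive.
    w-reflect : ∀ i j → suc i ℕ.+ j ≡.≡ m → w i * w j * cube (p ^ suc j) ≈ cube (q * p ^ j)
    w-reflect i j eq = unit-cancelˡ (unit-* (unit-num j j<m) (unit-den j j<m)) (begin
      (Nⱼ * Dⱼ) * (w i * w j * C) ≈⟨ solve 5 (λ N D w v C → (N :* D) :* (w :* v :* C) := :- ((:- N) :* w :* C :* (v :* D))) refl Nⱼ Dⱼ (w i) (w j) C ⟩
      - (- Nⱼ * w i * C * (w j * Dⱼ)) ≈⟨ -‿cong (*-cong (*-congʳ (*-congʳ (sym (den-reflect i j eq)))) (w-ratio₀ j<m)) ⟩
      - (A * Dᵢ * w i * C * Nⱼ) ≈⟨ solve 5 (λ A D w C N → :- (A :* D :* w :* C :* N) := :- (A :* (C :* (w :* D)) :* N)) refl A Dᵢ (w i) C Nⱼ ⟩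
      - (A * (C * (w i * Dᵢ)) * Nⱼ) ≈⟨ -‿cong (*-congʳ (*-congˡ (trans (*-congˡ (w-ratio₀ i<m)) (num-reflect i j eq)))) ⟩
      - (A * (- Dⱼ) * Nⱼ) ≈⟨ solve 3 (λ A D N → :- (A :* (:- D) :* N) := (N :* D) :* A) refl A Dⱼ Nⱼ ⟩
      (Nⱼ * Dⱼ) * A ∎)
      where
      i<m = left< eq
      j<m = right< eq
      Nⱼ = numerator j
      Dⱼ = denominator j
      Dᵢ = denominator i
      A = cube (q * p ^ j)
      C = cube (p ^ suc j)

    q^sk : ∀ k → q ^ (s′ ℕ.+ s ℕ.* k) ≈ q ^ s′ * p ^ k
    q^sk k = trans (^-homo-* q s′ (s ℕ.* k)) (*-congˡ (sym (^-assocʳ q s k)))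

    ∏w-total : ∏ m w ≈ ∏ m (λ j → - cube (q * p ^ j))
    ∏w-total = unit-cancelˡ (∏-unit m unit-den) (begin
      ∏ m denominator * ∏ m w ≈⟨ *-comm _ _ ⟩
      ∏ m w * ∏ m denominator ≈⟨ ∏-* m w denominator ⟨
      ∏ m (λ j → w j * denominator j) ≈⟨ ∏-cong< m (λ j j<m → w-ratio₀ j<m) ⟩
      ∏ m numerator ≈⟨ ∏-cong< m term ⟩
      ∏ m (λ j → - cube (q * p ^ j) * denominator (m ∸ suc j)) ≈⟨ ∏-* m _ _ ⟩
      ∏ m (λ j → - cube (q * p ^ j)) * ∏ m (λ j → denominator (m ∸ suc j)) ≈⟨ *-congˡ (∏-reverse m denominator) ⟨
      ∏ m (λ j → - cube (q * p ^ j)) * ∏ m denominator ≈⟨ *-comm _ _ ⟩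
      ∏ m denominator * ∏ m (λ j → - cube (q * p ^ j)) ∎)
      where
      term : ∀ j → j < m → numerator j ≈ - cube (q * p ^ j) * denominator (m ∸ suc j)
      term j j<m = begin
        numerator j ≈⟨ solve 1 (λ a → a := :- (:- a)) refl _ ⟩
        - - numerator j ≈⟨ -‿cong (den-reflect (m ∸ suc j) j (≡.trans (≡.sym (ℕₚ.+-suc (m ∸ suc j) j)) (ℕₚ.m∸n+n≡m j<m))) ⟨
        - (cube (q * p ^ j) * denominator (m ∸ suc j)) ≈⟨ solve 2 (λ a b → :- (a :* b) := :- a :* b) refl _ _ ⟩
        - cube (q * p ^ j) * denominator (m ∸ suc j) ∎

    sign-q^e : ∀ k → (- 1#) ^ k * q ^ qExponent s′ k ≈ ∏ k (λ j → - (q ^ s′ * p ^ j))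
    sign-q^e zero = *-identityˡ 1#
    sign-q^e (suc k) = begin
      (- 1# * (- 1#) ^ k) * q ^ (qExponent s′ k ℕ.+ (s′ ℕ.+ s ℕ.* k)) ≈⟨ *-congˡ (trans (^-homo-* q (qExponent s′ k) _) (*-congˡ (q^sk k))) ⟩
      (- 1# * (- 1#) ^ k) * (q ^ qExponent s′ k * (q ^ s′ * p ^ k)) ≈⟨ solve 3 (λ a b c → (:- con (+ 1) :* a) :* (b :* c) := (a :* b) :* :- c) refl _ _ _ ⟩
      ((- 1#) ^ k * q ^ qExponent s′ k) * - (q ^ s′ * p ^ k) ≈⟨ *-congʳ (sign-q^e k) ⟩
      ∏ (suc k) (λ j → - (q ^ s′ * p ^ j)) ∎

    -- In q^m g(m) each q·q^s′ p^j is p^(j+1), which is inverse to b_j = q p^(m-j-1). What remains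
    -- is B², where B is the product of the b_j, and the same pairing gives B² = q^m·q. The factor
    -- q^m is there to complete q^s′ to p = q^s.
    g-last : g m ≈ q
    g-last = unit-cancelˡ (unit-^ m unit-q) (begin
      q ^ m * g m ≈⟨ *-cong (sym (∏-const m q)) (*-cong (sign-q^e m) ∏w-total) ⟩
      ∏ m (λ _ → q) * (∏ m (λ j → - (q ^ s′ * p ^ j)) * ∏ m (λ j → - cube (q * p ^ j)))
        ≈⟨ *-congˡ (*-congˡ (∏-reverse m _)) ⟩
      ∏ m (λ _ → q) * (∏ m (λ j → - (q ^ s′ * p ^ j)) * ∏ m (λ j → - cube (b j)))
        ≈⟨ *-congˡ (∏-* m _ _) ⟨
      ∏ m (λ _ → q) * ∏ m (λ j → - (q ^ s′ * p ^ j) * - cube (b j))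
        ≈⟨ ∏-* m _ _ ⟨
      ∏ m (λ j → q * (- (q ^ s′ * p ^ j) * - cube (b j)))
        ≈⟨ ∏-cong< m term ⟩
      ∏ m (λ j → b j * b j) ≈⟨ ∏-* m b b ⟩
      B * B ≈⟨ *-congʳ B≈ ⟩
      (q ^ m * C) * B ≈⟨ *-assoc _ _ _ ⟩
      q ^ m * (C * B) ≈⟨ *-congˡ CB≈q ⟩
      q ^ m * q ∎)
      where
      b : ℕ → Carrier
      b j = q * p ^ (m ∸ suc j)
      B = ∏ m b
      C = ∏ m (p ^_)
      term : ∀ j → j < m → q * (- (q ^ s′ * p ^ j) * - cube (b j)) ≈ b j * b j
      term j j<m = begin
        q * (- (q ^ s′ * p ^ j) * - cube (b j)) ≈⟨ solve 4 (λ q r K b → q :* (:- (r :* K) :* :- (b :* b :* b)) := b :* b :* (b :* (q :* r :* K))) refl q (q ^ s′) (p ^ j) (b j) ⟩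
        b j * b j * (b j * p ^ suc j) ≈⟨ *-congˡ (inverse-pair (m ∸ suc j) (suc j) (ℕₚ.m∸n+n≡m j<m)) ⟩
        b j * b j * 1# ≈⟨ *-identityʳ _ ⟩
        b j * b j ∎
      B≈ : B ≈ q ^ m * C
      B≈ = begin
        B ≈⟨ ∏-reverse m (λ j → q * p ^ j) ⟨
        ∏ m (λ j → q * p ^ j) ≈⟨ ∏-* m _ _ ⟩
        ∏ m (λ _ → q) * C ≈⟨ *-congʳ (∏-const m q) ⟩
        q ^ m * C ∎
      CB≈q : C * B ≈ q
      CB≈q = unit-cancelˡ (unit-^ m unit-p) (begin
        p ^ m * (C * B) ≈⟨ *-assoc _ _ _ ⟨
        (p ^ m * C) * B ≈⟨ *-congʳ (trans (*-congʳ (sym (∏-const m p))) (sym (∏-* m _ _))) ⟩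
        ∏ m (λ j → p ^ suc j) * B ≈⟨ ∏-* m _ _ ⟨
        ∏ m (λ j → p ^ suc j * b j) ≈⟨ ∏-cong< m (λ j j<m → trans (*-comm _ _) (inverse-pair (m ∸ suc j) (suc j) (ℕₚ.m∸n+n≡m j<m))) ⟩
        ∏ m (λ _ → 1#) ≈⟨ trans (∏-const m 1#) (1^n m) ⟩
        1# ≈⟨ qp^m ⟨
        q * p ^ m ≈⟨ *-comm _ _ ⟩
        p ^ m * q ∎)

    -- Induction from g(m) = q: each step applies the recurrence of `g` once at i and once at k, and
    -- `w-reflect` evaluates the product w i · w k that arises.
    g-reflect : ∀ {i} k → i ℕ.+ k ≡.≡ m → g i ≈ q * (p ^ k * p ^ k) * g k
    g-reflect {i} zero eq = begin
      g i ≡⟨ ≡.cong g (≡.trans (≡.sym (ℕₚ.+-identityʳ i)) eq) ⟩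
      g m ≈⟨ g-last ⟩
      q ≈⟨ solve 1 (λ q → q := q :* (con (+ 1) :* con (+ 1)) :* (con (+ 1) :* con (+ 1) :* con (+ 1))) refl q ⟩
      q * (1# * 1#) * g 0 ∎
    g-reflect {i} (suc k) eq = unit-cancelˡ (unit-* (unit-* (unit-^ (suc k) unit-p) unit-q) (unit-^ k unit-p)) (begin
      (c * q * K) * g i ≈⟨ solve 2 (λ a b → a :* b := a :* con (+ 1) :* b) refl _ _ ⟩
      (c * q * K) * 1# * g i ≈⟨ *-congʳ (*-congˡ (inverse-pair i (suc k) eq)) ⟨
      (p * K * q * K) * ((q * I) * (p * K)) * g i
        ≈⟨ solve 5 (λ q K I r gi → ((q :* r) :* K :* q :* K) :* ((q :* I) :* ((q :* r) :* K)) :* gi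
             := q :* r :* ((r :* I) :* (q :* K :* (q :* K) :* (q :* K)) :* gi)) refl q K I r (g i) ⟩
      q * r * ((r * I) * cube (q * K) * g i) ≈⟨ *-congˡ (*-congʳ (*-congˡ (w-reflect i k eq′))) ⟨
      q * r * ((r * I) * (w i * w k * cube c) * g i)
        ≈⟨ solve 7 (λ q r I w v C gi → q :* r :* ((r :* I) :* (w :* v :* C) :* gi) := :- (q :* r :* v :* C :* (:- (r :* I) :* w :* gi))) refl q r I (w i) (w k) (cube c) (g i) ⟩
      - (q * r * w k * cube c * (- (r * I) * w i * g i)) ≈⟨ -‿cong (*-congˡ (trans (*-congʳ (*-congʳ (-‿cong (sym (q^sk i))))) (sym (g-suc i)))) ⟩
      - (q * r * w k * cube c * g (suc i)) ≈⟨ -‿cong (*-congˡ (g-reflect k eq′)) ⟩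
      - (q * r * w k * cube c * (q * (K * K) * g k))
        ≈⟨ solve 6 (λ q r v c K gk → :- (q :* r :* v :* (c :* c :* c) :* (q :* (K :* K) :* gk))
             := (c :* q :* K) :* (q :* (c :* c) :* (:- (r :* K) :* v :* gk))) refl q r (w k) c K (g k) ⟩
      (c * q * K) * (q * (c * c) * (- (r * K) * w k * g k))
        ≈⟨ *-congˡ (*-congˡ (trans (*-congʳ (*-congʳ (-‿cong (sym (q^sk k))))) (sym (g-suc k)))) ⟩
      (c * q * K) * (q * (c * c) * g (suc k)) ∎)
      where
      eq′ : suc i ℕ.+ k ≡.≡ m
      eq′ = ≡.trans (≡.sym (ℕₚ.+-suc i k)) eq
      c = p ^ suc k
      K = p ^ k
      I = p ^ i
      r = q ^ s′

    -- The sign comes from the bracket: q p^(2k)(1 - q p^(2i)) = q p^(2k) - 1, because q p^i p^k =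
    -- 1.
    α-reflect : ∀ i k → i ℕ.+ k ≡.≡ m → αᵣ i ≈ - αᵣ k
    α-reflect i k eq = unit-cancelˡ unit-1-q (begin
      (1# - q) * αᵣ i ≈⟨ *-congˡ (α≈g i) ⟩
      (1# - q) * (g i * [ 2 ℕ.* s ℕ.* i ℕ.+ 1 ]) ≈⟨ solve 3 (λ a b c → a :* (b :* c) := b :* (a :* c)) refl _ _ _ ⟩
      g i * ((1# - q) * [ 2 ℕ.* s ℕ.* i ℕ.+ 1 ]) ≈⟨ *-cong (g-reflect k eq) (trans (geom q (2 ℕ.* s ℕ.* i ℕ.+ 1)) (+-congˡ (-‿cong (q^2sk+1 i)))) ⟩
      q * (K * K) * g k * (1# - q * (I * I))
        ≈⟨ solve 4 (λ q K I g → q :* (K :* K) :* g :* (con (+ 1) :- q :* (I :* I)) := g :* (q :* (K :* K) :- ((q :* I) :* K) :* ((q :* I) :* K))) refl q K I (g k) ⟩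
      g k * (q * (K * K) - ((q * I) * K) * ((q * I) * K)) ≈⟨ *-congˡ (+-congˡ (-‿cong (*-cong (inverse-pair i k eq) (inverse-pair i k eq)))) ⟩
      g k * (q * (K * K) - 1# * 1#) ≈⟨ solve 2 (λ g a → g :* (a :- con (+ 1) :* con (+ 1)) := :- (g :* (con (+ 1) :- a))) refl _ _ ⟩
      - (g k * (1# - q * (K * K))) ≈⟨ -‿cong (*-congˡ (trans (geom q (2 ℕ.* s ℕ.* k ℕ.+ 1)) (+-congˡ (-‿cong (q^2sk+1 k))))) ⟨
      - (g k * ((1# - q) * [ 2 ℕ.* s ℕ.* k ℕ.+ 1 ])) ≈⟨ solve 3 (λ a b c → :- (b :* (a :* c)) := a :* :- (b :* c)) refl _ _ _ ⟩
      (1# - q) * - (g k * [ 2 ℕ.* s ℕ.* k ℕ.+ 1 ]) ≈⟨ *-congˡ (-‿cong (α≈g k)) ⟨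
      (1# - q) * - αᵣ k ∎)
      where
      K = p ^ k
      I = p ^ i

    -- Adding the sum to its reversal gives 2S = 0, and 2 is a unit.
    ∑α≈0 : ∑ (suc m) αᵣ ≈ 0#
    ∑α≈0 = unit-cancelˡ unit-2 (begin
      (1# + 1#) * S ≈⟨ solve 1 (λ S → (con (+ 1) :+ con (+ 1)) :* S := S :+ S) refl S ⟩
      S + S ≈⟨ +-congˡ (∑-reverse (suc m) αᵣ) ⟩
      S + ∑ (suc m) (λ k → αᵣ (m ∸ k)) ≈⟨ ∑-+ (suc m) _ _ ⟨
      ∑ (suc m) (λ k → αᵣ k + αᵣ (m ∸ k)) ≈⟨ ∑-zero (suc m) term ⟩
      0# ≈⟨ zeroʳ _ ⟨
      (1# + 1#) * 0# ∎)
      where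
      S = ∑ (suc m) αᵣ
      term : ∀ k → k < suc m → αᵣ k + αᵣ (m ∸ k) ≈ 0#
      term k k≤m = trans (+-congˡ (α-reflect (m ∸ k) k (ℕₚ.m∸n+n≡m (ℕₚ.≤-pred k≤m)))) (-‿inverseʳ _)

    Σ≤-single : ∀ n r {f} → r ≤ n → (∀ i → i ≤ n → ¬ (i ≡.≡ r) → f i ≈ 0#) → Σ≤ n f ≈ f r
    Σ≤-single zero zero _ _ = refl
    Σ≤-single (suc n) r {f} r≤n f0 with r ℕₚ.≟ suc n
    ... | yes ≡.refl = trans (+-congʳ (Σ≤-zero n λ i i≤n → f0 i (ℕₚ.m≤n⇒m≤1+n i≤n) λ i≡ → ℕₚ.<-irrefl i≡ (s≤s i≤n))) (+-identityˡ _)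
    ... | no r≢ = trans (+-cong (Σ≤-single n r (ℕₚ.≤-pred (ℕₚ.≤∧≢⇒< r≤n r≢)) λ i i≤n → f0 i (ℕₚ.m≤n⇒m≤1+n i≤n))
                          (f0 (suc n) ℕₚ.≤-refl λ eq → r≢ (≡.sym eq))) (+-identityʳ _)

    -- `A` is the summand as it really is at the root of unity. `αᵣ` agrees with it only on residues
    -- up to m: its `w` will have factors 1 - q^d removed, and on the remaining residues one such
    -- factor is left over.
    module _ (A : ℕ → Carrier)
      (A-low : ∀ l r → r ≤ m → A (l ℕ.* d ℕ.+ r) ≈ αᵣ (l ℕ.* d ℕ.+ r))
      (A-high : ∀ l r → m < r → r < d → A (l ℕ.* d ℕ.+ r) ≈ 0#) where

      open import Data.Nat.Divisibility using (_∣_; _∣?_; ∣m+n∣m⇒∣n; n∣m*n; >⇒∤)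
      open import Data.Nat.DivMod using (_/_; _%_; m≡m%n+[m/n]*n; m%n<n)

      -- The polynomial a(z); `block-starts` below is the series c(z^d).
      first-block : ℕ → Carrier
      first-block r with r ℕₚ.≤? m
      ... | yes _ = αᵣ r
      ... | no _ = 0#

      block-starts : ℕ → Carrier
      block-starts i with d ∣? i
      ... | yes _ = A i
      ... | no _ = 0#

      first-block-low : ∀ r → r ≤ m → first-block r ≈ αᵣ r
      first-block-low r r≤m with r ℕₚ.≤? m
      ... | yes _ = refl
      ... | no r≰m = contradiction r≤m r≰m

      first-block-high : ∀ r → m < r → first-block r ≈ 0#
      first-block-high r m<r with r ℕₚ.≤? m
      ... | yes r≤m = contradiction r≤m (ℕₚ.<⇒≱ m<r)
      ... | no _ = refl

      block-starts-yes : ∀ i → d ∣ i → block-starts i ≈ A i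
      block-starts-yes i d∣i with d ∣? i
      ... | yes _ = refl
      ... | no d∤i = contradiction d∣i d∤i

      block-starts-no : OnMultiples d block-starts
      block-starts-no i d∤i with d ∣? i
      ... | yes d∣i = contradiction d∣i d∤i
      ... | no _ = refl

      m<d : m < d
      m<d = s≤s (ℕₚ.m≤m+n m (s′ ℕ.* m))

      -- This leaves a single non-zero term in each coefficient of a(z) c(z^d).
      same-residue : ∀ l {i r} → i ≤ l ℕ.* d ℕ.+ r → i < d → r < d → d ∣ (l ℕ.* d ℕ.+ r ∸ i) → i ≡.≡ r
      same-residue l {i} {r} i≤k i<d r<d d∣k∸i with ℕₚ.<-cmp i r
      ... | tri≈ _ i≡r _ = i≡r
      ... | tri< i<r _ _ = contradiction
              (∣m+n∣m⇒∣n (≡.subst (d ∣_) (ℕₚ.+-∸-assoc (l ℕ.* d) (ℕₚ.<⇒≤ i<r)) d∣k∸i) (n∣m*n l))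
              (>⇒∤ {{ℕ.>-nonZero (ℕₚ.m<n⇒0<n∸m i<r)}} (ℕₚ.≤-<-trans (ℕₚ.m∸n≤m r i) r<d))
      ... | tri> _ _ r<i = contradiction
              (∣m+n∣m⇒∣n (≡.subst (d ∣_) (≡.sym eq) (n∣m*n l)) d∣k∸i)
              (>⇒∤ {{ℕ.>-nonZero (ℕₚ.m<n⇒0<n∸m r<i)}} (ℕₚ.≤-<-trans (ℕₚ.m∸n≤m i r) i<d))
        where
        eq : (l ℕ.* d ℕ.+ r ∸ i) ℕ.+ (i ∸ r) ≡.≡ l ℕ.* d
        eq = ℕₚ.+-cancelʳ-≡ r _ _ (≡.trans (ℕₚ.+-assoc (l ℕ.* d ℕ.+ r ∸ i) (i ∸ r) r)
               (≡.trans (≡.cong ((l ℕ.* d ℕ.+ r ∸ i) ℕ.+_) (ℕₚ.m∸n+n≡m (ℕₚ.<⇒≤ r<i))) (ℕₚ.m∸n+n≡m i≤k)))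

      factorization : A ≋ first-block ∙ block-starts
      factorization k = trans (reflexive (≡.cong A k≡)) (trans (at (k / d) (k % d) (m%n<n k d)) (reflexive (≡.cong (first-block ∙ block-starts) (≡.sym k≡))))
        where
        k≡ : k ≡.≡ k / d ℕ.* d ℕ.+ k % d
        k≡ = ≡.trans (m≡m%n+[m/n]*n k d) (ℕₚ.+-comm (k % d) _)
        at : ∀ l r → r < d → A (l ℕ.* d ℕ.+ r) ≈ (first-block ∙ block-starts) (l ℕ.* d ℕ.+ r)
        at l r r<d = trans (A≈ (r ℕₚ.≤? m)) (sym (Σ≤-single (l ℕ.* d ℕ.+ r) r (ℕₚ.m≤n+m r (l ℕ.* d)) off))
          where
          off : ∀ i → i ≤ l ℕ.* d ℕ.+ r → ¬ i ≡.≡ r → first-block i * block-starts (l ℕ.* d ℕ.+ r ∸ i) ≈ 0#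
          off i i≤k i≢r with i ℕₚ.≤? m
          ... | no _ = zeroˡ _
          ... | yes i≤m = trans (*-congˡ (block-starts-no _ λ d∣ → i≢r (same-residue l i≤k (ℕₚ.≤-<-trans i≤m m<d) r<d d∣))) (zeroʳ _)
          A≈ : Dec (r ≤ m) → A (l ℕ.* d ℕ.+ r) ≈ first-block r * block-starts (l ℕ.* d ℕ.+ r ∸ r)
          A≈ (no r≰m) = trans (A-high l r (ℕₚ.≰⇒> r≰m) r<d) (sym (trans (*-congʳ (first-block-high r (ℕₚ.≰⇒> r≰m))) (zeroˡ _)))
          A≈ (yes r≤m) = begin
            A (l ℕ.* d ℕ.+ r) ≈⟨ A-low l r r≤m ⟩
            αᵣ (l ℕ.* d ℕ.+ r) ≈⟨ α-periodic l r r≤m ⟩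
            αᵣ r * αᵣ (l ℕ.* d) ≡⟨ ≡.cong (λ i → αᵣ r * αᵣ i) (ℕₚ.+-identityʳ (l ℕ.* d)) ⟨
            αᵣ r * αᵣ (l ℕ.* d ℕ.+ 0) ≈⟨ *-cong (first-block-low r r≤m) (A-low l 0 z≤n) ⟨
            first-block r * A (l ℕ.* d ℕ.+ 0) ≡⟨ ≡.cong (λ i → first-block r * A i) (ℕₚ.+-identityʳ (l ℕ.* d)) ⟩
            first-block r * A (l ℕ.* d) ≈⟨ *-congˡ (block-starts-yes (l ℕ.* d) (n∣m*n l)) ⟨
            first-block r * block-starts (l ℕ.* d) ≡⟨ ≡.cong (λ i → first-block r * block-starts i) (ℕₚ.m+n∸n≡m (l ℕ.* d) r) ⟨
            first-block r * block-starts (l ℕ.* d ℕ.+ r ∸ r) ∎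

      ∑-power-A : ∀ N e → suc N ≤ s → ∑ (e ℕ.* d) (power A (suc N)) ≈ 0#
      ∑-power-A N e N<s = trans (∑-cong (e ℕ.* d) (power-cong (suc N) factorization))
        (∑-blocks first-block-high block-starts-no
          (trans (∑-cong< (suc m) λ r r≤m → first-block-low r (ℕₚ.≤-pred r≤m)) ∑α≈0)
          -- The hypothesis that the number of factors is at most s enters here: (N+1)m ≤ sm < d.
          N e (s≤s (ℕₚ.*-monoˡ-≤ m N<s)))

-- The period is passed as a parameter, so that it is compared syntactically when this is applied.
∑-power-vanishes : (R : CommutativeRing 0ℓ 0ℓ) → let open RingTools R in
  ∀ q x s′ m w d → d ≡.≡ suc (suc s′ ℕ.* m) → let open RootOfUnity R q x s′ m w using (numerator; denominator; αᵣ) in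
  q ^ d ≈ 1# →
  (∀ l j → j < m → w (l ℕ.* d ℕ.+ j) * denominator j ≈ numerator j) →
  (∀ j → j < m → Unit (numerator j)) → (∀ j → j < m → Unit (denominator j)) → Unit (1# - q) → Unit (1# + 1#) →
  (A : ℕ → Carrier) →
  (∀ l r → r ≤ m → A (l ℕ.* d ℕ.+ r) ≈ αᵣ (l ℕ.* d ℕ.+ r)) →
  (∀ l r → m < r → r < d → A (l ℕ.* d ℕ.+ r) ≈ 0#) →
  ∀ N e → suc N ≤ suc s′ → ∑ (e ℕ.* d) (Convolution.power R A (suc N)) ≈ 0#
∑-power-vanishes R q x s′ m w _ ≡.refl = RootOfUnity.∑-power-A R q x s′ m w

-- Homomorphisms, ideals, and fractions modulo an ideal.

open import Data.Nat.Base as ℕ using (ℕ; zero; suc; _∸_)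

-- Only compatibility with the operations is recorded, so that `forget`, which passes from fractions
-- modulo an ideal to exact fractions, is an instance.
record RingHom (A B : CommutativeRing 0ℓ 0ℓ) : Set where
  private
    module A = CommutativeRing A
    module B = CommutativeRing B
  field
    ⟦_⟧    : A.Carrier → B.Carrier
    +-homo : ∀ a b → ⟦ a A.+ b ⟧ B.≈ ⟦ a ⟧ B.+ ⟦ b ⟧
    *-homo : ∀ a b → ⟦ a A.* b ⟧ B.≈ ⟦ a ⟧ B.* ⟦ b ⟧
    neg-homo : ∀ a → ⟦ A.- a ⟧ B.≈ B.- ⟦ a ⟧
    0-homo : ⟦ A.0# ⟧ B.≈ B.0#
    1-homo : ⟦ A.1# ⟧ B.≈ B.1#

module HomProperties {A B : CommutativeRing 0ℓ 0ℓ} (φ : RingHom A B) where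
  open RingHom φ public
  private
    module A = RingTools A
    module B = RingTools B
    module CA = Convolution A
    module CB = Convolution B

  sub-homo : ∀ a b → ⟦ a A.- b ⟧ B.≈ ⟦ a ⟧ B.- ⟦ b ⟧
  sub-homo a b = B.trans (+-homo a _) (B.+-congˡ (neg-homo b))

  1-sub-homo : ∀ a → ⟦ A.1# A.- a ⟧ B.≈ B.1# B.- ⟦ a ⟧
  1-sub-homo a = B.trans (sub-homo _ a) (B.+-congʳ 1-homo)

  ^-homo : ∀ a n → ⟦ a A.^ n ⟧ B.≈ ⟦ a ⟧ B.^ n
  ^-homo a zero = 1-homo
  ^-homo a (suc n) = B.trans (*-homo a _) (B.*-congˡ (^-homo a n))

  ∑-homo : ∀ n f → ⟦ A.∑ n f ⟧ B.≈ B.∑ n (λ i → ⟦ f i ⟧)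
  ∑-homo zero f = 0-homo
  ∑-homo (suc n) f = B.trans (+-homo _ _) (B.+-congʳ (∑-homo n f))

  ∏-homo : ∀ n f → ⟦ A.∏ n f ⟧ B.≈ B.∏ n (λ i → ⟦ f i ⟧)
  ∏-homo zero f = 1-homo
  ∏-homo (suc n) f = B.trans (*-homo _ _) (B.*-congʳ (∏-homo n f))

  Σ≤-homo : ∀ n f → ⟦ CA.Σ≤ n f ⟧ B.≈ CB.Σ≤ n (λ i → ⟦ f i ⟧)
  Σ≤-homo zero f = B.refl
  Σ≤-homo (suc n) f = B.trans (+-homo _ _) (B.+-congʳ (Σ≤-homo n f))

  power-homo : ∀ f N k → ⟦ CA.power f N k ⟧ B.≈ CB.power (λ i → ⟦ f i ⟧) N k
  power-homo f zero zero = 1-homo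
  power-homo f zero (suc k) = 0-homo
  power-homo f (suc N) k = B.trans (Σ≤-homo k _) (CB.Σ≤-cong k λ i → B.trans (*-homo _ _) (B.*-congˡ (power-homo f N (k ∸ i))))

  bracket-homo : ∀ q n → ⟦ A.∑ n (q A.^_) ⟧ B.≈ B.∑ n (⟦ q ⟧ B.^_)
  bracket-homo q n = B.trans (∑-homo n (q A.^_)) (B.∑-cong n (^-homo q))

  sign-homo : ∀ k → ⟦ (A.- A.1#) A.^ k ⟧ B.≈ (B.- B.1#) B.^ k
  sign-homo k = B.trans (^-homo _ k) (B.^-congˡ k (B.trans (neg-homo _) (B.-‿cong 1-homo)))

  prefactor-homo : ∀ q s′ k → ⟦ (A.- A.1#) A.^ k A.* q A.^ qExponent s′ k A.* A.∑ (2 ℕ.* suc s′ ℕ.* k ℕ.+ 1) (q A.^_) ⟧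
    B.≈ (B.- B.1#) B.^ k B.* ⟦ q ⟧ B.^ qExponent s′ k B.* B.∑ (2 ℕ.* suc s′ ℕ.* k ℕ.+ 1) (⟦ q ⟧ B.^_)
  prefactor-homo q s′ k = B.trans (*-homo _ _) (B.*-cong (B.trans (*-homo _ _) (B.*-cong (sign-homo k) (^-homo q (qExponent s′ k)))) (bracket-homo q (2 ℕ.* suc s′ ℕ.* k ℕ.+ 1)))

  α-homo : ∀ q s′ w k → ⟦ Summands.αᵣ A q s′ w k ⟧ B.≈ Summands.αᵣ B ⟦ q ⟧ s′ (λ j → ⟦ w j ⟧) k
  α-homo q s′ w k = B.trans (*-homo _ _) (B.*-cong (prefactor-homo q s′ k) (∏-homo k w))

record Ideal (A : CommutativeRing 0ℓ 0ℓ) : Set₁ where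
  open CommutativeRing A
  field
    Member   : Carrier → Set
    resp     : ∀ {a b} → a ≈ b → Member a → Member b
    +-closed : ∀ {a b} → Member a → Member b → Member (a + b)
    *-closed : ∀ c {a} → Member a → Member (c * a)
    0-member : Member 0#

-- Fractions whose denominators are regular both in A and modulo the ideal, compared modulo the ideal.
module Fractions (A : CommutativeRing 0ℓ 0ℓ) (I : Ideal A) where
  open import Data.Integer.Base using (+_)
  open import Data.Product using (_×_; _,_; proj₂)
  open RingTools A
  open Ideal I

  Regular : Carrier → Set
  Regular b = ∀ f → b * f ≈ 0# → f ≈ 0#

  -- Regularity modulo the ideal makes equality of fractions modulo it transitive; regularity in the
  -- ring gives the same fraction an exact value.
  Admissible : Carrier → Set
  Admissible b = Regular b × (∀ f → Member (b * f) → Member f)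

  regular-* : ∀ {a b} → Regular a → Regular b → Regular (a * b)
  regular-* ra rb f eq = rb f (ra _ (trans (sym (*-assoc _ _ _)) eq))

  admissible-* : ∀ {a b} → Admissible a → Admissible b → Admissible (a * b)
  admissible-* (ra , ia) (rb , ib) = regular-* ra rb , λ f p → ib f (ia _ (resp (*-assoc _ _ _) p))

  admissible-1 : Admissible 1#
  admissible-1 = (λ f eq → trans (sym (*-identityˡ f)) eq) , λ f → resp (*-identityˡ f)

  record Fraction : Set where
    constructor _/_[_]
    field
      num den    : Carrier
      admissible : Admissible den
  open Fraction public

  infix 4 _∼_
  record _∼_ (r t : Fraction) : Set where
    constructor mod-I
    field
      cross : Member (num r * den t - num t * den r)
  open _∼_ public

  exact : ∀ {r t} → num r * den t ≈ num t * den r → r ∼ t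
  exact eq = mod-I (resp (sym (trans (+-congʳ eq) (-‿inverseʳ _))) 0-member)

  exact₀ : ∀ {r t} → 0# ≈ num r * den t - num t * den r → r ∼ t
  exact₀ eq = mod-I (resp eq 0-member)

  ∼-sym : ∀ {r t} → r ∼ t → t ∼ r
  ∼-sym (mod-I p) = mod-I (resp (solve 2 (λ a b → :- con (+ 1) :* (a :- b) := b :- a) refl _ _) (*-closed (- 1#) p))

  ∼-trans : ∀ {r t u} → r ∼ t → t ∼ u → r ∼ u
  ∼-trans {a / b [ _ ]} {c / d [ sd ]} {e / f [ _ ]} (mod-I p) (mod-I r) = mod-I (proj₂ sd _
    (resp (solve 6 (λ a b c d e f → f :* (a :* d :- c :* b) :+ b :* (c :* f :- e :* d) := d :* (a :* f :- e :* b)) refl a b c d e f)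
      (+-closed (*-closed f p) (*-closed b r))))

  infixl 6 _⊞_
  infixl 7 _⊠_
  _⊞_ _⊠_ : Fraction → Fraction → Fraction
  (a / b [ s ]) ⊞ (c / d [ t ]) = (a * d + c * b) / (b * d) [ admissible-* s t ]
  (a / b [ s ]) ⊠ (c / d [ t ]) = (a * c) / (b * d) [ admissible-* s t ]

  ⊟_ : Fraction → Fraction
  ⊟ (a / b [ s ]) = (- a) / b [ s ]

  ι : Carrier → Fraction
  ι a = a / 1# [ admissible-1 ]

  private
   fractionRing′ : CommutativeRing 0ℓ 0ℓ
   fractionRing′ = record
     { Carrier = Fraction ; _≈_ = _∼_ ; _+_ = _⊞_ ; _*_ = _⊠_ ; -_ = ⊟_ ; 0# = ι 0# ; 1# = ι 1#
     ; isCommutativeRing = record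
       { isRing = record
         { +-isAbelianGroup = record
           { isGroup = record
             { isMonoid = record
               { isSemigroup = record
                 { isMagma = record
                   { isEquivalence = record
                     { refl = exact refl ; sym = ∼-sym ; trans = ∼-trans }
                   ; ∙-cong = ⊞-cong _ _ _ _ }
                 ; assoc = λ (a / b [ _ ]) (c / d [ _ ]) (e / f [ _ ]) → exact₀ (solve 6 (λ a b c d e f →
                     con (+ 0) := ((a :* d :+ c :* b) :* f :+ e :* (b :* d)) :* (b :* (d :* f)) :- (a :* (d :* f) :+ (c :* f :+ e :* d) :* b) :* ((b :* d) :* f)) refl a b c d e f) }
               ; identity = (λ (a / b [ _ ]) → exact₀ (solve 2 (λ a b → con (+ 0) := (con (+ 0) :* b :+ a :* con (+ 1)) :* b :- a :* (con (+ 1) :* b)) refl a b))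
                          , (λ (a / b [ _ ]) → exact₀ (solve 2 (λ a b → con (+ 0) := (a :* con (+ 1) :+ con (+ 0) :* b) :* b :- a :* (b :* con (+ 1))) refl a b)) }
             ; inverse = (λ (a / b [ _ ]) → exact₀ (solve 2 (λ a b → con (+ 0) := ((:- a) :* b :+ a :* b) :* con (+ 1) :- con (+ 0) :* (b :* b)) refl a b))
                       , (λ (a / b [ _ ]) → exact₀ (solve 2 (λ a b → con (+ 0) := (a :* b :+ (:- a) :* b) :* con (+ 1) :- con (+ 0) :* (b :* b)) refl a b))
             ; ⁻¹-cong = λ {(a / b [ _ ])} {(c / d [ _ ])} (mod-I p) → mod-I (resp (solve 4 (λ a b c d → (:- con (+ 1)) :* (a :* d :- c :* b) := (:- a) :* d :- (:- c) :* b) refl a b c d) (*-closed (- 1#) p)) }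
           ; comm = λ (a / b [ _ ]) (c / d [ _ ]) → exact₀ (solve 4 (λ a b c d → con (+ 0) := (a :* d :+ c :* b) :* (d :* b) :- (c :* b :+ a :* d) :* (b :* d)) refl a b c d) }
         ; *-cong = ⊠-cong _ _ _ _
         ; *-assoc = λ (a / b [ _ ]) (c / d [ _ ]) (e / f [ _ ]) → exact₀ (solve 6 (λ a b c d e f →
             con (+ 0) := ((a :* c) :* e) :* (b :* (d :* f)) :- (a :* (c :* e)) :* ((b :* d) :* f)) refl a b c d e f)
         ; *-identity = (λ (a / b [ _ ]) → exact₀ (solve 2 (λ a b → con (+ 0) := (con (+ 1) :* a) :* b :- a :* (con (+ 1) :* b)) refl a b))
                      , (λ (a / b [ _ ]) → exact₀ (solve 2 (λ a b → con (+ 0) := (a :* con (+ 1)) :* b :- a :* (b :* con (+ 1))) refl a b))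
         ; distrib = (λ (a / b [ _ ]) (c / d [ _ ]) (e / f [ _ ]) → exact₀ (solve 6 (λ a b c d e f →
             con (+ 0) := (a :* (c :* f :+ e :* d)) :* ((b :* d) :* (b :* f)) :- ((a :* c) :* (b :* f) :+ (a :* e) :* (b :* d)) :* (b :* (d :* f))) refl a b c d e f))
           , (λ (a / b [ _ ]) (c / d [ _ ]) (e / f [ _ ]) → exact₀ (solve 6 (λ a b c d e f →
             con (+ 0) := ((c :* f :+ e :* d) :* a) :* ((d :* b) :* (f :* b)) :- ((c :* a) :* (f :* b) :+ (e :* a) :* (d :* b)) :* ((d :* f) :* b)) refl a b c d e f)) }
       ; *-comm = λ (a / b [ _ ]) (c / d [ _ ]) → exact₀ (solve 4 (λ a b c d → con (+ 0) := (a :* c) :* (d :* b) :- (c :* a) :* (b :* d)) refl a b c d) } }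
     where
     ⊞-cong : ∀ r r′ t t′ → r ∼ r′ → t ∼ t′ → r ⊞ t ∼ r′ ⊞ t′
     ⊞-cong (a / b [ _ ]) (a′ / b′ [ _ ]) (c / d [ _ ]) (c′ / d′ [ _ ]) (mod-I p) (mod-I r) = mod-I (resp
       (solve 8 (λ a b a′ b′ c d c′ d′ → (d :* d′) :* (a :* b′ :- a′ :* b) :+ (b :* b′) :* (c :* d′ :- c′ :* d)
          := (a :* d :+ c :* b) :* (b′ :* d′) :- (a′ :* d′ :+ c′ :* b′) :* (b :* d)) refl a b a′ b′ c d c′ d′)
       (+-closed (*-closed _ p) (*-closed _ r)))
     ⊠-cong : ∀ r r′ t t′ → r ∼ r′ → t ∼ t′ → r ⊠ t ∼ r′ ⊠ t′
     ⊠-cong (a / b [ _ ]) (a′ / b′ [ _ ]) (c / d [ _ ]) (c′ / d′ [ _ ]) (mod-I p) (mod-I r) = mod-I (resp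
       (solve 8 (λ a b a′ b′ c d c′ d′ → (c :* d′) :* (a :* b′ :- a′ :* b) :+ (a′ :* b) :* (c :* d′ :- c′ :* d)
          := (a :* c) :* (b′ :* d′) :- (a′ :* c′) :* (b :* d)) refl a b a′ b′ c d c′ d′)
       (+-closed (*-closed _ p) (*-closed _ r)))

  -- Opaque, so that unification treats the operations as rigid.
  opaque
    fractionRing : CommutativeRing 0ℓ 0ℓ
    fractionRing = fractionRing′

  module F = RingTools fractionRing

  opaque
    unfolding fractionRing

    frac : (a b : Carrier) → Admissible b → F.Carrier
    frac a b s = a / b [ s ]

    numer denom : F.Carrier → Carrier
    numer r = num r
    denom r = den r

    denom-admissible : ∀ r → Admissible (denom r)
    denom-admissible = admissible

    ≈⇒cross : ∀ {r t} → r F.≈ t → Member (numer r * denom t - numer t * denom r)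
    ≈⇒cross = cross

    cross⇒≈ : ∀ {r t} → numer r * denom t ≈ numer t * denom r → r F.≈ t
    cross⇒≈ = exact

    numer-frac : ∀ a b (s : Admissible b) → numer (frac a b s) ≈ a
    numer-frac a b s = refl

    denom-frac : ∀ a b (s : Admissible b) → denom (frac a b s) ≈ b
    denom-frac a b s = refl

    numer-+ : ∀ r t → numer (r F.+ t) ≈ numer r * denom t + numer t * denom r
    numer-+ r t = refl

    denom-+ : ∀ r t → denom (r F.+ t) ≈ denom r * denom t
    denom-+ r t = refl

    numer-* : ∀ r t → numer (r F.* t) ≈ numer r * numer t
    numer-* r t = refl

    denom-* : ∀ r t → denom (r F.* t) ≈ denom r * denom t
    denom-* r t = refl

    numer-neg : ∀ r → numer (F.- r) ≈ - numer r
    numer-neg r = refl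

    denom-neg : ∀ r → denom (F.- r) ≈ denom r
    denom-neg r = refl

    ιᶠ : Carrier → F.Carrier
    ιᶠ = ι

    numer-ι : ∀ a → numer (ιᶠ a) ≈ a
    numer-ι a = refl

    denom-ι : ∀ a → denom (ιᶠ a) ≈ 1#
    denom-ι a = refl

    ι-0 : ιᶠ 0# F.≈ F.0#
    ι-0 = exact refl

    ι-1 : ιᶠ 1# F.≈ F.1#
    ι-1 = exact refl

    ι-0′ : numer F.0# * 1# ≈ 0# * denom F.0#
    ι-0′ = refl

    ι-1′ : numer F.1# * 1# ≈ 1# * denom F.1#
    ι-1′ = refl

    ι-cong : ∀ {a b} → a ≈ b → ιᶠ a F.≈ ιᶠ b
    ι-cong eq = exact (*-congʳ eq)

    ι-+ : ∀ a b → ιᶠ (a + b) F.≈ ιᶠ a F.+ ιᶠ b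
    ι-+ a b = exact (solve 2 (λ a b → (a :+ b) :* (con (+ 1) :* con (+ 1)) := (a :* con (+ 1) :+ b :* con (+ 1)) :* con (+ 1)) refl a b)

    ι-* : ∀ a b → ιᶠ (a * b) F.≈ ιᶠ a F.* ιᶠ b
    ι-* a b = exact (solve 2 (λ a b → (a :* b) :* (con (+ 1) :* con (+ 1)) := (a :* b) :* con (+ 1)) refl a b)

    ι-neg : ∀ a → ιᶠ (- a) F.≈ F.- ιᶠ a
    ι-neg a = exact refl

    ι-member : ∀ {a} → Member a → ιᶠ a F.≈ F.0#
    ι-member {a} p = mod-I (resp (solve 1 (λ a → a := a :* con (+ 1) :- con (+ 0) :* con (+ 1)) refl a) p)

    ι-unit : ∀ {a} → Admissible a → F.Unit (ιᶠ a)
    ι-unit {a} s = 1# / a [ s ] , exact (solve 1 (λ a → (a :* con (+ 1)) :* con (+ 1) := con (+ 1) :* (con (+ 1) :* a)) refl a)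

    numer-member : ∀ {r} → r F.≈ F.0# → Member (numer r)
    numer-member {r} (mod-I p) = resp (solve 2 (λ a b → a :* con (+ 1) :- con (+ 0) :* b := a) refl (num r) (den r)) p

    frac-denom : ∀ a b (s : Admissible b) → frac a b s F.* ιᶠ b F.≈ ιᶠ a
    frac-denom a b s = exact (solve 2 (λ a b → (a :* b) :* con (+ 1) := a :* (b :* con (+ 1))) refl a b)

zeroIdeal : (A : CommutativeRing 0ℓ 0ℓ) → Ideal A
zeroIdeal A = record
  { Member = _≈ 0# ; resp = λ eq p → trans (sym eq) p
  ; +-closed = λ p r → trans (+-cong p r) (+-identityˡ 0#)
  ; *-closed = λ c p → trans (*-congˡ p) (zeroʳ c) ; 0-member = refl }
  where open CommutativeRing A

-- The polynomial ring ℤ[x,q] inside ℤ[[q]][[x]].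

module PolynomialRing where
  open import Defs
  open import Data.Nat.Base as ℕ using (ℕ; zero; suc; _∸_; _≤_; z≤n; s≤s)
  open import Data.Integer.Base as ℤ using (ℤ; +_)
  import Data.Integer.Properties as ℤₚ
  open import Data.Product using (Σ; _,_; proj₁)
  open import Data.Sum using (_⊎_; inj₁; inj₂)
  open import Relation.Binary.PropositionalEquality as ≡ using (_≡_; refl; sym; trans; cong; cong₂)
  open import Relation.Nullary using (yes; no)

  module Z[[q]] = PowerSeries ℤₚ.+-*-commutativeRing
  module Z[[x,q]] = PowerSeries Z[[q]].seriesRing
  private
    module P = CommutativeRing Z[[x,q]].seriesRing

  sumTo≡Σ≤ : ∀ n h → sumTo n h ≡ Z[[q]].Σ≤ n h
  sumTo≡Σ≤ zero h = refl
  sumTo≡Σ≤ (suc n) h = cong (ℤ._+ h (suc n)) (sumTo≡Σ≤ n h)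

  sumTo-cong≤ : ∀ n {f g} → (∀ i → i ≤ n → f i ≡ g i) → sumTo n f ≡ sumTo n g
  sumTo-cong≤ zero eq = eq 0 z≤n
  sumTo-cong≤ (suc n) eq = cong₂ ℤ._+_ (sumTo-cong≤ n λ i i≤n → eq i (ℕₚ.m≤n⇒m≤1+n i≤n)) (eq (suc n) ℕₚ.≤-refl)

  sumTo-zero : ∀ n {f} → (∀ i → i ≤ n → f i ≡ + 0) → sumTo n f ≡ + 0
  sumTo-zero zero eq = eq 0 z≤n
  sumTo-zero (suc n) eq = cong₂ ℤ._+_ (sumTo-zero n λ i i≤n → eq i (ℕₚ.m≤n⇒m≤1+n i≤n)) (eq (suc n) ℕₚ.≤-refl)

  Σ≤-pointwise : ∀ n (h : ℕ → ℕ → ℤ) j → Z[[x,q]].Σ≤ n h j ≡ sumTo n (λ i → h i j)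
  Σ≤-pointwise zero h j = refl
  Σ≤-pointwise (suc n) h j = cong (ℤ._+ h (suc n) j) (Σ≤-pointwise n h j)

  -- The ring laws for `⊗` are transported along this from the iterated power series ring.
  ⊗≈∙ : ∀ f g → f ⊗ g ≈ f P.* g
  ⊗≈∙ f g i j = sym (trans (Σ≤-pointwise i _ j) (sumTo-cong≤ i λ a _ → sym (sumTo≡Σ≤ j _)))

  ⊗-cong : ∀ {f f′ g g′} → f ≈ f′ → g ≈ g′ → f ⊗ g ≈ f′ ⊗ g′
  ⊗-cong p r i j = sumTo-cong≤ i λ a _ → sumTo-cong≤ j λ b _ → cong₂ ℤ._*_ (p a b) (r (i ∸ a) (j ∸ b))

  ≈-sym : ∀ {f g} → f ≈ g → g ≈ f
  ≈-sym p i j = sym (p i j)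

  ≈-trans : ∀ {f g h} → f ≈ g → g ≈ h → f ≈ h
  ≈-trans p r i j = trans (p i j) (r i j)

  ≈-refl : ∀ {f} → f ≈ f
  ≈-refl i j = refl

  ⊕-cong : ∀ {f f′ g g′} → f ≈ f′ → g ≈ g′ → f ⊕ g ≈ f′ ⊕ g′
  ⊕-cong p r i j = cong₂ ℤ._+_ (p i j) (r i j)

  𝟙≈unit : 𝟙 ≈ P.1#
  𝟙≈unit zero zero = refl
  𝟙≈unit zero (suc j) = refl
  𝟙≈unit (suc i) zero = refl
  𝟙≈unit (suc i) (suc j) = refl

  ⊗-comm : ∀ f g → f ⊗ g ≈ g ⊗ f
  ⊗-comm f g = ≈-trans (⊗≈∙ f g) (≈-trans (P.*-comm f g) (≈-sym (⊗≈∙ g f)))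

  ⊗-assoc : ∀ f g h → (f ⊗ g) ⊗ h ≈ f ⊗ (g ⊗ h)
  ⊗-assoc f g h = ≈-trans (⊗≈∙ (f ⊗ g) h) (≈-trans (P.*-congʳ {h} (⊗≈∙ f g)) (≈-trans (P.*-assoc f g h)
    (≈-trans (P.*-congˡ {f} (≈-sym (⊗≈∙ g h))) (≈-sym (⊗≈∙ f (g ⊗ h))))))

  ⊗-distribˡ : ∀ f g h → f ⊗ (g ⊕ h) ≈ f ⊗ g ⊕ f ⊗ h
  ⊗-distribˡ f g h = ≈-trans (⊗≈∙ f (g ⊕ h)) (≈-trans (P.distribˡ f g h)
    (P.+-cong (≈-sym (⊗≈∙ f g)) (≈-sym (⊗≈∙ f h))))

  ⊗-identityˡ : ∀ f → 𝟙 ⊗ f ≈ f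
  ⊗-identityˡ f = ≈-trans (⊗≈∙ 𝟙 f) (≈-trans (P.*-congʳ {f} 𝟙≈unit) (P.*-identityˡ f))

  ⊗-distribʳ : ∀ f g h → (g ⊕ h) ⊗ f ≈ g ⊗ f ⊕ h ⊗ f
  ⊗-distribʳ f g h = ≈-trans (⊗-comm (g ⊕ h) f) (≈-trans (⊗-distribˡ f g h) (P.+-cong (⊗-comm f g) (⊗-comm f h)))

  const-isPoly : ∀ c → IsPoly (const c)
  const-isPoly c = 1 , λ { zero (suc j) _ → refl ; (suc i) zero _ → refl ; (suc i) (suc j) _ → refl }

  ⊕-isPoly : ∀ {f g} → IsPoly f → IsPoly g → IsPoly (f ⊕ g)
  ⊕-isPoly (D , p) (E , r) = D ℕ.+ E , λ i j le → cong₂ ℤ._+_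
    (p i j (ℕₚ.≤-trans (ℕₚ.m≤m+n D E) le)) (r i j (ℕₚ.≤-trans (ℕₚ.m≤n+m E D) le))

  neg : Poly → Poly
  neg f i j = ℤ.- f i j

  neg-isPoly : ∀ {f} → IsPoly f → IsPoly (neg f)
  neg-isPoly (D , p) = D , λ i j le → cong ℤ.-_ (p i j le)

  split-degree : ∀ {D E} {i j a b} → D ℕ.+ E ≤ i ℕ.+ j → a ≤ i → b ≤ j →
    D ≤ a ℕ.+ b ⊎ E ≤ (i ∸ a) ℕ.+ (j ∸ b)
  split-degree {D} {E} {i} {j} {a} {b} le a≤i b≤j with D ℕₚ.≤? a ℕ.+ b
  ... | yes p = inj₁ p
  ... | no ¬p = inj₂ (ℕₚ.+-cancelˡ-≤ (a ℕ.+ b) E _ (begin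
      a ℕ.+ b ℕ.+ E ≤⟨ ℕₚ.+-monoˡ-≤ E (ℕₚ.<⇒≤ (ℕₚ.≰⇒> ¬p)) ⟩
      D ℕ.+ E ≤⟨ le ⟩
      i ℕ.+ j ≡⟨ cong₂ ℕ._+_ (ℕₚ.m+[n∸m]≡n a≤i) (ℕₚ.m+[n∸m]≡n b≤j) ⟨
      (a ℕ.+ (i ∸ a)) ℕ.+ (b ℕ.+ (j ∸ b)) ≡⟨ interchange a (i ∸ a) b (j ∸ b) ⟩
      (a ℕ.+ b) ℕ.+ ((i ∸ a) ℕ.+ (j ∸ b)) ∎))
    where
    open ℕₚ.≤-Reasoning
    open import Algebra.Properties.CommutativeSemigroup ℕₚ.+-commutativeSemigroup using (interchange)

  *≡0ˡ : ∀ {a} b → a ≡ + 0 → a ℤ.* b ≡ + 0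
  *≡0ˡ b refl = ℤₚ.*-zeroˡ b

  *≡0ʳ : ∀ a {b} → b ≡ + 0 → a ℤ.* b ≡ + 0
  *≡0ʳ a refl = ℤₚ.*-zeroʳ a

  ⊗-isPoly : ∀ {f g} → IsPoly f → IsPoly g → IsPoly (f ⊗ g)
  ⊗-isPoly {f} {g} (D , p) (E , r) = D ℕ.+ E , λ i j le →
    sumTo-zero i λ a a≤i → sumTo-zero j λ b b≤j → case a b (split-degree le a≤i b≤j)
    where
    case : ∀ a b {c d} → D ≤ a ℕ.+ b ⊎ E ≤ c ℕ.+ d → f a b ℤ.* g c d ≡ + 0
    case a b (inj₁ le) = *≡0ˡ _ (p _ _ le)
    case a b (inj₂ le) = *≡0ʳ (f a b) (r _ _ le)

  X-isPoly : IsPoly X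
  X-isPoly = 2 , λ { zero (suc j) _ → refl ; (suc zero) (suc j) _ → refl ; (suc (suc i)) _ _ → refl
                   ; (suc zero) zero (s≤s ()) }

  Q-isPoly : IsPoly Q
  Q-isPoly = 2 , λ { zero (suc zero) (s≤s ()) ; zero (suc (suc j)) _ → refl ; (suc i) _ _ → refl }

  Z[x,q] : Set
  Z[x,q] = Σ Poly IsPoly

  polyRing : CommutativeRing 0ℓ 0ℓ
  polyRing = record
    { Carrier = Z[x,q] ; _≈_ = λ f g → proj₁ f ≈ proj₁ g
    ; _+_ = λ (f , p) (g , r) → f ⊕ g , ⊕-isPoly p r
    ; _*_ = λ (f , p) (g , r) → f ⊗ g , ⊗-isPoly p r
    ; -_ = λ (f , p) → neg f , neg-isPoly p
    ; 0# = 𝟘 , 0 , λ _ _ _ → refl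
    ; 1# = 𝟙 , const-isPoly (+ 1)
    ; isCommutativeRing = record
      { isRing = record
        { +-isAbelianGroup = record
          { isGroup = record
            { isMonoid = record
              { isSemigroup = record
                { isMagma = record
                  { isEquivalence = record
                    { refl = ≈-refl ; sym = ≈-sym ; trans = ≈-trans }
                  ; ∙-cong = λ p r i j → cong₂ ℤ._+_ (p i j) (r i j) }
                ; assoc = λ (f , _) (g , _) (h , _) i j → ℤₚ.+-assoc (f i j) (g i j) (h i j) }
              ; identity = (λ (f , _) i j → ℤₚ.+-identityˡ (f i j)) , (λ (f , _) i j → ℤₚ.+-identityʳ (f i j)) }
            ; inverse = (λ (f , _) i j → ℤₚ.+-inverseˡ (f i j)) , (λ (f , _) i j → ℤₚ.+-inverseʳ (f i j))
            ; ⁻¹-cong = λ p i j → cong ℤ.-_ (p i j) }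
          ; comm = λ (f , _) (g , _) i j → ℤₚ.+-comm (f i j) (g i j) }
        ; *-cong = ⊗-cong
        ; *-assoc = λ (f , _) (g , _) (h , _) → ⊗-assoc f g h
        ; *-identity = (λ (f , _) → ⊗-identityˡ f) , (λ (f , _) → ≈-trans (⊗-comm f 𝟙) (⊗-identityˡ f))
        ; distrib = (λ (f , _) (g , _) (h , _) → ⊗-distribˡ f g h) , (λ (f , _) (g , _) (h , _) → ⊗-distribʳ f g h) }
      ; *-comm = λ (f , _) (g , _) → ⊗-comm f g } }

-- Leading monomials, degrees and absence of zero divisors.

module LeadingMonomials where
  open import Defs
  open PolynomialRing
  open import Data.Integer.Base as ℤ using (ℤ; +_)
  import Data.Integer.Properties as ℤₚ
  open import Data.Product using (∃; ∃₂; _×_; _,_)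
  open import Data.Sum using (inj₁; inj₂)
  open import Relation.Binary.PropositionalEquality as ≡ using (_≡_; _≢_; refl; sym; trans; cong; cong₂; subst)
  open import Relation.Binary.Definitions using (tri<; tri≈; tri>)
  open import Relation.Nullary using (¬_; yes; no; contradiction)
  open import Relation.Nullary.Decidable using (¬?; _×-dec_; decidable-stable)
  open import Relation.Unary using (Decidable)

  findMax : ∀ {P : ℕ → Set} → Decidable P → ∀ B → (∀ n → B ≤ n → ¬ P n) → ∀ {k} → P k →
    ∃ λ m → k ≤ m × P m × (∀ n → m < n → ¬ P n)
  findMax P? zero bound {k} Pk = contradiction Pk (bound k z≤n)
  findMax P? (suc B) bound {k} Pk with P? B
  ... | yes PB = B , ℕₚ.≤-pred (ℕₚ.≰⇒> λ B<k → bound k B<k Pk) , PB , bound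
  ... | no ¬PB = findMax P? B bound′ Pk
    where
    bound′ : ∀ n → B ≤ n → ¬ _
    bound′ n B≤n with B ℕₚ.≟ n
    ... | yes refl = ¬PB
    ... | no B≢n = bound n (ℕₚ.≤∧≢⇒< B≤n B≢n)

  -- (a , b) is the exponent of the leading monomial for the graded lexicographic order.
  record Leading (f : Poly) (a b : ℕ) : Set where
    field
      nonzero : f a b ≢ + 0
      higher  : ∀ i j → a ℕ.+ b < i ℕ.+ j → f i j ≡ + 0
      later   : ∀ i j → i ℕ.+ j ≡ a ℕ.+ b → a < i → f i j ≡ + 0

  stable : ∀ {i : ℤ} → ¬ ¬ i ≡ + 0 → i ≡ + 0
  stable {i} = decidable-stable (i ℤₚ.≟ + 0)

  -- Two bounded searches: one for the largest total degree that occurs, the other, within it, for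
  -- the largest exponent of x.
  leading : ∀ {f} → IsPoly f → ∀ {a b} → f a b ≢ + 0 → ∃₂ λ a′ b′ → a ℕ.+ b ≤ a′ ℕ.+ b′ × Leading f a′ b′
  leading {f} (D , f0) {a} {b} fab = lead (findMax total? D total-bound {a ℕ.+ b} (a , s≤s (ℕₚ.m≤m+n a b) , subst (λ j → f a j ≢ + 0) (sym (ℕₚ.m+n∸m≡n a b)) fab))
    where
    P : ℕ → ℕ → Set
    P t i = f i (t ∸ i) ≢ + 0
    P? : ∀ t → Decidable (P t)
    P? t i = ¬? (f i (t ∸ i) ℤₚ.≟ + 0)
    total : ℕ → Set
    total t = ∃ λ i → i < suc t × P t i
    total? : Decidable total
    total? t = ℕₚ.anyUpTo? (P? t) (suc t)
    total-bound : ∀ t → D ≤ t → ¬ total t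
    total-bound t D≤t (i , i≤t , fi) = fi (f0 i (t ∸ i) (subst (D ≤_) (sym (ℕₚ.m+[n∸m]≡n (ℕₚ.≤-pred i≤t))) D≤t))
    lead : ∃ (λ t → a ℕ.+ b ≤ t × total t × (∀ n → t < n → ¬ total n)) → _
    lead (t , ab≤t , (i , i≤t , fi) , t-max)
      with findMax (λ i → (i ℕₚ.<? suc t) ×-dec P? t i) (suc t) (λ n t<n (n≤t , _) → ℕₚ.<⇒≱ n≤t t<n) (i≤t , fi)
    ... | a′ , _ , (a′≤t , fa′) , a′-max = a′ , t ∸ a′ , subst (a ℕ.+ b ≤_) (sym t≡) ab≤t , record
        { nonzero = fa′
        ; higher = λ i j lt → stable λ fij → t-max (i ℕ.+ j) (subst (_< i ℕ.+ j) t≡ lt)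
            (i , s≤s (ℕₚ.m≤m+n i j) , subst (λ j → f i j ≢ + 0) (sym (ℕₚ.m+n∸m≡n i j)) fij)
        ; later = λ i j eq a′<i → stable λ fij → a′-max i a′<i
            ( s≤s (subst (i ≤_) (trans eq t≡) (ℕₚ.m≤m+n i j))
            , subst (λ j → f i j ≢ + 0) (trans (sym (ℕₚ.m+n∸m≡n i j)) (cong (_∸ i) (trans eq t≡))) fij) }
      where
      t≡ : a′ ℕ.+ (t ∸ a′) ≡ t
      t≡ = ℕₚ.m+[n∸m]≡n (ℕₚ.≤-pred a′≤t)

  sumTo-single : ∀ n r {h} → r ≤ n → (∀ i → i ≤ n → i ≢ r → h i ≡ + 0) → sumTo n h ≡ h r
  sumTo-single zero zero _ _ = refl
  sumTo-single (suc n) r {h} r≤n h0 with r ℕₚ.≟ suc n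
  ... | yes refl = trans (cong (ℤ._+ h (suc n)) (sumTo-zero n λ i i≤n → h0 i (ℕₚ.m≤n⇒m≤1+n i≤n) λ eq → ℕₚ.<-irrefl eq (s≤s i≤n))) (ℤₚ.+-identityˡ _)
  ... | no r≢ = trans (cong₂ ℤ._+_ (sumTo-single n r (ℕₚ.≤-pred (ℕₚ.≤∧≢⇒< r≤n r≢)) λ i i≤n → h0 i (ℕₚ.m≤n⇒m≤1+n i≤n))
                         (h0 (suc n) ℕₚ.≤-refl λ eq → r≢ (sym eq))) (ℤₚ.+-identityʳ _)

  ⊗-single : ∀ f g i j a b → a ≤ i → b ≤ j →
    (∀ a′ b′ → a′ ≤ i → b′ ≤ j → ¬ (a′ ≡ a × b′ ≡ b) → f a′ b′ ℤ.* g (i ∸ a′) (j ∸ b′) ≡ + 0) →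
    (f ⊗ g) i j ≡ f a b ℤ.* g (i ∸ a) (j ∸ b)
  ⊗-single f g i j a b a≤i b≤j off = trans
    (sumTo-single i a a≤i λ a′ a′≤i a′≢a → sumTo-zero j λ b′ b′≤j → off a′ b′ a′≤i b′≤j λ (eq , _) → a′≢a eq)
    (sumTo-single j b b≤j λ b′ b′≤j b′≢b → off a b′ a≤i b′≤j λ (_ , eq) → b′≢b eq)

  -- In any other splitting of the exponent, one of the two parts lies above the leading monomial of
  -- its polynomial.
  ⊗-leading : ∀ {f g a b c d} → Leading f a b → Leading g c d → (f ⊗ g) (a ℕ.+ c) (b ℕ.+ d) ≡ f a b ℤ.* g c d
  ⊗-leading {f} {g} {a} {b} {c} {d} lf lg = trans
    (⊗-single f g (a ℕ.+ c) (b ℕ.+ d) a b (ℕₚ.m≤m+n a c) (ℕₚ.m≤m+n b d) off)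
    (cong₂ (λ i j → f a b ℤ.* g i j) (ℕₚ.m+n∸m≡n a c) (ℕₚ.m+n∸m≡n b d))
    where
    module f = Leading lf
    module g = Leading lg
    open import Algebra.Properties.CommutativeSemigroup ℕₚ.+-commutativeSemigroup using (interchange)
    off : ∀ i j → i ≤ a ℕ.+ c → j ≤ b ℕ.+ d → ¬ (i ≡ a × j ≡ b) → f i j ℤ.* g (a ℕ.+ c ∸ i) (b ℕ.+ d ∸ j) ≡ + 0
    off i j i≤ j≤ ≢ab = by (ℕₚ.<-cmp (i ℕ.+ j) (a ℕ.+ b)) (ℕₚ.<-cmp i a)
      where
      i′ = a ℕ.+ c ∸ i
      j′ = b ℕ.+ d ∸ j
      totals : (i ℕ.+ j) ℕ.+ (i′ ℕ.+ j′) ≡ (a ℕ.+ b) ℕ.+ (c ℕ.+ d)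
      totals = trans (interchange i j i′ j′) (trans (cong₂ ℕ._+_ (ℕₚ.m+[n∸m]≡n i≤) (ℕₚ.m+[n∸m]≡n j≤)) (interchange a c b d))
      larger : ∀ {m n k l} → m ℕ.+ k ≡ n ℕ.+ l → m < n → l < k
      larger {m} {n} {k} {l} eq m<n = ℕₚ.≰⇒> λ k≤l → ℕₚ.<-irrefl eq (ℕₚ.+-mono-<-≤ m<n k≤l)
      by : _ → _ → f i j ℤ.* g i′ j′ ≡ + 0
      by (tri> _ _ gt) _ = *≡0ˡ _ (f.higher i j gt)
      by (tri< lt _ _) _ = *≡0ʳ (f i j) (g.higher i′ j′ (larger totals lt))
      by (tri≈ _ eq _) (tri> _ _ gt) = *≡0ˡ _ (f.later i j eq gt)
      by (tri≈ _ eq _) (tri< lt _ _) = *≡0ʳ (f i j) (g.later i′ j′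
        (ℕₚ.+-cancelˡ-≡ (a ℕ.+ b) _ _ (trans (cong (ℕ._+ (i′ ℕ.+ j′)) (sym eq)) totals))
        (larger (ℕₚ.m+[n∸m]≡n i≤) lt))
      by (tri≈ _ eq _) (tri≈ _ refl _) = contradiction (refl , ℕₚ.+-cancelˡ-≡ i j b eq) ≢ab

  -- Leading coefficients multiply to a non-zero integer, so total degrees add. The bound is written
  -- with sums to avoid K - (a + b); the case K = 0 is the absence of zero divisors.
  degree-bound : ∀ {f g} → IsPoly f → IsPoly g → ∀ {K a b} → f a b ≢ + 0 →
    (∀ i j → K ≤ i ℕ.+ j → (f ⊗ g) i j ≡ + 0) → ∀ i j → K ≤ (a ℕ.+ b) ℕ.+ (i ℕ.+ j) → g i j ≡ + 0
  degree-bound {f} {g} pf pg {K} {a} {b} fab fg0 i j K≤ = stable λ gij → contra (leading pf fab) (leading pg gij)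
    where
    open import Algebra.Properties.CommutativeSemigroup ℕₚ.+-commutativeSemigroup using (interchange)
    contra : ∃₂ (λ a′ b′ → a ℕ.+ b ≤ a′ ℕ.+ b′ × Leading f a′ b′) → ∃₂ (λ i′ j′ → i ℕ.+ j ≤ i′ ℕ.+ j′ × Leading g i′ j′) → _
    contra (a′ , b′ , ab≤ , lf) (i′ , j′ , ij≤ , lg)
      with ℤₚ.i*j≡0⇒i≡0∨j≡0 (f a′ b′) (trans (sym (⊗-leading lf lg))
             (fg0 (a′ ℕ.+ i′) (b′ ℕ.+ j′) (ℕₚ.≤-trans K≤ (ℕₚ.≤-trans (ℕₚ.+-mono-≤ ab≤ ij≤) (ℕₚ.≤-reflexive (interchange a′ b′ i′ j′))))))
    ... | inj₁ f≡0 = Leading.nonzero lf f≡0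
    ... | inj₂ g≡0 = Leading.nonzero lg g≡0

  ⊗-cancel-zero : ∀ {f g} → IsPoly f → IsPoly g → ∀ {a b} → f a b ≢ + 0 → f ⊗ g ≈ 𝟘 → g ≈ 𝟘
  ⊗-cancel-zero pf pg fab fg0 i j = degree-bound pf pg fab (λ i j _ → fg0 i j) i j z≤n

  Q⊗-suc : ∀ g i j → (Q ⊗ g) i (suc j) ≡ g i j
  Q⊗-suc g i j = trans (⊗-single Q g i (suc j) 0 1 z≤n (s≤s z≤n) off) (ℤₚ.*-identityˡ _)
    where
    off : ∀ a b → a ≤ i → b ≤ suc j → ¬ (a ≡ 0 × b ≡ 1) → Q a b ℤ.* g (i ∸ a) (suc j ∸ b) ≡ + 0
    off zero zero _ _ _ = ℤₚ.*-zeroˡ (g i (suc j))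
    off zero (suc zero) _ _ ≢ = contradiction (refl , refl) ≢
    off zero (suc (suc b)) _ _ _ = ℤₚ.*-zeroˡ (g i (suc j ∸ suc (suc b)))
    off (suc a) b _ _ _ = ℤₚ.*-zeroˡ (g (i ∸ suc a) (suc j ∸ b))

  Q⊗-zero : ∀ g i → (Q ⊗ g) i 0 ≡ + 0
  Q⊗-zero g i = sumTo-zero i λ { zero _ → ℤₚ.*-zeroˡ (g i 0) ; (suc a) _ → ℤₚ.*-zeroˡ (g (i ∸ suc a) 0) }

  X⊗-suc : ∀ g i j → (X ⊗ g) (suc i) j ≡ g i j
  X⊗-suc g i j = trans (⊗-single X g (suc i) j 1 0 (s≤s z≤n) z≤n off) (ℤₚ.*-identityˡ _)
    where
    off : ∀ a b → a ≤ suc i → b ≤ j → ¬ (a ≡ 1 × b ≡ 0) → X a b ℤ.* g (suc i ∸ a) (j ∸ b) ≡ + 0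
    off zero b _ _ _ = ℤₚ.*-zeroˡ (g (suc i) (j ∸ b))
    off (suc zero) zero _ _ ≢ = contradiction (refl , refl) ≢
    off (suc zero) (suc b) _ _ _ = ℤₚ.*-zeroˡ (g i (j ∸ suc b))
    off (suc (suc a)) b _ _ _ = ℤₚ.*-zeroˡ (g (suc i ∸ suc (suc a)) (j ∸ b))

  X⊗-zero : ∀ g j → (X ⊗ g) 0 j ≡ + 0
  X⊗-zero g j = sumTo-zero j λ b _ → ℤₚ.*-zeroˡ (g 0 (j ∸ b))

-- Lowest terms by linear algebra over ℤ.

module LowestForm where
  open import Defs
  open PolynomialRing
  open LeadingMonomials
  open import Data.Bool.Base using (Bool; true; false)
  import Data.Bool.Properties as Boolₚ
  open import Data.Integer.Base as ℤ using (ℤ; +_)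
  import Data.Integer.Properties as ℤₚ
  open import Data.Nat.Divisibility using (_∣_; _∣?_; _∣0; ∣⇒≤; m∣m*n)
  open import Data.Integer.Divisibility.Signed using (∣ᵤ⇒∣) renaming (divides to dividesₛ; _∣_ to _∣ₛ_; quotient to quotientₛ)
  open import Data.Integer.Solver using (module +-*-Solver)
  open +-*-Solver using (solve; _:=_; _:+_; _:*_; _:-_; :-_; con)
  open import Data.Product using (∃; ∃₂; _×_; _,_; proj₁; proj₂)
  open import Data.Product.Properties using (≡-dec)
  open import Data.Sum using (_⊎_; inj₁; inj₂)
  open import Data.Vec.Base as Vec using (Vec; []; _∷_)
  open import Data.List.Base as List using (List; []; _∷_)
  open import Data.List.Membership.Propositional using (_∈_; _∉_)
  open import Data.List.Membership.Propositional.Properties using (∈-filter⁺; ∈-filter⁻; ∈-cartesianProduct⁺; ∈-upTo⁺)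
  open import Data.List.Relation.Unary.Any using (here; there)
  open import Data.Vec.Relation.Unary.All as All using (All; []; _∷_)
  open import Relation.Binary.PropositionalEquality as ≡ using (_≡_; _≢_; refl; sym; trans; cong; cong₂; subst)
  open import Relation.Nullary using (¬_; Dec; yes; no; contradiction)
  open import Relation.Nullary.Decidable using (¬?; _×-dec_)

  zero? : ∀ {f} → IsPoly f → f ≈ 𝟘 ⊎ ∃₂ λ i j → f i j ≢ + 0
  zero? {f} (D , f0) with ℕₚ.anyUpTo? (λ i → ℕₚ.anyUpTo? (λ j → ¬? (f i j ℤₚ.≟ + 0)) D) D
  ... | yes (i , _ , j , _ , fij) = inj₂ (i , j , fij)
  ... | no none = inj₁ λ i j → stable λ fij → none
        ( i , ℕₚ.≰⇒> (λ D≤i → fij (f0 i j (ℕₚ.≤-trans D≤i (ℕₚ.m≤m+n i j))))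
        , j , ℕₚ.≰⇒> (λ D≤j → fij (f0 i j (ℕₚ.≤-trans D≤j (ℕₚ.m≤n+m j i)))) , fij)

  sumTo-comb : ∀ n a b u v → sumTo n (λ k → a ℤ.* u k ℤ.- b ℤ.* v k) ≡ a ℤ.* sumTo n u ℤ.- b ℤ.* sumTo n v
  sumTo-comb zero a b u v = refl
  sumTo-comb (suc n) a b u v = trans (cong (ℤ._+ (a ℤ.* u (suc n) ℤ.- b ℤ.* v (suc n))) (sumTo-comb n a b u v)) (eq a b (sumTo n u) (sumTo n v) (u (suc n)) (v (suc n)))
    where
    eq : ∀ a b U V u v → (a ℤ.* U ℤ.- b ℤ.* V) ℤ.+ (a ℤ.* u ℤ.- b ℤ.* v) ≡ a ℤ.* (U ℤ.+ u) ℤ.- b ℤ.* (V ℤ.+ v)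
    eq = solve 6 (λ a b U V u v → (a :* U :- b :* V) :+ (a :* u :- b :* v) := a :* (U :+ u) :- b :* (V :+ v)) refl

  combᵖ : ℤ → Poly → ℤ → Poly → Poly
  combᵖ a f b g i j = a ℤ.* f i j ℤ.- b ℤ.* g i j

  ⊗-combʳ : ∀ h a f b g → h ⊗ combᵖ a f b g ≈ combᵖ a (h ⊗ f) b (h ⊗ g)
  ⊗-combʳ h a f b g i j = trans
    (sumTo-cong≤ i λ k _ → trans (sumTo-cong≤ j λ l _ → eq a b (h k l) (f (i ∸ k) (j ∸ l)) (g (i ∸ k) (j ∸ l)))
      (sumTo-comb j a b (λ l → h k l ℤ.* f (i ∸ k) (j ∸ l)) (λ l → h k l ℤ.* g (i ∸ k) (j ∸ l))))
    (sumTo-comb i a b (λ k → sumTo j λ l → h k l ℤ.* f (i ∸ k) (j ∸ l)) (λ k → sumTo j λ l → h k l ℤ.* g (i ∸ k) (j ∸ l)))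
    where
    eq : ∀ a b h f g → h ℤ.* (a ℤ.* f ℤ.- b ℤ.* g) ≡ a ℤ.* (h ℤ.* f) ℤ.- b ℤ.* (h ℤ.* g)
    eq = solve 5 (λ a b h f g → h :* (a :* f :- b :* g) := a :* (h :* f) :- b :* (h :* g)) refl

  ⊗-combˡ : ∀ h a f b g → combᵖ a f b g ⊗ h ≈ combᵖ a (f ⊗ h) b (g ⊗ h)
  ⊗-combˡ h a f b g i j = trans (⊗-comm (combᵖ a f b g) h i j) (trans (⊗-combʳ h a f b g i j)
    (cong₂ (λ u v → a ℤ.* u ℤ.- b ℤ.* v) (⊗-comm h f i j) (⊗-comm h g i j)))

  Index : Set
  Index = Bool × ℕ × ℕ

  index≟ : (k l : Index) → Dec (k ≡ l)
  index≟ = ≡-dec Boolₚ._≟_ (≡-dec ℕₚ._≟_ ℕₚ._≟_)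

  -- A pair (B₁ , B₂) of polynomials, B₁ at index false and B₂ at index true.
  Pair : Set
  Pair = Index → ℤ

  _≐_ : Pair → Pair → Set
  e ≐ e′ = ∀ k → e k ≡ e′ k

  comb : ℤ → Pair → ℤ → Pair → Pair
  comb a e b h k = a ℤ.* e k ℤ.- b ℤ.* h k

  component : Bool → Pair → Poly
  component s e i j = e (s , i , j)

  PairIsPoly : Pair → Set
  PairIsPoly e = ∀ s → IsPoly (component s e)

  combᵖ-isPoly : ∀ a {f} b {g} → IsPoly f → IsPoly g → IsPoly (combᵖ a f b g)
  combᵖ-isPoly a b (D , p) (E , r) = D ℕ.+ E , λ i j le → cong₂ ℤ._-_
    (*≡0ʳ a (p i j (ℕₚ.≤-trans (ℕₚ.m≤m+n D E) le))) (*≡0ʳ b (r i j (ℕₚ.≤-trans (ℕₚ.m≤n+m E D) le)))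

  InSpan : ∀ {n} → Vec Pair n → Pair → Set
  InSpan [] e = ∀ k → e k ≡ + 0
  InSpan (g ∷ gs) e = ∃ λ c → InSpan gs (comb (+ 1) e c g)

  span-resp : ∀ {n} (gs : Vec Pair n) {e e′} → e ≐ e′ → InSpan gs e → InSpan gs e′
  span-resp [] eq p k = trans (sym (eq k)) (p k)
  span-resp (g ∷ gs) eq (c , p) = c , span-resp gs (λ k → cong (λ z → + 1 ℤ.* z ℤ.- c ℤ.* g k) (eq k)) p

  span-zero : ∀ {n} (gs : Vec Pair n) {e} → (∀ k → e k ≡ + 0) → InSpan gs e
  span-zero [] e0 = e0
  span-zero (g ∷ gs) {e} e0 = + 0 , span-zero gs λ k → trans (cong (λ z → + 1 ℤ.* z ℤ.- + 0 ℤ.* g k) (e0 k)) (eq (g k))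
    where
    eq : ∀ g → + 1 ℤ.* + 0 ℤ.- + 0 ℤ.* g ≡ + 0
    eq = solve 1 (λ g → con (+ 1) :* con (+ 0) :- con (+ 0) :* g := con (+ 0)) refl

  module Elimination (U V : Poly) (pU : IsPoly U) (pV : IsPoly V) where

    opaque
      -- A linear map whose kernel consists of the pairs with B₁/B₂ = U/V, once B₂ is non-zero.
      φ : Pair → Poly
      φ e = U ⊗ component true e ⊖ component false e ⊗ V

      φ-comb : ∀ a e b h i j → φ (comb a e b h) i j ≡ a ℤ.* φ e i j ℤ.- b ℤ.* φ h i j
      φ-comb a e b h i j = trans
        (cong₂ ℤ._-_ (⊗-combʳ U a (component true e) b (component true h) i j) (⊗-combˡ V a (component false e) b (component false h) i j))
        (eq a b _ _ _ _)
        where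
        eq : ∀ a b u v w z → (a ℤ.* u ℤ.- b ℤ.* v) ℤ.- (a ℤ.* w ℤ.- b ℤ.* z) ≡ a ℤ.* (u ℤ.- w) ℤ.- b ℤ.* (v ℤ.- z)
        eq = solve 6 (λ a b u v w z → (a :* u :- b :* v) :- (a :* w :- b :* z) := a :* (u :- w) :- b :* (v :- z)) refl

      φ-resp : ∀ {e e′} → e ≐ e′ → φ e ≈ φ e′
      φ-resp eq i j = cong₂ ℤ._-_ (⊗-cong {U} ≈-refl (λ i j → eq (true , i , j)) i j) (⊗-cong {g = V} (λ i j → eq (false , i , j)) ≈-refl i j)

      φ-isPoly : ∀ {e} → PairIsPoly e → IsPoly (φ e)
      φ-isPoly p = ⊕-isPoly (⊗-isPoly pU (p true)) (neg-isPoly (⊗-isPoly (p false) pV))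

      φ-zero⇒ : ∀ {e} → φ e ≈ 𝟘 → U ⊗ component true e ≈ component false e ⊗ V
      φ-zero⇒ φe i j = ℤₚ.i-j≡0⇒i≡j _ _ (φe i j)

      φ-zero⇐ : ∀ {e} → U ⊗ component true e ≈ component false e ⊗ V → φ e ≈ 𝟘
      φ-zero⇐ eq i j = ℤₚ.i≡j⇒i-j≡0 (eq i j)

    -- Elimination without division: if π is the coefficient of φ g at (i, j), the image of this
    -- combination has coefficient zero there.
    pivot : ℤ → ℕ → ℕ → Pair → Pair → Pair
    pivot π i j g h = comb π h (φ h i j) g

    span-unpivot : ∀ {n} π i j g (hs : Vec Pair n) {e} → InSpan (Vec.map (pivot π i j g) hs) e → InSpan (g ∷ hs) e
    span-unpivot π i j g [] {e} p = + 0 , λ k → trans (cong (λ z → + 1 ℤ.* z ℤ.- + 0 ℤ.* g k) (p k)) (eq (g k))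
      where
      eq : ∀ g → + 1 ℤ.* + 0 ℤ.- + 0 ℤ.* g ≡ + 0
      eq = solve 1 (λ g → con (+ 1) :* con (+ 0) :- con (+ 0) :* g := con (+ 0)) refl
    span-unpivot π i j g (h ∷ hs) {e} (a , p) with span-unpivot π i j g hs p
    ... | c , r = c ℤ.- a ℤ.* φ h i j , a ℤ.* π , span-resp hs (λ k → eq (e k) a π (h k) (φ h i j) (g k) c) r
      where
      eq : ∀ e a π h f g c → + 1 ℤ.* (+ 1 ℤ.* e ℤ.- a ℤ.* (π ℤ.* h ℤ.- f ℤ.* g)) ℤ.- c ℤ.* g
        ≡ + 1 ℤ.* (+ 1 ℤ.* e ℤ.- (c ℤ.- a ℤ.* f) ℤ.* g) ℤ.- (a ℤ.* π) ℤ.* h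
      eq = solve 7 (λ e a π h f g c → con (+ 1) :* (con (+ 1) :* e :- a :* (π :* h :- f :* g)) :- c :* g := con (+ 1) :* (con (+ 1) :* e :- (c :- a :* f) :* g) :- (a :* π) :* h) refl

    span-pivot : ∀ {n} π i j g (hs : Vec Pair n) {e} → InSpan hs e → InSpan (Vec.map (pivot π i j g) hs) (pivot π i j g e)
    span-pivot π i j g [] {e} p k = trans (cong₂ (λ z f → π ℤ.* z ℤ.- f ℤ.* g k) (p k) (φ-zero i j)) (eq π (g k))
      where
      eq : ∀ π g → π ℤ.* + 0 ℤ.- + 0 ℤ.* g ≡ + 0
      eq = solve 2 (λ π g → π :* con (+ 0) :- con (+ 0) :* g := con (+ 0)) refl
      φ-zero : φ e ≈ 𝟘
      φ-zero i j = trans (φ-resp {e} {comb (+ 0) e (+ 0) e} (λ k → trans (p k) (z (e k))) i j)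
        (trans (φ-comb (+ 0) e (+ 0) e i j) (sym (z (φ e i j))))
        where
        z : ∀ e → + 0 ≡ + 0 ℤ.* e ℤ.- + 0 ℤ.* e
        z = solve 1 (λ e → con (+ 0) := con (+ 0) :* e :- con (+ 0) :* e) refl
    span-pivot π i j g (h ∷ hs) {e} (a , p) = a , span-resp _
      (λ k → trans (cong (λ f → π ℤ.* (+ 1 ℤ.* e k ℤ.- a ℤ.* h k) ℤ.- f ℤ.* g k) (φ-comb (+ 1) e a h i j)) (eq π (e k) a (h k) (φ e i j) (φ h i j) (g k)))
      (span-pivot π i j g hs p)
      where
      eq : ∀ π e a h fe fh g → π ℤ.* (+ 1 ℤ.* e ℤ.- a ℤ.* h) ℤ.- (+ 1 ℤ.* fe ℤ.- a ℤ.* fh) ℤ.* g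
        ≡ + 1 ℤ.* (π ℤ.* e ℤ.- fe ℤ.* g) ℤ.- a ℤ.* (π ℤ.* h ℤ.- fh ℤ.* g)
      eq = solve 7 (λ π e a h fe fh g → π :* (con (+ 1) :* e :- a :* h) :- (con (+ 1) :* fe :- a :* fh) :* g := con (+ 1) :* (π :* e :- fe :* g) :- a :* (π :* h :- fh :* g)) refl

    Solvable Unsolvable : ∀ {n} → Vec Pair n → Set
    Solvable gs = ∃ λ e → InSpan gs e × φ e ≈ 𝟘 × ∃₂ λ i j → component true e i j ≢ + 0
    Unsolvable gs = ∀ e → InSpan gs e → φ e ≈ 𝟘 → component true e ≈ 𝟘

    solvable? : ∀ {n} (gs : Vec Pair n) → All PairIsPoly gs → Solvable gs ⊎ Unsolvable gs
    solvable? [] [] = inj₂ λ e p _ i j → p (true , i , j)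
    solvable? (g ∷ gs) (pg ∷ pgs) with zero? (φ-isPoly pg)
    solvable? (g ∷ gs) (pg ∷ pgs) | inj₁ φg with zero? (pg true)
    ... | inj₂ nz = inj₁ (g , (+ 1 , span-zero gs λ k → eq (g k)) , φg , nz)
      where
      eq : ∀ g → + 1 ℤ.* g ℤ.- + 1 ℤ.* g ≡ + 0
      eq = solve 1 (λ g → con (+ 1) :* g :- con (+ 1) :* g := con (+ 0)) refl
    ... | inj₁ g0 with solvable? gs pgs
    ... | inj₁ (e , p , r) = inj₁ (e , (+ 0 , span-resp gs (λ k → eq (e k) (g k)) p) , r)
      where
      eq : ∀ e g → e ≡ + 1 ℤ.* e ℤ.- + 0 ℤ.* g
      eq = solve 2 (λ e g → e := con (+ 1) :* e :- con (+ 0) :* g) refl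
    ... | inj₂ none = inj₂ λ e (c , p) φe i j → trans (eq (component true e i j) c (component true g i j))
        (cong₂ ℤ._+_ (none _ p (λ i j → trans (φ-comb (+ 1) e c g i j) (trans (cong₂ (λ u v → + 1 ℤ.* u ℤ.- c ℤ.* v) (φe i j) (φg i j)) (eq₀ c))) i j)
          (*≡0ʳ c (g0 i j)))
      where
      eq : ∀ e c g → e ≡ (+ 1 ℤ.* e ℤ.- c ℤ.* g) ℤ.+ c ℤ.* g
      eq = solve 3 (λ e c g → e := (con (+ 1) :* e :- c :* g) :+ c :* g) refl
      eq₀ : ∀ c → + 1 ℤ.* + 0 ℤ.- c ℤ.* + 0 ≡ + 0
      eq₀ = solve 1 (λ c → con (+ 1) :* con (+ 0) :- c :* con (+ 0) := con (+ 0)) refl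
    solvable? (g ∷ gs) (pg ∷ pgs) | inj₂ (i , j , π≢0) with solvable? (Vec.map (pivot (φ g i j) i j g) gs) (pivot-isPoly pgs)
      where
      pivot-isPoly : ∀ {n} {hs : Vec Pair n} → All PairIsPoly hs → All PairIsPoly (Vec.map (pivot (φ g i j) i j g) hs)
      pivot-isPoly [] = []
      pivot-isPoly {hs = h ∷ _} (ph ∷ phs) = (λ s → combᵖ-isPoly (φ g i j) (φ h i j) (ph s) (pg s)) ∷ pivot-isPoly phs
    ... | inj₁ (e , p , r) = inj₁ (e , span-unpivot (φ g i j) i j g gs p , r)
    ... | inj₂ none = inj₂ λ e (c , p) φe k l → by e c p φe k l
      where
      π = φ g i j
      by : ∀ e c → InSpan gs (comb (+ 1) e c g) → φ e ≈ 𝟘 → component true e ≈ 𝟘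
      by e c p φe k l with ℤₚ.i*j≡0⇒i≡0∨j≡0 π (trans (scaled k l) (none _ (span-pivot π i j g gs p) φe₂ k l))
        where
        -- `e₂` is the pivoted form of e - cg and equals π e: since φ e = 0, the image of e - cg has
        -- coefficient -cπ at (i, j), so the pivot adds cπ g back.
        e₁ e₂ : Pair
        e₁ = comb (+ 1) e c g
        e₂ = pivot π i j g e₁
        φe₁ : φ e₁ i j ≡ ℤ.- (c ℤ.* π)
        φe₁ = trans (φ-comb (+ 1) e c g i j) (trans (cong (λ z → + 1 ℤ.* z ℤ.- c ℤ.* π) (φe i j)) (eq (c ℤ.* π)))
          where
          eq : ∀ a → + 1 ℤ.* + 0 ℤ.- a ≡ ℤ.- a
          eq = solve 1 (λ a → con (+ 1) :* con (+ 0) :- a := :- a) refl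
        e₂≐ : ∀ k → π ℤ.* e k ≡ e₂ k
        e₂≐ k = sym (trans (cong (λ z → π ℤ.* (+ 1 ℤ.* e k ℤ.- c ℤ.* g k) ℤ.- z ℤ.* g k) φe₁) (eq π (e k) c (g k)))
          where
          eq : ∀ π e c g → π ℤ.* (+ 1 ℤ.* e ℤ.- c ℤ.* g) ℤ.- (ℤ.- (c ℤ.* π)) ℤ.* g ≡ π ℤ.* e
          eq = solve 4 (λ π e c g → π :* (con (+ 1) :* e :- c :* g) :- (:- (c :* π)) :* g := π :* e) refl
        scaled : ∀ k l → π ℤ.* component true e k l ≡ component true e₂ k l
        scaled k l = e₂≐ (true , k , l)
        φe₂ : φ e₂ ≈ 𝟘
        φe₂ k l = trans (φ-resp {e₂} {comb π e (+ 0) e} (λ m → trans (sym (e₂≐ m)) (eq π (e m))) k l)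
          (trans (φ-comb π e (+ 0) e k l) (trans (cong (λ z → π ℤ.* z ℤ.- + 0 ℤ.* z) (φe k l)) (eq₀ π)))
          where
          eq : ∀ π e → π ℤ.* e ≡ π ℤ.* e ℤ.- + 0 ℤ.* e
          eq = solve 2 (λ π e → π :* e := π :* e :- con (+ 0) :* e) refl
          eq₀ : ∀ π → π ℤ.* + 0 ℤ.- + 0 ℤ.* + 0 ≡ + 0
          eq₀ = solve 1 (λ π → π :* con (+ 0) :- con (+ 0) :* con (+ 0) := con (+ 0)) refl
      ... | inj₁ π≡0 = contradiction π≡0 π≢0
      ... | inj₂ e≡0 = e≡0

  δ : Index → Pair
  δ k l with index≟ k l
  ... | yes _ = + 1
  ... | no _ = + 0

  δ-self : ∀ k → δ k k ≡ + 1
  δ-self k with index≟ k k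
  ... | yes _ = refl
  ... | no k≢k = contradiction refl k≢k

  δ-other : ∀ {k l} → k ≢ l → δ k l ≡ + 0
  δ-other {k} {l} k≢l with index≟ k l
  ... | yes k≡l = contradiction k≡l k≢l
  ... | no _ = refl

  δ-isPoly : ∀ k → PairIsPoly (δ k)
  δ-isPoly (s , a , b) s′ = suc (a ℕ.+ b) , λ i j le → δ-other λ { refl → ℕₚ.<-irrefl refl le }

  monomials : (ℓ : List Index) → Vec Pair (List.length ℓ)
  monomials ℓ = Vec.map δ (Vec.fromList ℓ)

  monomials-isPoly : ∀ ℓ → All PairIsPoly (monomials ℓ)
  monomials-isPoly [] = []
  monomials-isPoly (k ∷ ℓ) = δ-isPoly k ∷ monomials-isPoly ℓ

  supported⇒span : ∀ ℓ {e} → (∀ k → k ∉ ℓ → e k ≡ + 0) → InSpan (monomials ℓ) e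
  supported⇒span [] e0 k = e0 k λ ()
  supported⇒span (k ∷ ℓ) {e} e0 = e k , supported⇒span ℓ λ l l∉ℓ → by l l∉ℓ (index≟ k l)
    where
    by : ∀ l → l ∉ ℓ → Dec (k ≡ l) → + 1 ℤ.* e l ℤ.- e k ℤ.* δ k l ≡ + 0
    by l _ (yes refl) = trans (cong (λ z → + 1 ℤ.* e k ℤ.- e k ℤ.* z) (δ-self k)) (solve 1 (λ a → con (+ 1) :* a :- a :* con (+ 1) := con (+ 0)) refl (e k))
    by l l∉ℓ (no k≢l) = trans (cong₂ (λ y z → + 1 ℤ.* y ℤ.- e k ℤ.* z) (e0 l λ { (here refl) → k≢l refl ; (there l∈) → l∉ℓ l∈ }) (δ-other k≢l))
      (solve 1 (λ a → con (+ 1) :* con (+ 0) :- a :* con (+ 0) := con (+ 0)) refl (e k))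

  span⇒supported : ∀ ℓ {e} → InSpan (monomials ℓ) e → ∀ k → k ∉ ℓ → e k ≡ + 0
  span⇒supported [] p k _ = p k
  span⇒supported (l ∷ ℓ) {e} (c , p) k k∉ = trans (trans
    (solve 2 (λ e c → e := con (+ 1) :* e :- c :* con (+ 0)) refl (e k) c)
    (cong (λ z → + 1 ℤ.* e k ℤ.- c ℤ.* z) (sym (δ-other λ { refl → k∉ (here refl) }))))
    (span⇒supported ℓ p k λ k∈ → k∉ (there k∈))

  Bounded : ℕ → Poly → Set
  Bounded K f = ∀ i j → K ≤ i ℕ.+ j → f i j ≡ + 0

  limit : ℕ → ℕ → Bool → ℕ
  limit K₁ K₂ false = K₁
  limit K₁ K₂ true = K₂

  limit≤ : ∀ K₁ K₂ s → limit K₁ K₂ s ≤ K₁ ℕ.+ K₂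
  limit≤ K₁ K₂ false = ℕₚ.m≤m+n K₁ K₂
  limit≤ K₁ K₂ true = ℕₚ.m≤n+m K₂ K₁

  below : ℕ → ℕ → Index → Set
  below K₁ K₂ (s , i , j) = i ℕ.+ j < limit K₁ K₂ s

  below? : ∀ K₁ K₂ k → Dec (below K₁ K₂ k)
  below? K₁ K₂ (s , i , j) = i ℕ.+ j ℕₚ.<? limit K₁ K₂ s

  box : ℕ → List Index
  box K = List.cartesianProduct (false ∷ true ∷ []) (List.cartesianProduct (List.upTo K) (List.upTo K))

  indices : ℕ → ℕ → List Index
  indices K₁ K₂ = List.filter (below? K₁ K₂) (box (K₁ ℕ.+ K₂))

  below⇒∈ : ∀ K₁ K₂ k → below K₁ K₂ k → k ∈ indices K₁ K₂
  below⇒∈ K₁ K₂ (s , i , j) lt = ∈-filter⁺ (below? K₁ K₂) (∈-cartesianProduct⁺ (s∈ s) (∈-cartesianProduct⁺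
    (∈-upTo⁺ (ℕₚ.≤-<-trans (ℕₚ.m≤m+n i j) lt′)) (∈-upTo⁺ (ℕₚ.≤-<-trans (ℕₚ.m≤n+m j i) lt′)))) lt
    where
    lt′ : i ℕ.+ j < K₁ ℕ.+ K₂
    lt′ = ℕₚ.<-≤-trans lt (limit≤ K₁ K₂ s)
    s∈ : ∀ s → s ∈ (false ∷ true ∷ [])
    s∈ false = here refl
    s∈ true = there (here refl)

  ∈⇒below : ∀ K₁ K₂ {k} → k ∈ indices K₁ K₂ → below K₁ K₂ k
  ∈⇒below K₁ K₂ k∈ = proj₂ (∈-filter⁻ (below? K₁ K₂) {xs = box (K₁ ℕ.+ K₂)} k∈)

  module LowestTerms (U V : Poly) (pU : IsPoly U) (pV : IsPoly V) where
    open Elimination U V pU pV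

    record Solution (K₁ K₂ : ℕ) : Set where
      field
        B₁ B₂    : Poly
        bounded₁ : Bounded K₁ B₁
        bounded₂ : Bounded K₂ B₂
        equation : U ⊗ B₂ ≈ B₁ ⊗ V
        nonzero₂ : ∃₂ λ i j → B₂ i j ≢ + 0

    NoSolution : ℕ → ℕ → Set
    NoSolution K₁ K₂ = ∀ B₁ B₂ → Bounded K₁ B₁ → Bounded K₂ B₂ → U ⊗ B₂ ≈ B₁ ⊗ V → B₂ ≈ 𝟘

    solution? : ∀ K₁ K₂ → Solution K₁ K₂ ⊎ NoSolution K₁ K₂
    solution? K₁ K₂ with solvable? (monomials (indices K₁ K₂)) (monomials-isPoly _)
    ... | inj₁ (e , p , φe , nz) = inj₁ record
        { B₁ = component false e ; B₂ = component true e
        ; bounded₁ = bounded false ; bounded₂ = bounded true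
        ; equation = φ-zero⇒ {e} φe ; nonzero₂ = nz }
      where
      bounded : ∀ s → Bounded (limit K₁ K₂ s) (component s e)
      bounded s i j le = span⇒supported (indices K₁ K₂) p (s , i , j) λ k∈ → ℕₚ.<⇒≱ (∈⇒below K₁ K₂ k∈) le
    ... | inj₂ none = inj₂ λ B₁ B₂ b₁ b₂ eq → none (pair B₁ B₂)
        (supported⇒span (indices K₁ K₂) λ k k∉ → outside B₁ B₂ b₁ b₂ k (ℕₚ.≮⇒≥ λ lt → k∉ (below⇒∈ K₁ K₂ k lt)))
        (φ-zero⇐ {pair B₁ B₂} eq)
      where
      pair : Poly → Poly → Pair
      pair B₁ B₂ (false , i , j) = B₁ i j
      pair B₁ B₂ (true , i , j) = B₂ i j
      outside : ∀ B₁ B₂ → Bounded K₁ B₁ → Bounded K₂ B₂ → ∀ k → limit K₁ K₂ (proj₁ k) ≤ proj₁ (proj₂ k) ℕ.+ proj₂ (proj₂ k) → pair B₁ B₂ k ≡ + 0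
      outside B₁ B₂ b₁ b₂ (false , i , j) le = b₁ i j le
      outside B₁ B₂ b₁ b₂ (true , i , j) le = b₂ i j le

    -- Only the bound on the denominator is lowered. The bound K₁ on the numerator can stay, since
    -- it is inherited by the cofactors of any common divisor.
    minimal : ∀ K₁ K₂ → Solution K₁ K₂ → ∃ λ K → Solution K₁ K × (∀ k → suc k ≡ K → NoSolution K₁ k)
    minimal K₁ zero sol = zero , sol , λ _ ()
    minimal K₁ (suc K₂) sol with solution? K₁ K₂
    ... | inj₁ sol′ = minimal K₁ K₂ sol′
    ... | inj₂ none = suc K₂ , sol , λ { _ refl → none }

    Divides : ℕ → Poly → Set
    Divides c f = ∀ i j → c ∣ ℤ.∣ f i j ∣

    divides? : ∀ {K f} c → Bounded K f → Dec (Divides c f)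
    divides? {K} {f} c f0 with ℕₚ.allUpTo? (λ i → ℕₚ.allUpTo? (λ j → c ∣? ℤ.∣ f i j ∣) K) K
    ... | no ¬all = no λ all → ¬all λ {i} _ {j} _ → all i j
    ... | yes all = yes λ i j → by i j (i ℕₚ.<? K) (j ℕₚ.<? K)
      where
      zero-case : ∀ i j → K ≤ i ℕ.+ j → c ∣ ℤ.∣ f i j ∣
      zero-case i j le = subst (λ z → c ∣ ℤ.∣ z ∣) (sym (f0 i j le)) (c ∣0)
      by : ∀ i j → Dec (i < K) → Dec (j < K) → c ∣ ℤ.∣ f i j ∣
      by i j (yes i<K) (yes j<K) = all i<K j<K
      by i j (no i≮K) _ = zero-case i j (ℕₚ.≤-trans (ℕₚ.≮⇒≥ i≮K) (ℕₚ.m≤m+n i j))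
      by i j (yes _) (no j≮K) = zero-case i j (ℕₚ.≤-trans (ℕₚ.≮⇒≥ j≮K) (ℕₚ.m≤n+m j i))

    divideᵖ : ∀ c f → Divides c f → Poly
    divideᵖ c f c∣f i j = quotientₛ (∣ᵤ⇒∣ {+ c} {f i j} (c∣f i j))

    divideᵖ-* : ∀ c f (c∣f : Divides c f) i j → f i j ≡ + c ℤ.* divideᵖ c f c∣f i j
    divideᵖ-* c f c∣f i j = trans (_∣ₛ_.equality (∣ᵤ⇒∣ {+ c} {f i j} (c∣f i j))) (ℤₚ.*-comm (divideᵖ c f c∣f i j) (+ c))

    cancel-natural : ∀ c a b → + suc c ℤ.* a ≡ + suc c ℤ.* b → a ≡ b
    cancel-natural c a b eq = ℤₚ.*-cancelˡ-≡ (+ suc c) a b eq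

    divideᵖ-bounded : ∀ c f {K} (c∣f : Divides (suc c) f) → Bounded K f → Bounded K (divideᵖ (suc c) f c∣f)
    divideᵖ-bounded c f c∣f f0 i j le = cancel-natural c _ _ (trans (sym (divideᵖ-* (suc c) f c∣f i j)) (trans (f0 i j le) (sym (ℤₚ.*-zeroʳ (+ suc c)))))

    scale≈ : ∀ c f (c∣f : Divides c f) → f ≈ combᵖ (+ c) (divideᵖ c f c∣f) (+ 0) 𝟘
    scale≈ c f c∣f i j = trans (divideᵖ-* c f c∣f i j) (solve 1 (λ a → a := a :- con (+ 0) :* con (+ 0)) refl (+ c ℤ.* divideᵖ c f c∣f i j))

    uncomb : ∀ a (f g : Poly) i j → combᵖ a f (+ 0) g i j ≡ a ℤ.* f i j
    uncomb a f g i j = solve 2 (λ u v → u :- con (+ 0) :* v := u) refl (a ℤ.* f i j) (g i j)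

    divide-solution : ∀ {K₁ K₂} c (sol : Solution K₁ K₂) → Divides (suc c) (Solution.B₁ sol) → Divides (suc c) (Solution.B₂ sol) → Solution K₁ K₂
    divide-solution c sol d₁ d₂ = record
      { B₁ = B₁′ ; B₂ = B₂′
      ; bounded₁ = divideᵖ-bounded c B₁ d₁ bounded₁ ; bounded₂ = divideᵖ-bounded c B₂ d₂ bounded₂
      ; equation = λ i j → cancel-natural c _ _ (trans (sym (uncomb (+ suc c) (U ⊗ B₂′) (U ⊗ 𝟘) i j)) (trans (scaled i j) (uncomb (+ suc c) (B₁′ ⊗ V) (𝟘 ⊗ V) i j)))
      ; nonzero₂ = proj₁ nonzero₂ , proj₁ (proj₂ nonzero₂) , λ eq → proj₂ (proj₂ nonzero₂)
          (trans (divideᵖ-* (suc c) B₂ d₂ _ _) (trans (cong (+ suc c ℤ.*_) eq) (ℤₚ.*-zeroʳ (+ suc c)))) }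
      where
      open Solution sol
      B₁′ = divideᵖ (suc c) B₁ d₁
      B₂′ = divideᵖ (suc c) B₂ d₂
      scaled : combᵖ (+ suc c) (U ⊗ B₂′) (+ 0) (U ⊗ 𝟘) ≈ combᵖ (+ suc c) (B₁′ ⊗ V) (+ 0) (𝟘 ⊗ V)
      scaled = ≈-trans (≈-sym (⊗-combʳ U (+ suc c) B₂′ (+ 0) 𝟘)) (≈-trans (⊗-cong {U} ≈-refl (≈-sym (scale≈ (suc c) B₂ d₂)))
        (≈-trans equation (≈-trans (⊗-cong {g = V} (scale≈ (suc c) B₁ d₁) ≈-refl) (⊗-combˡ V (+ suc c) B₁′ (+ 0) 𝟘))))

    Primitive : ∀ {K₁ K₂} → Solution K₁ K₂ → Set
    Primitive sol = ∀ c → 2 ≤ c → Divides c (Solution.B₁ sol) → ¬ Divides c (Solution.B₂ sol)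

    -- The absolute value of one fixed non-zero coefficient of the denominator. Dividing out a
    -- constant c ≥ 2 makes it smaller, so it bounds the number of divisions, and also the constants
    -- that have to be tried.
    size : ∀ {K₁ K₂} → Solution K₁ K₂ → ℕ
    size sol = ℤ.∣ B₂ (proj₁ nonzero₂) (proj₁ (proj₂ nonzero₂)) ∣
      where open Solution sol

    size-nonzero : ∀ {K₁ K₂} (sol : Solution K₁ K₂) → size sol ≢ 0
    size-nonzero sol eq = proj₂ (proj₂ (Solution.nonzero₂ sol)) (ℤₚ.∣i∣≡0⇒i≡0 eq)

    remove-content : ∀ {K₁ K₂} fuel (sol : Solution K₁ K₂) → size sol ≤ fuel → ∃ λ (sol : Solution K₁ K₂) → Primitive sol
    remove-content zero sol le = contradiction (ℕₚ.n≤0⇒n≡0 le) (size-nonzero sol)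
    remove-content (suc fuel) sol le = by (ℕₚ.anyUpTo? (λ c → (2 ℕₚ.≤? c) ×-dec (divides? c bounded₁ ×-dec divides? c bounded₂)) (suc (size sol)))
      where
      open Solution sol
      by : Dec (∃ λ c → c < suc (size sol) × 2 ≤ c × Divides c B₁ × Divides c B₂) → _
      by (no none) = sol , λ c 2≤c d₁ d₂ → none (c , s≤s (∣⇒≤ {{ℕ.≢-nonZero (size-nonzero sol)}} (d₂ _ _)) , 2≤c , d₁ , d₂)
      by (yes (suc c , _ , s≤s 1≤c , d₁ , d₂)) = remove-content fuel sol′ (ℕₚ.≤-pred (ℕₚ.<-≤-trans smaller le))
        where
        sol′ = divide-solution c sol d₁ d₂
        n = size sol′
        smaller : n < size sol
        smaller = begin-strict
          n <⟨ ℕₚ.m<m+n n (ℕₚ.*-mono-≤ 1≤c (ℕₚ.n≢0⇒n>0 (size-nonzero sol′))) ⟩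
          n ℕ.+ c ℕ.* n ≡⟨ ℤₚ.abs-* (+ suc c) (Solution.B₂ sol′ (proj₁ nonzero₂) (proj₁ (proj₂ nonzero₂))) ⟨
          ℤ.∣ + suc c ℤ.* Solution.B₂ sol′ (proj₁ nonzero₂) (proj₁ (proj₂ nonzero₂)) ∣ ≡⟨ cong ℤ.∣_∣ (divideᵖ-* (suc c) B₂ d₂ _ _) ⟨
          size sol ∎
          where open ℕₚ.≤-Reasoning

    module _ {K₁ K₂} (sol : Solution K₁ K₂) (none : ∀ k → suc k ≡ K₂ → NoSolution K₁ k) (prim : Primitive sol) where
      open Solution sol

      B₁-isPoly : IsPoly B₁
      B₁-isPoly = K₁ , bounded₁

      B₂-isPoly : IsPoly B₂
      B₂-isPoly = K₂ , bounded₂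

      B₂≉𝟘 : ¬ B₂ ≈ 𝟘
      B₂≉𝟘 B₂≈𝟘 = proj₂ (proj₂ nonzero₂) (B₂≈𝟘 _ _)

      ⊗𝟘 : ∀ f {g} → g ≈ 𝟘 → f ⊗ g ≈ 𝟘
      ⊗𝟘 f g≈𝟘 i j = sumTo-zero i λ a _ → sumTo-zero j λ b _ → *≡0ʳ (f a b) (g≈𝟘 _ _)

      module CommonDivisor (D C₁ C₂ : Poly) (pD : IsPoly D) (p₁ : IsPoly C₁) (p₂ : IsPoly C₂)
        (e₁ : B₁ ≈ D ⊗ C₁) (e₂ : B₂ ≈ D ⊗ C₂) where

        cofactor-equation : ∀ {a b} → D a b ≢ + 0 → U ⊗ C₂ ≈ C₁ ⊗ V
        cofactor-equation Dab i j = ℤₚ.i-j≡0⇒i≡j _ _ (trans (solve 2 (λ a b → a :- b := con (+ 1) :* a :- con (+ 1) :* b) refl ((U ⊗ C₂) i j) ((C₁ ⊗ V) i j))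
          (⊗-cancel-zero pD (combᵖ-isPoly (+ 1) (+ 1) (⊗-isPoly pU p₂) (⊗-isPoly p₁ pV)) Dab difference i j))
          where
          products : D ⊗ (U ⊗ C₂) ≈ D ⊗ (C₁ ⊗ V)
          products = ≈-trans (≈-sym (⊗-assoc D U C₂)) (≈-trans (⊗-cong {g = C₂} (⊗-comm D U) ≈-refl) (≈-trans (⊗-assoc U D C₂)
            (≈-trans (⊗-cong {U} ≈-refl (≈-sym e₂)) (≈-trans equation (≈-trans (⊗-cong {g = V} e₁ ≈-refl) (⊗-assoc D C₁ V))))))
          difference : D ⊗ combᵖ (+ 1) (U ⊗ C₂) (+ 1) (C₁ ⊗ V) ≈ 𝟘
          difference i j = trans (⊗-combʳ D (+ 1) (U ⊗ C₂) (+ 1) (C₁ ⊗ V) i j)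
            (trans (cong (λ z → + 1 ℤ.* z ℤ.- + 1 ℤ.* (D ⊗ (C₁ ⊗ V)) i j) (products i j))
              (solve 1 (λ a → con (+ 1) :* a :- con (+ 1) :* a := con (+ 0)) refl ((D ⊗ (C₁ ⊗ V)) i j)))

        cofactor-bounded : ∀ {a b} → D a b ≢ + 0 → ∀ {K k B} C → IsPoly C → B ≈ D ⊗ C → Bounded K B → K ≤ (a ℕ.+ b) ℕ.+ k → Bounded k C
        cofactor-bounded {a} {b} Dab C pC e bounded K≤ i j le = degree-bound pD pC Dab (λ i j le → trans (sym (e i j)) (bounded i j le)) i j
          (ℕₚ.≤-trans K≤ (ℕₚ.+-monoʳ-≤ (a ℕ.+ b) le))

        -- A monomial of positive degree in D would make C₁/C₂ a solution with a smaller bound on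
        -- the denominator.
        D-constant : ∀ a b → 1 ≤ a ℕ.+ b → D a b ≡ + 0
        D-constant a b 1≤ab = stable λ Dab → by Dab K₂ refl
          where
          by : D a b ≢ + 0 → ∀ K → K ≡ K₂ → _
          by Dab zero refl = B₂≉𝟘 λ i j → bounded₂ i j z≤n
          by Dab (suc k) refl = B₂≉𝟘 (≈-trans e₂ (⊗𝟘 D (none k refl C₁ C₂
            (cofactor-bounded Dab C₁ p₁ e₁ bounded₁ (ℕₚ.m≤n+m K₁ (a ℕ.+ b)))
            (cofactor-bounded Dab C₂ p₂ e₂ bounded₂ (ℕₚ.+-monoˡ-≤ k 1≤ab))
            (cofactor-equation Dab))))

        D⊗ : ∀ C i j → (D ⊗ C) i j ≡ D 0 0 ℤ.* C i j
        D⊗ C i j = ⊗-single D C i j 0 0 z≤n z≤n off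
          where
          off : ∀ a b → a ≤ i → b ≤ j → ¬ (a ≡ 0 × b ≡ 0) → D a b ℤ.* C (i ∸ a) (j ∸ b) ≡ + 0
          off zero zero _ _ ≢ = contradiction (refl , refl) ≢
          off zero (suc b) _ _ _ = *≡0ˡ _ (D-constant 0 (suc b) (s≤s z≤n))
          off (suc a) b _ _ _ = *≡0ˡ _ (D-constant (suc a) b (s≤s z≤n))

        D-divides : ∀ {B C} → B ≈ D ⊗ C → Divides ℤ.∣ D 0 0 ∣ B
        D-divides {B} {C} e i j = subst (λ z → ℤ.∣ D 0 0 ∣ ∣ ℤ.∣ z ∣) (sym (trans (e i j) (D⊗ C i j)))
          (subst (ℤ.∣ D 0 0 ∣ ∣_) (sym (ℤₚ.abs-* (D 0 0) (C i j))) (m∣m*n ℤ.∣ C i j ∣))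

        D∣𝟙 : D ∣ᵖ 𝟙
        -- The constant D divides all coefficients of B₁ and B₂, so primitivity leaves 1 and -1, and
        -- D is its own inverse.
        D∣𝟙 = const (D 0 0) , const-isPoly (D 0 0) , λ i j → sym (trans (D⊗ (const (D 0 0)) i j) (by i j))
          where
          c*c : ∀ c → ℤ.∣ c ∣ ≢ 0 → ¬ 2 ≤ ℤ.∣ c ∣ → c ℤ.* c ≡ + 1
          c*c (+ zero) ≢0 _ = contradiction refl ≢0
          c*c (+ suc zero) _ _ = refl
          c*c (+ suc (suc n)) _ ≱2 = contradiction (s≤s (s≤s z≤n)) ≱2
          c*c ℤ.-[1+ zero ] _ _ = refl
          c*c ℤ.-[1+ suc n ] _ ≱2 = contradiction (s≤s (s≤s z≤n)) ≱2
          D₀₀≢0 : ℤ.∣ D 0 0 ∣ ≢ 0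
          D₀₀≢0 eq = B₂≉𝟘 (≈-trans e₂ (λ i j → trans (D⊗ C₂ i j) (*≡0ˡ (C₂ i j) (ℤₚ.∣i∣≡0⇒i≡0 {D 0 0} eq))))
          by : ∀ i j → D 0 0 ℤ.* const (D 0 0) i j ≡ 𝟙 i j
          by zero zero = c*c (D 0 0) D₀₀≢0 λ 2≤ → prim ℤ.∣ D 0 0 ∣ 2≤ (D-divides {C = C₁} e₁) (D-divides {C = C₂} e₂)
          by zero (suc j) = ℤₚ.*-zeroʳ (D 0 0)
          by (suc i) zero = ℤₚ.*-zeroʳ (D 0 0)
          by (suc i) (suc j) = ℤₚ.*-zeroʳ (D 0 0)

      coprime : Coprime B₁ B₂
      coprime D pD (C₁ , p₁ , e₁) (C₂ , p₂ , e₂) = CommonDivisor.D∣𝟙 D C₁ C₂ pD p₁ p₂ e₁ e₂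

    lowest-terms : (∃₂ λ i j → V i j ≢ + 0) → ∃₂ λ A₁ A₂ → IsPoly A₁ × IsPoly A₂ × ¬ A₂ ≈ 𝟘 × U ⊗ A₂ ≈ A₁ ⊗ V × Coprime A₁ A₂
    lowest-terms V≢𝟘 with minimal (proj₁ pU) (proj₁ pV) record
      { B₁ = U ; B₂ = V ; bounded₁ = proj₂ pU ; bounded₂ = proj₂ pV ; equation = ≈-refl ; nonzero₂ = V≢𝟘 }
    ... | K , sol , none with remove-content (size sol) sol ℕₚ.≤-refl
    ... | sol′ , prim = B₁ , B₂ , B₁-isPoly sol′ none prim , B₂-isPoly sol′ none prim , B₂≉𝟘 sol′ none prim , equation , coprime sol′ none prim
      where open Solution sol′

-- Values of the formal fractions in the ring of exact fractions.

module FractionValues where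
  open import Defs
  open PolynomialRing
  open import Data.Nat.Base as ℕ using (zero; suc)
  open import Data.Integer.Base as ℤ using (+_)
  open import Data.Product using (_,_; proj₁; proj₂)

  opaque
    A : CommutativeRing 0ℓ 0ℓ
    A = polyRing

  module 𝔸 = RingTools A

  opaque
    unfolding A

    ↓ : 𝔸.Carrier → Poly
    ↓ = proj₁

    ↓-isPoly : ∀ a → IsPoly (↓ a)
    ↓-isPoly = proj₂

    ↑ : (f : Poly) → IsPoly f → 𝔸.Carrier
    ↑ f p = f , p

    ↓↑ : ∀ f (p : IsPoly f) → ↓ (↑ f p) ≈ f
    ↓↑ f p = ≈-refl

    ↓-cong : ∀ {a b} → a 𝔸.≈ b → ↓ a ≈ ↓ b
    ↓-cong eq = eq

    ↓-inj : ∀ {a b} → ↓ a ≈ ↓ b → a 𝔸.≈ b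
    ↓-inj eq = eq

    ↓-+ : ∀ a b → ↓ (a 𝔸.+ b) ≈ ↓ a ⊕ ↓ b
    ↓-+ a b = ≈-refl

    ↓-- : ∀ a b → ↓ (a 𝔸.- b) ≈ ↓ a ⊖ ↓ b
    ↓-- a b = ≈-refl

    ↓-* : ∀ a b → ↓ (a 𝔸.* b) ≈ ↓ a ⊗ ↓ b
    ↓-* a b = ≈-refl

    ↓-neg : ∀ a → ↓ (𝔸.- a) ≈ neg (↓ a)
    ↓-neg a = ≈-refl

    ↓-0 : ↓ 𝔸.0# ≈ 𝟘
    ↓-0 = ≈-refl

    ↓-1 : ↓ 𝔸.1# ≈ 𝟙
    ↓-1 = ≈-refl

  xᴬ qᴬ : 𝔸.Carrier
  xᴬ = ↑ X X-isPoly
  qᴬ = ↑ Q Q-isPoly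

  ⊖-cong : ∀ {f f′ g g′} → f ≈ f′ → g ≈ g′ → f ⊖ g ≈ f′ ⊖ g′
  ⊖-cong p r i j = ≡.cong₂ ℤ._-_ (p i j) (r i j)

  infix 4 _↤_
  _↤_ : Poly → 𝔸.Carrier → Set
  f ↤ a = f ≈ ↓ a

  ↤-⊕ : ∀ {f g a b} → f ↤ a → g ↤ b → f ⊕ g ↤ a 𝔸.+ b
  ↤-⊕ {a = a} {b} p r = ≈-trans (⊕-cong p r) (≈-sym (↓-+ a b))

  ↤-⊖ : ∀ {f g a b} → f ↤ a → g ↤ b → f ⊖ g ↤ a 𝔸.- b
  ↤-⊖ {a = a} {b} p r = ≈-trans (⊖-cong p r) (≈-sym (↓-- a b))

  ↤-⊗ : ∀ {f g a b} → f ↤ a → g ↤ b → f ⊗ g ↤ a 𝔸.* b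
  ↤-⊗ {a = a} {b} p r = ≈-trans (⊗-cong p r) (≈-sym (↓-* a b))

  ↤-𝟘 : 𝟘 ↤ 𝔸.0#
  ↤-𝟘 = ≈-sym ↓-0

  ↤-𝟙 : 𝟙 ↤ 𝔸.1#
  ↤-𝟙 = ≈-sym ↓-1

  ↤-X : X ↤ xᴬ
  ↤-X = ≈-sym (↓↑ X X-isPoly)

  ↤-Q : Q ↤ qᴬ
  ↤-Q = ≈-sym (↓↑ Q Q-isPoly)

  ↤-^ : ∀ {f a} n → f ↤ a → f ^ᵖ n ↤ a 𝔸.^ n
  ↤-^ zero p = ↤-𝟙
  ↤-^ (suc n) p = ↤-⊗ p (↤-^ n p)

  ↤-≈ : ∀ {f a b} → f ↤ a → a 𝔸.≈ b → f ↤ b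
  ↤-≈ p eq = ≈-trans p (↓-cong eq)

  ↤-inj : ∀ {f g a b} → f ↤ a → g ↤ b → f ≈ g → a 𝔸.≈ b
  ↤-inj p r eq = ↓-inj (≈-trans (≈-sym p) (≈-trans eq r))

  ↤-qint : ∀ n → qint n ↤ 𝔸.∑ n (qᴬ 𝔸.^_)
  ↤-qint zero = ↤-𝟘
  ↤-qint (suc n) = ↤-⊕ (↤-qint n) (↤-^ n ↤-Q)

  ↤-sgn : ∀ n → sgn n ↤ (𝔸.- 𝔸.1#) 𝔸.^ n
  ↤-sgn n = ↤-^ n (≈-sym (≈-trans (↓-neg 𝔸.1#) neg𝟙))
    where
    neg𝟙 : neg (↓ 𝔸.1#) ≈ const (ℤ.- + 1)
    neg𝟙 zero zero = ≡.cong ℤ.-_ (↓-1 0 0)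
    neg𝟙 zero (suc j) = ≡.cong ℤ.-_ (↓-1 0 (suc j))
    neg𝟙 (suc i) zero = ≡.cong ℤ.-_ (↓-1 (suc i) 0)
    neg𝟙 (suc i) (suc j) = ≡.cong ℤ.-_ (↓-1 (suc i) (suc j))

  module E = Fractions A (zeroIdeal A)
  module 𝔼 = E.F

  ιᴱ : RingHom A E.fractionRing
  ιᴱ = record { ⟦_⟧ = E.ιᶠ ; +-homo = E.ι-+ ; *-homo = E.ι-* ; neg-homo = E.ι-neg ; 0-homo = E.ι-0 ; 1-homo = E.ι-1 }

  open 𝔸 using (solve; _:=_; _:+_; _:*_; _:-_; :-_)

  regular-cancel : ∀ {b f g} → E.Regular b → b 𝔸.* f 𝔸.≈ b 𝔸.* g → f 𝔸.≈ g
  regular-cancel {b} {f} {g} r eq = 𝔸.trans (solve 2 (λ f g → f := (f :- g) :+ g) 𝔸.refl f g)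
    (𝔸.trans (𝔸.+-congʳ (r (f 𝔸.- g) (𝔸.trans (solve 3 (λ b f g → b :* (f :- g) := b :* f :- b :* g) 𝔸.refl b f g)
      (𝔸.trans (𝔸.+-congʳ eq) (𝔸.-‿inverseʳ _))))) (𝔸.+-identityˡ g))

  regular⇒admissible : ∀ {b} → E.Regular b → E.Admissible b
  regular⇒admissible r = r , r

  cross₀ : ∀ {e e′} → e 𝔼.≈ e′ → E.numer e 𝔸.* E.denom e′ 𝔸.≈ E.numer e′ 𝔸.* E.denom e
  cross₀ {e} {e′} eq = 𝔸.trans (solve 2 (λ a b → a := (a :- b) :+ b) 𝔸.refl _ _) (𝔸.trans (𝔸.+-congʳ (E.≈⇒cross eq)) (𝔸.+-identityˡ _))

  -- An `RF` is a bare pair of coefficient functions. This supplies what it does not carry: both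
  -- parts are polynomials, the denominator is regular, and the quotient has value `e`, expressed by
  -- cross-multiplication.
  record Represents (r : RF) (e : 𝔼.Carrier) : Set where
    constructor represents
    field
      top bot : 𝔸.Carrier
      top↤ : proj₁ r ↤ top
      bot↤ : proj₂ r ↤ bot
      bot-regular : E.Regular bot
      value : top 𝔸.* E.denom e 𝔸.≈ E.numer e 𝔸.* bot

  rep-≈ : ∀ {r e e′} → Represents r e → e 𝔼.≈ e′ → Represents r e′
  rep-≈ {r} {e} {e′} (represents u v pu pv rv eq) e≈ = represents u v pu pv rv (regular-cancel (proj₁ (E.denom-admissible e)) (begin
    d 𝔸.* (u 𝔸.* d′) ≈⟨ solve 3 (λ d u d′ → d :* (u :* d′) := (u :* d) :* d′) 𝔸.refl d u d′ ⟩
    (u 𝔸.* d) 𝔸.* d′ ≈⟨ 𝔸.*-congʳ eq ⟩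
    (E.numer e 𝔸.* v) 𝔸.* d′ ≈⟨ solve 3 (λ n v d′ → (n :* v) :* d′ := (n :* d′) :* v) 𝔸.refl _ v d′ ⟩
    (E.numer e 𝔸.* d′) 𝔸.* v ≈⟨ 𝔸.*-congʳ (cross₀ e≈) ⟩
    (E.numer e′ 𝔸.* d) 𝔸.* v ≈⟨ solve 3 (λ n d v → (n :* d) :* v := d :* (n :* v)) 𝔸.refl _ d v ⟩
    d 𝔸.* (E.numer e′ 𝔸.* v) ∎))
    where
    open import Relation.Binary.Reasoning.Setoid 𝔸.setoid
    d = E.denom e
    d′ = E.denom e′

  rep-poly : ∀ {f a} → f ↤ a → Represents (poly f) (E.ιᶠ a)
  rep-poly {f} {a} p = represents a 𝔸.1# p ↤-𝟙 (proj₁ E.admissible-1)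
    (𝔸.*-cong (𝔸.sym (E.numer-ι a)) (E.denom-ι a))

  rep-+ : ∀ {r t e f} → Represents r e → Represents t f → Represents (r +ʳ t) (e 𝔼.+ f)
  rep-+ {e = e} {f} (represents a b pa pb rb eq) (represents c d pc pd rd eq′) =
    represents (a 𝔸.* d 𝔸.+ c 𝔸.* b) (b 𝔸.* d) (↤-⊕ (↤-⊗ pa pd) (↤-⊗ pc pb)) (↤-⊗ pb pd) (E.regular-* rb rd) (begin
      (a 𝔸.* d 𝔸.+ c 𝔸.* b) 𝔸.* E.denom (e 𝔼.+ f) ≈⟨ 𝔸.*-congˡ (E.denom-+ e f) ⟩
      (a 𝔸.* d 𝔸.+ c 𝔸.* b) 𝔸.* (de 𝔸.* df) ≈⟨ solve 6 (λ a b c d x y → (a :* d :+ c :* b) :* (x :* y) := (a :* x) :* (d :* y) :+ (c :* y) :* (b :* x)) 𝔸.refl a b c d de df ⟩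
      (a 𝔸.* de) 𝔸.* (d 𝔸.* df) 𝔸.+ (c 𝔸.* df) 𝔸.* (b 𝔸.* de) ≈⟨ 𝔸.+-cong (𝔸.*-congʳ eq) (𝔸.*-congʳ eq′) ⟩
      (ne 𝔸.* b) 𝔸.* (d 𝔸.* df) 𝔸.+ (nf 𝔸.* d) 𝔸.* (b 𝔸.* de) ≈⟨ solve 6 (λ b d x y n m → (n :* b) :* (d :* y) :+ (m :* d) :* (b :* x) := (n :* y :+ m :* x) :* (b :* d)) 𝔸.refl b d de df ne nf ⟩
      (ne 𝔸.* df 𝔸.+ nf 𝔸.* de) 𝔸.* (b 𝔸.* d) ≈⟨ 𝔸.*-congʳ (E.numer-+ e f) ⟨
      E.numer (e 𝔼.+ f) 𝔸.* (b 𝔸.* d) ∎)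
    where
    open import Relation.Binary.Reasoning.Setoid 𝔸.setoid
    de = E.denom e
    df = E.denom f
    ne = E.numer e
    nf = E.numer f

  rep-- : ∀ {r t e f} → Represents r e → Represents t f → Represents (r -ʳ t) (e 𝔼.- f)
  rep-- {e = e} {f} (represents a b pa pb rb eq) (represents c d pc pd rd eq′) =
    represents (a 𝔸.* d 𝔸.- c 𝔸.* b) (b 𝔸.* d) (↤-⊖ (↤-⊗ pa pd) (↤-⊗ pc pb)) (↤-⊗ pb pd) (E.regular-* rb rd) (begin
      (a 𝔸.* d 𝔸.- c 𝔸.* b) 𝔸.* E.denom (e 𝔼.- f) ≈⟨ 𝔸.*-congˡ (𝔸.trans (E.denom-+ e (𝔼.- f)) (𝔸.*-congˡ (E.denom-neg f))) ⟩
      (a 𝔸.* d 𝔸.- c 𝔸.* b) 𝔸.* (de 𝔸.* df) ≈⟨ solve 6 (λ a b c d x y → (a :* d :- c :* b) :* (x :* y) := (a :* x) :* (d :* y) :- (c :* y) :* (b :* x)) 𝔸.refl a b c d de df ⟩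
      (a 𝔸.* de) 𝔸.* (d 𝔸.* df) 𝔸.- (c 𝔸.* df) 𝔸.* (b 𝔸.* de) ≈⟨ 𝔸.+-cong (𝔸.*-congʳ eq) (𝔸.-‿cong (𝔸.*-congʳ eq′)) ⟩
      (ne 𝔸.* b) 𝔸.* (d 𝔸.* df) 𝔸.- (nf 𝔸.* d) 𝔸.* (b 𝔸.* de) ≈⟨ solve 6 (λ b d x y n m → (n :* b) :* (d :* y) :- (m :* d) :* (b :* x) := (n :* y :+ (:- m) :* x) :* (b :* d)) 𝔸.refl b d de df ne nf ⟩
      (ne 𝔸.* df 𝔸.+ (𝔸.- nf) 𝔸.* de) 𝔸.* (b 𝔸.* d)
        ≈⟨ 𝔸.*-congʳ (𝔸.trans (E.numer-+ e (𝔼.- f)) (𝔸.+-cong (𝔸.*-congˡ (E.denom-neg f)) (𝔸.*-congʳ (E.numer-neg f)))) ⟨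
      E.numer (e 𝔼.- f) 𝔸.* (b 𝔸.* d) ∎)
    where
    open import Relation.Binary.Reasoning.Setoid 𝔸.setoid
    de = E.denom e
    df = E.denom f
    ne = E.numer e
    nf = E.numer f

  rep-* : ∀ {r t e f} → Represents r e → Represents t f → Represents (r *ʳ t) (e 𝔼.* f)
  rep-* {e = e} {f} (represents a b pa pb rb eq) (represents c d pc pd rd eq′) =
    represents (a 𝔸.* c) (b 𝔸.* d) (↤-⊗ pa pc) (↤-⊗ pb pd) (E.regular-* rb rd) (begin
      (a 𝔸.* c) 𝔸.* E.denom (e 𝔼.* f) ≈⟨ 𝔸.*-congˡ (E.denom-* e f) ⟩
      (a 𝔸.* c) 𝔸.* (E.denom e 𝔸.* E.denom f) ≈⟨ solve 4 (λ a c x y → (a :* c) :* (x :* y) := (a :* x) :* (c :* y)) 𝔸.refl a c _ _ ⟩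
      (a 𝔸.* E.denom e) 𝔸.* (c 𝔸.* E.denom f) ≈⟨ 𝔸.*-cong eq eq′ ⟩
      (E.numer e 𝔸.* b) 𝔸.* (E.numer f 𝔸.* d) ≈⟨ solve 4 (λ n b m d → (n :* b) :* (m :* d) := (n :* m) :* (b :* d)) 𝔸.refl _ b _ d ⟩
      (E.numer e 𝔸.* E.numer f) 𝔸.* (b 𝔸.* d) ≈⟨ 𝔸.*-congʳ (E.numer-* e f) ⟨
      E.numer (e 𝔼.* f) 𝔸.* (b 𝔸.* d) ∎)
    where open import Relation.Binary.Reasoning.Setoid 𝔸.setoid

  regular-cong : ∀ {a b} → a 𝔸.≈ b → E.Regular a → E.Regular b
  regular-cong eq r f p = r f (𝔸.trans (𝔸.*-congʳ eq) p)

  regular-factorˡ : ∀ {a b} → E.Regular (a 𝔸.* b) → E.Regular a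
  regular-factorˡ {a} {b} r f p = r f (𝔸.trans (solve 3 (λ a b f → (a :* b) :* f := b :* (a :* f)) 𝔸.refl a b f) (𝔸.trans (𝔸.*-congˡ p) (𝔸.zeroʳ b)))

  -- From e·e⁻¹ = 1 the product of the two numerators equals the product of the two denominators,
  -- which is regular; a factor of a regular element is regular.
  unit⇒regular-numer : ∀ {e} → 𝔼.Unit e → E.Regular (E.numer e)
  unit⇒regular-numer {e} (e⁻¹ , inv) = regular-factorˡ {b = E.numer e⁻¹} (regular-cong (begin
    E.denom e 𝔸.* E.denom e⁻¹ ≈⟨ E.denom-* e e⁻¹ ⟨
    E.denom (e 𝔼.* e⁻¹) ≈⟨ 𝔸.*-identityˡ _ ⟨
    𝔸.1# 𝔸.* E.denom (e 𝔼.* e⁻¹) ≈⟨ 𝔸.*-congʳ (E.numer-ι 𝔸.1#) ⟨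
    E.numer (E.ιᶠ 𝔸.1#) 𝔸.* E.denom (e 𝔼.* e⁻¹) ≈⟨ cross₀ (𝔼.trans inv (𝔼.sym E.ι-1)) ⟨
    E.numer (e 𝔼.* e⁻¹) 𝔸.* E.denom (E.ιᶠ 𝔸.1#) ≈⟨ 𝔸.*-cong (E.numer-* e e⁻¹) (E.denom-ι 𝔸.1#) ⟩
    E.numer e 𝔸.* E.numer e⁻¹ 𝔸.* 𝔸.1# ≈⟨ 𝔸.*-identityʳ _ ⟩
    E.numer e 𝔸.* E.numer e⁻¹ ∎) (E.regular-* (proj₁ (E.denom-admissible e)) (proj₁ (E.denom-admissible e⁻¹))))
    where open import Relation.Binary.Reasoning.Setoid 𝔸.setoid

  rep-invert : ∀ {r e} → Represents r e → ((e⁻¹ , _) : 𝔼.Unit e) → Represents (proj₂ r , proj₁ r) e⁻¹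
  rep-invert {e = e} (represents a b pa pb rb eq) u@(e⁻¹ , inv) = represents b a pb pa
    (regular-factorˡ {b = E.denom e} (regular-cong (𝔸.sym eq) (E.regular-* (unit⇒regular-numer u) rb)))
    (regular-cancel (E.regular-* (unit⇒regular-numer u) (proj₁ (E.denom-admissible e))) (begin
      (ne 𝔸.* de) 𝔸.* (b 𝔸.* di) ≈⟨ solve 4 (λ n d b x → (n :* d) :* (b :* x) := (n :* b) :* (d :* x)) 𝔸.refl ne de b di ⟩
      (ne 𝔸.* b) 𝔸.* (de 𝔸.* di) ≈⟨ 𝔸.*-cong (𝔸.sym eq) (𝔸.sym inv′) ⟩
      (a 𝔸.* de) 𝔸.* (ne 𝔸.* ni) ≈⟨ solve 4 (λ a d n x → (a :* d) :* (n :* x) := (n :* d) :* (x :* a)) 𝔸.refl a de ne ni ⟩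
      (ne 𝔸.* de) 𝔸.* (ni 𝔸.* a) ∎))
    where
    open import Relation.Binary.Reasoning.Setoid 𝔸.setoid
    de = E.denom e
    di = E.denom e⁻¹
    ne = E.numer e
    ni = E.numer e⁻¹
    inv′ : ne 𝔸.* ni 𝔸.≈ de 𝔸.* di
    inv′ = begin
      ne 𝔸.* ni ≈⟨ 𝔸.*-identityʳ _ ⟨
      ne 𝔸.* ni 𝔸.* 𝔸.1# ≈⟨ 𝔸.*-cong (E.numer-* e e⁻¹) (E.denom-ι 𝔸.1#) ⟨
      E.numer (e 𝔼.* e⁻¹) 𝔸.* E.denom (E.ιᶠ 𝔸.1#) ≈⟨ cross₀ (𝔼.trans inv (𝔼.sym E.ι-1)) ⟩
      E.numer (E.ιᶠ 𝔸.1#) 𝔸.* E.denom (e 𝔼.* e⁻¹) ≈⟨ 𝔸.*-cong (E.numer-ι 𝔸.1#) (E.denom-* e e⁻¹) ⟩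
      𝔸.1# 𝔸.* (de 𝔸.* di) ≈⟨ 𝔸.*-identityˡ _ ⟩
      de 𝔸.* di ∎

  rep-/ : ∀ {r t e f} → Represents r e → Represents t f → ((f⁻¹ , _) : 𝔼.Unit f) → Represents (r /ʳ t) (e 𝔼.* f⁻¹)
  rep-/ p r u = rep-* p (rep-invert r u)

-- Regular elements of ℤ[x,q], and cancellation modulo 1 - q^j.

module Regularity where
  open import Defs
  open PolynomialRing
  open FractionValues
  open LeadingMonomials
  open import Data.Bool.Base using (Bool; T; true; false; if_then_else_)
  open import Data.Nat.Base as ℕ using (ℕ; zero; suc; _≤_; _<_; _<ᵇ_; s≤s; NonZero)
  open import Data.Integer.Base as ℤ using (ℤ; +_)
  import Data.Integer.Properties as ℤₚ
  open import Data.Product using (∃; _,_; proj₁; proj₂)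
  open import Relation.Nullary using (¬_)
  open import Relation.Binary.Reasoning.Setoid 𝔸.setoid
  open 𝔸 hiding (_≉_; _≈_)
  open E using (Regular)

  regular-coefficient : ∀ b {i j} → ↓ b i j ≡.≢ + 0 → Regular b
  regular-coefficient b {i} {j} bij f bf = ↓-inj (≈-trans
    (⊗-cancel-zero (↓-isPoly b) (↓-isPoly f) bij (≈-trans (≈-sym (↓-* b f)) (≈-trans (↓-cong bf) ↓-0))) (≈-sym ↓-0))

  q*≈ : ∀ a → ↓ (qᴬ 𝔸.* a) ≈ Q ⊗ ↓ a
  q*≈ a = ≈-sym (↤-⊗ ↤-Q ≈-refl)

  x*≈ : ∀ a → ↓ (xᴬ 𝔸.* a) ≈ X ⊗ ↓ a
  x*≈ a = ≈-sym (↤-⊗ ↤-X ≈-refl)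

  q*-suc : ∀ a i j → ↓ (qᴬ 𝔸.* a) i (suc j) ≡.≡ ↓ a i j
  q*-suc a i j = ≡.trans (q*≈ a i (suc j)) (Q⊗-suc (↓ a) i j)

  q*-zero : ∀ a i → ↓ (qᴬ 𝔸.* a) i 0 ≡.≡ + 0
  q*-zero a i = ≡.trans (q*≈ a i 0) (Q⊗-zero (↓ a) i)

  x*-suc : ∀ a i j → ↓ (xᴬ 𝔸.* a) (suc i) j ≡.≡ ↓ a i j
  x*-suc a i j = ≡.trans (x*≈ a (suc i) j) (X⊗-suc (↓ a) i j)

  x*-zero : ∀ a j → ↓ (xᴬ 𝔸.* a) 0 j ≡.≡ + 0
  x*-zero a j = ≡.trans (x*≈ a 0 j) (X⊗-zero (↓ a) j)

  sub-coefficient : ∀ a b i j {m n} → ↓ a i j ≡.≡ m → ↓ b i j ≡.≡ n → ↓ (a 𝔸.- b) i j ≡.≡ m ℤ.- n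
  sub-coefficient a b i j p r = ≡.trans (↓-- a b i j) (≡.cong₂ ℤ._-_ p r)

  nonzero : ∀ {i : ℤ} → i ≡.≡ + 1 → i ≡.≢ + 0
  nonzero ≡.refl ()

  regular-1-q^ : ∀ j → Regular (1# 𝔸.- qᴬ ^ suc j)
  regular-1-q^ j = regular-coefficient _ (nonzero (sub-coefficient 1# (qᴬ ^ suc j) 0 0 (↓-1 0 0) (q*-zero (qᴬ ^ j) 0)))

  regular-1-xq^ : ∀ b → Regular (1# 𝔸.- xᴬ 𝔸.* b)
  regular-1-xq^ b = regular-coefficient _ (nonzero (sub-coefficient 1# (xᴬ 𝔸.* b) 0 0 (↓-1 0 0) (x*-zero b 0)))

  regular-x-q^ : ∀ j → Regular (xᴬ 𝔸.- qᴬ ^ j)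
  regular-x-q^ j = regular-coefficient _ (nonzero (sub-coefficient xᴬ (qᴬ ^ j) 1 0 (↓↑ X X-isPoly 1 0) (q^j j)))
    where
    q^j : ∀ j → ↓ (qᴬ ^ j) 1 0 ≡.≡ + 0
    q^j zero = ↓-1 1 0
    q^j (suc j) = q*-zero (qᴬ ^ j) 1

  regular-x : Regular xᴬ
  regular-x = regular-coefficient xᴬ {1} {0} (nonzero (↓↑ X X-isPoly 1 0))

  regular-q : Regular qᴬ
  regular-q = regular-coefficient qᴬ {0} {1} (nonzero (↓↑ Q Q-isPoly 0 1))

  natural : ℕ → Carrier
  natural c = ∑ c (λ _ → 1#)

  natural-coefficient : ∀ c → ↓ (natural c) 0 0 ≡.≡ + c
  natural-coefficient zero = ↓-0 0 0
  natural-coefficient (suc c) = ≡.trans (↓-+ (natural c) 1# 0 0) (≡.trans (≡.cong₂ ℤ._+_ (natural-coefficient c) (↓-1 0 0)) (≡.cong +_ (ℕₚ.+-comm c 1)))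

  regular-natural : ∀ c → Regular (natural (suc c))
  regular-natural c = regular-coefficient _ {0} {0} (λ eq → case (≡.trans (≡.sym (natural-coefficient (suc c))) eq))
    where
    case : ¬ (+ suc c ≡.≡ + 0)
    case ()

  -- Keeping only the monomials selected by χ is additive and commutes with integers, and for
  -- `xBelow` also with multiplication by q. It replaces division algorithms in the cancellation
  -- lemmas below.
  truncateᵖ : (ℕ → ℕ → Bool) → Poly → Poly
  truncateᵖ χ f i j = if χ i j then f i j else + 0

  truncateᵖ-isPoly : ∀ χ {f} → IsPoly f → IsPoly (truncateᵖ χ f)
  truncateᵖ-isPoly χ (D , f0) = D , λ i j le → by i j (f0 i j le)
    where
    by : ∀ i j {z} → z ≡.≡ + 0 → (if χ i j then z else + 0) ≡.≡ + 0
    by i j ≡.refl with χ i j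
    ... | true = ≡.refl
    ... | false = ≡.refl

  truncate : (ℕ → ℕ → Bool) → Carrier → Carrier
  truncate χ a = ↑ (truncateᵖ χ (↓ a)) (truncateᵖ-isPoly χ (↓-isPoly a))

  truncate-coefficient : ∀ χ a i j → ↓ (truncate χ a) i j ≡.≡ (if χ i j then ↓ a i j else + 0)
  truncate-coefficient χ a = ↓↑ _ _

  truncate-cong : ∀ χ {a b} → a 𝔸.≈ b → truncate χ a 𝔸.≈ truncate χ b
  truncate-cong χ {a} {b} eq = ↓-inj λ i j → ≡.trans (truncate-coefficient χ a i j)
    (≡.trans (≡.cong (if χ i j then_else + 0) (↓-cong eq i j)) (≡.sym (truncate-coefficient χ b i j)))

  truncate-+ : ∀ χ a b → truncate χ (a 𝔸.+ b) 𝔸.≈ truncate χ a 𝔸.+ truncate χ b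
  truncate-+ χ a b = ↓-inj λ i j → ≡.trans (truncate-coefficient χ (a 𝔸.+ b) i j) (≡.trans (by i j)
    (≡.sym (≡.trans (↓-+ (truncate χ a) (truncate χ b) i j) (≡.cong₂ ℤ._+_ (truncate-coefficient χ a i j) (truncate-coefficient χ b i j)))))
    where
    by : ∀ i j → (if χ i j then ↓ (a 𝔸.+ b) i j else + 0) ≡.≡ (if χ i j then ↓ a i j else + 0) ℤ.+ (if χ i j then ↓ b i j else + 0)
    by i j with χ i j
    ... | true = ↓-+ a b i j
    ... | false = ≡.refl

  truncate-- : ∀ χ a b → truncate χ (a 𝔸.- b) 𝔸.≈ truncate χ a 𝔸.- truncate χ b
  truncate-- χ a b = begin
    truncate χ (a 𝔸.- b) ≈⟨ solve 2 (λ u v → u := (u :+ v) :- v) 𝔸.refl _ (truncate χ b) ⟩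
    truncate χ (a 𝔸.- b) 𝔸.+ truncate χ b 𝔸.- truncate χ b ≈⟨ +-congʳ (truncate-+ χ (a 𝔸.- b) b) ⟨
    truncate χ (a 𝔸.- b 𝔸.+ b) 𝔸.- truncate χ b ≈⟨ +-congʳ (truncate-cong χ (solve 2 (λ a b → a :- b :+ b := a) 𝔸.refl a b)) ⟩
    truncate χ a 𝔸.- truncate χ b ∎

  truncate-split : ∀ χ a b → (∀ i j → χ i j ≡.≡ false → ↓ a i j ≡.≡ + 0) → (∀ i j → χ i j ≡.≡ true → ↓ b i j ≡.≡ + 0) →
    truncate χ (a 𝔸.- b) 𝔸.≈ a
  truncate-split χ a b a0 b0 = ↓-inj λ i j → ≡.trans (truncate-coefficient χ (a 𝔸.- b) i j) (by i j)
    where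
    by : ∀ i j → (if χ i j then ↓ (a 𝔸.- b) i j else + 0) ≡.≡ ↓ a i j
    by i j with χ i j in eq
    ... | true = ≡.trans (sub-coefficient a b i j ≡.refl (b0 i j eq)) (ℤₚ.+-identityʳ _)
    ... | false = ≡.sym (a0 i j eq)

  xBelow qBelow : ℕ → ℕ → ℕ → Bool
  xBelow K i j = i <ᵇ K
  qBelow K i j = j <ᵇ K

  <ᵇ-true : ∀ m n → (m <ᵇ n) ≡.≡ true → m < n
  <ᵇ-true m n eq = ℕₚ.<ᵇ⇒< m n (≡.subst T (≡.sym eq) _)

  <ᵇ-false : ∀ m n → (m <ᵇ n) ≡.≡ false → n ≤ m
  <ᵇ-false m n eq = ℕₚ.≮⇒≥ λ m<n → ≡.subst T eq (ℕₚ.<⇒<ᵇ m<n)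

  x^*-low : ∀ K a i j → i < K → ↓ (xᴬ ^ K 𝔸.* a) i j ≡.≡ + 0
  x^*-low (suc K) a i j i<K = ≡.trans (↓-cong (*-assoc xᴬ (xᴬ ^ K) a) i j) (by i i<K)
    where
    by : ∀ i → i < suc K → ↓ (xᴬ 𝔸.* (xᴬ ^ K 𝔸.* a)) i j ≡.≡ + 0
    by zero _ = x*-zero _ j
    by (suc i) (s≤s i<K) = ≡.trans (x*-suc (xᴬ ^ K 𝔸.* a) i j) (x^*-low K a i j i<K)

  q^*-low : ∀ K a i j → j < K → ↓ (qᴬ ^ K 𝔸.* a) i j ≡.≡ + 0
  q^*-low (suc K) a i j j<K = ≡.trans (↓-cong (*-assoc qᴬ (qᴬ ^ K) a) i j) (by j j<K)
    where
    by : ∀ j → j < suc K → ↓ (qᴬ 𝔸.* (qᴬ ^ K 𝔸.* a)) i j ≡.≡ + 0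
    by zero _ = q*-zero _ i
    by (suc j) (s≤s j<K) = ≡.trans (q*-suc (qᴬ ^ K 𝔸.* a) i j) (q^*-low K a i j j<K)

  truncate-q* : ∀ K a → truncate (xBelow K) (qᴬ 𝔸.* a) 𝔸.≈ qᴬ 𝔸.* truncate (xBelow K) a
  truncate-q* K a = ↓-inj λ i j → ≡.trans (truncate-coefficient (xBelow K) (qᴬ 𝔸.* a) i j) (by i j)
    where
    by : ∀ i j → (if i <ᵇ K then ↓ (qᴬ 𝔸.* a) i j else + 0) ≡.≡ ↓ (qᴬ 𝔸.* truncate (xBelow K) a) i j
    by i zero with i <ᵇ K
    ... | true = ≡.trans (q*-zero a i) (≡.sym (q*-zero (truncate (xBelow K) a) i))
    ... | false = ≡.sym (q*-zero (truncate (xBelow K) a) i)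
    by i (suc j) = ≡.trans (≡.cong (if i <ᵇ K then_else + 0) (q*-suc a i j))
      (≡.sym (≡.trans (q*-suc (truncate (xBelow K) a) i j) (truncate-coefficient (xBelow K) a i j)))

  truncate-q^* : ∀ K m a → truncate (xBelow K) (qᴬ ^ m 𝔸.* a) 𝔸.≈ qᴬ ^ m 𝔸.* truncate (xBelow K) a
  truncate-q^* K zero a = 𝔸.trans (truncate-cong (xBelow K) (*-identityˡ a)) (𝔸.sym (*-identityˡ _))
  truncate-q^* K (suc m) a = begin
    truncate (xBelow K) (qᴬ 𝔸.* qᴬ ^ m 𝔸.* a) ≈⟨ truncate-cong (xBelow K) (*-assoc _ _ a) ⟩
    truncate (xBelow K) (qᴬ 𝔸.* (qᴬ ^ m 𝔸.* a)) ≈⟨ truncate-q* K _ ⟩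
    qᴬ 𝔸.* truncate (xBelow K) (qᴬ ^ m 𝔸.* a) ≈⟨ *-congˡ (truncate-q^* K m a) ⟩
    qᴬ 𝔸.* (qᴬ ^ m 𝔸.* truncate (xBelow K) a) ≈⟨ *-assoc _ _ _ ⟨
    qᴬ 𝔸.* qᴬ ^ m 𝔸.* truncate (xBelow K) a ∎

  truncate-natural* : ∀ χ c a → truncate χ (natural c 𝔸.* a) 𝔸.≈ natural c 𝔸.* truncate χ a
  truncate-natural* χ zero a = begin
    truncate χ (0# 𝔸.* a) ≈⟨ truncate-cong χ (solve 1 (λ a → con (+ 0) :* a := a :- a) 𝔸.refl a) ⟩
    truncate χ (a 𝔸.- a) ≈⟨ truncate-- χ a a ⟩
    truncate χ a 𝔸.- truncate χ a ≈⟨ solve 1 (λ a → a :- a := con (+ 0) :* a) 𝔸.refl _ ⟩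
    0# 𝔸.* truncate χ a ∎
  truncate-natural* χ (suc c) a = begin
    truncate χ ((natural c 𝔸.+ 1#) 𝔸.* a) ≈⟨ truncate-cong χ (solve 2 (λ c a → (c :+ con (+ 1)) :* a := c :* a :+ a) 𝔸.refl _ a) ⟩
    truncate χ (natural c 𝔸.* a 𝔸.+ a) ≈⟨ truncate-+ χ _ a ⟩
    truncate χ (natural c 𝔸.* a) 𝔸.+ truncate χ a ≈⟨ +-congʳ (truncate-natural* χ c a) ⟩
    natural c 𝔸.* truncate χ a 𝔸.+ truncate χ a ≈⟨ solve 2 (λ c a → (c :+ con (+ 1)) :* a := c :* a :+ a) 𝔸.refl _ _ ⟨
    (natural c 𝔸.+ 1#) 𝔸.* truncate χ a ∎

  infix 4 _∣ᴬ_
  _∣ᴬ_ : Carrier → Carrier → Set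
  u ∣ᴬ f = ∃ λ g → f 𝔸.≈ u 𝔸.* g

  ∣ᴬ-cong : ∀ {u f g} → f 𝔸.≈ g → u ∣ᴬ f → u ∣ᴬ g
  ∣ᴬ-cong eq (h , p) = h , 𝔸.trans (𝔸.sym eq) p

  ∣ᴬ-+ : ∀ {u f g} → u ∣ᴬ f → u ∣ᴬ g → u ∣ᴬ f 𝔸.+ g
  ∣ᴬ-+ (h , p) (k , r) = h 𝔸.+ k , 𝔸.trans (+-cong p r) (𝔸.sym (distribˡ _ _ _))

  ∣ᴬ-* : ∀ c {u f} → u ∣ᴬ f → u ∣ᴬ c 𝔸.* f
  ∣ᴬ-* c {u} (h , p) = c 𝔸.* h , 𝔸.trans (*-congˡ p) (solve 3 (λ c u h → c :* (u :* h) := u :* (c :* h)) 𝔸.refl c u h)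

  ∣ᴬ-refl-* : ∀ u c → u ∣ᴬ u 𝔸.* c
  ∣ᴬ-refl-* u c = c , 𝔸.refl

  a-b∣a^n-b^n : ∀ a b n → (a 𝔸.- b) ∣ᴬ (a ^ n 𝔸.- b ^ n)
  a-b∣a^n-b^n a b zero = 0# , solve 2 (λ a b → con (+ 1) :- con (+ 1) := (a :- b) :* con (+ 0)) 𝔸.refl a b
  a-b∣a^n-b^n a b (suc n) = ∣ᴬ-cong (solve 4 (λ a b A B → a :* (A :- B) :+ B :* (a :- b) := a :* A :- b :* B) 𝔸.refl a b (a ^ n) (b ^ n))
    (∣ᴬ-+ (∣ᴬ-* a (a-b∣a^n-b^n a b n)) (∣ᴬ-* (b ^ n) (1# , 𝔸.sym (*-identityʳ _))))

  1-a∣1-a^n : ∀ a n → (1# 𝔸.- a) ∣ᴬ (1# 𝔸.- a ^ n)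
  1-a∣1-a^n a n = ∣ᴬ-cong (+-congʳ (1^n n)) (a-b∣a^n-b^n 1# a n)

  -- As K exceeds the degree of f in x, dropping the monomials with x-exponent at least K from f -
  -- x^K f recovers f. Applied to (1 - q^j) g, the truncation acts on g alone.
  x-period : ∀ j K f → (∀ i k → K ≤ i → ↓ f i k ≡.≡ + 0) → (1# 𝔸.- qᴬ ^ j) ∣ᴬ (f 𝔸.- xᴬ ^ K 𝔸.* f) → (1# 𝔸.- qᴬ ^ j) ∣ᴬ f
  x-period j K f f0 (g , eq) = truncate χ g , 𝔸.sym (begin
    (1# 𝔸.- qᴬ ^ j) 𝔸.* truncate χ g ≈⟨ solve 2 (λ u g → (con (+ 1) :- u) :* g := g :- u :* g) 𝔸.refl _ _ ⟩
    truncate χ g 𝔸.- qᴬ ^ j 𝔸.* truncate χ g ≈⟨ +-congˡ (-‿cong (truncate-q^* K j g)) ⟨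
    truncate χ g 𝔸.- truncate χ (qᴬ ^ j 𝔸.* g) ≈⟨ truncate-- χ g _ ⟨
    truncate χ (g 𝔸.- qᴬ ^ j 𝔸.* g) ≈⟨ truncate-cong χ (solve 2 (λ u g → (con (+ 1) :- u) :* g := g :- u :* g) 𝔸.refl _ g) ⟨
    truncate χ ((1# 𝔸.- qᴬ ^ j) 𝔸.* g) ≈⟨ truncate-cong χ eq ⟨
    truncate χ (f 𝔸.- xᴬ ^ K 𝔸.* f) ≈⟨ truncate-split χ f _ (λ i k e → f0 i k (<ᵇ-false i K e)) (λ i k e → x^*-low K f i k (<ᵇ-true i K e)) ⟩
    f ∎)
    where χ = xBelow K

  -- If L divides 1 - x^(jK) modulo 1 - q^j for every K, then L f ≡ 0 gives f ≡ x^(jK) f, and a K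
  -- beyond the degree of f finishes the proof.
  period-cancel : ∀ j L f → .{{NonZero j}} → (∀ K → ∃ λ r → (1# 𝔸.- qᴬ ^ j) ∣ᴬ (1# 𝔸.- xᴬ ^ (j ℕ.* K) 𝔸.- r 𝔸.* L)) →
    (1# 𝔸.- qᴬ ^ j) ∣ᴬ (L 𝔸.* f) → (1# 𝔸.- qᴬ ^ j) ∣ᴬ f
  period-cancel j L f period u∣Lf with ↓-isPoly f
  ... | D , f0 = x-period j (j ℕ.* D) f (λ i k le → f0 i k (ℕₚ.≤-trans (ℕₚ.m≤n*m D j) (ℕₚ.≤-trans le (ℕₚ.m≤m+n i k))))
    (∣ᴬ-cong (solve 4 (λ X r L f → f :* (con (+ 1) :- X :- r :* L) :+ r :* (L :* f) := f :- X :* f) 𝔸.refl (xᴬ ^ (j ℕ.* D)) (proj₁ (period D)) L f)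
      (∣ᴬ-+ (∣ᴬ-* f (proj₂ (period D))) (∣ᴬ-* (proj₁ (period D)) u∣Lf)))

  1-q^j∣1-q^jm : ∀ j m → (1# 𝔸.- qᴬ ^ j) ∣ᴬ (1# 𝔸.- qᴬ ^ (j ℕ.* m))
  1-q^j∣1-q^jm j m = ∣ᴬ-cong (+-congˡ (-‿cong (^-assocʳ qᴬ j m))) (1-a∣1-a^n (qᴬ ^ j) m)

  power-mod : ∀ j m K → (1# 𝔸.- qᴬ ^ j) ∣ᴬ (1# 𝔸.- (qᴬ ^ m) ^ (j ℕ.* K))
  power-mod j m K = ∣ᴬ-cong (+-congˡ (-‿cong (𝔸.trans (reflexive (≡.cong (qᴬ ^_) eq)) (𝔸.sym (^-assocʳ qᴬ m (j ℕ.* K)))))) (1-q^j∣1-q^jm j (m ℕ.* K))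
    where
    eq : j ℕ.* (m ℕ.* K) ≡.≡ m ℕ.* (j ℕ.* K)
    eq = ≡.trans (≡.sym (ℕₚ.*-assoc j m K)) (≡.trans (≡.cong (ℕ._* K) (ℕₚ.*-comm j m)) (ℕₚ.*-assoc m j K))

  -- 1 - x q^m divides 1 - x^(jK) q^(mjK), which is 1 - x^(jK) modulo 1 - q^j; the exponent is a
  -- multiple of j for this purpose.
  1-xq^-cancel : ∀ j m f → .{{NonZero j}} → (1# 𝔸.- qᴬ ^ j) ∣ᴬ ((1# 𝔸.- xᴬ 𝔸.* qᴬ ^ m) 𝔸.* f) → (1# 𝔸.- qᴬ ^ j) ∣ᴬ f
  1-xq^-cancel j m f = period-cancel j (1# 𝔸.- xᴬ 𝔸.* qᴬ ^ m) f λ K → r K , ∣ᴬ-cong (eq K) (∣ᴬ-* (𝔸.- (xᴬ ^ (j ℕ.* K))) (power-mod j m K))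
    where
    r : ℕ → Carrier
    r K = proj₁ (1-a∣1-a^n (xᴬ 𝔸.* qᴬ ^ m) (j ℕ.* K))
    eq : ∀ K → 𝔸.- (xᴬ ^ (j ℕ.* K)) 𝔸.* (1# 𝔸.- (qᴬ ^ m) ^ (j ℕ.* K)) 𝔸.≈ 1# 𝔸.- xᴬ ^ (j ℕ.* K) 𝔸.- r K 𝔸.* (1# 𝔸.- xᴬ 𝔸.* qᴬ ^ m)
    eq K = begin
      𝔸.- P 𝔸.* (1# 𝔸.- R) ≈⟨ solve 2 (λ P R → :- P :* (con (+ 1) :- R) := con (+ 1) :- P :- (con (+ 1) :- P :* R)) 𝔸.refl P R ⟩
      1# 𝔸.- P 𝔸.- (1# 𝔸.- P 𝔸.* R) ≈⟨ +-congˡ (-‿cong (+-congˡ (-‿cong (^-distrib-* xᴬ (qᴬ ^ m) (j ℕ.* K))))) ⟨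
      1# 𝔸.- P 𝔸.- (1# 𝔸.- (xᴬ 𝔸.* qᴬ ^ m) ^ (j ℕ.* K)) ≈⟨ +-congˡ (-‿cong (𝔸.trans (proj₂ (1-a∣1-a^n (xᴬ 𝔸.* qᴬ ^ m) (j ℕ.* K))) (*-comm _ _))) ⟩
      1# 𝔸.- P 𝔸.- r K 𝔸.* (1# 𝔸.- xᴬ 𝔸.* qᴬ ^ m) ∎
      where
      P = xᴬ ^ (j ℕ.* K)
      R = (qᴬ ^ m) ^ (j ℕ.* K)

  -- x - q^m divides x^(jK) - q^(mjK), which is x^(jK) - 1 modulo 1 - q^j.
  x-q^-cancel : ∀ j m f → .{{NonZero j}} → (1# 𝔸.- qᴬ ^ j) ∣ᴬ ((xᴬ 𝔸.- qᴬ ^ m) 𝔸.* f) → (1# 𝔸.- qᴬ ^ j) ∣ᴬ f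
  x-q^-cancel j m f = period-cancel j (xᴬ 𝔸.- qᴬ ^ m) f λ K → 𝔸.- r K , ∣ᴬ-cong (eq K) (power-mod j m K)
    where
    r : ℕ → Carrier
    r K = proj₁ (a-b∣a^n-b^n xᴬ (qᴬ ^ m) (j ℕ.* K))
    eq : ∀ K → 1# 𝔸.- (qᴬ ^ m) ^ (j ℕ.* K) 𝔸.≈ 1# 𝔸.- xᴬ ^ (j ℕ.* K) 𝔸.- (𝔸.- r K) 𝔸.* (xᴬ 𝔸.- qᴬ ^ m)
    eq K = begin
      1# 𝔸.- R ≈⟨ solve 2 (λ P R → con (+ 1) :- R := con (+ 1) :- P :+ (P :- R)) 𝔸.refl P R ⟩
      1# 𝔸.- P 𝔸.+ (P 𝔸.- R) ≈⟨ +-congˡ (proj₂ (a-b∣a^n-b^n xᴬ (qᴬ ^ m) (j ℕ.* K))) ⟩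
      1# 𝔸.- P 𝔸.+ (xᴬ 𝔸.- qᴬ ^ m) 𝔸.* r K ≈⟨ solve 3 (λ P L r → con (+ 1) :- P :+ L :* r := con (+ 1) :- P :- (:- r) :* L) 𝔸.refl P _ (r K) ⟩
      1# 𝔸.- P 𝔸.- (𝔸.- r K) 𝔸.* (xᴬ 𝔸.- qᴬ ^ m) ∎
      where
      P = xᴬ ^ (j ℕ.* K)
      R = (qᴬ ^ m) ^ (j ℕ.* K)

  -- From N f = (1 - q^j) g and S = (1 - q^(jD))/(1 - q^j) follows N S f = g - q^(jD) g. With jD
  -- beyond the degree of g in q, truncation shows that N divides g, and N is then cancelled in
  -- ℤ[x,q].
  natural-cancel : ∀ j c f → .{{NonZero j}} → (1# 𝔸.- qᴬ ^ j) ∣ᴬ (natural (suc c) 𝔸.* f) → (1# 𝔸.- qᴬ ^ j) ∣ᴬ f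
  natural-cancel j c f (g , eq) with ↓-isPoly g
  ... | D , g0 = h , regular-cancel (regular-natural c) (begin
      N 𝔸.* f ≈⟨ eq ⟩
      u 𝔸.* g ≈⟨ *-congˡ Nh ⟨
      u 𝔸.* (N 𝔸.* h) ≈⟨ solve 3 (λ u N h → u :* (N :* h) := N :* (u :* h)) 𝔸.refl u N h ⟩
      N 𝔸.* (u 𝔸.* h) ∎)
    where
    N = natural (suc c)
    u = 1# 𝔸.- qᴬ ^ j
    K = j ℕ.* D
    χ = qBelow K
    S = proj₁ (1-q^j∣1-q^jm j D)
    h = truncate χ (S 𝔸.* f)
    Nh : N 𝔸.* h 𝔸.≈ g
    Nh = begin
      N 𝔸.* truncate χ (S 𝔸.* f) ≈⟨ truncate-natural* χ (suc c) _ ⟨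
      truncate χ (N 𝔸.* (S 𝔸.* f)) ≈⟨ truncate-cong χ (begin
        N 𝔸.* (S 𝔸.* f) ≈⟨ solve 3 (λ N S f → N :* (S :* f) := S :* (N :* f)) 𝔸.refl N S f ⟩
        S 𝔸.* (N 𝔸.* f) ≈⟨ *-congˡ eq ⟩
        S 𝔸.* (u 𝔸.* g) ≈⟨ solve 3 (λ S u g → S :* (u :* g) := (u :* S) :* g) 𝔸.refl S u g ⟩
        (u 𝔸.* S) 𝔸.* g ≈⟨ *-congʳ (proj₂ (1-q^j∣1-q^jm j D)) ⟨
        (1# 𝔸.- qᴬ ^ K) 𝔸.* g ≈⟨ solve 2 (λ u g → (con (+ 1) :- u) :* g := g :- u :* g) 𝔸.refl _ g ⟩
        g 𝔸.- qᴬ ^ K 𝔸.* g ∎) ⟩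
      truncate χ (g 𝔸.- qᴬ ^ K 𝔸.* g)
        ≈⟨ truncate-split χ g _ (λ i k e → g0 i k (ℕₚ.≤-trans (ℕₚ.m≤n*m D j) (ℕₚ.≤-trans (<ᵇ-false k K e) (ℕₚ.m≤n+m k i)))) (λ i k e → q^*-low K g i k (<ᵇ-true k K e)) ⟩
      g ∎

-- The summation in the definition of t(k), made accessible.

module Unfolding where
  open import Defs
  open PolynomialRing
  open import Data.Nat.Base as ℕ using (ℕ; zero; suc; _∸_)
  open import Data.Integer.Base as ℤ using (ℤ; +_; sign; ∣_∣; _◃_)
  import Data.Integer.Properties as ℤₚ
  open import Data.Sign.Base as Sign using (Sign)
  open import Data.Vec.Base as Vec using (Vec; []; _∷_)
  open import Data.List.Base as List using ([]; _∷_; foldr)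
  open import Data.Product using (Σ; _×_; _,_; proj₁; proj₂)
  open import Relation.Binary.PropositionalEquality as ≡ using (_≡_; refl)
  open import Relation.Nullary using (¬_; yes; no; contradiction)

  -- The function folded by `t` is local to it; unification against `refl` gives access to it.
  t-unfold : ∀ s N k → Σ (Vec ℕ N → RF → RF) λ F → t s N k ≡ foldr F (poly 𝟘) (boxVecs N k)
  t-unfold s N k = _ , refl

  step : ∀ s N k → Vec ℕ N → RF → RF
  step s N k = proj₁ (t-unfold s N k)

  -- The product z ⊗ b, with b given through the signs σ and absolute values ν of its coefficients.
  signed-⊗ : Poly → (ℕ → ℕ → ℕ → ℕ → Sign) → (ℕ → ℕ → ℕ → ℕ → ℕ) → Poly
  signed-⊗ z σ ν i j = sumTo i λ a → sumTo j λ b → (sign (z a b) Sign.* σ i j a b) ◃ (∣ z a b ∣ ℕ.* ν i j a b)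

  -- The local function prodα of t cannot be named outside Defs. In prodα (i ∷ v) = α s i *ʳ prodα v the
  -- coefficients of prodα v occur only through their signs and absolute values, which unification recovers.
  mutual
    num-sign den-sign : (s m k : ℕ) (v : Vec ℕ m) → ℕ → ℕ → ℕ → ℕ → Sign
    num-sign s m k v i j a b = _
    den-sign s m k v i j a b = _

    num-abs den-abs : (s m k : ℕ) (v : Vec ℕ m) → ℕ → ℕ → ℕ → ℕ → ℕ
    num-abs s m k v i j a b = _
    den-abs s m k v i j a b = _

    step-∷ : ∀ s m k i (v : Vec ℕ m) acc → Vec.sum (i ∷ v) ≡ k → step s (suc m) k (i ∷ v) acc ≡
      ( signed-⊗ (proj₁ (α s i)) (num-sign s m k v) (num-abs s m k v) ⊗ proj₂ acc
          ⊕ proj₁ acc ⊗ signed-⊗ (proj₂ (α s i)) (den-sign s m k v) (den-abs s m k v)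
      , signed-⊗ (proj₂ (α s i)) (den-sign s m k v) (den-abs s m k v) ⊗ proj₂ acc )
    step-∷ s m k i v acc eq with Vec.sum (i ∷ v) ℕₚ.≟ k
    ... | yes _ = refl
    ... | no ≢ = contradiction eq ≢

  αProduct : ∀ s {m} → Vec ℕ m → RF
  αProduct s [] = poly 𝟙
  αProduct s (i ∷ v) = α s i *ʳ αProduct s v

  signed-⊗≈ : ∀ z {σ ν g} → (∀ i j a b → σ i j a b ◃ ν i j a b ≡ g (i ∸ a) (j ∸ b)) → signed-⊗ z σ ν ≈ z ⊗ g
  signed-⊗≈ z {σ} {ν} eq i j = sumTo-cong≤ i λ a _ → sumTo-cong≤ j λ b _ → ≡.trans
    (ℤₚ.◃-distrib-* (sign (z a b)) (σ i j a b) ∣ z a b ∣ (ν i j a b))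
    (≡.cong₂ ℤ._*_ (ℤₚ.◃-inverse (z a b)) (eq i j a b))

  -- The placeholders of `step-∷` are the signs and absolute values of the coefficients of prodα v.
  -- `◃-inverse` reassembles each coefficient, and induction on v identifies the product with
  -- `αProduct`.
  num-value : ∀ s m k v i j a b → num-sign s m k v i j a b ◃ num-abs s m k v i j a b ≡ proj₁ (αProduct s v) (i ∸ a) (j ∸ b)
  num-value s zero k [] i j a b = ℤₚ.◃-inverse (𝟙 (i ∸ a) (j ∸ b))
  num-value s (suc m) k (n ∷ v) i j a b = ≡.trans
    (ℤₚ.◃-inverse (signed-⊗ (proj₁ (α s n)) (num-sign s m k v) (num-abs s m k v) (i ∸ a) (j ∸ b)))
    (signed-⊗≈ (proj₁ (α s n)) {num-sign s m k v} {num-abs s m k v} {proj₁ (αProduct s v)} (num-value s m k v) (i ∸ a) (j ∸ b))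

  den-value : ∀ s m k v i j a b → den-sign s m k v i j a b ◃ den-abs s m k v i j a b ≡ proj₂ (αProduct s v) (i ∸ a) (j ∸ b)
  den-value s zero k [] i j a b = ℤₚ.◃-inverse (𝟙 (i ∸ a) (j ∸ b))
  den-value s (suc m) k (n ∷ v) i j a b = ≡.trans
    (ℤₚ.◃-inverse (signed-⊗ (proj₂ (α s n)) (den-sign s m k v) (den-abs s m k v) (i ∸ a) (j ∸ b)))
    (signed-⊗≈ (proj₂ (α s n)) {den-sign s m k v} {den-abs s m k v} {proj₂ (αProduct s v)} (den-value s m k v) (i ∸ a) (j ∸ b))

  infix 4 _≈ʳ_
  _≈ʳ_ : RF → RF → Set
  r ≈ʳ r′ = (proj₁ r ≈ proj₁ r′) × (proj₂ r ≈ proj₂ r′)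

  ≈ʳ-reflexive : ∀ {r r′} → r ≡ r′ → r ≈ʳ r′
  ≈ʳ-reflexive refl = ≈-refl , ≈-refl

  step-yes : ∀ s N k v acc → Vec.sum v ≡ k → step s N k v acc ≈ʳ αProduct s v +ʳ acc
  step-yes s zero k [] acc eq = ≈ʳ-reflexive (nil eq)
    where
    nil : 0 ≡ k → step s zero k [] acc ≡ poly 𝟙 +ʳ acc
    nil eq with Vec.sum {0} [] ℕₚ.≟ k
    ... | yes _ = refl
    ... | no ≢ = contradiction eq ≢
  step-yes s (suc m) k (i ∷ v) acc eq = num≈ , den≈
    where
    unfolded = ≈ʳ-reflexive (step-∷ s m k i v acc eq)
    num⊗ = signed-⊗≈ (proj₁ (α s i)) {num-sign s m k v} {num-abs s m k v} {proj₁ (αProduct s v)} (num-value s m k v)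
    den⊗ = signed-⊗≈ (proj₂ (α s i)) {den-sign s m k v} {den-abs s m k v} {proj₂ (αProduct s v)} (den-value s m k v)
    num≈ : proj₁ (step s (suc m) k (i ∷ v) acc) ≈ proj₁ (αProduct s (i ∷ v) +ʳ acc)
    num≈ = ≈-trans (proj₁ unfolded) (⊕-cong (⊗-cong {g = proj₂ acc} num⊗ ≈-refl) (⊗-cong {proj₁ acc} ≈-refl den⊗))
    den≈ : proj₂ (step s (suc m) k (i ∷ v) acc) ≈ proj₂ (αProduct s (i ∷ v) +ʳ acc)
    den≈ = ≈-trans (proj₂ unfolded) (⊗-cong {g = proj₂ acc} den⊗ ≈-refl)

  step-no : ∀ s N k v acc → ¬ Vec.sum v ≡ k → step s N k v acc ≈ʳ poly 𝟘 +ʳ acc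
  step-no s N k v acc ≢ = ≈ʳ-reflexive off
    where
    off : step s N k v acc ≡ poly 𝟘 +ʳ acc
    off with Vec.sum v ℕₚ.≟ k
    ... | yes eq = contradiction eq ≢
    ... | no _ = refl

-- The exact values of α(k) and t(k).

module Representation where
  open import Defs
  open PolynomialRing
  open FractionValues
  open Regularity
  open Unfolding using (step; t-unfold; αProduct; _≈ʳ_; step-yes; step-no)
  open import Data.Nat.Base as ℕ using (ℕ; zero; suc; _∸_; _≤_; _<_)
  open import Data.Nat.Combinatorics using (_C_)
  open BinomialExponent using (exponent≡)
  open import Data.Integer.Base as ℤ using (+_)
  open import Data.List.Base as List using (List; []; _∷_)
  open import Data.Vec.Base as Vec using (Vec; []; _∷_)
  open import Data.Product using (_,_; proj₁; proj₂)
  open import Function.Base using (_∘_; id)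
  open import Relation.Nullary using (¬_; Dec; yes; no; contradiction)
  open import Relation.Binary.Reasoning.Setoid 𝔼.setoid
  module ιP = HomProperties ιᴱ
  module EC = Convolution E.fractionRing
  open 𝔼 using (∏; ∑; _^_; 1#; 0#)
    renaming (_≈_ to _≃_; _+_ to _+ᴱ_; _*_ to _*ᴱ_; _-_ to _-ᴱ_; -_ to -ᴱ_)

  xᴱ qᴱ : 𝔼.Carrier
  xᴱ = E.ιᶠ xᴬ
  qᴱ = E.ιᶠ qᴬ

  unit-ι : ∀ {b} → E.Regular b → 𝔼.Unit (E.ιᶠ b)
  unit-ι r = E.ι-unit (regular⇒admissible r)

  rep-x : Represents x xᴱ
  rep-x = rep-poly ↤-X

  rep-q : Represents q qᴱ
  rep-q = rep-poly ↤-Q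

  rep-1 : Represents (poly 𝟙) 1#
  rep-1 = rep-≈ (rep-poly ↤-𝟙) E.ι-1

  rep-0 : Represents (poly 𝟘) 0#
  rep-0 = rep-≈ (rep-poly ↤-𝟘) E.ι-0

  rep-^ : ∀ {r e} n → Represents r e → Represents (r ^ʳ n) (e ^ n)
  rep-^ zero p = rep-1
  rep-^ (suc n) p = rep-* p (rep-^ n p)

  rep-poch : ∀ {a b e f} k → Represents a e → Represents b f → Represents (poch a b k) (∏ k (λ j → 1# -ᴱ e *ᴱ f ^ j))
  rep-poch zero p r = rep-1
  rep-poch (suc k) p r = rep-* (rep-poch k p r) (rep-- rep-1 (rep-* p (rep-^ k r)))

  rep-sum : ∀ {f e} n → (∀ k → Represents (f k) (e k)) → Represents (sumʳ n f) (∑ n e)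
  rep-sum zero p = rep-0
  rep-sum (suc n) p = rep-+ (rep-sum n p) (p n)

  rep-resp : ∀ {r r′ e} → r ≈ʳ r′ → Represents r′ e → Represents r e
  rep-resp (p , p′) (represents u v pu pv rv eq) = represents u v (≈-trans p pu) (≈-trans p′ pv) rv eq

  module RepresentSum (s′ : ℕ) (w : ℕ → 𝔼.Carrier) where
    s : ℕ
    s = suc s′

    open Summands E.fractionRing qᴱ s′ w using (αᵣ)

    pᴱ : 𝔼.Carrier
    pᴱ = qᴱ ^ s

    factor : 𝔼.Carrier → 𝔼.Carrier
    factor b = (1# -ᴱ xᴱ *ᴱ b) *ᴱ (xᴱ -ᴱ b) *ᴱ (1# -ᴱ b)

    module _ (w-ratio : ∀ j → w j *ᴱ factor (pᴱ ^ suc j) ≃ factor (qᴱ *ᴱ pᴱ ^ j)) where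

      unit-x : 𝔼.Unit xᴱ
      unit-x = unit-ι regular-x

      x⁻¹ : 𝔼.Carrier
      x⁻¹ = proj₁ unit-x

      -- The Pochhammer symbols in `α` have parameters xa, a/x and a, with a = q above and a = q^s
      -- below. The leading x is common to both and drops out of w.
      monic-factor : ∀ a b → factor (a *ᴱ b) ≃ xᴱ *ᴱ ((1# -ᴱ (xᴱ *ᴱ a) *ᴱ b) *ᴱ (1# -ᴱ (a *ᴱ x⁻¹) *ᴱ b) *ᴱ (1# -ᴱ a *ᴱ b))
      monic-factor a b = begin
        (1# -ᴱ xᴱ *ᴱ (a *ᴱ b)) *ᴱ (xᴱ -ᴱ a *ᴱ b) *ᴱ (1# -ᴱ a *ᴱ b)
          ≈⟨ 𝔼.*-congʳ (𝔼.*-congˡ (𝔼.+-congˡ (𝔼.-‿cong (𝔼.trans (𝔼.sym (𝔼.*-identityˡ _)) (𝔼.*-congʳ (𝔼.sym (proj₂ unit-x))))))) ⟩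
        (1# -ᴱ xᴱ *ᴱ (a *ᴱ b)) *ᴱ (xᴱ -ᴱ xᴱ *ᴱ x⁻¹ *ᴱ (a *ᴱ b)) *ᴱ (1# -ᴱ a *ᴱ b)
          ≈⟨ 𝔼.solve 4 (λ x y a b → (con (+ 1) :- x :* (a :* b)) :* (x :- x :* y :* (a :* b)) :* (con (+ 1) :- a :* b)
               := x :* ((con (+ 1) :- (x :* a) :* b) :* (con (+ 1) :- (a :* y) :* b) :* (con (+ 1) :- a :* b))) 𝔼.refl xᴱ x⁻¹ a b ⟩
        xᴱ *ᴱ ((1# -ᴱ (xᴱ *ᴱ a) *ᴱ b) *ᴱ (1# -ᴱ (a *ᴱ x⁻¹) *ᴱ b) *ᴱ (1# -ᴱ a *ᴱ b)) ∎
        where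
        open 𝔼 using (_:=_; _:*_; _:-_; :-_; con)

      triple : 𝔼.Carrier → ℕ → 𝔼.Carrier
      triple a j = (1# -ᴱ (xᴱ *ᴱ a) *ᴱ pᴱ ^ j) *ᴱ (1# -ᴱ (a *ᴱ x⁻¹) *ᴱ pᴱ ^ j) *ᴱ (1# -ᴱ a *ᴱ pᴱ ^ j)

      w-triple : ∀ j → w j *ᴱ triple pᴱ j ≃ triple qᴱ j
      w-triple j = 𝔼.unit-cancelˡ unit-x (begin
        xᴱ *ᴱ (w j *ᴱ triple pᴱ j) ≈⟨ 𝔼.solve 3 (λ x w t → x 𝔼.:* (w 𝔼.:* t) 𝔼.:= w 𝔼.:* (x 𝔼.:* t)) 𝔼.refl xᴱ (w j) (triple pᴱ j) ⟩
        w j *ᴱ (xᴱ *ᴱ triple pᴱ j) ≈⟨ 𝔼.*-congˡ (monic-factor pᴱ (pᴱ ^ j)) ⟨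
        w j *ᴱ factor (pᴱ ^ suc j) ≈⟨ w-ratio j ⟩
        factor (qᴱ *ᴱ pᴱ ^ j) ≈⟨ monic-factor qᴱ (pᴱ ^ j) ⟩
        xᴱ *ᴱ triple qᴱ j ∎)

      ∏-triple : ∀ a k → ∏ k (triple a) ≃ ∏ k (λ j → 1# -ᴱ (xᴱ *ᴱ a) *ᴱ pᴱ ^ j) *ᴱ ∏ k (λ j → 1# -ᴱ (a *ᴱ x⁻¹) *ᴱ pᴱ ^ j) *ᴱ ∏ k (λ j → 1# -ᴱ a *ᴱ pᴱ ^ j)
      ∏-triple a k = 𝔼.trans (𝔼.∏-* k _ _) (𝔼.*-congʳ (𝔼.∏-* k _ _))

      p^≃ : ∀ j → E.ιᶠ (qᴬ 𝔸.^ (s ℕ.* j)) ≃ pᴱ ^ j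
      p^≃ j = 𝔼.trans (ιP.^-homo qᴬ (s ℕ.* j)) (𝔼.sym (𝔼.^-assocʳ qᴱ s j))

      unit-triple : ∀ j → 𝔼.Unit (triple pᴱ j)
      unit-triple j = 𝔼.unit-factorˡ {b = xᴱ} (𝔼.unit-cong (begin
        E.ιᶠ (1-xb 𝔸.* x-b 𝔸.* 1-b) ≈⟨ 𝔼.trans (E.ι-* _ _) (𝔼.*-congʳ (E.ι-* _ _)) ⟩
        E.ιᶠ 1-xb *ᴱ E.ιᶠ x-b *ᴱ E.ιᶠ 1-b
          ≈⟨ 𝔼.*-cong (𝔼.*-cong (𝔼.trans (ιP.1-sub-homo _) (𝔼.+-congˡ (𝔼.-‿cong (𝔼.trans (E.ι-* _ _) (𝔼.*-congˡ b≃)))))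
               (𝔼.trans (ιP.sub-homo _ _) (𝔼.+-congˡ (𝔼.-‿cong b≃)))) (𝔼.trans (ιP.1-sub-homo _) (𝔼.+-congˡ (𝔼.-‿cong b≃))) ⟩
        factor (pᴱ ^ suc j) ≈⟨ monic-factor pᴱ (pᴱ ^ j) ⟩
        xᴱ *ᴱ triple pᴱ j ≈⟨ 𝔼.*-comm _ _ ⟩
        triple pᴱ j *ᴱ xᴱ ∎)
        (unit-ι (E.regular-* (E.regular-* (regular-1-xq^ b) (regular-x-q^ (s ℕ.* suc j))) (regular-1-q^ (j ℕ.+ s′ ℕ.* suc j)))))
        where
        b = qᴬ 𝔸.^ (s ℕ.* suc j)
        1-xb = 𝔸.1# 𝔸.- xᴬ 𝔸.* b
        x-b = xᴬ 𝔸.- b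
        1-b = 𝔸.1# 𝔸.- b
        b≃ = p^≃ (suc j)

      rep-α : ∀ k → Represents (α s k) (αᵣ k)
      rep-α k = rep-≈ (rep-* (rep-poly (↤-⊗ (↤-⊗ (↤-sgn k) (↤-^ (s ℕ.* (suc k C 2) ∸ k) ↤-Q)) (↤-qint (2 ℕ.* s ℕ.* k ℕ.+ 1))))
          (rep-/ (rep-* (rep-* (rep-poch k (rep-* rep-x rep-q) rep-p) (rep-poch k (rep-/ rep-q rep-x unit-x) rep-p)) (rep-poch k rep-q rep-p))
                 (rep-* (rep-* (rep-poch k (rep-* rep-x rep-p) rep-p) (rep-poch k (rep-/ rep-p rep-x unit-x) rep-p)) (rep-poch k rep-p rep-p))
                 unit-bottom))
        (𝔼.*-cong prefactor quotient)
        where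
        rep-p : Represents (q ^ʳ s) pᴱ
        rep-p = rep-^ s rep-q
        bottom top : 𝔼.Carrier
        bottom = ∏ k (λ j → 1# -ᴱ (xᴱ *ᴱ pᴱ) *ᴱ pᴱ ^ j) *ᴱ ∏ k (λ j → 1# -ᴱ (pᴱ *ᴱ x⁻¹) *ᴱ pᴱ ^ j) *ᴱ ∏ k (λ j → 1# -ᴱ pᴱ *ᴱ pᴱ ^ j)
        top = ∏ k (λ j → 1# -ᴱ (xᴱ *ᴱ qᴱ) *ᴱ pᴱ ^ j) *ᴱ ∏ k (λ j → 1# -ᴱ (qᴱ *ᴱ x⁻¹) *ᴱ pᴱ ^ j) *ᴱ ∏ k (λ j → 1# -ᴱ qᴱ *ᴱ pᴱ ^ j)
        unit-bottom : 𝔼.Unit bottom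
        unit-bottom = 𝔼.unit-cong (∏-triple pᴱ k) (𝔼.∏-unit k λ j _ → unit-triple j)
        quotient : top *ᴱ proj₁ unit-bottom ≃ ∏ k w
        quotient = begin
          top *ᴱ proj₁ unit-bottom ≈⟨ 𝔼.*-congʳ (∏-triple qᴱ k) ⟨
          ∏ k (triple qᴱ) *ᴱ proj₁ unit-bottom ≈⟨ 𝔼.*-congʳ (𝔼.trans (𝔼.sym (𝔼.∏-cong k w-triple)) (𝔼.∏-* k w (triple pᴱ))) ⟩
          ∏ k w *ᴱ ∏ k (triple pᴱ) *ᴱ proj₁ unit-bottom ≈⟨ 𝔼.trans (𝔼.*-assoc _ _ _) (𝔼.*-congˡ (𝔼.*-congʳ (∏-triple pᴱ k))) ⟩
          ∏ k w *ᴱ (bottom *ᴱ proj₁ unit-bottom) ≈⟨ 𝔼.trans (𝔼.*-congˡ (proj₂ unit-bottom)) (𝔼.*-identityʳ _) ⟩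
          ∏ k w ∎
        prefactor : E.ιᶠ ((𝔸.- 𝔸.1#) 𝔸.^ k 𝔸.* qᴬ 𝔸.^ (s ℕ.* (suc k C 2) ∸ k) 𝔸.* 𝔸.∑ (2 ℕ.* s ℕ.* k ℕ.+ 1) (qᴬ 𝔸.^_))
          ≃ (-ᴱ 1#) ^ k *ᴱ qᴱ ^ qExponent s′ k *ᴱ ∑ (2 ℕ.* s ℕ.* k ℕ.+ 1) (qᴱ ^_)
        prefactor = 𝔼.trans (E.ι-cong (𝔸.*-congʳ (𝔸.*-congˡ (𝔸.reflexive (≡.cong (qᴬ 𝔸.^_) (exponent≡ s′ k)))))) (ιP.prefactor-homo qᴬ s′ k)

      αᴱ-product : ∀ {N} → Vec ℕ N → 𝔼.Carrier
      αᴱ-product [] = 1#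
      αᴱ-product (i ∷ v) = αᵣ i *ᴱ αᴱ-product v

      rep-αProduct : ∀ {N} (v : Vec ℕ N) → Represents (αProduct s v) (αᴱ-product v)
      rep-αProduct [] = rep-1
      rep-αProduct (i ∷ v) = rep-* (rep-α i) (rep-αProduct v)

      term : ∀ {N} → ℕ → Vec ℕ N → 𝔼.Carrier
      term k v with Vec.sum v ℕₚ.≟ k
      ... | yes _ = αᴱ-product v
      ... | no _ = 0#

      term-yes : ∀ {N} k (v : Vec ℕ N) → Vec.sum v ≡.≡ k → αᴱ-product v ≃ term k v
      term-yes k v eq with Vec.sum v ℕₚ.≟ k
      ... | yes _ = 𝔼.refl
      ... | no ≢ = contradiction eq ≢

      term-no : ∀ {N} k (v : Vec ℕ N) → ¬ Vec.sum v ≡.≡ k → 0# ≃ term k v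
      term-no k v ≢ with Vec.sum v ℕₚ.≟ k
      ... | yes eq = contradiction eq ≢
      ... | no _ = 𝔼.refl

      rep-step : ∀ {N} k (v : Vec ℕ N) {acc e} → Represents acc e → Represents (step s N k v acc) (term k v +ᴱ e)
      rep-step {N} k v {acc} {e} p = by (Vec.sum v ℕₚ.≟ k)
        where
        by : Dec (Vec.sum v ≡.≡ k) → Represents (step s N k v acc) (term k v +ᴱ e)
        by (yes eq) = rep-resp (step-yes s N k v acc eq) (rep-≈ (rep-+ (rep-αProduct v) p) (𝔼.+-congʳ (term-yes k v eq)))
        by (no ≢) = rep-resp (step-no s N k v acc ≢) (rep-≈ (rep-+ rep-0 p) (𝔼.+-congʳ (term-no k v ≢)))

      total : ∀ {N} → (Vec ℕ N → 𝔼.Carrier) → List (Vec ℕ N) → 𝔼.Carrier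
      total f = List.foldr (λ v e → f v +ᴱ e) 0#

      rep-foldr : ∀ {N} k ℓ → Represents (List.foldr (step s N k) (poly 𝟘) ℓ) (total (term k) ℓ)
      rep-foldr k [] = rep-0
      rep-foldr k (v ∷ ℓ) = rep-step k v (rep-foldr k ℓ)

      total-cong : ∀ {N} {f g : Vec ℕ N → 𝔼.Carrier} → (∀ v → f v ≃ g v) → ∀ ℓ → total f ℓ ≃ total g ℓ
      total-cong eq [] = 𝔼.refl
      total-cong eq (v ∷ ℓ) = 𝔼.+-cong (eq v) (total-cong eq ℓ)

      total-* : ∀ {N} c (f : Vec ℕ N → 𝔼.Carrier) ℓ → total (λ v → c *ᴱ f v) ℓ ≃ c *ᴱ total f ℓ
      total-* c f [] = 𝔼.sym (𝔼.zeroʳ c)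
      total-* c f (v ∷ ℓ) = 𝔼.trans (𝔼.+-congˡ (total-* c f ℓ)) (𝔼.sym (𝔼.distribˡ _ _ _))

      total-0 : ∀ {N} (ℓ : List (Vec ℕ N)) → total (λ _ → 0#) ℓ ≃ 0#
      total-0 [] = 𝔼.refl
      total-0 (v ∷ ℓ) = 𝔼.trans (𝔼.+-identityˡ _) (total-0 ℓ)

      total-++ : ∀ {N} (f : Vec ℕ N → 𝔼.Carrier) ℓ ℓ′ → total f (ℓ List.++ ℓ′) ≃ total f ℓ +ᴱ total f ℓ′
      total-++ f [] ℓ′ = 𝔼.sym (𝔼.+-identityˡ _)
      total-++ f (v ∷ ℓ) ℓ′ = 𝔼.trans (𝔼.+-congˡ (total-++ f ℓ ℓ′)) (𝔼.sym (𝔼.+-assoc _ _ _))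

      total-map : ∀ {M N} (f : Vec ℕ N → 𝔼.Carrier) (h : Vec ℕ M → Vec ℕ N) ℓ → total f (List.map h ℓ) ≃ total (f ∘ h) ℓ
      total-map f h [] = 𝔼.refl
      total-map f h (v ∷ ℓ) = 𝔼.+-congˡ (total-map f h ℓ)

      total-concatMap : ∀ {N} (f : Vec ℕ N → 𝔼.Carrier) (g : ℕ → List (Vec ℕ N)) (h : ℕ → ℕ) n → total f (List.concatMap g (List.applyUpTo h n)) ≃ ∑ n (λ i → total f (g (h i)))
      total-concatMap f g h zero = 𝔼.refl
      total-concatMap f g h (suc n) = begin
        total f (g (h 0) List.++ List.concatMap g (List.applyUpTo (h ∘ suc) n)) ≈⟨ total-++ f (g (h 0)) _ ⟩
        total f (g (h 0)) +ᴱ total f (List.concatMap g (List.applyUpTo (h ∘ suc) n)) ≈⟨ 𝔼.+-congˡ (total-concatMap f g (h ∘ suc) n) ⟩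
        total f (g (h 0)) +ᴱ ∑ n (λ i → total f (g (h (suc i)))) ≈⟨ 𝔼.∑-first n (λ i → total f (g (h i))) ⟨
        ∑ (suc n) (λ i → total f (g (h i))) ∎

      term-∷ : ∀ {N} k i (v : Vec ℕ N) → i ≤ k → term k (i ∷ v) ≃ αᵣ i *ᴱ term (k ∸ i) v
      term-∷ k i v i≤k with Vec.sum (i ∷ v) ℕₚ.≟ k | Vec.sum v ℕₚ.≟ k ∸ i
      ... | yes _ | yes _ = 𝔼.refl
      ... | no _ | no _ = 𝔼.sym (𝔼.zeroʳ _)
      ... | yes eq | no ≢ = contradiction (≡.trans (≡.sym (ℕₚ.m+n∸m≡n i _)) (≡.cong (_∸ i) eq)) ≢
      ... | no ≢ | yes eq = contradiction (≡.trans (≡.cong (i ℕ.+_) eq) (ℕₚ.m+[n∸m]≡n i≤k)) ≢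

      term-∷-large : ∀ {N} k i (v : Vec ℕ N) → k < i → term k (i ∷ v) ≃ 0#
      term-∷-large k i v k<i with Vec.sum (i ∷ v) ℕₚ.≟ k
      ... | no _ = 𝔼.refl
      ... | yes eq = contradiction (≡.subst (i ≤_) eq (ℕₚ.m≤m+n i _)) (ℕₚ.<⇒≱ k<i)

      -- `boxVecs` keeps its bound while the remaining sum falls to k - i, so the induction needs an
      -- arbitrary bound B ≥ k.
      total-box : ∀ N B k → k ≤ B → total (term k) (boxVecs N B) ≃ EC.power αᵣ N k
      total-box zero B zero _ = 𝔼.+-identityʳ _
      total-box zero B (suc k) _ = 𝔼.+-identityʳ _
      total-box (suc N) B k k≤B = begin
        total (term k) (boxVecs (suc N) B) ≈⟨ total-concatMap (term k) (λ i → List.map (i ∷_) (boxVecs N B)) id (suc B) ⟩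
        ∑ (suc B) slice ≈⟨ EC.∑-truncate slice-large B k≤B ⟩
        ∑ (suc k) slice ≈⟨ 𝔼.∑-cong< (suc k) (λ i i≤k → slice-small i (ℕₚ.≤-pred i≤k)) ⟩
        ∑ (suc k) (λ i → αᵣ i *ᴱ EC.power αᵣ N (k ∸ i)) ≈⟨ EC.∑≈Σ≤ k _ ⟩
        EC.power αᵣ (suc N) k ∎
        where
        slice : ℕ → 𝔼.Carrier
        slice i = total (term k) (List.map (i ∷_) (boxVecs N B))
        slice-large : ∀ i → k < i → slice i ≃ 0#
        slice-large i k<i = 𝔼.trans (total-map (term k) (i ∷_) (boxVecs N B))
          (𝔼.trans (total-cong (λ v → term-∷-large k i v k<i) (boxVecs N B)) (total-0 (boxVecs N B)))
        slice-small : ∀ i → i ≤ k → slice i ≃ αᵣ i *ᴱ EC.power αᵣ N (k ∸ i)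
        slice-small i i≤k = begin
          slice i ≈⟨ total-map (term k) (i ∷_) (boxVecs N B) ⟩
          total (term k ∘ (i ∷_)) (boxVecs N B) ≈⟨ total-cong (λ v → term-∷ k i v i≤k) (boxVecs N B) ⟩
          total (λ v → αᵣ i *ᴱ term (k ∸ i) v) (boxVecs N B) ≈⟨ total-* (αᵣ i) (term (k ∸ i)) (boxVecs N B) ⟩
          αᵣ i *ᴱ total (term (k ∸ i)) (boxVecs N B) ≈⟨ 𝔼.*-congˡ (total-box N B (k ∸ i) (ℕₚ.≤-trans (ℕₚ.m∸n≤m k i) k≤B)) ⟩
          αᵣ i *ᴱ EC.power αᵣ N (k ∸ i) ∎

      rep-t : ∀ N k → Represents (t s N k) (EC.power αᵣ N k)
      rep-t N k = ≡.subst (λ r → Represents r (EC.power αᵣ N k)) (≡.sym (proj₂ (t-unfold s N k)))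
        (rep-≈ (rep-foldr k (boxVecs N k)) (total-box N k k ℕₚ.≤-refl))

      rep-total : ∀ N n → Represents (sumʳ n (t s N)) (∑ n (EC.power αᵣ N))
      rep-total N n = rep-sum n (rep-t N)

-- Regularity modulo the factors of the modulus, and vanishing at roots of unity.

module Cancellation where
  open FractionValues
  open Regularity
  open import Data.Nat.Base as ℕ using (ℕ; zero; suc; _∸_; _<_; z≤n; s≤s; NonZero)
  open import Data.Nat.Divisibility as ℕ∣ using (divides) renaming (_∣_ to _∣ₙ_; _∣?_ to _∣ₙ?_)
  open import Data.Nat.GCD using (gcd; gcd[m,n]∣m; gcd[m,n]∣n; gcd[m,n]≢0; module Bézout; gcd-GCD)
  open import Data.Nat.Induction using (<-rec)
  open import Data.Integer.Base as ℤ using (+_)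
  open import Data.List.Base as List using (List; []; _∷_; _++_)
  open import Data.List.Relation.Unary.All as All using (All; []; _∷_)
  import Data.List.Relation.Unary.All.Properties as Allₚ
  open import Data.Product using (∃; _×_; _,_; proj₁; proj₂)
  open import Data.Sum using (inj₂)
  open import Relation.Binary.Definitions using (tri<; tri≈; tri>)
  open import Relation.Nullary using (¬_; contradiction)
  open import Relation.Binary.Reasoning.Setoid 𝔸.setoid
  open 𝔸
  open E using (Regular)
  import Defs

  divisibility : Carrier → Ideal A
  divisibility π = record
    { Member = π ∣ᴬ_ ; resp = ∣ᴬ-cong ; +-closed = ∣ᴬ-+ ; *-closed = λ c → ∣ᴬ-* c ; 0-member = 0# , sym (zeroʳ π) }

  Cancels : Carrier → Carrier → Set
  Cancels π w = ∀ f → π ∣ᴬ w * f → π ∣ᴬ f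

  cancels-* : ∀ {π v w} → Cancels π v → Cancels π w → Cancels π (v * w)
  cancels-* cv cw f p = cw f (cv _ (∣ᴬ-cong (*-assoc _ _ f) p))

  cancels-neg : ∀ {π w} → Cancels π w → Cancels π (- w)
  cancels-neg cw f p = cw f (∣ᴬ-cong (solve 2 (λ w f → (:- con (+ 1)) :* ((:- w) :* f) := w :* f) refl _ f) (∣ᴬ-* (- 1#) p))

  -- If c w ≡ u modulo π, then w f ≡ 0 forces u f ≡ 0.
  cancels-mod : ∀ {π w} c u k → c * w ≈ u + π * k → Cancels π u → Cancels π w
  cancels-mod {π} {w} c u k eq cu f p = cu f (∣ᴬ-cong (begin
    c * (w * f) + - (k * f) * π ≈⟨ +-congʳ (trans (sym (*-assoc c w f)) (*-congʳ eq)) ⟩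
    (u + π * k) * f + - (k * f) * π ≈⟨ solve 4 (λ u π k f → (u :+ π :* k) :* f :+ :- (k :* f) :* π := u :* f) refl u π k f ⟩
    u * f ∎) (∣ᴬ-+ (∣ᴬ-* c p) (∣ᴬ-* (- (k * f)) (1# , sym (*-identityʳ π)))))

  -- If u f = π g, then u divides π g, so g = u h, and the regular element u cancels to give f = π
  -- h. This transfers what is known modulo 1 - q^j to the moduli `πₐ` and `πᵦ`.
  cancels-swap : ∀ {π u} → Regular u → Cancels u π → Cancels π u
  cancels-swap {π} {u} ru cπ f (g , eq) with cπ g (f , sym eq)
  ... | h , g≈uh = h , regular-cancel ru (begin
    u * f ≈⟨ eq ⟩
    π * g ≈⟨ *-congˡ g≈uh ⟩
    π * (u * h) ≈⟨ solve 3 (λ π u h → π :* (u :* h) := u :* (π :* h)) refl π u h ⟩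
    u * (π * h) ∎)

  πₐ πᵦ : ℕ → Carrier
  πₐ n = 1# - xᴬ * qᴬ ^ n
  πᵦ n = xᴬ - qᴬ ^ n

  cancelsₐ-1-q^ : ∀ n j → Cancels (πₐ n) (1# - qᴬ ^ suc j)
  cancelsₐ-1-q^ n j = cancels-swap (regular-1-q^ j) λ f → 1-xq^-cancel (suc j) n f

  cancelsᵦ-1-q^ : ∀ n j → Cancels (πᵦ n) (1# - qᴬ ^ suc j)
  cancelsᵦ-1-q^ n j = cancels-swap (regular-1-q^ j) λ f → x-q^-cancel (suc j) n f

  suc∸ : ∀ {b n} → b < n → ∃ λ k → n ≡.≡ b ℕ.+ suc k
  suc∸ {b} {n} b<n = n ∸ suc b , ≡.sym (≡.trans (ℕₚ.+-suc b (n ∸ suc b)) (ℕₚ.m+[n∸m]≡n b<n))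

  -- Where x q^n = 1, the element 1 - x q^b is, up to a sign and a power of q, equal to 1 - q^|n-b|.
  cancelsₐ-1-xq^ : ∀ n b → ¬ b ≡.≡ n → Cancels (πₐ n) (1# - xᴬ * qᴬ ^ b)
  cancelsₐ-1-xq^ n b b≢n with ℕₚ.<-cmp b n
  ... | tri≈ _ eq _ = contradiction eq b≢n
  ... | tri< b<n _ _ with suc∸ b<n
  ... | k , ≡.refl = cancels-mod (qᴬ ^ suc k) (- (1# - qᴬ ^ suc k)) 1# (begin
      Q * (1# - xᴬ * B) ≈⟨ solve 3 (λ Q x B → Q :* (con (+ 1) :- x :* B) := :- (con (+ 1) :- Q) :+ (con (+ 1) :- x :* (B :* Q)) :* con (+ 1)) refl Q xᴬ B ⟩
      - (1# - Q) + (1# - xᴬ * (B * Q)) * 1# ≈⟨ +-congˡ (*-congʳ (+-congˡ (-‿cong (*-congˡ (^-homo-* qᴬ b (suc k)))))) ⟨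
      - (1# - Q) + πₐ (b ℕ.+ suc k) * 1# ∎) (cancels-neg {w = 1# - Q} (cancelsₐ-1-q^ (b ℕ.+ suc k) k))
    where
    Q = qᴬ ^ suc k
    B = qᴬ ^ b
  cancelsₐ-1-xq^ n b b≢n | tri> _ _ n<b with suc∸ n<b
  ... | k , ≡.refl = cancels-mod 1# (1# - qᴬ ^ suc k) (qᴬ ^ suc k) (begin
      1# * (1# - xᴬ * qᴬ ^ (n ℕ.+ suc k)) ≈⟨ *-congˡ (+-congˡ (-‿cong (*-congˡ (^-homo-* qᴬ n (suc k))))) ⟩
      1# * (1# - xᴬ * (qᴬ ^ n * Q)) ≈⟨ solve 3 (λ Q x B → con (+ 1) :* (con (+ 1) :- x :* (B :* Q)) := (con (+ 1) :- Q) :+ (con (+ 1) :- x :* B) :* Q) refl Q xᴬ (qᴬ ^ n) ⟩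
      (1# - Q) + πₐ n * Q ∎) (cancelsₐ-1-q^ n k)
    where
    Q = qᴬ ^ suc k

  -- Multiplied by q^(n+1), x - q^b becomes 1 - q^(n+1+b), whose exponent is positive whatever b is.
  cancelsₐ-x-q^ : ∀ n b → Cancels (πₐ (suc n)) (xᴬ - qᴬ ^ b)
  cancelsₐ-x-q^ n b = cancels-mod (qᴬ ^ suc n) (1# - qᴬ ^ (suc n ℕ.+ b)) (- 1#) (begin
    Q * (xᴬ - B) ≈⟨ solve 3 (λ Q x B → Q :* (x :- B) := (con (+ 1) :- Q :* B) :+ (con (+ 1) :- x :* Q) :* :- con (+ 1)) refl Q xᴬ B ⟩
    (1# - Q * B) + πₐ (suc n) * - 1# ≈⟨ +-congʳ (+-congˡ (-‿cong (^-homo-* qᴬ (suc n) b))) ⟨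
    (1# - qᴬ ^ (suc n ℕ.+ b)) + πₐ (suc n) * - 1# ∎) (cancelsₐ-1-q^ (suc n) (n ℕ.+ b))
    where
    Q = qᴬ ^ suc n
    B = qᴬ ^ b

  divide-q : ∀ g → (∀ i → ↓ g i 0 ≡.≡ + 0) → qᴬ ∣ᴬ g
  divide-q g g0 = h , ↓-inj eq
    where
    shifted : PolynomialRing.Z[x,q]
    shifted = (λ i j → ↓ g i (suc j)) , proj₁ (↓-isPoly g) , λ i j le → proj₂ (↓-isPoly g) i (suc j) (ℕₚ.≤-trans le (ℕₚ.+-monoʳ-≤ i (ℕₚ.n≤1+n j)))
    h = ↑ (proj₁ shifted) (proj₂ shifted)
    eq : ↓ g Defs.≈ ↓ (qᴬ * h)
    eq i zero = ≡.trans (g0 i) (≡.sym (q*-zero h i))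
    eq i (suc j) = ≡.sym (≡.trans (q*-suc h i j) (↓↑ _ (proj₂ shifted) i j))

  -- After the swap, the claim is that x - q^(n+1) is regular modulo q, where it is just x: if q
  -- divides x g, the part of g free of q vanishes.
  cancelsᵦ-q : ∀ n → Cancels (πᵦ (suc n)) qᴬ
  cancelsᵦ-q n = cancels-swap regular-q λ g (f , eq) → divide-q g λ i → ≡.trans (≡.sym (x*-suc g i 0)) (≡.trans
    (↓-cong (begin
      xᴬ * g ≈⟨ solve 4 (λ x q Q g → x :* g := (x :- q :* Q) :* g :+ q :* (Q :* g)) refl xᴬ qᴬ (qᴬ ^ n) g ⟩
      πᵦ (suc n) * g + qᴬ * (qᴬ ^ n * g) ≈⟨ +-congʳ eq ⟩
      qᴬ * f + qᴬ * (qᴬ ^ n * g) ≈⟨ distribˡ _ _ _ ⟨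
      qᴬ * (f + qᴬ ^ n * g) ∎) (suc i) 0) (q*-zero (f + qᴬ ^ n * g) (suc i)))

  cancels-1 : ∀ {π} → Cancels π 1#
  cancels-1 f p = ∣ᴬ-cong (*-identityˡ f) p

  cancelsᵦ-q^ : ∀ n k → Cancels (πᵦ (suc n)) (qᴬ ^ k)
  cancelsᵦ-q^ n zero = cancels-1
  cancelsᵦ-q^ n (suc k) = cancels-* {v = qᴬ} (cancelsᵦ-q n) (cancelsᵦ-q^ n k)

  cancelsᵦ-x-q^ : ∀ n b → ¬ b ≡.≡ suc n → Cancels (πᵦ (suc n)) (xᴬ - qᴬ ^ b)
  cancelsᵦ-x-q^ n b b≢n with ℕₚ.<-cmp b (suc n)
  ... | tri≈ _ eq _ = contradiction eq b≢n
  ... | tri< b<n _ _ with suc∸ b<n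
  ... | k , eq = cancels-mod 1# (- (B * (1# - Q))) 1# (begin
      1# * (xᴬ - B) ≈⟨ solve 3 (λ x B Q → con (+ 1) :* (x :- B) := :- (B :* (con (+ 1) :- Q)) :+ (x :- B :* Q) :* con (+ 1)) refl xᴬ B Q ⟩
      - (B * (1# - Q)) + (xᴬ - B * Q) * 1# ≈⟨ +-congˡ (*-congʳ (+-congˡ (-‿cong (trans (sym (^-homo-* qᴬ b (suc k))) (reflexive (≡.cong (qᴬ ^_) (≡.sym eq))))))) ⟩
      - (B * (1# - Q)) + πᵦ (suc n) * 1# ∎)
      (cancels-neg {w = B * (1# - Q)} (cancels-* {v = B} (cancelsᵦ-q^ n b) (cancelsᵦ-1-q^ (suc n) k)))
    where
    Q = qᴬ ^ suc k
    B = qᴬ ^ b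
  cancelsᵦ-x-q^ n b b≢n | tri> _ _ n<b with suc∸ n<b
  ... | k , ≡.refl = cancels-mod 1# (B * (1# - Q)) 1# (begin
      1# * (xᴬ - qᴬ ^ (suc n ℕ.+ suc k)) ≈⟨ *-congˡ (+-congˡ (-‿cong (^-homo-* qᴬ (suc n) (suc k)))) ⟩
      1# * (xᴬ - B * Q) ≈⟨ solve 3 (λ x B Q → con (+ 1) :* (x :- B :* Q) := B :* (con (+ 1) :- Q) :+ (x :- B) :* con (+ 1)) refl xᴬ B Q ⟩
      B * (1# - Q) + πᵦ (suc n) * 1# ∎) (cancels-* {v = B} (cancelsᵦ-q^ n (suc n)) (cancelsᵦ-1-q^ (suc n) k))
    where
    Q = qᴬ ^ suc k
    B = qᴬ ^ suc n

  cancelsᵦ-1-xq^ : ∀ n b → Cancels (πᵦ (suc n)) (1# - xᴬ * qᴬ ^ b)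
  cancelsᵦ-1-xq^ n b = cancels-mod 1# (1# - qᴬ ^ (suc n ℕ.+ b)) (- B) (begin
    1# * (1# - xᴬ * B) ≈⟨ solve 3 (λ x B Q → con (+ 1) :* (con (+ 1) :- x :* B) := (con (+ 1) :- Q :* B) :+ (x :- Q) :* :- B) refl xᴬ B (qᴬ ^ suc n) ⟩
    (1# - qᴬ ^ suc n * B) + πᵦ (suc n) * - B ≈⟨ +-congʳ (+-congˡ (-‿cong (^-homo-* qᴬ (suc n) b))) ⟨
    (1# - qᴬ ^ (suc n ℕ.+ b)) + πᵦ (suc n) * - B ∎) (cancelsᵦ-1-q^ (suc n) (n ℕ.+ b))
    where B = qᴬ ^ b

  offRoots : List ℕ → Carrier
  offRoots [] = 1#
  offRoots (j ∷ js) = (1# - qᴬ ^ j) * offRoots js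

  offRoots-++ : ∀ js ks → offRoots (js ++ ks) ≈ offRoots js * offRoots ks
  offRoots-++ [] ks = sym (*-identityˡ _)
  offRoots-++ (j ∷ js) ks = trans (*-congˡ (offRoots-++ js ks)) (sym (*-assoc _ _ _))

  -- f vanishes at the primitive d-th roots of unity: this form avoids cyclotomic polynomials.
  VanishesAt : ℕ → Carrier → Set
  VanishesAt d f = ∃ λ js → All (λ j → ¬ d ∣ₙ j) js × (1# - qᴬ ^ d) ∣ᴬ offRoots js * f

  vanishing : ℕ → Ideal A
  vanishing d = record
    { Member = VanishesAt d
    ; resp = λ eq (js , off , p) → js , off , ∣ᴬ-cong (*-congˡ eq) p
    ; +-closed = λ {a} {b} (js , off , p) (ks , off′ , r) → js ++ ks , Allₚ.++⁺ off off′ , ∣ᴬ-cong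
        (trans (solve 4 (λ J K a b → K :* (J :* a) :+ J :* (K :* b) := (J :* K) :* (a :+ b)) refl (offRoots js) (offRoots ks) a b) (*-congʳ (sym (offRoots-++ js ks))))
        (∣ᴬ-+ (∣ᴬ-* (offRoots ks) p) (∣ᴬ-* (offRoots js) r))
    ; *-closed = λ c {a} (js , off , p) → js , off , ∣ᴬ-cong (solve 3 (λ c J a → c :* (J :* a) := J :* (c :* a)) refl c (offRoots js) a) (∣ᴬ-* c p)
    ; 0-member = [] , [] , 0# , solve 1 (λ u → con (+ 1) :* con (+ 0) := u :* con (+ 0)) refl (1# - qᴬ ^ d) }

  cancels⇒vanishing : ∀ {d w} → Cancels (1# - qᴬ ^ d) w → ∀ f → VanishesAt d (w * f) → VanishesAt d f
  cancels⇒vanishing {w = w} cw f (js , off , p) = js , off , cw _ (∣ᴬ-cong (solve 3 (λ J w f → J :* (w :* f) := w :* (J :* f)) refl (offRoots js) w f) p)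

  -- A factor that is non-zero at the primitive d-th roots of unity simply joins the list.
  off⇒vanishing : ∀ {d j} → ¬ d ∣ₙ j → ∀ f → VanishesAt d ((1# - qᴬ ^ j) * f) → VanishesAt d f
  off⇒vanishing {j = j} d∤j f (js , off , p) = j ∷ js , d∤j ∷ off ,
    ∣ᴬ-cong (solve 3 (λ J w f → J :* (w :* f) := (w :* J) :* f) refl (offRoots js) (1# - qᴬ ^ j) f) p

  cancels-natural : ∀ d c → .{{NonZero d}} → Cancels (1# - qᴬ ^ d) (natural (suc c))
  cancels-natural d c f = natural-cancel d c f

  bracket≈natural : ∀ d c → (1# - qᴬ ^ d) ∣ᴬ (natural c - ∑ c ((qᴬ ^ d) ^_))
  bracket≈natural d zero = 0# , solve 1 (λ u → con (+ 0) :- con (+ 0) := u :* con (+ 0)) refl (1# - qᴬ ^ d)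
  bracket≈natural d (suc c) = ∣ᴬ-cong (solve 3 (λ n b p → (n :- b) :+ (con (+ 1) :- p) := (n :+ con (+ 1)) :- (b :+ p)) refl (natural c) (∑ c ((qᴬ ^ d) ^_)) ((qᴬ ^ d) ^ c))
    (∣ᴬ-+ (bracket≈natural d c) (1-a∣1-a^n (qᴬ ^ d) c))

  cancels-bracket : ∀ d c → .{{NonZero d}} → Cancels (1# - qᴬ ^ d) (∑ (suc c) ((qᴬ ^ d) ^_))
  cancels-bracket d c with bracket≈natural d (suc c)
  ... | k , eq = cancels-mod 1# (natural (suc c)) (- k) (begin
    1# * B ≈⟨ solve 2 (λ n b → con (+ 1) :* b := n :- (n :- b)) refl (natural (suc c)) B ⟩
    natural (suc c) - (natural (suc c) - B) ≈⟨ +-congˡ (-‿cong eq) ⟩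
    natural (suc c) - (1# - qᴬ ^ d) * k ≈⟨ solve 3 (λ n u k → n :- u :* k := n :+ u :* :- k) refl _ _ k ⟩
    natural (suc c) + (1# - qᴬ ^ d) * - k ∎) (cancels-natural d c)
    where B = ∑ (suc c) ((qᴬ ^ d) ^_)

  1-q^-mult : ∀ j a → (1# - qᴬ ^ j) ∣ᴬ (1# - qᴬ ^ (a ℕ.* j))
  1-q^-mult j a = ∣ᴬ-cong (+-congˡ (-‿cong (reflexive (≡.cong (qᴬ ^_) (ℕₚ.*-comm j a))))) (1-q^j∣1-q^jm j a)

  -- By Bézout, 1 - q^j divides 1 - q^gcd(j,n) modulo 1 - q^n.
  gcd-mod : ∀ j n f → (1# - qᴬ ^ n) ∣ᴬ (1# - qᴬ ^ j) * f → (1# - qᴬ ^ n) ∣ᴬ (1# - qᴬ ^ gcd j n) * f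
  gcd-mod j n f p with Bézout.identity (gcd-GCD j n)
  ... | Bézout.+- a b eq = ∣ᴬ-cong (begin
      k * ((1# - qᴬ ^ j) * f) + - (qᴬ ^ g * f) * (1# - qᴬ ^ (b ℕ.* n))
        ≈⟨ solve 5 (λ k u f G B → k :* (u :* f) :+ :- (G :* f) :* (con (+ 1) :- B) := (u :* k) :* f :- G :* f :+ (G :* B) :* f) refl k (1# - qᴬ ^ j) f (qᴬ ^ g) (qᴬ ^ (b ℕ.* n)) ⟩
      ((1# - qᴬ ^ j) * k) * f - qᴬ ^ g * f + (qᴬ ^ g * qᴬ ^ (b ℕ.* n)) * f
        ≈⟨ +-cong (+-congʳ (*-congʳ (sym (proj₂ (1-q^-mult j a))))) (*-congʳ (trans (sym (^-homo-* qᴬ g (b ℕ.* n))) (reflexive (≡.cong (qᴬ ^_) eq)))) ⟩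
      (1# - qᴬ ^ (a ℕ.* j)) * f - qᴬ ^ g * f + qᴬ ^ (a ℕ.* j) * f
        ≈⟨ solve 3 (λ P G f → (con (+ 1) :- P) :* f :- G :* f :+ P :* f := (con (+ 1) :- G) :* f) refl (qᴬ ^ (a ℕ.* j)) (qᴬ ^ g) f ⟩
      (1# - qᴬ ^ g) * f ∎) (∣ᴬ-+ (∣ᴬ-* k p) (∣ᴬ-* (- (qᴬ ^ g * f)) (1-q^-mult n b)))
    where
    g = gcd j n
    k = proj₁ (1-q^-mult j a)
  ... | Bézout.-+ a b eq = ∣ᴬ-cong (begin
      (- (qᴬ ^ g * k)) * ((1# - qᴬ ^ j) * f) + f * (1# - qᴬ ^ (b ℕ.* n))
        ≈⟨ solve 5 (λ k u f G B → (:- (G :* k)) :* (u :* f) :+ f :* (con (+ 1) :- B) := f :- B :* f :- (G :* (u :* k)) :* f) refl k (1# - qᴬ ^ j) f (qᴬ ^ g) (qᴬ ^ (b ℕ.* n)) ⟩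
      f - qᴬ ^ (b ℕ.* n) * f - (qᴬ ^ g * ((1# - qᴬ ^ j) * k)) * f
        ≈⟨ +-cong (+-congˡ (-‿cong (*-congʳ (trans (reflexive (≡.cong (qᴬ ^_) (≡.sym eq))) (^-homo-* qᴬ g (a ℕ.* j)))))) (-‿cong (*-congʳ (*-congˡ (sym (proj₂ (1-q^-mult j a)))))) ⟩
      f - (qᴬ ^ g * qᴬ ^ (a ℕ.* j)) * f - (qᴬ ^ g * (1# - qᴬ ^ (a ℕ.* j))) * f
        ≈⟨ solve 3 (λ P G f → f :- (G :* P) :* f :- (G :* (con (+ 1) :- P)) :* f := (con (+ 1) :- G) :* f) refl (qᴬ ^ (a ℕ.* j)) (qᴬ ^ g) f ⟩
      (1# - qᴬ ^ g) * f ∎) (∣ᴬ-+ (∣ᴬ-* (- (qᴬ ^ g * k)) p) (∣ᴬ-* f (1-q^-mult n b)))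
    where
    g = gcd j n
    k = proj₁ (1-q^-mult j a)

  -- Let g = gcd(j, n) and 1 - q^n = (1 - q^g) B. From F = (1 - q^g) F′ follows B F = (1 - q^n) F′,
  -- and `gcd-mod` shows that 1 - q^n divides (1 - q^g) F. As B is the integer n/g modulo 1 - q^g, 1
  -- - q^n divides (n/g) F, and the integer can be cancelled.
  cancel-off : ∀ n j F → .{{NonZero n}} → (1# - qᴬ ^ gcd j n) ∣ᴬ F → (1# - qᴬ ^ n) ∣ᴬ (1# - qᴬ ^ j) * F → (1# - qᴬ ^ n) ∣ᴬ F
  cancel-off n j F {{n≢0}} (F′ , F≈) p with gcd[m,n]∣n j n
  ... | divides zero eq = contradiction eq (ℕ.≢-nonZero⁻¹ n)
  ... | divides (suc c) eq = cancels-natural n c F (∣ᴬ-cong (begin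
      (F′ * (1# - qᴬ ^ n)) + (proj₁ B) * ((1# - qᴬ ^ g) * F)
        ≈⟨ +-cong (trans (*-congˡ geometric) (trans (solve 3 (λ F′ u b → F′ :* (u :* b) := b :* (u :* F′)) refl F′ (1# - qᴬ ^ g) bracket) (*-congˡ (sym F≈))))
             (trans (solve 3 (λ b u F → b :* (u :* F) := (u :* b) :* F) refl (proj₁ B) (1# - qᴬ ^ g) F) (*-congʳ (sym (proj₂ B)))) ⟩
      bracket * F + (natural (suc c) - bracket) * F ≈⟨ solve 3 (λ b n F → b :* F :+ (n :- b) :* F := n :* F) refl bracket (natural (suc c)) F ⟩
      natural (suc c) * F ∎)
      (∣ᴬ-+ (∣ᴬ-* F′ (1# , sym (*-identityʳ _))) (∣ᴬ-* (proj₁ B) (gcd-mod j n F p))))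
    where
    g = gcd j n
    bracket = ∑ (suc c) ((qᴬ ^ g) ^_)
    B = bracket≈natural g (suc c)
    geometric : 1# - qᴬ ^ n ≈ (1# - qᴬ ^ g) * bracket
    geometric = sym (trans (geom (qᴬ ^ g) (suc c)) (+-congˡ (-‿cong (trans (^-assocʳ qᴬ g (suc c)) (reflexive (≡.cong (qᴬ ^_) (≡.trans (ℕₚ.*-comm g (suc c)) (≡.sym eq))))))))

  gcd<n : ∀ j n → .{{NonZero n}} → ¬ n ∣ₙ j → gcd j n < n
  gcd<n j n n∤j = ℕₚ.≤∧≢⇒< (ℕ∣.∣⇒≤ (gcd[m,n]∣n j n)) λ eq → n∤j (≡.subst (_∣ₙ j) eq (gcd[m,n]∣m j n))

  -- Strong induction on n: the list obtained for d = n is emptied factor by factor. For j in it,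
  -- gcd(j, n) < n, and the induction hypothesis for the gcd is the first premise of `cancel-off`.
  -- The factor 1 - q accounts for d = 1.
  vanishes⇒∣ : ∀ n → .{{NonZero n}} → ∀ f → (∀ d → d ∣ₙ n → 1 < d → VanishesAt d f) → (1# - qᴬ ^ n) ∣ᴬ (1# - qᴬ) * f
  vanishes⇒∣ n {{n≢0}} = <-rec Claim rec n n≢0
    where
    Claim : ℕ → Set
    Claim n = .(NonZero n) → ∀ f → (∀ d → d ∣ₙ n → 1 < d → VanishesAt d f) → (1# - qᴬ ^ n) ∣ᴬ (1# - qᴬ) * f
    rec : ∀ n → (∀ {m} → m < n → Claim m) → Claim n
    rec zero ih ()
    rec (suc zero) ih _ f van = ∣ᴬ-cong (*-congʳ (+-congˡ (-‿cong (*-identityʳ qᴬ)))) (∣ᴬ-refl-* (1# - qᴬ ^ 1) f)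
    rec n@(suc (suc _)) ih _ f van with van n ℕ∣.∣-refl (s≤s (s≤s z≤n))
    ... | js , off , p = remove js off (∣ᴬ-cong (solve 3 (λ u J f → u :* (J :* f) := J :* (u :* f)) refl (1# - qᴬ) (offRoots js) f) (∣ᴬ-* (1# - qᴬ) p))
      where
      remove : ∀ js → All (λ j → ¬ n ∣ₙ j) js → (1# - qᴬ ^ n) ∣ᴬ offRoots js * ((1# - qᴬ) * f) → (1# - qᴬ ^ n) ∣ᴬ (1# - qᴬ) * f
      remove [] [] p = ∣ᴬ-cong (*-identityˡ _) p
      remove (j ∷ js) (n∤j ∷ off) p = remove js off (cancel-off n j (offRoots js * ((1# - qᴬ) * f))
        (∣ᴬ-* (offRoots js) (ih (gcd<n j n n∤j) (ℕ.≢-nonZero (gcd[m,n]≢0 j n (inj₂ λ ()))) f λ d d∣g → van d (ℕ∣.∣-trans d∣g (gcd[m,n]∣n j n))))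
        (∣ᴬ-cong (*-assoc _ _ _) p))

-- From values modulo an ideal to membership of numerators.

module Comparison where
  open import Defs using (RF; Poly; _⊗_)
  import Defs
  open PolynomialRing
  open FractionValues
  open Regularity
  open Representation
  open import Data.Nat.Base as ℕ using (ℕ; suc)
  open import Data.Nat.Divisibility as ℕ∣ using () renaming (_∣_ to _∣ₙ_)
  open import Data.Integer.Base as ℤ using (+_)
  open import Data.Product using (_,_; proj₁; proj₂)

  summand-cong : (R : CommutativeRing 0ℓ 0ℓ) → let open CommutativeRing R in ∀ s′ {q q′ w w′} → q ≈ q′ → (∀ j → w j ≈ w′ j) →
    ∀ k → Summands.αᵣ R q s′ w k ≈ Summands.αᵣ R q′ s′ w′ k
  summand-cong R s′ q≈ w≈ k = *-cong (*-cong (*-congˡ (^-congˡ (qExponent s′ k) q≈)) (∑-cong (2 ℕ.* suc s′ ℕ.* k ℕ.+ 1) λ i → ^-congˡ i q≈)) (∏-cong k w≈)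
    where open RingTools R

  factorᴬ : 𝔸.Carrier → 𝔸.Carrier
  factorᴬ b = (𝔸.1# 𝔸.- xᴬ 𝔸.* b) 𝔸.* (xᴬ 𝔸.- b) 𝔸.* (𝔸.1# 𝔸.- b)

  q^_ : ℕ → 𝔸.Carrier
  q^ k = qᴬ 𝔸.^ k

  module FactorHom {B : CommutativeRing 0ℓ 0ℓ} (φ : RingHom A B) (φ-cong : ∀ {a b} → a 𝔸.≈ b → CommutativeRing._≈_ B (RingHom.⟦_⟧ φ a) (RingHom.⟦_⟧ φ b)) where
    open HomProperties φ
    open RingTools B

    factorᴮ : Carrier → Carrier
    factorᴮ b = (1# - ⟦ xᴬ ⟧ * b) * (⟦ xᴬ ⟧ - b) * (1# - b)

    1-homo′ : ∀ {a b} → ⟦ a ⟧ ≈ b → ⟦ 𝔸.1# 𝔸.- a ⟧ ≈ 1# - b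
    1-homo′ {a} eq = trans (1-sub-homo a) (+-congˡ (-‿cong eq))

    1-x-homo : ∀ {a b} → ⟦ a ⟧ ≈ b → ⟦ 𝔸.1# 𝔸.- xᴬ 𝔸.* a ⟧ ≈ 1# - ⟦ xᴬ ⟧ * b
    1-x-homo eq = 1-homo′ (trans (*-homo _ _) (*-congˡ eq))

    x-homo : ∀ {a b} → ⟦ a ⟧ ≈ b → ⟦ xᴬ 𝔸.- a ⟧ ≈ ⟦ xᴬ ⟧ - b
    x-homo {a} eq = trans (sub-homo _ a) (+-congˡ (-‿cong eq))

    factor-homo : ∀ {a b} → ⟦ a ⟧ ≈ b → ⟦ factorᴬ a ⟧ ≈ factorᴮ b
    factor-homo eq = trans (*-homo _ _) (*-cong (trans (*-homo _ _) (*-cong (1-x-homo eq) (x-homo eq))) (1-homo′ eq))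

    q^s-homo : ∀ s j → ⟦ q^ (s ℕ.* j) ⟧ ≈ (⟦ qᴬ ⟧ ^ s) ^ j
    q^s-homo s j = trans (^-homo qᴬ (s ℕ.* j)) (sym (^-assocʳ ⟦ qᴬ ⟧ s j))

    q^1+s-homo : ∀ s j → ⟦ q^ suc (s ℕ.* j) ⟧ ≈ ⟦ qᴬ ⟧ * (⟦ qᴬ ⟧ ^ s) ^ j
    q^1+s-homo s j = trans (*-homo _ _) (*-congˡ (q^s-homo s j))

  regular-factor : ∀ k → E.Regular (factorᴬ (q^ suc k))
  regular-factor k = E.regular-* (E.regular-* (regular-1-xq^ _) (regular-x-q^ (suc k))) (regular-1-q^ k)

  module Compare (I : Ideal A) where
    open Ideal I
    module T = Fractions A I
    module 𝕋 = T.F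

    ιᵀ : RingHom A T.fractionRing
    ιᵀ = record { ⟦_⟧ = T.ιᶠ ; +-homo = T.ι-+ ; *-homo = T.ι-* ; neg-homo = T.ι-neg ; 0-homo = T.ι-0 ; 1-homo = T.ι-1 }

    ⟦_⟧ᴱ : 𝕋.Carrier → 𝔼.Carrier
    ⟦ r ⟧ᴱ = E.frac (T.numer r) (T.denom r) (regular⇒admissible (proj₁ (T.denom-admissible r)))

    numerᴱ : ∀ r → E.numer ⟦ r ⟧ᴱ 𝔸.≈ T.numer r
    numerᴱ r = E.numer-frac _ _ _

    denomᴱ : ∀ r → E.denom ⟦ r ⟧ᴱ 𝔸.≈ T.denom r
    denomᴱ r = E.denom-frac _ _ _

    same : ∀ {e f n d} → E.numer e 𝔸.≈ n → E.denom e 𝔸.≈ d → E.numer f 𝔸.≈ n → E.denom f 𝔸.≈ d → e 𝔼.≈ f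
    same p r p′ r′ = E.cross⇒≈ (𝔸.*-cong (𝔸.trans p (𝔸.sym p′)) (𝔸.trans r′ (𝔸.sym r)))

    -- Forgetting the ideal respects the operations, but not equality modulo the ideal.
    forget : RingHom T.fractionRing E.fractionRing
    forget = record
      { ⟦_⟧ = ⟦_⟧ᴱ
      ; +-homo = λ r t → same (𝔸.trans (numerᴱ _) (T.numer-+ r t)) (𝔸.trans (denomᴱ _) (T.denom-+ r t))
          (𝔸.trans (E.numer-+ _ _) (𝔸.+-cong (𝔸.*-cong (numerᴱ r) (denomᴱ t)) (𝔸.*-cong (numerᴱ t) (denomᴱ r)))) (𝔸.trans (E.denom-+ _ _) (𝔸.*-cong (denomᴱ r) (denomᴱ t)))
      ; *-homo = λ r t → same (𝔸.trans (numerᴱ _) (T.numer-* r t)) (𝔸.trans (denomᴱ _) (T.denom-* r t))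
          (𝔸.trans (E.numer-* _ _) (𝔸.*-cong (numerᴱ r) (numerᴱ t))) (𝔸.trans (E.denom-* _ _) (𝔸.*-cong (denomᴱ r) (denomᴱ t)))
      ; neg-homo = λ r → same (𝔸.trans (numerᴱ _) (T.numer-neg r)) (𝔸.trans (denomᴱ _) (T.denom-neg r))
          (𝔸.trans (E.numer-neg _) (𝔸.-‿cong (numerᴱ r))) (𝔸.trans (E.denom-neg _) (denomᴱ r))
      ; 0-homo = 𝔼.trans (forget-≈ T.ι-0′) E.ι-0
      ; 1-homo = 𝔼.trans (forget-≈ T.ι-1′) E.ι-1 }
      where
      forget-≈ : ∀ {r a} → T.numer r 𝔸.* 𝔸.1# 𝔸.≈ a 𝔸.* T.denom r → ⟦ r ⟧ᴱ 𝔼.≈ E.ιᶠ a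
      forget-≈ {r} {a} eq = E.cross⇒≈ (𝔸.trans (𝔸.*-cong (numerᴱ r) (E.denom-ι a)) (𝔸.trans eq (𝔸.sym (𝔸.*-cong (E.numer-ι a) (denomᴱ r)))))

    module forget = HomProperties forget

    forget-ι : ∀ a → ⟦ T.ιᶠ a ⟧ᴱ 𝔼.≈ E.ιᶠ a
    forget-ι a = same (𝔸.trans (numerᴱ _) (T.numer-ι a)) (𝔸.trans (denomᴱ _) (T.denom-ι a)) (E.numer-ι a) (E.denom-ι a)

    forget-frac : ∀ a b (s : T.Admissible b) (r : E.Regular b) → ⟦ T.frac a b s ⟧ᴱ 𝔼.≈ E.frac a b (regular⇒admissible r)
    forget-frac a b s r = same (𝔸.trans (numerᴱ _) (T.numer-frac a b s)) (𝔸.trans (denomᴱ _) (T.denom-frac a b s)) (E.numer-frac a b _) (E.denom-frac a b _)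

    -- Cancelling the denominator of r gives a₂·`numer τ` = `denom τ`·a₁. The left side lies in the
    -- ideal, and `denom τ` is regular modulo it.
    conclude : ∀ {r} τ → Represents r ⟦ τ ⟧ᴱ → τ 𝕋.≈ 𝕋.0# → ∀ a₁ a₂ → proj₁ r ⊗ ↓ a₂ Defs.≈ ↓ a₁ ⊗ proj₂ r → Member a₁
    conclude τ (represents u v pu pv rv eq) τ≈0 a₁ a₂ cross = proj₂ (T.denom-admissible τ) a₁
      (resp (regular-cancel rv (begin
        v 𝔸.* (a₂ 𝔸.* T.numer τ) ≈⟨ solve 3 (λ v a n → v :* (a :* n) := a :* (n :* v)) 𝔸.refl v a₂ (T.numer τ) ⟩
        a₂ 𝔸.* (T.numer τ 𝔸.* v) ≈⟨ 𝔸.*-congˡ (𝔸.trans (𝔸.*-congʳ (𝔸.sym (numerᴱ τ))) (𝔸.trans (𝔸.sym eq) (𝔸.*-congˡ (denomᴱ τ)))) ⟩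
        a₂ 𝔸.* (u 𝔸.* T.denom τ) ≈⟨ solve 3 (λ a u d → a :* (u :* d) := d :* (u :* a)) 𝔸.refl a₂ u (T.denom τ) ⟩
        T.denom τ 𝔸.* (u 𝔸.* a₂) ≈⟨ 𝔸.*-congˡ (↤-inj (↤-⊗ pu ≈-refl) (↤-⊗ ≈-refl pv) cross) ⟩
        T.denom τ 𝔸.* (a₁ 𝔸.* v) ≈⟨ solve 3 (λ d a v → d :* (a :* v) := v :* (d :* a)) 𝔸.refl (T.denom τ) a₁ v ⟩
        v 𝔸.* (T.denom τ 𝔸.* a₁) ∎)) (*-closed a₂ (T.numer-member τ≈0)))
      where
      open import Relation.Binary.Reasoning.Setoid 𝔸.setoid
      open 𝔸 using (solve; _:=_; _:*_)

  module Setting (s′ : ℕ) where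
    s : ℕ
    s = suc s′

    wᴱ : ℕ → 𝔼.Carrier
    -- `s * suc j` reduces to `suc (j + s′ * suc j)`, the positive exponent that `regular-factor`
    -- expects.
    wᴱ j = E.frac (factorᴬ (q^ suc (s ℕ.* j))) (factorᴬ (q^ (s ℕ.* suc j))) (regular⇒admissible (regular-factor (j ℕ.+ s′ ℕ.* suc j)))

    module FE = FactorHom ιᴱ E.ι-cong

    wᴱ-ratio : ∀ j → wᴱ j 𝔼.* FE.factorᴮ ((qᴱ 𝔼.^ s) 𝔼.^ suc j) 𝔼.≈ FE.factorᴮ (qᴱ 𝔼.* (qᴱ 𝔼.^ s) 𝔼.^ j)
    wᴱ-ratio j = 𝔼.trans (𝔼.*-congˡ (𝔼.sym (FE.factor-homo (FE.q^s-homo s (suc j))))) (𝔼.trans (E.frac-denom _ _ _) (FE.factor-homo (FE.q^1+s-homo s j)))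

    open RepresentSum s′ wᴱ using (rep-total)
    open Summands E.fractionRing qᴱ s′ wᴱ using () renaming (αᵣ to αᴱ)

    difference : ℕ → ℕ → Poly → RF
    difference N n f = Defs.sumʳ n (Defs.t s N) Defs.-ʳ Defs.poly f

    -- It is asked of every fraction a₁/a₂ equal to the difference, so that the factors of the
    -- modulus can be treated before lowest terms are chosen.
    NumeratorIn : Ideal A → ℕ → ℕ → Poly → Set
    NumeratorIn I N n f = ∀ a₁ a₂ → proj₁ (difference N n f) ⊗ ↓ a₂ Defs.≈ ↓ a₁ ⊗ proj₂ (difference N n f) → Ideal.Member I a₁

    module Conclude (I : Ideal A) (N n : ℕ) where
      open Compare I public
      module TC = Convolution T.fractionRing

      -- The sum is computed modulo the ideal, and `forget` carries the same expression to its exact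
      -- value. Any β with exact values α(k) will do, which leaves room to cancel factors that
      -- vanish at the point.
      membership : (β : ℕ → 𝕋.Carrier) → (∀ k → ⟦ β k ⟧ᴱ 𝔼.≈ αᴱ k) → ∀ {f} c → f ↤ c →
        𝕋.∑ n (TC.power β N) 𝕋.≈ T.ιᶠ c →
        NumeratorIn I N n f
      membership β β≈ c f↤c eq = conclude (𝕋.∑ n (TC.power β N) 𝕋.- T.ιᶠ c)
        (rep-≈ (rep-- (rep-total wᴱ-ratio N n) (rep-poly f↤c)) (begin
          𝔼.∑ n (EC.power αᴱ N) 𝔼.- E.ιᶠ c ≈⟨ 𝔼.+-cong (𝔼.∑-cong n (EC.power-cong N (λ k → 𝔼.sym (β≈ k)))) (𝔼.-‿cong (𝔼.sym (forget-ι c))) ⟩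
          𝔼.∑ n (EC.power (λ k → ⟦ β k ⟧ᴱ) N) 𝔼.- ⟦ T.ιᶠ c ⟧ᴱ ≈⟨ 𝔼.+-congʳ (𝔼.∑-cong n (λ k → forget.power-homo β N k)) ⟨
          𝔼.∑ n (λ k → ⟦ TC.power β N k ⟧ᴱ) 𝔼.- ⟦ T.ιᶠ c ⟧ᴱ ≈⟨ 𝔼.+-congʳ (forget.∑-homo n (TC.power β N)) ⟨
          ⟦ 𝕋.∑ n (TC.power β N) ⟧ᴱ 𝔼.- ⟦ T.ιᶠ c ⟧ᴱ ≈⟨ forget.sub-homo _ _ ⟨
          ⟦ 𝕋.∑ n (TC.power β N) 𝕋.- T.ιᶠ c ⟧ᴱ ∎))
        (𝕋.trans (𝕋.+-congʳ eq) (𝕋.-‿inverseʳ _))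
        where open import Relation.Binary.Reasoning.Setoid 𝔼.setoid

-- The congruence modulo 1 - x q^n and modulo x - q^n.

module SpecialPoints where
  open FractionValues
  open Regularity
  open Representation
  open Cancellation
  open Comparison
  open import Data.Nat.Base as ℕ using (ℕ; zero; suc; _≤_; z≤n; s≤s)
  import Data.Nat.Divisibility as ℕ∣
  open import Data.Integer.Base as ℤ using (+_)
  open import Data.Product using (_,_; proj₁; proj₂)
  open import Relation.Nullary using (¬_)

  -- The sum of 1 + sj over j < m; for n = sm + 1 it equals (n - 1)(n - s + 1)/(2s).
  valueExponent : ℕ → ℕ → ℕ
  valueExponent s zero = 0
  valueExponent s (suc j) = valueExponent s j ℕ.+ suc (s ℕ.* j)

  module Value (R : CommutativeRing 0ℓ 0ℓ) (q : CommutativeRing.Carrier R) (s : ℕ) where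
    open RingTools R
    open import Relation.Binary.Reasoning.Setoid setoid

    ∏-value : ∀ m → ∏ m (λ j → - (q * (q ^ s) ^ j)) ≈ q ^ valueExponent s m * (- 1#) ^ m
    ∏-value zero = sym (*-identityˡ 1#)
    ∏-value (suc m) = begin
      ∏ m (λ j → - (q * (q ^ s) ^ j)) * - (q * (q ^ s) ^ m) ≈⟨ *-cong (∏-value m) (-‿cong (*-congˡ (^-assocʳ q s m))) ⟩
      q ^ valueExponent s m * (- 1#) ^ m * - (q ^ suc (s ℕ.* m))
        ≈⟨ solve 3 (λ a b c → a :* b :* :- c := (a :* c) :* ((:- con (+ 1)) :* b)) refl _ _ _ ⟩
      (q ^ valueExponent s m * q ^ suc (s ℕ.* m)) * (- 1#) ^ suc m ≈⟨ *-congʳ (^-homo-* q (valueExponent s m) _) ⟨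
      q ^ valueExponent s (suc m) * (- 1#) ^ suc m ∎

    value^N : ∀ m N b → (∏ m (λ j → - (q * (q ^ s) ^ j)) * b) ^ N ≈ q ^ (N ℕ.* valueExponent s m) * b ^ N * (- 1#) ^ (N ℕ.* m)
    value^N m N b = begin
      (∏ m (λ j → - (q * (q ^ s) ^ j)) * b) ^ N ≈⟨ ^-congˡ N (*-congʳ (∏-value m)) ⟩
      (q ^ valueExponent s m * (- 1#) ^ m * b) ^ N ≈⟨ trans (^-distrib-* _ b N) (*-congʳ (^-distrib-* _ _ N)) ⟩
      (q ^ valueExponent s m) ^ N * ((- 1#) ^ m) ^ N * b ^ N
        ≈⟨ *-congʳ (*-cong (flip q (valueExponent s m)) (flip (- 1#) m)) ⟩
      q ^ (N ℕ.* valueExponent s m) * (- 1#) ^ (N ℕ.* m) * b ^ N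
        ≈⟨ solve 3 (λ a b c → a :* b :* c := a :* c :* b) refl _ _ _ ⟩
      q ^ (N ℕ.* valueExponent s m) * b ^ N * (- 1#) ^ (N ℕ.* m) ∎
      where
      flip : ∀ a k → (a ^ k) ^ N ≈ a ^ (N ℕ.* k)
      flip a k = trans (^-assocʳ a k N) (reflexive (≡.cong (a ^_) (ℕₚ.*-comm k N)))

  module SpecialPoint (s′ m N : ℕ) (N≤s : N ≤ suc s′) where
    open Setting s′ public

    n : ℕ
    n = suc (s ℕ.* m)

    right-side : 𝔸.Carrier
    right-side = q^ (N ℕ.* valueExponent s m) 𝔸.* 𝔸.∑ n (qᴬ 𝔸.^_) 𝔸.^ N 𝔸.* (𝔸.- 𝔸.1#) 𝔸.^ (N ℕ.* m)

    module Conclusion (I : Ideal A) where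
      open Conclude I N n public
      module FT = FactorHom ιᵀ T.ι-cong
      module ιᵀ = HomProperties ιᵀ

      xᵀ qᵀ pᵀ : 𝕋.Carrier
      xᵀ = T.ιᶠ xᴬ
      qᵀ = T.ιᶠ qᴬ
      pᵀ = qᵀ 𝕋.^ s

      -- The two points differ only in `y`, the inverse of q^n, and the unit `κ` that relates x - b
      -- to the evaluation: y = κ = x where x q^n = 1, and y = q^(-n), κ = q^n where x = q^n.
      module _
        (adm-den : ∀ j → T.Admissible (factorᴬ (q^ (s ℕ.* suc j))))
        (adm-1-q : ∀ j → T.Admissible (𝔸.1# 𝔸.- q^ suc j))
        (y κ : 𝕋.Carrier) (unit-κ : 𝕋.Unit κ)
        (y-inv : y 𝕋.* qᵀ 𝕋.^ n 𝕋.≈ 𝕋.1#)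
        (factor-y : ∀ b → FT.factorᴮ b 𝕋.≈ κ 𝕋.* ((𝕋.1# 𝕋.- y 𝕋.* b) 𝕋.* (𝕋.1# 𝕋.- qᵀ 𝕋.^ n 𝕋.* b) 𝕋.* (𝕋.1# 𝕋.- b)))
        (unit-y : ∀ j → 𝕋.Unit (𝕋.1# 𝕋.- y 𝕋.* pᵀ 𝕋.^ suc j))
        where

        wᵀ : ℕ → 𝕋.Carrier
        wᵀ j = T.frac (factorᴬ (q^ suc (s ℕ.* j))) (factorᴬ (q^ (s ℕ.* suc j))) (adm-den j)

        wᵀ-ratio : ∀ j → wᵀ j 𝕋.* FT.factorᴮ (pᵀ 𝕋.^ suc j) 𝕋.≈ FT.factorᴮ (qᵀ 𝕋.* pᵀ 𝕋.^ j)
        wᵀ-ratio j = 𝕋.trans (𝕋.*-congˡ (𝕋.sym (FT.factor-homo (FT.q^s-homo s (suc j))))) (𝕋.trans (T.frac-denom _ _ _) (FT.factor-homo (FT.q^1+s-homo s j)))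

        module Ev = Evaluation T.fractionRing qᵀ y s′ m wᵀ

        ratio : ∀ j → wᵀ j 𝕋.* Ev.denominator j 𝕋.≈ Ev.numerator j
        ratio j = 𝕋.unit-cancelˡ unit-κ (begin
          κ 𝕋.* (wᵀ j 𝕋.* Ev.denominator j) ≈⟨ 𝕋.solve 3 (λ κ w d → κ 𝕋.:* (w 𝕋.:* d) 𝕋.:= w 𝕋.:* (κ 𝕋.:* d)) 𝕋.refl _ _ _ ⟩
          wᵀ j 𝕋.* (κ 𝕋.* Ev.denominator j) ≈⟨ 𝕋.*-congˡ (factor-y _) ⟨
          wᵀ j 𝕋.* FT.factorᴮ (pᵀ 𝕋.^ suc j) ≈⟨ wᵀ-ratio j ⟩
          FT.factorᴮ (qᵀ 𝕋.* pᵀ 𝕋.^ j) ≈⟨ factor-y _ ⟩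
          κ 𝕋.* Ev.numerator j ∎)
          where open import Relation.Binary.Reasoning.Setoid 𝕋.setoid

        unit-p : ∀ j → 𝕋.Unit (𝕋.1# 𝕋.- pᵀ 𝕋.^ suc j)
        unit-p j = 𝕋.unit-cong (FT.1-homo′ (FT.q^s-homo s (suc j))) (T.ι-unit (adm-1-q (j ℕ.+ s′ ℕ.* suc j)))

        unit-a : ∀ j → 𝕋.Unit (𝕋.1# 𝕋.- qᵀ 𝕋.* pᵀ 𝕋.^ j)
        unit-a j = 𝕋.unit-cong (FT.1-homo′ (FT.q^1+s-homo s j)) (T.ι-unit (adm-1-q (s ℕ.* j)))

        β : ℕ → 𝕋.Carrier
        β = Ev.αᵣ

        β≈ : ∀ k → ⟦ β k ⟧ᴱ 𝔼.≈ Summands.αᵣ E.fractionRing qᴱ s′ wᴱ k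
        β≈ k = 𝔼.trans (forget.α-homo qᵀ s′ wᵀ k) (summand-cong E.fractionRing s′ (forget-ι qᴬ) (λ j → forget-frac _ _ _ _) k)

        sum-value : 𝕋.∑ n (TC.power β N) 𝕋.≈ T.ιᶠ right-side
        sum-value = begin
          -- Nm ≤ sm = n - 1, so the first n coefficients contain the whole N-th power.
          𝕋.∑ n (TC.power β N) ≈⟨ TC.∑-power (Ev.α-vanish y-inv ratio unit-p unit-a unit-y) N (s ℕ.* m) (ℕₚ.*-monoˡ-≤ m N≤s) ⟩
          𝕋.∑ (suc m) β 𝕋.^ N ≈⟨ 𝕋.^-congˡ N (Ev.∑α y-inv ratio unit-p unit-a unit-y) ⟩
          Ev.value y-inv ratio unit-p unit-a unit-y 𝕋.^ N ≈⟨ Value.value^N T.fractionRing qᵀ s m N _ ⟩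
          qᵀ 𝕋.^ (N ℕ.* valueExponent s m) 𝕋.* 𝕋.∑ n (qᵀ 𝕋.^_) 𝕋.^ N 𝕋.* (𝕋.- 𝕋.1#) 𝕋.^ (N ℕ.* m)
            ≈⟨ 𝕋.*-cong (𝕋.*-cong (ιᵀ.^-homo qᴬ (N ℕ.* valueExponent s m)) (𝕋.trans (ιᵀ.^-homo _ N) (𝕋.^-congˡ N (ιᵀ.bracket-homo qᴬ n)))) (ιᵀ.sign-homo (N ℕ.* m)) ⟨
          T.ιᶠ (q^ (N ℕ.* valueExponent s m)) 𝕋.* T.ιᶠ (𝔸.∑ n (qᴬ 𝔸.^_) 𝔸.^ N) 𝕋.* T.ιᶠ ((𝔸.- 𝔸.1#) 𝔸.^ (N ℕ.* m))
            ≈⟨ 𝕋.trans (T.ι-* _ _) (𝕋.*-congʳ (T.ι-* _ _)) ⟨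
          T.ιᶠ right-side ∎
          where open import Relation.Binary.Reasoning.Setoid 𝕋.setoid

        conclusion : ∀ {f} → f ↤ right-side → NumeratorIn I N n f
        conclusion f↤ = membership β β≈ right-side f↤ sum-value

  module _ (s″ m N : ℕ) (N≤s : N ≤ suc (suc s″)) where
    open SpecialPoint (suc s″) m N N≤s

    -- n leaves remainder 1 modulo s ≥ 2. Hence the denominators 1 - x q^(sj) and x - q^(sj) do not
    -- vanish at the special points.
    multiple≢n : ∀ j → ¬ s ℕ.* j ≡.≡ n
    multiple≢n j eq = ℕ∣.>⇒∤ (s≤s (s≤s z≤n)) (ℕ∣.∣m+n∣m⇒∣n {s} {s ℕ.* m} {1} (≡.subst (s ℕ∣.∣_) (≡.trans eq (ℕₚ.+-comm 1 (s ℕ.* m))) (ℕ∣.m∣m*n j)) (ℕ∣.m∣m*n m))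

    module _ where
      open Conclusion (divisibility (πₐ n))

      private
        adm-1-q : ∀ j → T.Admissible (𝔸.1# 𝔸.- q^ suc j)
        adm-1-q j = regular-1-q^ j , cancelsₐ-1-q^ n j

        adm-1-xq : ∀ j → T.Admissible (𝔸.1# 𝔸.- xᴬ 𝔸.* q^ (s ℕ.* suc j))
        adm-1-xq j = regular-1-xq^ _ , cancelsₐ-1-xq^ n _ (multiple≢n (suc j))

        adm-den : ∀ j → T.Admissible (factorᴬ (q^ (s ℕ.* suc j)))
        adm-den j = T.admissible-* (T.admissible-* (adm-1-xq j) (regular-x-q^ (s ℕ.* suc j) , cancelsₐ-x-q^ (s ℕ.* m) (s ℕ.* suc j))) (adm-1-q (j ℕ.+ suc s″ ℕ.* suc j))

        y-inv : xᵀ 𝕋.* qᵀ 𝕋.^ n 𝕋.≈ 𝕋.1#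
        y-inv = begin
          xᵀ 𝕋.* qᵀ 𝕋.^ n ≈⟨ 𝕋.solve 1 (λ a → a 𝕋.:= 𝕋.con (+ 1) 𝕋.:- (𝕋.con (+ 1) 𝕋.:- a)) 𝕋.refl _ ⟩
          𝕋.1# 𝕋.- (𝕋.1# 𝕋.- xᵀ 𝕋.* qᵀ 𝕋.^ n) ≈⟨ 𝕋.+-congˡ (𝕋.-‿cong (FT.1-x-homo (ιᵀ.^-homo qᴬ n))) ⟨
          𝕋.1# 𝕋.- T.ιᶠ (πₐ n) ≈⟨ 𝕋.+-congˡ (𝕋.-‿cong (T.ι-member (𝔸.1# , 𝔸.sym (𝔸.*-identityʳ _)))) ⟩
          𝕋.1# 𝕋.- 𝕋.0# ≈⟨ 𝕋.solve 0 (𝕋.con (+ 1) 𝕋.:- 𝕋.con (+ 0) 𝕋.:= 𝕋.con (+ 1)) 𝕋.refl ⟩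
          𝕋.1# ∎
          where open import Relation.Binary.Reasoning.Setoid 𝕋.setoid

        factor-y : ∀ b → FT.factorᴮ b 𝕋.≈ xᵀ 𝕋.* ((𝕋.1# 𝕋.- xᵀ 𝕋.* b) 𝕋.* (𝕋.1# 𝕋.- qᵀ 𝕋.^ n 𝕋.* b) 𝕋.* (𝕋.1# 𝕋.- b))
        factor-y b = begin
          (𝕋.1# 𝕋.- xᵀ 𝕋.* b) 𝕋.* (xᵀ 𝕋.- b) 𝕋.* (𝕋.1# 𝕋.- b) ≈⟨ 𝕋.*-congʳ (𝕋.*-congˡ (𝕋.+-congˡ (𝕋.-‿cong (𝕋.trans (𝕋.sym (𝕋.*-identityˡ b)) (𝕋.*-congʳ (𝕋.sym y-inv)))))) ⟩
          (𝕋.1# 𝕋.- xᵀ 𝕋.* b) 𝕋.* (xᵀ 𝕋.- xᵀ 𝕋.* qᵀ 𝕋.^ n 𝕋.* b) 𝕋.* (𝕋.1# 𝕋.- b)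
            ≈⟨ 𝕋.solve 5 (λ A x Q b C → A 𝕋.:* (x 𝕋.:- x 𝕋.:* Q 𝕋.:* b) 𝕋.:* C 𝕋.:= x 𝕋.:* (A 𝕋.:* (𝕋.con (+ 1) 𝕋.:- Q 𝕋.:* b) 𝕋.:* C)) 𝕋.refl _ xᵀ _ b _ ⟩
          xᵀ 𝕋.* ((𝕋.1# 𝕋.- xᵀ 𝕋.* b) 𝕋.* (𝕋.1# 𝕋.- qᵀ 𝕋.^ n 𝕋.* b) 𝕋.* (𝕋.1# 𝕋.- b)) ∎
          where open import Relation.Binary.Reasoning.Setoid 𝕋.setoid

      membershipₐ : ∀ {f} → f ↤ right-side → NumeratorIn (divisibility (πₐ n)) N n f
      membershipₐ f↤ = conclusion adm-den adm-1-q xᵀ xᵀ (qᵀ 𝕋.^ n , y-inv) y-inv factor-y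
        (λ j → 𝕋.unit-cong (FT.1-x-homo (FT.q^s-homo s (suc j))) (T.ι-unit (adm-1-xq j))) f↤

    module _ where
      open Conclusion (divisibility (πᵦ n))

      private
        adm-1-q : ∀ j → T.Admissible (𝔸.1# 𝔸.- q^ suc j)
        adm-1-q j = regular-1-q^ j , cancelsᵦ-1-q^ n j

        adm-x-q : ∀ j → T.Admissible (xᴬ 𝔸.- q^ (s ℕ.* suc j))
        adm-x-q j = regular-x-q^ (s ℕ.* suc j) , cancelsᵦ-x-q^ (s ℕ.* m) _ (multiple≢n (suc j))

        adm-den : ∀ j → T.Admissible (factorᴬ (q^ (s ℕ.* suc j)))
        adm-den j = T.admissible-* (T.admissible-* (regular-1-xq^ _ , cancelsᵦ-1-xq^ (s ℕ.* m) (s ℕ.* suc j)) (adm-x-q j)) (adm-1-q (j ℕ.+ suc s″ ℕ.* suc j))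

        unit-q^n : 𝕋.Unit (qᵀ 𝕋.^ n)
        unit-q^n = 𝕋.unit-^ n (T.ι-unit (regular-q , cancelsᵦ-q (s ℕ.* m)))

        y : 𝕋.Carrier
        y = proj₁ unit-q^n

        x≈ : xᵀ 𝕋.≈ qᵀ 𝕋.^ n
        x≈ = begin
          xᵀ ≈⟨ 𝕋.solve 2 (λ x Q → x 𝕋.:= Q 𝕋.:+ (x 𝕋.:- Q)) 𝕋.refl xᵀ (qᵀ 𝕋.^ n) ⟩
          qᵀ 𝕋.^ n 𝕋.+ (xᵀ 𝕋.- qᵀ 𝕋.^ n) ≈⟨ 𝕋.+-congˡ (FT.x-homo (ιᵀ.^-homo qᴬ n)) ⟨
          qᵀ 𝕋.^ n 𝕋.+ T.ιᶠ (πᵦ n) ≈⟨ 𝕋.+-congˡ (T.ι-member (𝔸.1# , 𝔸.sym (𝔸.*-identityʳ _))) ⟩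
          qᵀ 𝕋.^ n 𝕋.+ 𝕋.0# ≈⟨ 𝕋.+-identityʳ _ ⟩
          qᵀ 𝕋.^ n ∎
          where open import Relation.Binary.Reasoning.Setoid 𝕋.setoid

        x-b : ∀ b → xᵀ 𝕋.- b 𝕋.≈ qᵀ 𝕋.^ n 𝕋.* (𝕋.1# 𝕋.- y 𝕋.* b)
        x-b b = begin
          xᵀ 𝕋.- b ≈⟨ 𝕋.+-cong x≈ (𝕋.-‿cong (𝕋.trans (𝕋.sym (𝕋.*-identityˡ b)) (𝕋.*-congʳ (𝕋.sym (proj₂ unit-q^n))))) ⟩
          qᵀ 𝕋.^ n 𝕋.- qᵀ 𝕋.^ n 𝕋.* y 𝕋.* b ≈⟨ 𝕋.solve 3 (λ Q y b → Q 𝕋.:- Q 𝕋.:* y 𝕋.:* b 𝕋.:= Q 𝕋.:* (𝕋.con (+ 1) 𝕋.:- y 𝕋.:* b)) 𝕋.refl _ y b ⟩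
          qᵀ 𝕋.^ n 𝕋.* (𝕋.1# 𝕋.- y 𝕋.* b) ∎
          where open import Relation.Binary.Reasoning.Setoid 𝕋.setoid

        factor-y : ∀ b → FT.factorᴮ b 𝕋.≈ qᵀ 𝕋.^ n 𝕋.* ((𝕋.1# 𝕋.- y 𝕋.* b) 𝕋.* (𝕋.1# 𝕋.- qᵀ 𝕋.^ n 𝕋.* b) 𝕋.* (𝕋.1# 𝕋.- b))
        factor-y b = 𝕋.trans (𝕋.*-congʳ (𝕋.*-cong (𝕋.+-congˡ (𝕋.-‿cong (𝕋.*-congʳ x≈))) (x-b b)))
          (𝕋.solve 4 (λ A Q B C → A 𝕋.:* (Q 𝕋.:* B) 𝕋.:* C 𝕋.:= Q 𝕋.:* (B 𝕋.:* A 𝕋.:* C)) 𝕋.refl _ _ _ _)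

      membershipᵦ : ∀ {f} → f ↤ right-side → NumeratorIn (divisibility (πᵦ n)) N n f
      membershipᵦ f↤ = conclusion adm-den adm-1-q y (qᵀ 𝕋.^ n) unit-q^n (𝕋.trans (𝕋.*-comm _ _) (proj₂ unit-q^n)) factor-y
        (λ j → 𝕋.unit-factorˡ {b = qᵀ 𝕋.^ n} (𝕋.unit-cong (𝕋.trans (FT.x-homo (FT.q^s-homo s (suc j))) (𝕋.trans (x-b _) (𝕋.*-comm _ _))) (T.ι-unit (adm-x-q j)))) f↤

-- Vanishing of the sum at primitive d-th roots of unity.

module RootsOfUnity where
  open FractionValues
  open Regularity
  open Representation
  open Cancellation
  open Comparison
  open import Data.Nat.Base as ℕ using (ℕ; zero; suc; _≤_; _<_; z≤n; s≤s)
  open import Data.Nat.DivMod using (_/_; _%_; m≡m%n+[m/n]*n; m%n<n; m<n⇒m%n≡m; [m+kn]%n≡m%n)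
  import Data.Nat.Divisibility as ℕ∣
  open import Data.Nat.Coprimality using (coprime-divisor)
  open import Data.Integer.Base as ℤ using (+_)
  open import Data.List.Base as List using ([])
  open import Data.List.Relation.Unary.All as All using ([])
  open import Data.Product using (_×_; _,_; proj₁)
  open import Relation.Nullary using (¬_; Dec; yes; no; contradiction)

  frac-cross : ∀ {a b a′ b′ θ θ′} (r : E.Regular b) (r′ : E.Regular b′) → a 𝔸.* θ′ 𝔸.* b′ 𝔸.≈ θ 𝔸.* a′ 𝔸.* b →
    E.frac a b (regular⇒admissible r) 𝔼.* E.ιᶠ θ′ 𝔼.≈ E.ιᶠ θ 𝔼.* E.frac a′ b′ (regular⇒admissible r′)
  frac-cross {a} {b} {a′} {b′} {θ} {θ′} r r′ eq = E.cross⇒≈ (begin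
    E.numer (f 𝔼.* E.ιᶠ θ′) 𝔸.* E.denom (E.ιᶠ θ 𝔼.* f′)
      ≈⟨ 𝔸.*-cong (𝔸.trans (E.numer-* _ _) (𝔸.*-cong (E.numer-frac _ _ _) (E.numer-ι θ′))) (𝔸.trans (E.denom-* _ _) (𝔸.*-cong (E.denom-ι θ) (E.denom-frac _ _ _))) ⟩
    (a 𝔸.* θ′) 𝔸.* (𝔸.1# 𝔸.* b′) ≈⟨ 𝔸.*-congˡ (𝔸.*-identityˡ b′) ⟩
    a 𝔸.* θ′ 𝔸.* b′ ≈⟨ eq ⟩
    θ 𝔸.* a′ 𝔸.* b ≈⟨ 𝔸.*-congˡ (𝔸.*-identityʳ b) ⟨
    (θ 𝔸.* a′) 𝔸.* (b 𝔸.* 𝔸.1#)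
      ≈⟨ 𝔸.*-cong (𝔸.trans (E.numer-* _ _) (𝔸.*-cong (E.numer-ι θ) (E.numer-frac _ _ _))) (𝔸.trans (E.denom-* _ _) (𝔸.*-cong (E.denom-frac _ _ _) (E.denom-ι θ′))) ⟨
    E.numer (E.ιᶠ θ 𝔼.* f′) 𝔸.* E.denom (f 𝔼.* E.ιᶠ θ′) ∎)
    where
    open import Relation.Binary.Reasoning.Setoid 𝔸.setoid
    f = E.frac a b (regular⇒admissible r)
    f′ = E.frac a′ b′ (regular⇒admissible r′)

  module RootCase (s″ m′ : ℕ) where
    s′ = suc s″
    m = suc m′
    open Setting s′ public

    d : ℕ
    d = suc (s ℕ.* m)

    I : Ideal A
    I = vanishing d

    m<d : m < d
    m<d = s≤s (ℕₚ.m≤n*m m s)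

    -- Since s ≥ 2 and m ≥ 1, the residue m, at which a factor of (q;q^s)_k vanishes, differs from
    -- the residue d - 1, at which one of (q^s;q^s)_k does.
    sm<d : suc m < d
    sm<d = s≤s (ℕₚ.≤-trans (ℕₚ.≤-reflexive (ℕₚ.+-comm 1 m)) (ℕₚ.+-monoʳ-≤ m (ℕₚ.m≤n⇒m≤n+o (s″ ℕ.* m) (s≤s z≤n))))

    u : 𝔸.Carrier
    u = 𝔸.1# 𝔸.- q^ d

    bracketᵈ : ℕ → 𝔸.Carrier
    bracketᵈ c = 𝔸.∑ c ((q^ d) 𝔸.^_)

    bracketᵈ-value : ∀ c {k} → d ℕ.* c ≡.≡ k → u 𝔸.* bracketᵈ c 𝔸.≈ 𝔸.1# 𝔸.- q^ k
    bracketᵈ-value c eq = 𝔸.trans (𝔸.geom (q^ d) c) (𝔸.+-congˡ (𝔸.-‿cong (𝔸.trans (𝔸.^-assocʳ qᴬ d c) (𝔸.reflexive (≡.cong q^_ eq)))))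

    pair : 𝔸.Carrier → 𝔸.Carrier
    pair b = (𝔸.1# 𝔸.- xᴬ 𝔸.* b) 𝔸.* (xᴬ 𝔸.- b)

    -- 1 - q^(1+sk) and 1 - q^(s(k+1)), divided by 1 - q^d whenever that is possible.
    opaque
      upper lower : ℕ → 𝔸.Carrier
      upper k with k % d ℕₚ.≟ m
      ... | yes _ = bracketᵈ (suc (s ℕ.* (k / d)))
      ... | no _ = 𝔸.1# 𝔸.- q^ suc (s ℕ.* k)
      lower k with suc (k % d) ℕₚ.≟ d
      ... | yes _ = bracketᵈ (s ℕ.* suc (k / d))
      ... | no _ = 𝔸.1# 𝔸.- q^ (s ℕ.* suc k)

      -- The power of 1 - q^d by which (q;q^s)_k / (q^s;q^s)_k exceeds the product of upper j / lower j over j < k,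
      -- as a function of k mod d.
      carry : ℕ → 𝔸.Carrier
      carry r with r ℕₚ.≤? m
      ... | yes _ = 𝔸.1#
      ... | no _ = u

      -- For k = ld + m the exponent is 1 + sk = d(1 + sl), because 1 + sm = d.
      upper-special : ∀ k → k % d ≡.≡ m → u 𝔸.* upper k 𝔸.≈ 𝔸.1# 𝔸.- q^ suc (s ℕ.* k)
      upper-special k eq with k % d ℕₚ.≟ m
      ... | no ≢ = contradiction eq ≢
      ... | yes _ = bracketᵈ-value (suc (s ℕ.* (k / d))) (≡.trans
          (S.solve 3 (λ s m l → (S.con 1 S.:+ s S.:* m) S.:* (S.con 1 S.:+ s S.:* l) S.:= S.con 1 S.:+ s S.:* (m S.:+ l S.:* (S.con 1 S.:+ s S.:* m))) ≡.refl s m (k / d))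
          (≡.cong (λ k → suc (s ℕ.* k)) (≡.sym (≡.trans (m≡m%n+[m/n]*n k d) (≡.cong (ℕ._+ k / d ℕ.* d) eq)))))
        where module S = Data.Nat.Solver.+-*-Solver

      upper-generic : ∀ k → ¬ k % d ≡.≡ m → upper k 𝔸.≈ 𝔸.1# 𝔸.- q^ suc (s ℕ.* k)
      upper-generic k ≢ with k % d ℕₚ.≟ m
      ... | yes eq = contradiction eq ≢
      ... | no _ = 𝔸.refl

      lower-special : ∀ k → suc (k % d) ≡.≡ d → u 𝔸.* lower k 𝔸.≈ 𝔸.1# 𝔸.- q^ (s ℕ.* suc k)
      lower-special k eq with suc (k % d) ℕₚ.≟ d
      ... | no ≢ = contradiction eq ≢
      ... | yes _ = bracketᵈ-value (s ℕ.* suc (k / d)) (≡.trans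
          (S.solve 3 (λ s d l → d S.:* (s S.:* (S.con 1 S.:+ l)) S.:= s S.:* (d S.:+ l S.:* d)) ≡.refl s d (k / d))
          (≡.cong (s ℕ.*_) (≡.sym (≡.trans (≡.cong suc (m≡m%n+[m/n]*n k d)) (≡.cong (ℕ._+ k / d ℕ.* d) eq)))))
        where module S = Data.Nat.Solver.+-*-Solver

      lower-generic : ∀ k → ¬ suc (k % d) ≡.≡ d → lower k 𝔸.≈ 𝔸.1# 𝔸.- q^ (s ℕ.* suc k)
      lower-generic k ≢ with suc (k % d) ℕₚ.≟ d
      ... | yes eq = contradiction eq ≢
      ... | no _ = 𝔸.refl

      carry-low : ∀ r → r ≤ m → carry r 𝔸.≈ 𝔸.1#
      carry-low r r≤m with r ℕₚ.≤? m
      ... | yes _ = 𝔸.refl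
      ... | no r≰m = contradiction r≤m r≰m

      carry-high : ∀ r → m < r → carry r 𝔸.≈ u
      carry-high r m<r with r ℕₚ.≤? m
      ... | yes r≤m = contradiction r≤m (ℕₚ.<⇒≱ m<r)
      ... | no _ = 𝔸.refl

    residue : ∀ l r → r < d → (l ℕ.* d ℕ.+ r) % d ≡.≡ r
    residue l r r<d = ≡.trans (≡.cong (_% d) (ℕₚ.+-comm (l ℕ.* d) r)) (≡.trans ([m+kn]%n≡m%n r l d) (m<n⇒m%n≡m r<d))

    suc-residue : ∀ k → suc (k % d) < d → suc k % d ≡.≡ suc (k % d)
    suc-residue k lt = ≡.trans (≡.cong (λ k → suc k % d) (m≡m%n+[m/n]*n k d)) (≡.trans ([m+kn]%n≡m%n (suc (k % d)) (k / d) d) (m<n⇒m%n≡m lt))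

    suc-residue-0 : ∀ k → suc (k % d) ≡.≡ d → suc k % d ≡.≡ 0
    suc-residue-0 k eq = ≡.trans (≡.cong (λ k → suc k % d) (m≡m%n+[m/n]*n k d)) (≡.trans (≡.cong (λ r → (r ℕ.+ k / d ℕ.* d) % d) eq) ([m+kn]%n≡m%n 0 (suc (k / d)) d))

    -- Passing the residue m removes a factor 1 - q^d from the numerator, and passing d - 1 removes
    -- one from the denominator; `carry` records a factor taken out above and not yet below.
    carry-step : ∀ k → upper k 𝔸.* carry (suc k % d) 𝔸.* (𝔸.1# 𝔸.- q^ (s ℕ.* suc k)) 𝔸.≈ carry (k % d) 𝔸.* (𝔸.1# 𝔸.- q^ suc (s ℕ.* k)) 𝔸.* lower k
    carry-step k = by (k % d ℕₚ.<? m) (k % d ℕₚ.≟ m) (suc (k % d) ℕₚ.≟ d)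
      where
      open import Relation.Binary.Reasoning.Setoid 𝔸.setoid
      open 𝔸 using (solve; _:=_; _:*_; con)
      r = k % d
      U = 𝔸.1# 𝔸.- q^ suc (s ℕ.* k)
      V = 𝔸.1# 𝔸.- q^ (s ℕ.* suc k)
      not-last : ¬ suc r ≡.≡ d → suc r < d
      not-last ≢ = ℕₚ.≤∧≢⇒< (m%n<n k d) ≢
      generic : ¬ r ≡.≡ m → ¬ suc r ≡.≡ d → carry (suc r) 𝔸.≈ carry r → _
      generic r≢m r≢ same = begin
        upper k 𝔸.* carry (suc k % d) 𝔸.* V ≈⟨ 𝔸.*-congʳ (𝔸.*-cong (upper-generic k r≢m) (𝔸.trans (𝔸.reflexive (≡.cong carry (suc-residue k (not-last r≢)))) same)) ⟩
        U 𝔸.* carry r 𝔸.* V ≈⟨ 𝔸.*-cong (𝔸.*-comm _ _) (𝔸.sym (lower-generic k r≢)) ⟩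
        carry r 𝔸.* U 𝔸.* lower k ∎
      by : Dec (r < m) → Dec (r ≡.≡ m) → Dec (suc r ≡.≡ d) → _
      by (yes r<m) _ _ = generic (λ r≡m → ℕₚ.<-irrefl r≡m r<m) (λ eq → ℕₚ.<-irrefl eq (ℕₚ.≤-<-trans r<m m<d))
        (𝔸.trans (carry-low (suc r) r<m) (𝔸.sym (carry-low r (ℕₚ.<⇒≤ r<m))))
      by (no _) (yes r≡m) (yes eq) = contradiction (≡.trans (≡.sym (≡.cong suc r≡m)) eq) (ℕₚ.<⇒≢ sm<d)
      by (no _) (yes r≡m) (no r≢) = begin
        upper k 𝔸.* carry (suc k % d) 𝔸.* V ≈⟨ 𝔸.*-congʳ (𝔸.*-congˡ (𝔸.trans (𝔸.reflexive (≡.cong carry (suc-residue k (not-last r≢)))) (carry-high (suc r) (s≤s (ℕₚ.≤-reflexive (≡.sym r≡m)))))) ⟩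
        upper k 𝔸.* u 𝔸.* V ≈⟨ 𝔸.*-congʳ (𝔸.trans (𝔸.*-comm _ _) (upper-special k r≡m)) ⟩
        U 𝔸.* V ≈⟨ 𝔸.*-cong (𝔸.trans (𝔸.sym (𝔸.*-identityˡ U)) (𝔸.*-congʳ (𝔸.sym (carry-low r (ℕₚ.≤-reflexive r≡m))))) (𝔸.sym (lower-generic k r≢)) ⟩
        carry r 𝔸.* U 𝔸.* lower k ∎
      by (no r≮m) (no r≢m) (no r≢) = generic r≢m r≢ (𝔸.trans (carry-high (suc r) (ℕₚ.m<n⇒m<1+n m<r)) (𝔸.sym (carry-high r m<r)))
        where
        m<r : m < r
        m<r = ℕₚ.≤∧≢⇒< (ℕₚ.≮⇒≥ r≮m) λ eq → r≢m (≡.sym eq)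
      by (no r≮m) (no r≢m) (yes eq) = begin
        upper k 𝔸.* carry (suc k % d) 𝔸.* V ≈⟨ 𝔸.*-congʳ (𝔸.*-cong (upper-generic k r≢m) (𝔸.trans (𝔸.reflexive (≡.cong carry (suc-residue-0 k eq))) (carry-low 0 z≤n))) ⟩
        U 𝔸.* 𝔸.1# 𝔸.* V ≈⟨ 𝔸.*-congˡ (lower-special k eq) ⟨
        U 𝔸.* 𝔸.1# 𝔸.* (u 𝔸.* lower k) ≈⟨ solve 3 (λ U u l → U :* con (+ 1) :* (u :* l) := u :* U :* l) 𝔸.refl U u (lower k) ⟩
        u 𝔸.* U 𝔸.* lower k ≈⟨ 𝔸.*-congʳ (𝔸.*-congʳ (carry-high r (ℕₚ.≤∧≢⇒< (ℕₚ.≮⇒≥ r≮m) λ eq → r≢m (≡.sym eq)))) ⟨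
        carry r 𝔸.* U 𝔸.* lower k ∎

    module L = Fractions A I

    adm-off : ∀ j → ¬ d ℕ∣.∣ j → L.Admissible (𝔸.1# 𝔸.- q^ j)
    adm-off zero d∤0 = contradiction (d ℕ∣.∣0) d∤0
    adm-off (suc j) d∤j = regular-1-q^ j , off⇒vanishing d∤j

    adm-pair : ∀ b → L.Admissible (pair (q^ b))
    adm-pair b = L.admissible-* (regular-1-xq^ _ , cancels⇒vanishing (λ f → 1-xq^-cancel d b f)) (regular-x-q^ b , cancels⇒vanishing (λ f → x-q^-cancel d b f))

    adm-bracket : ∀ c → L.Admissible (bracketᵈ (suc c))
    adm-bracket c = regular-factorˡ {b = u} (regular-cong (𝔸.trans (𝔸.sym (bracketᵈ-value (suc c) ≡.refl)) (𝔸.*-comm _ _)) (regular-1-q^ (c ℕ.+ s ℕ.* m ℕ.* suc c)))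
      , cancels⇒vanishing (cancels-bracket d c)

    -- d = sm + 1 is coprime to s, so d would have to divide k + 1.
    d∤s[k+1] : ∀ k → ¬ suc (k % d) ≡.≡ d → ¬ d ℕ∣.∣ s ℕ.* suc k
    d∤s[k+1] k ≢ d∣ = ≢ (ℕₚ.≤-antisym (m%n<n k d) (ℕ∣.∣⇒≤ (ℕ∣.∣m+n∣m⇒∣n {d} {k / d ℕ.* d}
      (≡.subst (d ℕ∣.∣_) (≡.trans (≡.cong suc (m≡m%n+[m/n]*n k d)) (ℕₚ.+-comm (suc (k % d)) _)) (coprime-divisor coprime d∣)) (ℕ∣.n∣m*n (k / d)))))
      where
      coprime : ∀ {i} → i ℕ∣.∣ d × i ℕ∣.∣ s → i ≡.≡ 1
      coprime {i} (i∣d , i∣s) = ℕ∣.∣1⇒≡1 (ℕ∣.∣m+n∣m⇒∣n {i} {s ℕ.* m} (≡.subst (i ℕ∣.∣_) (ℕₚ.+-comm 1 (s ℕ.* m)) i∣d) (ℕ∣.∣m⇒∣m*n m i∣s))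

    opaque
      unfolding lower

      adm-lower : ∀ k → L.Admissible (lower k)
      adm-lower k with suc (k % d) ℕₚ.≟ d
      ... | yes _ = adm-bracket (k / d ℕ.+ suc s″ ℕ.* suc (k / d))
      ... | no ≢ = adm-off (s ℕ.* suc k) (d∤s[k+1] k ≢)

    module _ (N e : ℕ) (N<s : suc N ≤ s) where
      open Conclude I (suc N) (e ℕ.* d)
      module FT = FactorHom ιᵀ T.ι-cong
      module ιᵀ = HomProperties ιᵀ

      xᵀ qᵀ pᵀ : 𝕋.Carrier
      xᵀ = T.ιᶠ xᴬ
      qᵀ = T.ιᶠ qᴬ
      pᵀ = qᵀ 𝕋.^ s

      adm-w : ∀ k → T.Admissible (pair (q^ (s ℕ.* suc k)) 𝔸.* lower k)
      adm-w k = T.admissible-* (adm-pair (s ℕ.* suc k)) (adm-lower k)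

      -- The quotient `wᴱ` with the factors 1 - q^d removed, which makes every denominator
      -- admissible; `carry` restores the exact value in `β`.
      w : ℕ → 𝕋.Carrier
      w k = T.frac (pair (q^ suc (s ℕ.* k)) 𝔸.* upper k) (pair (q^ (s ℕ.* suc k)) 𝔸.* lower k) (adm-w k)

      module RU = RootOfUnity T.fractionRing qᵀ xᵀ s′ m w

      w-carry : ∀ k → ⟦ w k ⟧ᴱ 𝔼.* E.ιᶠ (carry (suc k % d)) 𝔼.≈ E.ιᶠ (carry (k % d)) 𝔼.* wᴱ k
      w-carry k = 𝔼.trans (𝔼.*-congʳ (forget-frac _ _ (adm-w k) (proj₁ (adm-w k)))) (frac-cross _ _ (begin
        (P 𝔸.* upper k) 𝔸.* carry (suc k % d) 𝔸.* (R 𝔸.* V) ≈⟨ solve 5 (λ P a c R V → (P :* a) :* c :* (R :* V) := (P :* R) :* (a :* c :* V)) 𝔸.refl P _ _ R V ⟩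
        (P 𝔸.* R) 𝔸.* (upper k 𝔸.* carry (suc k % d) 𝔸.* V) ≈⟨ 𝔸.*-congˡ (carry-step k) ⟩
        (P 𝔸.* R) 𝔸.* (carry (k % d) 𝔸.* U 𝔸.* lower k) ≈⟨ solve 5 (λ P R c U l → (P :* R) :* (c :* U :* l) := c :* (P :* U) :* (R :* l)) 𝔸.refl P R _ U _ ⟩
        carry (k % d) 𝔸.* (P 𝔸.* U) 𝔸.* (R 𝔸.* lower k) ∎))
        where
        open import Relation.Binary.Reasoning.Setoid 𝔸.setoid
        open 𝔸 using (solve; _:=_; _:*_)
        P = pair (q^ suc (s ℕ.* k))
        R = pair (q^ (s ℕ.* suc k))
        U = 𝔸.1# 𝔸.- q^ suc (s ℕ.* k)
        V = 𝔸.1# 𝔸.- q^ (s ℕ.* suc k)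

      ∏-carry : ∀ k → 𝔼.∏ k (λ j → ⟦ w j ⟧ᴱ) 𝔼.* E.ιᶠ (carry (k % d)) 𝔼.≈ 𝔼.∏ k wᴱ
      ∏-carry zero = 𝔼.trans (𝔼.*-identityˡ _) (𝔼.trans (E.ι-cong (carry-low 0 z≤n)) E.ι-1)
      ∏-carry (suc k) = begin
        𝔼.∏ k w′ 𝔼.* ⟦ w k ⟧ᴱ 𝔼.* E.ιᶠ (carry (suc k % d)) ≈⟨ 𝔼.trans (𝔼.*-assoc _ _ _) (𝔼.*-congˡ (w-carry k)) ⟩
        𝔼.∏ k w′ 𝔼.* (E.ιᶠ (carry (k % d)) 𝔼.* wᴱ k) ≈⟨ 𝔼.*-assoc _ _ _ ⟨
        𝔼.∏ k w′ 𝔼.* E.ιᶠ (carry (k % d)) 𝔼.* wᴱ k ≈⟨ 𝔼.*-congʳ (∏-carry k) ⟩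
        𝔼.∏ (suc k) wᴱ ∎
        where
        open import Relation.Binary.Reasoning.Setoid 𝔼.setoid
        w′ : ℕ → 𝔼.Carrier
        w′ j = ⟦ w j ⟧ᴱ

      β : ℕ → 𝕋.Carrier
      β k = RU.αᵣ k 𝕋.* T.ιᶠ (carry (k % d))

      β≈ : ∀ k → ⟦ β k ⟧ᴱ 𝔼.≈ Summands.αᵣ E.fractionRing qᴱ s′ wᴱ k
      β≈ k = 𝔼.trans (forget.*-homo _ _) (𝔼.trans
        (𝔼.*-cong (𝔼.trans (forget.α-homo qᵀ s′ w k) (summand-cong E.fractionRing s′ (forget-ι qᴬ) (λ j → 𝔼.refl) k)) (forget-ι (carry (k % d))))
        (𝔼.trans (𝔼.*-assoc _ _ _) (𝔼.*-congˡ (∏-carry k))))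

      u≈0 : T.ιᶠ u 𝕋.≈ 𝕋.0#
      u≈0 = T.ι-member ([] , [] , 𝔸.1# , 𝔸.*-comm _ _)

      q^d≈1 : qᵀ 𝕋.^ d 𝕋.≈ 𝕋.1#
      q^d≈1 = begin
        qᵀ 𝕋.^ d ≈⟨ 𝕋.solve 1 (λ a → a 𝕋.:= 𝕋.con (+ 1) 𝕋.:- (𝕋.con (+ 1) 𝕋.:- a)) 𝕋.refl _ ⟩
        𝕋.1# 𝕋.- (𝕋.1# 𝕋.- qᵀ 𝕋.^ d) ≈⟨ 𝕋.+-congˡ (𝕋.-‿cong (FT.1-homo′ (ιᵀ.^-homo qᴬ d))) ⟨
        𝕋.1# 𝕋.- T.ιᶠ u ≈⟨ 𝕋.+-congˡ (𝕋.-‿cong u≈0) ⟩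
        𝕋.1# 𝕋.- 𝕋.0# ≈⟨ 𝕋.solve 0 (𝕋.con (+ 1) 𝕋.:- 𝕋.con (+ 0) 𝕋.:= 𝕋.con (+ 1)) 𝕋.refl ⟩
        𝕋.1# ∎
        where open import Relation.Binary.Reasoning.Setoid 𝕋.setoid

      p^d : ∀ l → pᵀ 𝕋.^ (l ℕ.* d) 𝕋.≈ 𝕋.1#
      p^d l = begin
        pᵀ 𝕋.^ (l ℕ.* d) ≈⟨ 𝕋.^-assocʳ qᵀ s (l ℕ.* d) ⟩
        qᵀ 𝕋.^ (s ℕ.* (l ℕ.* d)) ≡⟨ ≡.cong (qᵀ 𝕋.^_) (S.solve 3 (λ s l d → s S.:* (l S.:* d) S.:= d S.:* (s S.:* l)) ≡.refl s l d) ⟩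
        qᵀ 𝕋.^ (d ℕ.* (s ℕ.* l)) ≈⟨ 𝕋.^-assocʳ qᵀ d (s ℕ.* l) ⟨
        (qᵀ 𝕋.^ d) 𝕋.^ (s ℕ.* l) ≈⟨ 𝕋.trans (𝕋.^-congˡ (s ℕ.* l) q^d≈1) (𝕋.1^n (s ℕ.* l)) ⟩
        𝕋.1# ∎
        where
        open import Relation.Binary.Reasoning.Setoid 𝕋.setoid
        module S = Data.Nat.Solver.+-*-Solver

      p-periodic : ∀ l j → pᵀ 𝕋.^ (l ℕ.* d ℕ.+ j) 𝕋.≈ pᵀ 𝕋.^ j
      p-periodic l j = 𝕋.trans (𝕋.^-homo-* pᵀ (l ℕ.* d) j) (𝕋.trans (𝕋.*-congʳ (p^d l)) (𝕋.*-identityˡ _))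

      w-generic : ∀ k {c b} → upper k 𝔸.≈ 𝔸.1# 𝔸.- q^ suc (s ℕ.* k) → lower k 𝔸.≈ 𝔸.1# 𝔸.- q^ (s ℕ.* suc k) →
        T.ιᶠ (q^ suc (s ℕ.* k)) 𝕋.≈ c → T.ιᶠ (q^ (s ℕ.* suc k)) 𝕋.≈ b →
        w k 𝕋.* FT.factorᴮ b 𝕋.≈ FT.factorᴮ c
      w-generic k {c} {b} up lo c≈ b≈ = begin
        w k 𝕋.* FT.factorᴮ b ≈⟨ 𝕋.*-congˡ (FT.factor-homo b≈) ⟨
        w k 𝕋.* T.ιᶠ (factorᴬ (q^ (s ℕ.* suc k))) ≈⟨ 𝕋.*-congˡ (T.ι-cong (𝔸.*-congˡ lo)) ⟨
        w k 𝕋.* T.ιᶠ (pair (q^ (s ℕ.* suc k)) 𝔸.* lower k) ≈⟨ T.frac-denom (pair (q^ suc (s ℕ.* k)) 𝔸.* upper k) (pair (q^ (s ℕ.* suc k)) 𝔸.* lower k) (adm-w k) ⟩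
        T.ιᶠ (pair (q^ suc (s ℕ.* k)) 𝔸.* upper k) ≈⟨ T.ι-cong (𝔸.*-congˡ up) ⟩
        T.ιᶠ (factorᴬ (q^ suc (s ℕ.* k))) ≈⟨ FT.factor-homo c≈ ⟩
        FT.factorᴮ c ∎
        where open import Relation.Binary.Reasoning.Setoid 𝕋.setoid

      w-ratio : ∀ l j → j < m → w (l ℕ.* d ℕ.+ j) 𝕋.* RU.denominator j 𝕋.≈ RU.numerator j
      w-ratio l j j<m = w-generic (l ℕ.* d ℕ.+ j)
        (upper-generic (l ℕ.* d ℕ.+ j) λ eq → ℕₚ.<-irrefl (≡.trans (≡.sym r≡) eq) j<m)
        (lower-generic (l ℕ.* d ℕ.+ j) λ eq → ℕₚ.<-irrefl (≡.trans (≡.cong suc (≡.sym r≡)) eq) (ℕₚ.≤-<-trans j<m m<d))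
        (𝕋.trans (FT.q^1+s-homo s (l ℕ.* d ℕ.+ j)) (𝕋.*-congˡ (p-periodic l j)))
        (𝕋.trans (FT.q^s-homo s (suc (l ℕ.* d ℕ.+ j)))
          (𝕋.trans (𝕋.reflexive (≡.cong (pᵀ 𝕋.^_) (≡.sym (ℕₚ.+-suc (l ℕ.* d) j)))) (p-periodic l (suc j))))
        where
        r≡ : (l ℕ.* d ℕ.+ j) % d ≡.≡ j
        r≡ = residue l j (ℕₚ.<-trans j<m m<d)

      unit-num : ∀ j → j < m → 𝕋.Unit (RU.numerator j)
      unit-num j j<m = 𝕋.unit-cong (FT.factor-homo (FT.q^1+s-homo s j))
        (T.ι-unit (T.admissible-* (adm-pair (suc (s ℕ.* j))) (adm-off (suc (s ℕ.* j)) (ℕ∣.>⇒∤ (s≤s (ℕₚ.*-monoʳ-< s j<m))))))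

      unit-den : ∀ j → j < m → 𝕋.Unit (RU.denominator j)
      unit-den j j<m = 𝕋.unit-cong (FT.factor-homo (FT.q^s-homo s (suc j)))
        (T.ι-unit (T.admissible-* (adm-pair (s ℕ.* suc j)) (adm-off (s ℕ.* suc j) (ℕ∣.>⇒∤ (s≤s (ℕₚ.*-monoʳ-≤ s j<m))))))

      unit-1-q : 𝕋.Unit (𝕋.1# 𝕋.- qᵀ)
      unit-1-q = 𝕋.unit-cong (FT.1-homo′ (T.ι-cong (𝔸.*-identityʳ qᴬ))) (T.ι-unit (adm-off 1 (ℕ∣.>⇒∤ (s≤s (s≤s z≤n)))))

      unit-2 : 𝕋.Unit (𝕋.1# 𝕋.+ 𝕋.1#)
      unit-2 = 𝕋.unit-cong (𝕋.trans (T.ι-cong (𝔸.+-congʳ (𝔸.+-identityˡ 𝔸.1#))) (𝕋.trans (T.ι-+ _ _) (𝕋.+-cong T.ι-1 T.ι-1)))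
        (T.ι-unit (regular-natural 1 , cancels⇒vanishing (cancels-natural d 1)))

      β-low : ∀ k → carry (k % d) 𝔸.≈ 𝔸.1# → β k 𝕋.≈ RU.αᵣ k
      β-low k eq = 𝕋.trans (𝕋.*-congˡ (𝕋.trans (T.ι-cong eq) T.ι-1)) (𝕋.*-identityʳ _)

      β-high : ∀ k → carry (k % d) 𝔸.≈ u → β k 𝕋.≈ 𝕋.0#
      β-high k eq = 𝕋.trans (𝕋.*-congˡ (𝕋.trans (T.ι-cong eq) u≈0)) (𝕋.zeroʳ _)

      carry-residue : ∀ l r → r < d → carry ((l ℕ.* d ℕ.+ r) % d) 𝔸.≈ carry r
      carry-residue l r r<d = 𝔸.reflexive (≡.cong carry (residue l r r<d))

      sum-vanishes : 𝕋.∑ (e ℕ.* d) (TC.power β (suc N)) 𝕋.≈ 𝕋.0#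
      sum-vanishes = ∑-power-vanishes T.fractionRing qᵀ xᵀ s′ m w d ≡.refl q^d≈1 w-ratio unit-num unit-den unit-1-q unit-2 β
        (λ l r r≤m → β-low (l ℕ.* d ℕ.+ r) (𝔸.trans (carry-residue l r (ℕₚ.≤-<-trans r≤m m<d)) (carry-low r r≤m)))
        (λ l r m<r r<d → β-high (l ℕ.* d ℕ.+ r) (𝔸.trans (carry-residue l r r<d) (carry-high r m<r)))
        N e N<s

      membershipᶜ : ∀ {f} c → f ↤ c → VanishesAt d c → NumeratorIn I (suc N) (e ℕ.* d) f
      membershipᶜ c f↤ vc = membership β β≈ c f↤ (𝕋.trans sum-vanishes (𝕋.sym (T.ι-member vc)))

-- Divisors of n, exponents of the right-hand side, and assembly of the congruence.

open import Defs
open PolynomialRing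
open FractionValues
open Regularity
open Representation
open LowestForm using (zero?; module LowestTerms)
open Cancellation
open Comparison using (q^_)
open SpecialPoints using (valueExponent; membershipₐ; membershipᵦ; module SpecialPoint)
open RootsOfUnity using (module RootCase)
open import Data.Nat as ℕ using (ℕ; zero; suc; _≤_; _<_; _∸_; _+_; _*_; z≤n; s≤s; NonZero)
open import Data.Nat.DivMod using (_/_; _%_; m≡m%n+[m/n]*n; m*n/n≡m; %-distribˡ-*; m<n⇒m%n≡m)
open import Data.Nat.Divisibility as ℕ∣ using (_∣_; divides; ∣-trans; ∣-refl; m∣m*n; n∣m*n)
open import Data.Nat.Primality using (Prime)
open import Data.Nat.Primality.Factorisation using (PrimeFactorisation; factorise)
open import Data.Nat.ListAction using (product)
open import Data.Integer.Base as ℤ using (+_)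
open import Data.List.Base using ([]; _∷_)
open import Data.List.Relation.Unary.All using (All; []; _∷_)
open import Data.Product using (∃; ∃₂; _×_; _,_; proj₁; proj₂)
open import Data.Sum using (inj₁; inj₂)
open import Relation.Binary.PropositionalEquality as ≡ using (_≡_; refl; sym; trans; cong; cong₂; subst)
open import Relation.Nullary using (¬_; contradiction)

module _ (s : ℕ) .{{_ : NonZero s}} (1<s : 1 < s) (n : ℕ) (primes : ∀ p → Prime p → p ∣ n → p % s ≡ 1) where

  product-residue : ∀ ps → All Prime ps → product ps ∣ n → product ps % s ≡ 1
  product-residue [] [] _ = m<n⇒m%n≡m 1<s
  product-residue (p ∷ ps) (pp ∷ pps) p∣n = trans (%-distribˡ-* p (product ps) s)
    (trans (cong₂ (λ a b → (a * b) % s) (primes p pp (∣-trans (m∣m*n (product ps)) p∣n)) (product-residue ps pps (∣-trans (n∣m*n p) p∣n)))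
      (m<n⇒m%n≡m 1<s))

  divisor-residue : ∀ d → .{{NonZero d}} → d ∣ n → d % s ≡ 1
  divisor-residue d d∣n = subst (λ k → k % s ≡ 1) (sym isFactorisation) (product-residue factors factorsPrime (subst (_∣ n) isFactorisation d∣n))
    where open PrimeFactorisation (factorise d)

  divisor-form : ∀ d → .{{NonZero d}} → d ∣ n → ∃ λ m → d ≡ suc (s * m)
  divisor-form d d∣n = d / s , trans (m≡m%n+[m/n]*n d s) (cong₂ _+_ (divisor-residue d d∣n) (ℕₚ.*-comm (d / s) s))

-- The doubling and the shift to j + 1 avoid division and subtraction in ℕ.
double-valueExponent : ∀ s j → 2 * valueExponent s (suc j) ≡ suc j * (s * j + 2)
double-valueExponent s zero = S.solve 1 (λ s → S.con 2 S.:* (S.con 1 S.:+ s S.:* S.con 0) S.:= S.con 1 S.:* (s S.:* S.con 0 S.:+ S.con 2)) refl s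
  where module S = Data.Nat.Solver.+-*-Solver
double-valueExponent s (suc j) = trans (ℕₚ.*-distribˡ-+ 2 (valueExponent s (suc j)) (suc (s * suc j)))
  (trans (cong (_+ 2 * suc (s * suc j)) (double-valueExponent s j))
    (S.solve 2 (λ s j → (S.con 1 S.:+ j) S.:* (s S.:* j S.:+ S.con 2) S.:+ S.con 2 S.:* (S.con 1 S.:+ s S.:* (S.con 1 S.:+ j))
      S.:= (S.con 2 S.:+ j) S.:* (s S.:* (S.con 1 S.:+ j) S.:+ S.con 2)) refl s j))
  where module S = Data.Nat.Solver.+-*-Solver

q-exponent : ∀ s′ N m → divℕ (N * (suc s′ * m) * (suc (suc s′ * m) + 1 ∸ suc s′)) (2 * suc s′) ≡ N * valueExponent (suc s′) m
q-exponent s′ N m = trans (cong (λ k → divℕ k (2 * suc s′)) (eq m)) (m*n/n≡m (N * valueExponent (suc s′) m) (2 * suc s′))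
  where
  s = suc s′
  module S = Data.Nat.Solver.+-*-Solver
  eq : ∀ m → N * (s * m) * (suc (s * m) + 1 ∸ s) ≡ N * valueExponent s m * (2 * s)
  -- For m = 0 the difference n + 1 ∸ s is truncated as soon as s > 2, but the factor n - 1 = 0
  -- makes both sides zero.
  eq zero = trans (cong (λ k → N * k * (suc (s * 0) + 1 ∸ s)) (ℕₚ.*-zeroʳ s)) (trans (cong (_* (suc (s * 0) + 1 ∸ s)) (ℕₚ.*-zeroʳ N)) (sym (cong (_* (2 * s)) (ℕₚ.*-zeroʳ N))))
  eq (suc j) = begin
    N * (s * suc j) * (suc (s * suc j) + 1 ∸ s) ≡⟨ cong (λ k → N * (s * suc j) * (k ∸ s)) (S.solve 2 (λ s j → S.con 1 S.:+ s S.:* (S.con 1 S.:+ j) S.:+ S.con 1 S.:= s S.:+ (s S.:* j S.:+ S.con 2)) refl s j) ⟩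
    N * (s * suc j) * (s + (s * j + 2) ∸ s) ≡⟨ cong (N * (s * suc j) *_) (ℕₚ.m+n∸m≡n s (s * j + 2)) ⟩
    N * (s * suc j) * (s * j + 2) ≡⟨ S.solve 4 (λ N s k t → N S.:* (s S.:* k) S.:* t S.:= N S.:* s S.:* (k S.:* t)) refl N s (suc j) (s * j + 2) ⟩
    N * s * (suc j * (s * j + 2)) ≡⟨ cong (N * s *_) (double-valueExponent s j) ⟨
    N * s * (2 * valueExponent s (suc j)) ≡⟨ S.solve 3 (λ N s e → N S.:* s S.:* (S.con 2 S.:* e) S.:= N S.:* e S.:* (S.con 2 S.:* s)) refl N s (valueExponent s (suc j)) ⟩
    N * valueExponent s (suc j) * (2 * s) ∎
    where open ≡.≡-Reasoning

sign-exponent : ∀ s′ N m → divℕ (N * (suc s′ * m)) (suc s′) ≡ N * m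
sign-exponent s′ N m = trans (cong (λ k → divℕ k (suc s′)) (S.solve 3 (λ N s m → N S.:* (s S.:* m) S.:= N S.:* m S.:* s) refl N (suc s′) m)) (m*n/n≡m (N * m) (suc s′))
  where module S = Data.Nat.Solver.+-*-Solver

isPoly-≈ : ∀ {f g} → f ≈ g → IsPoly g → IsPoly f
isPoly-≈ eq (D , g0) = D , λ i j le → trans (eq i j) (g0 i j le)

regular-nonzero : ∀ {f v} → f ↤ v → E.Regular v → ∃₂ λ i j → ¬ f i j ≡ + 0
regular-nonzero {f} {v} f↤v rv with zero? (isPoly-≈ f↤v (↓-isPoly v))
... | inj₂ nonzero = nonzero
... | inj₁ f≈𝟘 = contradiction (trans (sym (↓-1 0 0)) (trans (↓-cong (rv 𝔸.1# (𝔸.trans (𝔸.*-identityʳ v) v≈0)) 0 0) (↓-0 0 0))) λ ()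
  where
  v≈0 : v 𝔸.≈ 𝔸.0#
  v≈0 = ↤-inj f↤v ↤-𝟘 f≈𝟘

∣ᵖ-trans : ∀ {D F G} → D ∣ᵖ F → F ∣ᵖ G → D ∣ᵖ G
∣ᵖ-trans {D} {F} {G} (C , pC , F≈) (C′ , pC′ , G≈) = C ⊗ C′ , ⊗-isPoly pC pC′ ,
  ≈-trans G≈ (≈-trans (⊗-cong {g = C′} F≈ ≈-refl) (⊗-assoc D C C′))

[_]ᴬ : ℕ → 𝔸.Carrier
[ n ]ᴬ = 𝔸.∑ n (qᴬ 𝔸.^_)

cancels-[n] : ∀ {π} n → Cancels π (𝔸.1# 𝔸.- q^ n) → Cancels π [ n ]ᴬ
cancels-[n] {π} n = cancels-mod (𝔸.1# 𝔸.- qᴬ) (𝔸.1# 𝔸.- q^ n) 𝔸.0#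
  (𝔸.trans (𝔸.geom qᴬ n) (𝔸.solve 2 (λ a π → a 𝔸.:= a 𝔸.:+ π 𝔸.:* 𝔸.con (+ 0)) 𝔸.refl _ π))

[n]-∣ : ∀ n a → (𝔸.1# 𝔸.- q^ n) ∣ᴬ (𝔸.1# 𝔸.- qᴬ) 𝔸.* a → [ n ]ᴬ ∣ᴬ a
[n]-∣ n a (g , eq) = g , regular-cancel (regular-cong (𝔸.+-congˡ (𝔸.-‿cong (𝔸.*-identityʳ qᴬ))) (regular-1-q^ 0))
  (𝔸.trans eq (𝔸.trans (𝔸.*-congʳ (𝔸.sym (𝔸.geom qᴬ n))) (𝔸.*-assoc _ _ _)))

-- In place of coprimality, π₁ is regular modulo π₂ and π₃, and π₂ modulo π₃: each further factor
-- then divides the cofactor left by the earlier ones.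
product-∣ : ∀ {π₁ π₂ π₃} a → π₁ ∣ᴬ a → π₂ ∣ᴬ a → π₃ ∣ᴬ a → Cancels π₂ π₁ → Cancels π₃ π₁ → Cancels π₃ π₂ → (π₁ 𝔸.* π₂ 𝔸.* π₃) ∣ᴬ a
product-∣ {π₁} {π₂} {π₃} a (b , a≈) π₂∣a π₃∣a c₁₂ c₁₃ c₂₃ = combine (c₁₂ b (∣ᴬ-cong a≈ π₂∣a))
  where
  combine : π₂ ∣ᴬ b → (π₁ 𝔸.* π₂ 𝔸.* π₃) ∣ᴬ a
  combine (c , b≈) = assemble (c₂₃ c (c₁₃ (π₂ 𝔸.* c) (∣ᴬ-cong (𝔸.trans a≈ (𝔸.*-congˡ b≈)) π₃∣a)))
    where
    assemble : π₃ ∣ᴬ c → (π₁ 𝔸.* π₂ 𝔸.* π₃) ∣ᴬ a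
    assemble (e , c≈) = e , 𝔸.trans a≈ (𝔸.trans (𝔸.*-congˡ (𝔸.trans b≈ (𝔸.*-congˡ c≈)))
      (𝔸.solve 4 (λ a b c e → a 𝔸.:* (b 𝔸.:* (c 𝔸.:* e)) 𝔸.:= (a 𝔸.:* b 𝔸.:* c) 𝔸.:* e) 𝔸.refl π₁ π₂ π₃ e))

Congruence : (s N n : ℕ) → Set
Congruence s N n = sumʳ n (t s N)
  ≡ʳ poly (Q ^ᵖ divℕ (N * (n ∸ 1) * (n + 1 ∸ s)) (2 * s) ⊗ qint n ^ᵖ N ⊗ sgn (divℕ (N * (n ∸ 1)) s))
  mod (qint n ⊗ (𝟙 ⊖ X ⊗ Q ^ᵖ n) ⊗ (X ⊖ Q ^ᵖ n))

modulus : ℕ → Poly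
modulus n = qint n ⊗ (𝟙 ⊖ X ⊗ Q ^ᵖ n) ⊗ (X ⊖ Q ^ᵖ n)

modulus↤ : ∀ n → modulus n ↤ [ n ]ᴬ 𝔸.* πₐ n 𝔸.* πᵦ n
modulus↤ n = ↤-⊗ (↤-⊗ (↤-qint n) (↤-⊖ ↤-𝟙 (↤-⊗ ↤-X (↤-^ n ↤-Q)))) (↤-⊖ ↤-X (↤-^ n ↤-Q))

module _ (s″ m N : ℕ) (N<s : suc N ≤ suc (suc s″))
  (primes : ∀ p → Prime p → p ∣ suc (suc (suc s″) * m) → p % suc (suc s″) ≡ 1) where
  open SpecialPoint (suc s″) m (suc N) N<s using (s; n; right-side; wᴱ; wᴱ-ratio; NumeratorIn; difference)

  right : Poly
  right = Q ^ᵖ divℕ (suc N * (n ∸ 1) * (n + 1 ∸ s)) (2 * s) ⊗ qint n ^ᵖ suc N ⊗ sgn (divℕ (suc N * (n ∸ 1)) s)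

  right↤ : right ↤ right-side
  right↤ = ↤-≈ (general (divℕ (suc N * (n ∸ 1) * (n + 1 ∸ s)) (2 * s)) (divℕ (suc N * (n ∸ 1)) s))
    (𝔸.reflexive (cong₂ (λ a b → q^ a 𝔸.* [ n ]ᴬ 𝔸.^ suc N 𝔸.* (𝔸.- 𝔸.1#) 𝔸.^ b) (q-exponent (suc s″) (suc N) m) (sign-exponent (suc s″) (suc N) m)))
    where
    general : ∀ a b → Q ^ᵖ a ⊗ qint n ^ᵖ suc N ⊗ sgn b ↤ q^ a 𝔸.* [ n ]ᴬ 𝔸.^ suc N 𝔸.* (𝔸.- 𝔸.1#) 𝔸.^ b
    general a b = ↤-⊗ (↤-⊗ (↤-^ a ↤-Q) (↤-^ (suc N) (↤-qint n))) (↤-sgn b)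

  -- The exponent of [n] is positive, and 1 - q turns one [n] into 1 - q^n, a multiple of 1 - q^d.
  -- As d > 1 does not divide 1, the list consisting of 1 alone is a valid witness.
  right-vanishes : ∀ d → 1 < d → d ∣ n → VanishesAt d right-side
  right-vanishes d 1<d (divides e eq) = 1 ∷ [] , ℕ∣.>⇒∤ 1<d ∷ [] , ∣ᴬ-cong (begin
    (P 𝔸.* [ n ]ᴬ 𝔸.^ N 𝔸.* σ) 𝔸.* (𝔸.1# 𝔸.- q^ n) ≈⟨ 𝔸.*-congˡ (𝔸.geom qᴬ n) ⟨
    (P 𝔸.* [ n ]ᴬ 𝔸.^ N 𝔸.* σ) 𝔸.* ((𝔸.1# 𝔸.- qᴬ) 𝔸.* [ n ]ᴬ)
      ≈⟨ 𝔸.solve 5 (λ P B σ q b → (P 𝔸.:* B 𝔸.:* σ) 𝔸.:* ((𝔸.con (+ 1) 𝔸.:- q) 𝔸.:* b)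
           𝔸.:= ((𝔸.con (+ 1) 𝔸.:- q 𝔸.:* 𝔸.con (+ 1)) 𝔸.:* 𝔸.con (+ 1)) 𝔸.:* (P 𝔸.:* (b 𝔸.:* B) 𝔸.:* σ)) 𝔸.refl P _ σ qᴬ [ n ]ᴬ ⟩
    offRoots (1 ∷ []) 𝔸.* right-side ∎)
    (∣ᴬ-* _ (∣ᴬ-cong (𝔸.+-congˡ (𝔸.-‿cong (𝔸.reflexive (cong q^_ (sym eq))))) (1-q^-mult d e)))
    where
    open import Relation.Binary.Reasoning.Setoid 𝔸.setoid
    P = q^ (suc N * valueExponent s m)
    σ = (𝔸.- 𝔸.1#) 𝔸.^ (suc N * m)

  numerator-vanishes : ∀ d → d ∣ n → 1 < d → NumeratorIn (vanishing d) (suc N) n right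
  numerator-vanishes d d∣n 1<d = by d 1<d d∣n (divisor-form s (s≤s (s≤s z≤n)) n primes d {{ℕ.>-nonZero (ℕₚ.<-trans (s≤s z≤n) 1<d)}} d∣n)
    where
    by : ∀ d → 1 < d → d ∣ n → (∃ λ m → d ≡ suc (s * m)) → NumeratorIn (vanishing d) (suc N) n right
    by d 1<d d∣n (zero , d≡) = contradiction (subst (1 <_) (trans d≡ (cong suc (ℕₚ.*-zeroʳ s))) 1<d) (ℕₚ.<-irrefl refl)
    by d 1<d d∣n@(divides e eq) (suc m′ , refl) = subst (λ k → NumeratorIn (vanishing d) (suc N) k right) (sym eq)
      (RootCase.membershipᶜ s″ m′ N e N<s right-side right↤ (right-vanishes d 1<d d∣n))

  U V : Poly
  U = proj₁ (difference (suc N) n right)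
  V = proj₂ (difference (suc N) n right)

  represented : Represents (difference (suc N) n right) _
  represented = rep-- (RepresentSum.rep-total (suc s″) wᴱ wᴱ-ratio (suc N) n) (rep-poly right↤)

  module R = Represents represented

  module _ (A₁ A₂ : Poly) (p₁ : IsPoly A₁) (p₂ : IsPoly A₂) (cross : U ⊗ A₂ ≈ A₁ ⊗ V) where
    a₁ a₂ : 𝔸.Carrier
    a₁ = ↑ A₁ p₁
    a₂ = ↑ A₂ p₂

    cross↓ : U ⊗ ↓ a₂ ≈ ↓ a₁ ⊗ V
    cross↓ = ≈-trans (⊗-cong {U} ≈-refl (↓↑ A₂ p₂)) (≈-trans cross (⊗-cong {g = V} (≈-sym (↓↑ A₁ p₁)) ≈-refl))

    divides-a₁ : ([ n ]ᴬ 𝔸.* πₐ n 𝔸.* πᵦ n) ∣ᴬ a₁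
    divides-a₁ = product-∣ a₁
      ([n]-∣ n a₁ (vanishes⇒∣ n a₁ λ d d∣n 1<d → numerator-vanishes d d∣n 1<d a₁ a₂ cross↓))
      (membershipₐ s″ m (suc N) N<s right↤ a₁ a₂ cross↓)
      (membershipᵦ s″ m (suc N) N<s right↤ a₁ a₂ cross↓)
      (cancels-[n] n (cancelsₐ-1-q^ n (s * m))) (cancels-[n] n (cancelsᵦ-1-q^ n (s * m))) (cancelsᵦ-1-xq^ (s * m) n)

    modulus-divides : modulus n ∣ᵖ A₁
    modulus-divides = ↓ c , ↓-isPoly c , ≈-trans (≈-sym (↓↑ A₁ p₁)) (≈-trans (↓-cong (proj₂ divides-a₁)) (≈-sym (↤-⊗ (modulus↤ n) (≈-refl {↓ c}))))
      where c = proj₁ divides-a₁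

  congruence : Congruence s (suc N) n
  congruence = by (LowestTerms.lowest-terms U V (isPoly-≈ R.top↤ (↓-isPoly R.top)) (isPoly-≈ R.bot↤ (↓-isPoly R.bot)) (regular-nonzero R.bot↤ R.bot-regular))
    where
    by : (∃₂ λ A₁ A₂ → IsPoly A₁ × IsPoly A₂ × ¬ A₂ ≈ 𝟘 × U ⊗ A₂ ≈ A₁ ⊗ V × Coprime A₁ A₂) → Congruence s (suc N) n
    by (A₁ , A₂ , p₁ , p₂ , A₂≉𝟘 , cross , coprime) = A₁ , A₂ , p₁ , p₂ , A₂≉𝟘 , cross , coprime , P∣A₁ ,
      -- The modulus divides A₁, so a common divisor of the modulus and A₂ is one of A₁ and A₂.
      λ D pD D∣P D∣A₂ → coprime D pD (∣ᵖ-trans {D} {modulus n} {A₁} D∣P P∣A₁) D∣A₂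
      where
      P∣A₁ : modulus n ∣ᵖ A₁
      P∣A₁ = modulus-divides A₁ A₂ p₁ p₂ cross

theorem1 : (s N : ℕ) → 2 ≤ N → N ≤ s → (n : ℕ) → 1 ≤ n
    → (∀ p → Prime p → p ∣ n → modℕ p s ≡ 1)
    → sumʳ n (t s N)
      ≡ʳ poly (Q ^ᵖ divℕ (N * (n ∸ 1) * (n + 1 ∸ s)) (2 * s) ⊗ qint n ^ᵖ N ⊗ sgn (divℕ (N * (n ∸ 1)) s))
      mod (qint n ⊗ (𝟙 ⊖ X ⊗ Q ^ᵖ n) ⊗ (X ⊖ Q ^ᵖ n))
theorem1 (suc (suc s″)) (suc N) 2≤N N≤s n 1≤n primes = by n primes (divisor-form (suc (suc s″)) (s≤s (s≤s z≤n)) n primes n {{ℕ.>-nonZero 1≤n}} ∣-refl)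
  where
  by : ∀ n → (∀ p → Prime p → p ∣ n → modℕ p (suc (suc s″)) ≡ 1) → (∃ λ m → n ≡ suc (suc (suc s″) * m)) → Congruence (suc (suc s″)) (suc N) n
  by n primes (m , refl) = congruence s″ m N N≤s primes
theorem1 (suc zero) (suc N) (s≤s (s≤s _)) (s≤s ())
theorem1 zero (suc N) _ ()
theorem1 zero zero ()
theorem1 (suc s) zero ()
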